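{- For partitions $\mu\subseteq\lambda$ and an indeterminate $y$, \[ \sum_\nu \mathrm{vs}_{\lambda/\nu}(t)\,\mathrm{sk}_{\nu/\mu}(t)\,y^{|\lambda/\nu|}=\sum_\sigma t^{n(\sigma)-\binom{\ell(\sigma)}{2}}\,f^\lambda_{\sigma\mu}(t)\prod_{j=1}^{\ell(\sigma)}(y+t^{j-1}), \] where the left sum is over partitions $\nu$ with $\mu\subseteq\nu\subseteq\lambda$ and the right sum over all partitions $\sigma$. Equivalently, for every $m\ge0$, \[ \sum_{\nu:\ |\lambda/\nu|=m}\mathrm{vs}_{\lambda/\nu}(t)\,\mathrm{sk}_{\nu/\mu}(t)=\sum_\sigma t^{n(\sigma)-\binom m2}\,f^\lambda_{\sigma\mu}(t)\begin{bmatrix}\ell(\sigma)\\ m\end{bmatrix}_{t^{ -1}}. \]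
   Context: $P_\lambda=P_\lambda(t)$ are Hall--Littlewood functions in the ring of symmetric functions over $\mathbb{Q}(t)$; $f^\lambda_{\sigma\mu}(t)$ is the coefficient of $P_\lambda$ in $P_\sigma P_\mu$. For a partition $\sigma$, $\ell(\sigma)$ is its number of parts and $n(\sigma)=\sum_i(i-1)\sigma_i$. $\lambda^c$ is the conjugate partition, $m_j(\mu)$ the number of parts of $\mu$ equal to $j$, $|\lambda/\nu|=|\lambda|-|\nu|$, and $\begin{bmatrix} a\\ b\end{bmatrix}_q=\frac{(1-q^a)\cdots(1-q^{a-b+1})}{(1-q^b)\cdots(1-q)}$. $\lambda/\nu$ is a vertical strip if $\lambda_i\le\nu_i+1$ for all $i$; $\mathrm{vs}_{\lambda/\nu}(t)=\prod_{j\ge1}\begin{bmatrix}\lambda^c_j-\lambda^c_{j+1}\\ \lambda^c_j-\nu^c_j\end{bmatrix}_t$ if $\lambda/\nu$ is a vertical strip and $0$ otherwise; $\mathrm{sk}_{\nu/\mu}(t)=t^{\sum_j\binom{\nu^c_j-\mu^c_j}{2}}\prod_{j\ge1}\begin{bmatrix}\nu^c_j-\mu^c_{j+1}\\ m_j(\mu)\end{bmatrix}_t$. -}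

module Defs where

open import Algebra using (CommutativeRing)
open import Data.Empty using (⊥)
open import Data.Fin.Base using (Fin; toℕ) renaming (zero to fzero; suc to fsuc)
import Data.Fin.Properties as Fin
open import Data.Fin.Permutation using (Permutation; _⟨$⟩ʳ_; insert) renaming (id to idₚ)
open import Data.Integer.Base using (ℤ; +_; -[1+_])
open import Data.List.Base
  using (List; []; _∷_; map; concatMap; filter; foldr; length; zipWith; upTo; allFin; mapMaybe)
open import Data.List.Membership.Propositional using (_∉_)
open import Data.List.Relation.Unary.All using (All; all?)
open import Data.List.Relation.Unary.Linked using (Linked; linked?)
open import Data.List.Relation.Unary.Unique.Propositional using (Unique)
open import Data.Maybe.Base using (Maybe; just; nothing)
open import Data.Nat.Base as ℕ using (ℕ; zero; suc; _≤_; _<_; _≥_; _∸_; z≤n)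
open import Data.Nat.Combinatorics using (_C_)
open import Data.Nat.ListAction using (sum)
import Data.Nat.Properties as ℕ
open import Data.Product using (∃; _×_; _,_)
open import Data.Rational.Base as ℚ using (ℚ)
import Data.Rational.Properties as ℚ
open import Function.Base using (_∘_)
open import Level using (0ℓ)
open import Relation.Binary using (Decidable)
open import Relation.Binary.PropositionalEquality as ≡ using (_≡_; _≢_)
open import Relation.Nullary using (Dec; yes; no; ¬_; does; contradiction)
open import Relation.Nullary.Decidable using (map′; _×-dec_)
open import Data.Bool.Base using (if_then_else_)

record IntegralDomain : Set₁ where
  field
    commutativeRing : CommutativeRing 0ℓ 0ℓ
  open CommutativeRing commutativeRing public
  field
    _≟_       : Decidable _≈_
    1≉0       : ¬ (1# ≈ 0#)
    *-nonzero : ∀ {a b} → ¬ (a ≈ 0#) → ¬ (b ≈ 0#) → ¬ (a * b ≈ 0#)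

-- The inverse is total, with the convention 0⁻¹ = 0.
record Field : Set₁ where
  field
    integralDomain : IntegralDomain
  open IntegralDomain integralDomain public
  infix 9 _⁻¹
  field
    _⁻¹       : Carrier → Carrier
    ⁻¹-cong   : ∀ {a b} → a ≈ b → a ⁻¹ ≈ b ⁻¹
    ⁻¹-zero   : 0# ⁻¹ ≈ 0#
    ⁻¹-inverse : ∀ {a} → ¬ (a ≈ 0#) → a * a ⁻¹ ≈ 1#

  infixl 7 _÷_
  _÷_ : Carrier → Carrier → Carrier
  a ÷ b = a * b ⁻¹

module Operations (R : CommutativeRing 0ℓ 0ℓ) where
  open CommutativeRing R hiding (zero)
  open import Algebra.Properties.Semiring.Exp semiring public using (_^_)

  ∑ : {A : Set} → List A → (A → Carrier) → Carrier
  ∑ xs g = foldr _+_ 0# (map g xs)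

  ∏ : {A : Set} → List A → (A → Carrier) → Carrier
  ∏ xs g = foldr _*_ 1# (map g xs)

  -- s is the sum of g over all of A, where g vanishes outside a finite set.
  IsFiniteSum : {A : Set} → (A → Carrier) → Carrier → Set
  IsFiniteSum {A} g s =
    ∃ λ (xs : List A) → Unique xs × (∀ a → a ∉ xs → g a ≈ 0#) × s ≈ ∑ xs g

module FieldOperations (K : Field) where
  open Field K hiding (zero)
  open Operations commutativeRing public

  infixr 8 _^ᶻ_
  _^ᶻ_ : Carrier → ℤ → Carrier
  a ^ᶻ (+ n)      = a ^ n
  a ^ᶻ -[1+ n ]   = (a ⁻¹) ^ suc n

  gaussianBinomial : Carrier → ℕ → ℕ → Carrier
  gaussianBinomial q a b =
    ∏ (upTo b) (λ i → 1# - q ^ (a ∸ i)) ÷ ∏ (upTo b) (λ i → 1# - q ^ suc i)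

-- Polynomials in one variable: a list holds the coefficients of
-- 1, X, X², …, and trailing zeros are immaterial.

module Polynomials (D : IntegralDomain) where
  open IntegralDomain D hiding (zero)
  open import Relation.Binary.Reasoning.Setoid setoid
  open import Algebra.Properties.Ring ring using (-0#≈0#)
  import Algebra.Solver.Ring.NaturalCoefficients.Default commutativeSemiring as S

  Poly : Set
  Poly = List Carrier

  coeff : Poly → ℕ → Carrier
  coeff []      _       = 0#
  coeff (a ∷ p) zero    = a
  coeff (a ∷ p) (suc k) = coeff p k

  infix 4 _≈ₚ_
  record _≈ₚ_ (p q : Poly) : Set where
    constructor mk≈
    field at : ∀ k → coeff p k ≈ coeff q k
  open _≈ₚ_ public

  constₚ : Carrier → Poly
  constₚ a = a ∷ []

  X : Poly
  X = 0# ∷ 1# ∷ []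

  infixl 6 _+ₚ_
  infixl 7 _*ₚ_ _·_

  _+ₚ_ : Poly → Poly → Poly
  []      +ₚ q       = q
  (a ∷ p) +ₚ []      = a ∷ p
  (a ∷ p) +ₚ (b ∷ q) = (a + b) ∷ (p +ₚ q)

  -ₚ_ : Poly → Poly
  -ₚ_ = map (-_)

  _·_ : Carrier → Poly → Poly
  a · p = map (a *_) p

  _*ₚ_ : Poly → Poly → Poly
  []      *ₚ q = []
  (a ∷ p) *ₚ q = a · q +ₚ (0# ∷ p *ₚ q)

  coeff-+ : ∀ p q k → coeff (p +ₚ q) k ≈ coeff p k + coeff q k
  coeff-+ []      q       k       = sym (+-identityˡ _)
  coeff-+ (a ∷ p) []      k       = sym (+-identityʳ _)
  coeff-+ (a ∷ p) (b ∷ q) zero    = refl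
  coeff-+ (a ∷ p) (b ∷ q) (suc k) = coeff-+ p q k

  coeff-neg : ∀ p k → coeff (-ₚ p) k ≈ - coeff p k
  coeff-neg []      k       = sym -0#≈0#
  coeff-neg (a ∷ p) zero    = refl
  coeff-neg (a ∷ p) (suc k) = coeff-neg p k

  coeff-· : ∀ a p k → coeff (a · p) k ≈ a * coeff p k
  coeff-· a []      k       = sym (zeroʳ a)
  coeff-· a (b ∷ p) zero    = refl
  coeff-· a (b ∷ p) (suc k) = coeff-· a p k

  private
    reflₚ : ∀ {p} → p ≈ₚ p
    reflₚ = mk≈ λ _ → refl

    symₚ : ∀ {p q} → p ≈ₚ q → q ≈ₚ p
    symₚ e = mk≈ λ k → sym (at e k)

    transₚ : ∀ {p q r} → p ≈ₚ q → q ≈ₚ r → p ≈ₚ r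
    transₚ e f = mk≈ λ k → trans (at e k) (at f k)

    ∷-cong : ∀ {a b p q} → a ≈ b → p ≈ₚ q → (a ∷ p) ≈ₚ (b ∷ q)
    ∷-cong e f = mk≈ λ { zero → e ; (suc k) → at f k }

    tail≈ : ∀ {a b p q} → (a ∷ p) ≈ₚ (b ∷ q) → p ≈ₚ q
    tail≈ e = mk≈ λ k → at e (suc k)

    +ₚ-cong : ∀ {p p′ q q′} → p ≈ₚ p′ → q ≈ₚ q′ → p +ₚ q ≈ₚ p′ +ₚ q′
    +ₚ-cong {p} {p′} {q} {q′} e f = mk≈ λ k → begin
      coeff (p +ₚ q) k         ≈⟨ coeff-+ p q k ⟩
      coeff p k + coeff q k    ≈⟨ +-cong (at e k) (at f k) ⟩
      coeff p′ k + coeff q′ k  ≈⟨ coeff-+ p′ q′ k ⟨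
      coeff (p′ +ₚ q′) k       ∎

    +ₚ-assoc : ∀ p q r → (p +ₚ q) +ₚ r ≈ₚ p +ₚ (q +ₚ r)
    +ₚ-assoc p q r = mk≈ λ k → begin
      coeff ((p +ₚ q) +ₚ r) k                ≈⟨ coeff-+ (p +ₚ q) r k ⟩
      coeff (p +ₚ q) k + coeff r k           ≈⟨ +-congʳ (coeff-+ p q k) ⟩
      (coeff p k + coeff q k) + coeff r k    ≈⟨ +-assoc _ _ _ ⟩
      coeff p k + (coeff q k + coeff r k)    ≈⟨ +-congˡ (coeff-+ q r k) ⟨
      coeff p k + coeff (q +ₚ r) k           ≈⟨ coeff-+ p (q +ₚ r) k ⟨
      coeff (p +ₚ (q +ₚ r)) k                ∎

    +ₚ-comm : ∀ p q → p +ₚ q ≈ₚ q +ₚ p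
    +ₚ-comm p q = mk≈ λ k →
      trans (coeff-+ p q k) (trans (+-comm _ _) (sym (coeff-+ q p k)))

    +ₚ-identityʳ : ∀ p → p +ₚ [] ≈ₚ p
    +ₚ-identityʳ p = mk≈ λ k → trans (coeff-+ p [] k) (+-identityʳ _)

    -ₚ-cong : ∀ {p q} → p ≈ₚ q → -ₚ p ≈ₚ -ₚ q
    -ₚ-cong {p} {q} e = mk≈ λ k →
      trans (coeff-neg p k) (trans (-‿cong (at e k)) (sym (coeff-neg q k)))

    -ₚ-inverseʳ : ∀ p → p +ₚ (-ₚ p) ≈ₚ []
    -ₚ-inverseʳ p = mk≈ λ k → trans (coeff-+ p (-ₚ p) k)
      (trans (+-congˡ (coeff-neg p k)) (-‿inverseʳ _))

    interchange : ∀ p q r s → (p +ₚ q) +ₚ (r +ₚ s) ≈ₚ (p +ₚ r) +ₚ (q +ₚ s)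
    interchange p q r s = mk≈ λ k → begin
      coeff ((p +ₚ q) +ₚ (r +ₚ s)) k
        ≈⟨ trans (coeff-+ (p +ₚ q) _ k) (+-cong (coeff-+ p q k) (coeff-+ r s k)) ⟩
      (coeff p k + coeff q k) + (coeff r k + coeff s k)
        ≈⟨ S.solve 4 (λ a b c d → (a S.:+ b) S.:+ (c S.:+ d) S.:= (a S.:+ c) S.:+ (b S.:+ d))
             refl (coeff p k) (coeff q k) (coeff r k) (coeff s k) ⟩
      (coeff p k + coeff r k) + (coeff q k + coeff s k)
        ≈⟨ trans (coeff-+ (p +ₚ r) _ k) (+-cong (coeff-+ p r k) (coeff-+ q s k)) ⟨
      coeff ((p +ₚ r) +ₚ (q +ₚ s)) k ∎

    ·-cong : ∀ {a b p q} → a ≈ b → p ≈ₚ q → a · p ≈ₚ b · q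
    ·-cong {a} {b} {p} {q} e f = mk≈ λ k →
      trans (coeff-· a p k) (trans (*-cong e (at f k)) (sym (coeff-· b q k)))

    ·-distribˡ : ∀ a p q → a · (p +ₚ q) ≈ₚ a · p +ₚ a · q
    ·-distribˡ a p q = mk≈ λ k → begin
      coeff (a · (p +ₚ q)) k              ≈⟨ trans (coeff-· a (p +ₚ q) k) (*-congˡ (coeff-+ p q k)) ⟩
      a * (coeff p k + coeff q k)         ≈⟨ distribˡ a _ _ ⟩
      a * coeff p k + a * coeff q k       ≈⟨ +-cong (coeff-· a p k) (coeff-· a q k) ⟨
      coeff (a · p) k + coeff (a · q) k   ≈⟨ coeff-+ (a · p) (a · q) k ⟨
      coeff (a · p +ₚ a · q) k            ∎

    ·-assoc : ∀ a b p → a · (b · p) ≈ₚ (a * b) · p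
    ·-assoc a b p = mk≈ λ k → trans (coeff-· a (b · p) k)
      (trans (*-congˡ (coeff-· b p k)) (trans (sym (*-assoc a b _)) (sym (coeff-· (a * b) p k))))

    0·≈[] : ∀ {a} p → a ≈ 0# → a · p ≈ₚ []
    0·≈[] {a} p e = mk≈ λ k → trans (coeff-· a p k) (trans (*-congʳ e) (zeroˡ _))

    0∷[]≈[] : (0# ∷ []) ≈ₚ []
    0∷[]≈[] = mk≈ λ { zero → refl ; (suc k) → refl }

    0∷-+ : ∀ p q → (0# ∷ (p +ₚ q)) ≈ₚ (0# ∷ p) +ₚ (0# ∷ q)
    0∷-+ p q = ∷-cong (sym (+-identityˡ 0#)) reflₚ

    *ₚ-congˡ : ∀ p {q r} → q ≈ₚ r → p *ₚ q ≈ₚ p *ₚ r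
    *ₚ-congˡ []      e = reflₚ
    *ₚ-congˡ (a ∷ p) e = +ₚ-cong (·-cong refl e) (∷-cong refl (*ₚ-congˡ p e))

    *ₚ-zeroʳ : ∀ p → p *ₚ [] ≈ₚ []
    *ₚ-zeroʳ []      = reflₚ
    *ₚ-zeroʳ (a ∷ p) = transₚ (∷-cong refl (*ₚ-zeroʳ p)) 0∷[]≈[]

    *ₚ-∷ʳ : ∀ p b q → p *ₚ (b ∷ q) ≈ₚ b · p +ₚ (0# ∷ p *ₚ q)
    *ₚ-∷ʳ []      b q = symₚ 0∷[]≈[]
    *ₚ-∷ʳ (a ∷ p) b q = ∷-cong (+-congʳ (*-comm a b))
      (transₚ (+ₚ-cong (reflₚ {a · q}) (*ₚ-∷ʳ p b q))
        (transₚ (symₚ (+ₚ-assoc (a · q) (b · p) _))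
          (transₚ (+ₚ-cong (+ₚ-comm (a · q) (b · p)) reflₚ) (+ₚ-assoc (b · p) (a · q) _))))

    *ₚ-comm : ∀ p q → p *ₚ q ≈ₚ q *ₚ p
    *ₚ-comm []      q = symₚ (*ₚ-zeroʳ q)
    *ₚ-comm (a ∷ p) q =
      transₚ (+ₚ-cong reflₚ (∷-cong refl (*ₚ-comm p q))) (symₚ (*ₚ-∷ʳ q a p))

    *ₚ-cong : ∀ {p p′ q q′} → p ≈ₚ p′ → q ≈ₚ q′ → p *ₚ q ≈ₚ p′ *ₚ q′
    *ₚ-cong {p} {p′} {q} {q′} e f = transₚ (*ₚ-congˡ p f)
      (transₚ (*ₚ-comm p q′) (transₚ (*ₚ-congˡ q′ e) (*ₚ-comm q′ p′)))

    *ₚ-distribˡ : ∀ p q r → p *ₚ (q +ₚ r) ≈ₚ p *ₚ q +ₚ p *ₚ r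
    *ₚ-distribˡ []      q r = reflₚ
    *ₚ-distribˡ (a ∷ p) q r = transₚ
      (+ₚ-cong (·-distribˡ a q r) (transₚ (∷-cong refl (*ₚ-distribˡ p q r)) (0∷-+ (p *ₚ q) (p *ₚ r))))
      (interchange (a · q) (a · r) (0# ∷ p *ₚ q) (0# ∷ p *ₚ r))

    *ₚ-distribʳ : ∀ p q r → (q +ₚ r) *ₚ p ≈ₚ q *ₚ p +ₚ r *ₚ p
    *ₚ-distribʳ p q r = transₚ (*ₚ-comm (q +ₚ r) p)
      (transₚ (*ₚ-distribˡ p q r) (+ₚ-cong (*ₚ-comm p q) (*ₚ-comm p r)))

    ·-*ₚ : ∀ a p q → (a · p) *ₚ q ≈ₚ a · (p *ₚ q)
    ·-*ₚ a []      q = reflₚ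
    ·-*ₚ a (b ∷ p) q = transₚ
      (+ₚ-cong (symₚ (·-assoc a b q)) (∷-cong (sym (zeroʳ a)) (·-*ₚ a p q)))
      (symₚ (·-distribˡ a (b · q) (0# ∷ p *ₚ q)))

    0∷-*ₚ : ∀ p q → (0# ∷ p) *ₚ q ≈ₚ 0# ∷ (p *ₚ q)
    0∷-*ₚ p q = +ₚ-cong (0·≈[] q refl) (reflₚ {0# ∷ p *ₚ q})

    *ₚ-assoc : ∀ p q r → (p *ₚ q) *ₚ r ≈ₚ p *ₚ (q *ₚ r)
    *ₚ-assoc []      q r = reflₚ
    *ₚ-assoc (a ∷ p) q r = transₚ (*ₚ-distribʳ r (a · q) (0# ∷ p *ₚ q))
      (+ₚ-cong (·-*ₚ a q r)
        (transₚ (0∷-*ₚ (p *ₚ q) r) (∷-cong refl (*ₚ-assoc p q r))))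

    *ₚ-identityˡ : ∀ p → constₚ 1# *ₚ p ≈ₚ p
    *ₚ-identityˡ p = transₚ
      (+ₚ-cong (mk≈ λ k → trans (coeff-· 1# p k) (*-identityˡ _)) 0∷[]≈[])
      (+ₚ-identityʳ p)

    ≟[] : ∀ p → Dec (p ≈ₚ [])
    ≟[] []      = yes reflₚ
    ≟[] (a ∷ p) = map′
      (λ (e , f) → transₚ (∷-cong e f) 0∷[]≈[])
      (λ e → at e zero , mk≈ (λ k → at e (suc k)))
      ((a ≟ 0#) ×-dec ≟[] p)

    _≟ₚ_ : Decidable _≈ₚ_
    []      ≟ₚ q       = map′ symₚ symₚ (≟[] q)
    (a ∷ p) ≟ₚ []      = ≟[] (a ∷ p)
    (a ∷ p) ≟ₚ (b ∷ q) = map′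
      (λ (e , f) → ∷-cong e f)
      (λ e → at e zero , tail≈ e)
      ((a ≟ b) ×-dec (p ≟ₚ q))

    0∷-nonzero : ∀ {p} → ¬ (p ≈ₚ []) → ¬ ((0# ∷ p) ≈ₚ [])
    0∷-nonzero p≉0 e = p≉0 (mk≈ λ k → at e (suc k))

    tail-nonzero : ∀ {a p} → a ≈ 0# → ¬ ((a ∷ p) ≈ₚ []) → ¬ (p ≈ₚ [])
    tail-nonzero e ap≉0 f = ap≉0 (transₚ (∷-cong e f) 0∷[]≈[])

    head-nonzero : ∀ {a} p → ¬ (a ≈ 0#) → ∀ q → ¬ (q ≈ₚ []) → ¬ ((a ∷ p) *ₚ q ≈ₚ [])
    head-nonzero {a} p a≉0 []      q≉0 e = q≉0 reflₚ
    head-nonzero {a} p a≉0 (b ∷ q) q≉0 e = by-cases (b ≟ 0#)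
      where
      by-cases : Dec (b ≈ 0#) → ⊥
      by-cases (no b≉0)  = *-nonzero a≉0 b≉0 (trans (sym (+-identityʳ _)) (at e zero))
      by-cases (yes b≈0) = 0∷-nonzero (head-nonzero p a≉0 q (tail-nonzero b≈0 q≉0))
        (transₚ (+ₚ-cong (symₚ (0·≈[] (a ∷ p) b≈0)) (reflₚ {0# ∷ (a ∷ p) *ₚ q}))
          (transₚ (symₚ (*ₚ-∷ʳ (a ∷ p) b q)) e))

    *ₚ-nonzero : ∀ p q → ¬ (p ≈ₚ []) → ¬ (q ≈ₚ []) → ¬ (p *ₚ q ≈ₚ [])
    *ₚ-nonzero []      q p≉0 q≉0 e = p≉0 reflₚ
    *ₚ-nonzero (a ∷ p) q p≉0 q≉0 e = by-cases (a ≟ 0#)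
      where
      by-cases : Dec (a ≈ 0#) → ⊥
      by-cases (no a≉0)  = head-nonzero p a≉0 q q≉0 e
      by-cases (yes a≈0) = 0∷-nonzero (*ₚ-nonzero p q (tail-nonzero a≈0 p≉0) q≉0)
        (transₚ (+ₚ-cong (symₚ (0·≈[] q a≈0)) (reflₚ {0# ∷ p *ₚ q})) e)

  commutativeRingₚ : CommutativeRing 0ℓ 0ℓ
  commutativeRingₚ = record
    { Carrier = Poly ; _≈_ = _≈ₚ_ ; _+_ = _+ₚ_ ; _*_ = _*ₚ_ ; -_ = -ₚ_ ; 0# = [] ; 1# = constₚ 1#
    ; isCommutativeRing = record
      { isRing = record
        { +-isAbelianGroup = record
          { isGroup = record
            { isMonoid = record
              { isSemigroup = record
                { isMagma = record
                  { isEquivalence = record { refl = reflₚ ; sym = symₚ ; trans = transₚ }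
                  ; ∙-cong = +ₚ-cong }
                ; assoc = +ₚ-assoc }
              ; identity = (λ _ → reflₚ) , +ₚ-identityʳ }
            ; inverse = (λ p → transₚ (+ₚ-comm (-ₚ p) p) (-ₚ-inverseʳ p)) , -ₚ-inverseʳ
            ; ⁻¹-cong = -ₚ-cong }
          ; comm = +ₚ-comm }
        ; *-cong = *ₚ-cong
        ; *-assoc = *ₚ-assoc
        ; *-identity = *ₚ-identityˡ , λ p → transₚ (*ₚ-comm p (constₚ 1#)) (*ₚ-identityˡ p)
        ; distrib = *ₚ-distribˡ , *ₚ-distribʳ }
      ; *-comm = *ₚ-comm } }

  integralDomainₚ : IntegralDomain
  integralDomainₚ = record
    { commutativeRing = commutativeRingₚ
    ; _≟_ = _≟ₚ_
    ; 1≉0 = λ e → 1≉0 (at e zero)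
    ; *-nonzero = λ {p} {q} → *ₚ-nonzero p q
    }

module Fractions (D : IntegralDomain) where
  open IntegralDomain D hiding (zero)
  open import Relation.Binary.Reasoning.Setoid setoid
  open import Algebra.Properties.Ring ring using (-‿distribˡ-*; x∙y⁻¹≈ε⇒x≈y)
  import Algebra.Solver.Ring.NaturalCoefficients.Default commutativeSemiring as S
  open S using (solve; _:+_; _:*_; _:=_)

  record Fraction : Set where
    constructor fraction
    field
      num   : Carrier
      den   : Carrier
      den≉0 : ¬ (den ≈ 0#)
  open Fraction public

  infix 4 _≈ᶠ_
  record _≈ᶠ_ (x y : Fraction) : Set where
    constructor mk≈
    field cross : num x * den y ≈ num y * den x
  open _≈ᶠ_ public

  ι : Carrier → Fraction
  ι a = fraction a 1# 1≉0

  infixl 6 _+ᶠ_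
  infixl 7 _*ᶠ_

  _+ᶠ_ : Fraction → Fraction → Fraction
  fraction a b b≉0 +ᶠ fraction c d d≉0 =
    fraction (a * d + c * b) (b * d) (*-nonzero b≉0 d≉0)

  _*ᶠ_ : Fraction → Fraction → Fraction
  fraction a b b≉0 *ᶠ fraction c d d≉0 = fraction (a * c) (b * d) (*-nonzero b≉0 d≉0)

  -ᶠ_ : Fraction → Fraction
  -ᶠ fraction a b b≉0 = fraction (- a) b b≉0

  0ᶠ 1ᶠ : Fraction
  0ᶠ = ι 0#
  1ᶠ = ι 1#

  inv : Fraction → Fraction
  inv (fraction a b b≉0) with a ≟ 0#
  ... | yes _   = 0ᶠ
  ... | no  a≉0 = fraction b a a≉0

  private
    *-cancelʳ : ∀ {a b c} → ¬ (c ≈ 0#) → a * c ≈ b * c → a ≈ b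
    *-cancelʳ {a} {b} {c} c≉0 e with (a - b) ≟ 0#
    ... | yes z = x∙y⁻¹≈ε⇒x≈y a b z
    ... | no nz = contradiction (begin
      (a - b) * c        ≈⟨ distribʳ c a (- b) ⟩
      a * c + (- b) * c  ≈⟨ +-cong e (sym (-‿distribˡ-* b c)) ⟩
      b * c - b * c      ≈⟨ -‿inverseʳ (b * c) ⟩
      0#                 ∎) (*-nonzero nz c≉0)

    reflᶠ : ∀ {x} → x ≈ᶠ x
    reflᶠ = mk≈ refl

    symᶠ : ∀ {x y} → x ≈ᶠ y → y ≈ᶠ x
    symᶠ e = mk≈ (sym (cross e))

    transᶠ : ∀ {x y z} → x ≈ᶠ y → y ≈ᶠ z → x ≈ᶠ z
    transᶠ {fraction a b _} {fraction c d d≉0} {fraction e f _} (mk≈ p) (mk≈ q) =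
      mk≈ (*-cancelʳ d≉0 (begin
        (a * f) * d  ≈⟨ solve 3 (λ a f d → (a :* f) :* d := (a :* d) :* f) refl a f d ⟩
        (a * d) * f  ≈⟨ *-congʳ p ⟩
        (c * b) * f  ≈⟨ solve 3 (λ c b f → (c :* b) :* f := (c :* f) :* b) refl c b f ⟩
        (c * f) * b  ≈⟨ *-congʳ q ⟩
        (e * d) * b  ≈⟨ solve 3 (λ e d b → (e :* d) :* b := (e :* b) :* d) refl e d b ⟩
        (e * b) * d  ∎))

    +ᶠ-cong : ∀ {x x′ y y′} → x ≈ᶠ x′ → y ≈ᶠ y′ → x +ᶠ y ≈ᶠ x′ +ᶠ y′
    +ᶠ-cong {fraction a b _} {fraction a′ b′ _} {fraction c d _} {fraction c′ d′ _} (mk≈ p) (mk≈ q) =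
      mk≈ (begin
        (a * d + c * b) * (b′ * d′)
          ≈⟨ solve 6 (λ a b c d b′ d′ → (a :* d :+ c :* b) :* (b′ :* d′)
               := (a :* b′) :* (d :* d′) :+ (c :* d′) :* (b :* b′)) refl a b c d b′ d′ ⟩
        (a * b′) * (d * d′) + (c * d′) * (b * b′)
          ≈⟨ +-cong (*-congʳ p) (*-congʳ q) ⟩
        (a′ * b) * (d * d′) + (c′ * d) * (b * b′)
          ≈⟨ solve 6 (λ a′ b c′ d b′ d′ → (a′ :* b) :* (d :* d′) :+ (c′ :* d) :* (b :* b′)
               := (a′ :* d′ :+ c′ :* b′) :* (b :* d)) refl a′ b c′ d b′ d′ ⟩
        (a′ * d′ + c′ * b′) * (b * d) ∎)

    *ᶠ-cong : ∀ {x x′ y y′} → x ≈ᶠ x′ → y ≈ᶠ y′ → x *ᶠ y ≈ᶠ x′ *ᶠ y′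
    *ᶠ-cong {fraction a b _} {fraction a′ b′ _} {fraction c d _} {fraction c′ d′ _} (mk≈ p) (mk≈ q) =
      mk≈ (begin
        (a * c) * (b′ * d′)    ≈⟨ swap a c b′ d′ ⟩
        (a * b′) * (c * d′)    ≈⟨ *-cong p q ⟩
        (a′ * b) * (c′ * d)    ≈⟨ swap a′ b c′ d ⟩
        (a′ * c′) * (b * d)    ∎)
      where
      swap : ∀ a b c d → (a * b) * (c * d) ≈ (a * c) * (b * d)
      swap = solve 4 (λ a b c d → (a :* b) :* (c :* d) := (a :* c) :* (b :* d)) refl

    +ᶠ-assoc : ∀ x y z → (x +ᶠ y) +ᶠ z ≈ᶠ x +ᶠ (y +ᶠ z)
    +ᶠ-assoc (fraction a b _) (fraction c d _) (fraction e f _) = mk≈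
      (solve 6 (λ a b c d e f →
        ((a :* d :+ c :* b) :* f :+ e :* (b :* d)) :* (b :* (d :* f))
        := (a :* (d :* f) :+ (c :* f :+ e :* d) :* b) :* ((b :* d) :* f)) refl a b c d e f)

    +ᶠ-comm : ∀ x y → x +ᶠ y ≈ᶠ y +ᶠ x
    +ᶠ-comm (fraction a b _) (fraction c d _) = mk≈
      (solve 4 (λ a b c d → (a :* d :+ c :* b) :* (d :* b) := (c :* b :+ a :* d) :* (b :* d))
        refl a b c d)

    +ᶠ-identityˡ : ∀ x → 0ᶠ +ᶠ x ≈ᶠ x
    +ᶠ-identityˡ (fraction a b _) = mk≈ (*-cong
      (trans (+-cong (zeroˡ b) (*-identityʳ a)) (+-identityˡ a)) (sym (*-identityˡ b)))

    -ᶠ-inverseˡ : ∀ x → (-ᶠ x) +ᶠ x ≈ᶠ 0ᶠ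
    -ᶠ-inverseˡ (fraction a b _) = mk≈ (begin
      (- a * b + a * b) * 1#  ≈⟨ *-identityʳ _ ⟩
      - a * b + a * b         ≈⟨ +-congʳ (-‿distribˡ-* a b) ⟨
      - (a * b) + a * b       ≈⟨ -‿inverseˡ _ ⟩
      0#                      ≈⟨ zeroˡ _ ⟨
      0# * (b * b)            ∎)

    -ᶠ-cong : ∀ {x y} → x ≈ᶠ y → -ᶠ x ≈ᶠ -ᶠ y
    -ᶠ-cong {fraction a b _} {fraction c d _} (mk≈ p) = mk≈
      (trans (sym (-‿distribˡ-* a d)) (trans (-‿cong p) (-‿distribˡ-* c b)))

    *ᶠ-assoc : ∀ x y z → (x *ᶠ y) *ᶠ z ≈ᶠ x *ᶠ (y *ᶠ z)
    *ᶠ-assoc (fraction a b _) (fraction c d _) (fraction e f _) = mk≈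
      (*-cong (*-assoc a c e) (sym (*-assoc b d f)))

    *ᶠ-comm : ∀ x y → x *ᶠ y ≈ᶠ y *ᶠ x
    *ᶠ-comm (fraction a b _) (fraction c d _) = mk≈ (*-cong (*-comm a c) (*-comm d b))

    *ᶠ-identityˡ : ∀ x → 1ᶠ *ᶠ x ≈ᶠ x
    *ᶠ-identityˡ (fraction a b _) = mk≈ (*-cong (*-identityˡ a) (sym (*-identityˡ b)))

    *ᶠ-distribˡ : ∀ x y z → x *ᶠ (y +ᶠ z) ≈ᶠ x *ᶠ y +ᶠ x *ᶠ z
    *ᶠ-distribˡ (fraction a b _) (fraction c d _) (fraction e f _) = mk≈
      (solve 6 (λ a b c d e f →
        (a :* (c :* f :+ e :* d)) :* ((b :* d) :* (b :* f))
        := ((a :* c) :* (b :* f) :+ (a :* e) :* (b :* d)) :* (b :* (d :* f))) refl a b c d e f)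

    num≈0 : ∀ {x} → num x ≈ 0# → x ≈ᶠ 0ᶠ
    num≈0 {fraction a b _} e = mk≈ (trans (*-identityʳ a) (trans e (sym (zeroˡ b))))

    ≈0⇒num : ∀ {x} → x ≈ᶠ 0ᶠ → num x ≈ 0#
    ≈0⇒num {fraction a b _} (mk≈ e) = trans (sym (*-identityʳ a)) (trans e (zeroˡ b))

    _≟ᶠ_ : Decidable _≈ᶠ_
    x ≟ᶠ y = map′ mk≈ cross ((num x * den y) ≟ (num y * den x))

    inv-cong : ∀ {x y} → x ≈ᶠ y → inv x ≈ᶠ inv y
    inv-cong {fraction a b b≉0} {fraction c d d≉0} e with a ≟ 0# | c ≟ 0#
    ... | yes _   | yes _   = reflᶠ
    ... | yes a≈0 | no c≉0  = contradiction (≈0⇒num (transᶠ (symᶠ e) (num≈0 a≈0))) c≉0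
    ... | no a≉0  | yes c≈0 = contradiction (≈0⇒num (transᶠ e (num≈0 c≈0))) a≉0
    ... | no _    | no _    = mk≈ (trans (*-comm b c) (trans (sym (cross e)) (*-comm a d)))

    inv-zero : inv 0ᶠ ≈ᶠ 0ᶠ
    inv-zero with 0# ≟ 0#
    ... | yes _  = reflᶠ
    ... | no 0≉0 = contradiction refl 0≉0

    inv-inverse : ∀ {x} → ¬ (x ≈ᶠ 0ᶠ) → x *ᶠ inv x ≈ᶠ 1ᶠ
    inv-inverse {fraction a b b≉0} x≉0 with a ≟ 0#
    ... | yes a≈0 = contradiction (num≈0 a≈0) x≉0
    ... | no a≉0  = mk≈ (trans (*-identityʳ _) (trans (*-comm a b) (sym (*-identityˡ _))))

    ringᶠ : CommutativeRing 0ℓ 0ℓ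
    ringᶠ = record
      { Carrier = Fraction ; _≈_ = _≈ᶠ_ ; _+_ = _+ᶠ_ ; _*_ = _*ᶠ_ ; -_ = -ᶠ_ ; 0# = 0ᶠ ; 1# = 1ᶠ
      ; isCommutativeRing = record
        { isRing = record
          { +-isAbelianGroup = record
            { isGroup = record
              { isMonoid = record
                { isSemigroup = record
                  { isMagma = record
                    { isEquivalence = record { refl = reflᶠ ; sym = symᶠ ; trans = transᶠ }
                    ; ∙-cong = +ᶠ-cong }
                  ; assoc = +ᶠ-assoc }
                ; identity = +ᶠ-identityˡ , λ x → transᶠ (+ᶠ-comm x 0ᶠ) (+ᶠ-identityˡ x) }
              ; inverse = -ᶠ-inverseˡ , λ x → transᶠ (+ᶠ-comm x (-ᶠ x)) (-ᶠ-inverseˡ x)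
              ; ⁻¹-cong = -ᶠ-cong }
            ; comm = +ᶠ-comm }
          ; *-cong = *ᶠ-cong
          ; *-assoc = *ᶠ-assoc
          ; *-identity = *ᶠ-identityˡ , λ x → transᶠ (*ᶠ-comm x 1ᶠ) (*ᶠ-identityˡ x)
          ; distrib = *ᶠ-distribˡ , λ x y z → transᶠ (*ᶠ-comm (y +ᶠ z) x)
              (transᶠ (*ᶠ-distribˡ x y z) (+ᶠ-cong (*ᶠ-comm x y) (*ᶠ-comm x z))) }
        ; *-comm = *ᶠ-comm } }

  fractionField : Field
  fractionField = record
    { integralDomain = record
      { commutativeRing = ringᶠ
      ; _≟_ = _≟ᶠ_
      ; 1≉0 = λ e → 1≉0 (≈0⇒num e)
      ; *-nonzero = λ x≉0 y≉0 e →
          *-nonzero (x≉0 ∘ num≈0) (y≉0 ∘ num≈0) (≈0⇒num e)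
      }
    ; _⁻¹ = inv
    ; ⁻¹-cong = inv-cong
    ; ⁻¹-zero = inv-zero
    ; ⁻¹-inverse = inv-inverse
    }

ℚ-domain : IntegralDomain
ℚ-domain = record
  { commutativeRing = ℚ.+-*-commutativeRing
  ; _≟_ = ℚ._≟_
  ; 1≉0 = λ ()
  ; *-nonzero = nonzero
  }
  where
  nonzero : ∀ {a b} → a ≢ ℚ.0ℚ → b ≢ ℚ.0ℚ → a ℚ.* b ≢ ℚ.0ℚ
  nonzero {a} {b} a≢0 b≢0 e = b≢0 (begin
    b                          ≡⟨ ℚ.*-identityˡ b ⟨
    ℚ.1ℚ ℚ.* b                 ≡⟨ ≡.cong (ℚ._* b) (ℚ.*-inverseˡ a) ⟨
    (ℚ.1/ a) ℚ.* a ℚ.* b       ≡⟨ ℚ.*-assoc (ℚ.1/ a) a b ⟩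
    (ℚ.1/ a) ℚ.* (a ℚ.* b)     ≡⟨ ≡.cong ((ℚ.1/ a) ℚ.*_) e ⟩
    (ℚ.1/ a) ℚ.* ℚ.0ℚ          ≡⟨ ℚ.*-zeroʳ (ℚ.1/ a) ⟩
    ℚ.0ℚ                       ∎)
    where
    open ≡.≡-Reasoning
    instance
      a-nonZero : ℚ.NonZero a
      a-nonZero = ℚ.≢-nonZero a≢0

ℚ⟨t⟩ : Field
ℚ⟨t⟩ = Fractions.fractionField (Polynomials.integralDomainₚ ℚ-domain)

indeterminate : Field.Carrier ℚ⟨t⟩
indeterminate = Fractions.ι (Polynomials.integralDomainₚ ℚ-domain) (Polynomials.X ℚ-domain)

module RationalFunctions (K : Field) where
  open Field K using (Carrier; integralDomain)

  K[x] : ℕ → IntegralDomain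
  K[x] zero    = integralDomain
  K[x] (suc n) = Polynomials.integralDomainₚ (K[x] n)

  constant : ∀ n → Carrier → IntegralDomain.Carrier (K[x] n)
  constant zero    a = a
  constant (suc n) a = Polynomials.constₚ (K[x] n) (constant n a)

  variableₚ : ∀ n → Fin n → IntegralDomain.Carrier (K[x] n)
  variableₚ (suc n) fzero    = Polynomials.X (K[x] n)
  variableₚ (suc n) (fsuc i) = Polynomials.constₚ (K[x] n) (variableₚ n i)

  K⟨x⟩ : ℕ → Field
  K⟨x⟩ n = Fractions.fractionField (K[x] n)

  scalar : ∀ n → Carrier → Field.Carrier (K⟨x⟩ n)
  scalar n a = Fractions.ι (K[x] n) (constant n a)

  var : ∀ n → Fin n → Field.Carrier (K⟨x⟩ n)
  var n i = Fractions.ι (K[x] n) (variableₚ n i)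

productRing : (ℕ → CommutativeRing 0ℓ 0ℓ) → CommutativeRing 0ℓ 0ℓ
productRing R = record
  { Carrier = ∀ n → Carrier (R n)
  ; _≈_ = λ f g → ∀ n → _≈_ (R n) (f n) (g n)
  ; _+_ = λ f g n → _+_ (R n) (f n) (g n)
  ; _*_ = λ f g n → _*_ (R n) (f n) (g n)
  ; -_ = λ f n → -_ (R n) (f n)
  ; 0# = λ n → 0# (R n)
  ; 1# = λ n → 1# (R n)
  ; isCommutativeRing = record
    { isRing = record
      { +-isAbelianGroup = record
        { isGroup = record
          { isMonoid = record
            { isSemigroup = record
              { isMagma = record
                { isEquivalence = record
                  { refl = λ n → refl (R n)
                  ; sym = λ e n → sym (R n) (e n)
                  ; trans = λ e f n → trans (R n) (e n) (f n) }
                ; ∙-cong = λ e f n → +-cong (R n) (e n) (f n) }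
              ; assoc = λ f g h n → +-assoc (R n) (f n) (g n) (h n) }
            ; identity = (λ f n → +-identityˡ (R n) (f n)) , λ f n → +-identityʳ (R n) (f n) }
          ; inverse = (λ f n → -‿inverseˡ (R n) (f n)) , λ f n → -‿inverseʳ (R n) (f n)
          ; ⁻¹-cong = λ e n → -‿cong (R n) (e n) }
        ; comm = λ f g n → +-comm (R n) (f n) (g n) }
      ; *-cong = λ e f n → *-cong (R n) (e n) (f n)
      ; *-assoc = λ f g h n → *-assoc (R n) (f n) (g n) (h n)
      ; *-identity = (λ f n → *-identityˡ (R n) (f n)) , λ f n → *-identityʳ (R n) (f n)
      ; distrib = (λ f g h n → distribˡ (R n) (f n) (g n) (h n))
                , λ f g h n → distribʳ (R n) (f n) (g n) (h n) }
    ; *-comm = λ f g n → *-comm (R n) (f n) (g n) } }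
  where open CommutativeRing

record Partition : Set where
  constructor partition
  field
    parts       : List ℕ
    .decreasing : Linked _≥_ parts
    .positive   : All (0 <_) parts
open Partition public

entry : List ℕ → ℕ → ℕ
entry []       _       = 0
entry (a ∷ as) zero    = a
entry (a ∷ as) (suc i) = entry as i

-- Indices start at 0: part σ i is σᵢ₊₁.
part : Partition → ℕ → ℕ
part σ = entry (parts σ)

ℓ : Partition → ℕ
ℓ σ = length (parts σ)

size : Partition → ℕ
size σ = sum (parts σ)

-- n(σ) = ∑ᵢ (i-1) σᵢ
n⟨_⟩ : Partition → ℕ
n⟨ σ ⟩ = sum (zipWith ℕ._*_ (upTo (ℓ σ)) (parts σ))

-- σᶜⱼ = #{ i | σᵢ ≥ j }, for j ≥ 1
conj : Partition → ℕ → ℕ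
conj σ j = length (filter (j ℕ.≤?_) (parts σ))

mult : Partition → ℕ → ℕ
mult σ j = length (filter (j ℕ.≟_) (parts σ))

infix 4 _⊆_ _⊆?_
_⊆_ : Partition → Partition → Set
μ ⊆ σ = ∀ i → part μ i ≤ part σ i

-- This presupposes ν ⊆ σ.
VerticalStrip : Partition → Partition → Set
VerticalStrip σ ν = ∀ i → part σ i ≤ part ν i ℕ.+ 1

private
  entry-beyond : ∀ as {i} → length as ≤ i → entry as i ≡ 0
  entry-beyond []       _             = ≡.refl
  entry-beyond (a ∷ as) (ℕ.s≤s le)    = entry-beyond as le

  decideAll : ∀ σ (b : ℕ → ℕ) → Dec (∀ i → part σ i ≤ b i)
  decideAll σ b = map′ extend (λ h {i} _ → h i) (ℕ.allUpTo? (λ i → part σ i ℕ.≤? b i) (ℓ σ))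
    where
    extend : (∀ {i} → i < ℓ σ → part σ i ≤ b i) → ∀ i → part σ i ≤ b i
    extend h i with i ℕ.<? ℓ σ
    ... | yes i<ℓ = h i<ℓ
    ... | no i≮ℓ  = ≡.subst (_≤ b i) (≡.sym (entry-beyond (parts σ) (ℕ.≮⇒≥ i≮ℓ))) z≤n

_⊆?_ : ∀ μ σ → Dec (μ ⊆ σ)
μ ⊆? σ = decideAll μ (part σ)

verticalStrip? : ∀ σ ν → Dec (VerticalStrip σ ν)
verticalStrip? σ ν = decideAll σ (λ i → part ν i ℕ.+ 1)

toPartition : List ℕ → Maybe Partition
toPartition as with linked? ℕ._≥?_ as | all? (0 ℕ.<?_) as
... | yes d | yes p = just (partition as d p)
... | _     | _     = nothing

-- All lists of length ≤ k with entries ≤ b, each occurring once.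
boundedLists : ℕ → ℕ → List (List ℕ)
boundedLists zero    b = [] ∷ []
boundedLists (suc k) b = [] ∷ concatMap (λ a → map (a ∷_) (boundedLists k b)) (upTo (suc b))

-- The partitions ν with μ ⊆ ν ⊆ σ, each occurring once.
interval : Partition → Partition → List Partition
interval μ σ =
  filter (λ ν → (μ ⊆? ν) ×-dec (ν ⊆? σ)) (mapMaybe toPartition (boundedLists (ℓ σ) (part σ 0)))

module HallLittlewood (K : Field) (t : Field.Carrier K) where
  open Field K public using (Carrier; _≈_; _+_; _*_; _-_; 0#; 1#; _⁻¹; _÷_; commutativeRing)
  open FieldOperations K public
  open RationalFunctions K public

  -- The factors with j > σ₁ (respectively j > ν₁) are equal to 1.

  vs : Partition → Partition → Carrier
  vs σ ν = if does (verticalStrip? σ ν)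
    then ∏ (upTo (part σ 0)) (λ i → let j = suc i in
           gaussianBinomial t (conj σ j ∸ conj σ (suc j)) (conj σ j ∸ conj ν j))
    else 0#

  sk : Partition → Partition → Carrier
  sk ν μ =
    t ^ sum (map (λ i → let j = suc i in (conj ν j ∸ conj μ j) C 2) (upTo (part ν 0)))
    * ∏ (upTo (part ν 0)) (λ i → let j = suc i in
        gaussianBinomial t (conj ν j ∸ conj μ (suc j)) (mult μ j))

  -- w ∈ Sₙ is determined by the value w(0) and by the permutation of n-1
  -- elements it induces between the remaining ones.
  permutations : ∀ n → List (Permutation n n)
  permutations zero    = idₚ ∷ []
  permutations (suc n) =
    concatMap (λ j → map (insert fzero j) (permutations n)) (allFin (suc n))

  vₘ : ℕ → Carrier
  vₘ m = ∏ (upTo m) (λ i → (1# - t ^ suc i) ÷ (1# - t))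

  -- v_σ(t) = ∏_{j ≥ 0} v_{m_j}(t), where m₀ = n - ℓ(σ)
  v : ℕ → Partition → Carrier
  v n σ = vₘ (n ∸ ℓ σ) * ∏ (upTo (part σ 0)) (λ i → vₘ (mult σ (suc i)))

  -- The Hall–Littlewood polynomial
  --   P_σ(x₁,…,xₙ;t) = v_σ(t)⁻¹ ∑_{w ∈ Sₙ} w (x^σ ∏_{i<j} (xᵢ - t xⱼ)/(xᵢ - xⱼ)),
  -- which is 0 by convention when n < ℓ(σ).
  module _ (n : ℕ) where
    private
      module F = Field (K⟨x⟩ n)
      module O = FieldOperations (K⟨x⟩ n)

    symmetrizand : Partition → (Fin n → F.Carrier) → F.Carrier
    symmetrizand σ x =
      O.∏ (allFin n) (λ i → x i O.^ part σ (toℕ i)) F.*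
      O.∏ (allFin n) (λ i → O.∏ (filter (i Fin.<?_) (allFin n)) (λ j →
        (x i F.- scalar n t F.* x j) F.÷ (x i F.- x j)))

    P⟨_vars⟩ : Partition → F.Carrier
    P⟨_vars⟩ σ = if does (ℓ σ ℕ.≤? n)
      then scalar n (v n σ) F.⁻¹ F.*
           O.∑ (permutations n) (λ w → symmetrizand σ (λ i → var n (w ⟨$⟩ʳ i)))
      else F.0#

  -- A symmetric function is identified with the family of its restrictions to
  -- n variables, n = 0, 1, 2, …; this embeds the ring of symmetric functions
  -- over K in the ring of all families.
  families : CommutativeRing 0ℓ 0ℓ
  families = productRing (λ n → Field.commutativeRing (K⟨x⟩ n))

  module Families where
    open CommutativeRing families public
    open Operations families public

  P : Partition → Families.Carrier
  P σ n = P⟨_vars⟩ n σ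

  scale : Carrier → Families.Carrier
  scale a n = scalar n a

  -- f ρ σ μ is the coefficient of P_ρ in P_σ P_μ.
  IsStructureConstants : (Partition → Partition → Partition → Carrier) → Set
  IsStructureConstants f = ∀ σ μ →
    Families.IsFiniteSum (λ ρ → scale (f ρ σ μ) Families.* P ρ) (P σ Families.* P μ)

  module K[y] where
    open Polynomials (Field.integralDomain K) public using () renaming (constₚ to const; X to y)
    open CommutativeRing (Polynomials.commutativeRingₚ (Field.integralDomain K)) public
    open Operations (Polynomials.commutativeRingₚ (Field.integralDomain K)) public

open HallLittlewood ℚ⟨t⟩ indeterminate public

t : Carrier
t = indeterminate

-- Every symmetric polynomial ∑_w w(x^α ∏_{i<j} (xᵢ - t xⱼ)/(xᵢ - xⱼ)) =: R_α satisfies the straightening rule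
-- R_{…,a,a+1,…} = t R_{…,a+1,a,…}. Multiplying by the elementary symmetric polynomial e_r adds 0-1 vectors to α, so
-- straightening inside each block of equal exponents gives the Pieri rule e_r P_ν = ∑_λ vs_{λ/ν} P_λ.
-- In terms of columns (conjugate parts) the sum ∑_ν vs_{λ/ν} sk_{ν/μ} y^{|λ/ν|} factorizes, and the q-binomial theorem
-- shows that it is δ_{λμ} at y = -1, and t^{n(λ) - C(ℓ(λ),2)} ∏_{j ≤ ℓ(λ)} (y + t^{j-1}) for μ = ∅. With the first value
-- and the Pieri rule, the sums q_{μ,k} = ∑_{|ν/μ| = k} sk_{ν/μ} P_ν satisfy ∑_r (-1)^r e_r q_{μ,k-r} = δ_{k0} P_μ, a
-- recursion that forces q_{μ,k} = q_{∅,k} P_μ. Multiplying by e_m and expanding both sides by the Pieri rule (with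
-- the second value on the right) gives the theorem, once the P_λ are known to be linearly independent. This is
-- shown by setting one variable to 0: it kills P_λ when ℓ(λ) is the number of variables, in which case P_λ is
-- x₁⋯xₙ times a smaller one, and otherwise gives P_λ in one variable fewer. Independence and the substitution
-- xᵢ ↦ t xᵢ show that f^λ_{σμ} = 0 unless |λ| = |σ| + |μ|, so that the right-hand side is a finite sum.

module Submission where

open import Defs using
  ( IntegralDomain; Field; module IntegralDomain; module Field; module Operations; module FieldOperations
  ; module Polynomials; module Fractions; module RationalFunctions; module HallLittlewood
  ; Partition; partition; parts; entry; part; ℓ; size; n⟨_⟩; conj; mult; _⊆_; _⊆?_
  ; VerticalStrip; verticalStrip?; toPartition; boundedLists; interval )
open import Algebra using (CommutativeRing)
import Algebra.Properties.CommutativeSemiring.Exp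
import Algebra.Properties.Ring
import Algebra.Solver.Ring.NaturalCoefficients.Default
open import Data.Bool.Base using (if_then_else_)
open import Data.Empty using (⊥-elim)
open import Data.Fin.Base using (Fin; toℕ; punchIn) renaming (zero to fzero; suc to fsuc)
import Data.Fin.Properties as Fin
open import Data.Fin.Permutation using (_⟨$⟩ʳ_; insert; insert-punchIn)
open import Data.Integer.Base using (_⊖_)
open import Data.Integer.Properties using ([1+m]⊖[1+n]≡m⊖n)
open import Data.List.Base
  using (List; []; _∷_; _++_; map; concatMap; filter; length; replicate; zipWith; upTo; applyUpTo; drop; allFin; mapMaybe; tabulate)
open import Data.List.Properties using (map-upTo; map-applyUpTo; length-applyUpTo; upTo-∷ʳ; map-∘; filter-all; length-filter; map-tabulate; length-++; length-map; length-replicate; map-++; ++-assoc; ++-identityʳ; map-replicate; filter-accept; filter-reject; ∷-injectiveˡ; ∷-injectiveʳ; ≡-dec)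
open import Data.List.Membership.Propositional using (_∈_; _∉_; find; lose)
open import Data.List.Membership.Propositional.Properties using (∈-upTo⁻; ∈-upTo⁺; ∈-map⁻; ∈-map⁺; ∈-concatMap⁺; ∈-concatMap⁻; ∈-filter⁺; ∈-filter⁻)
open import Data.List.Relation.Unary.All as All using (All; []; _∷_; all?; universal)
import Data.List.Relation.Unary.All.Properties as All
import Data.List.Relation.Unary.AllPairs as AP
open import Data.List.Relation.Unary.Any using (here; there; any?)
open import Data.List.Relation.Unary.Linked using (Linked; []; [-]; _∷_; linked?)
open import Data.List.Relation.Unary.Unique.Propositional using (Unique)
import Data.List.Relation.Unary.Unique.Propositional.Properties as Unique
open import Data.Maybe.Base using (just; nothing)
open import Data.Nat.Base as ℕ using (ℕ; zero; suc; _≤_; _<_; _≥_; _∸_; z≤n; s≤s)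
open import Data.Nat.Combinatorics using (_C_; nCk+nC[k+1]≡[n+1]C[k+1]; nC1≡n)
open import Data.Nat.ListAction using (sum)
open import Data.Nat.ListAction.Properties using (sum-++)
import Data.Nat.Properties as ℕ
open import Data.Product using (∃; _×_; _,_; proj₁; proj₂)
open import Data.Sum.Base using (_⊎_; inj₁; inj₂)
open import Data.Unit.Base using (⊤; tt)
open import Data.Vec.Base as Vec using (Vec; []; _∷_)
import Data.Vec.Properties as Vec
import Data.Vec.Relation.Unary.All as VAll
import Data.Vec.Relation.Unary.All.Properties as VAll
open import Function.Base using (_∘_; _⟨_⟩_)
open import Level using (0ℓ)
open import Relation.Binary.Definitions using (Tri; tri<; tri≈; tri>)
open import Relation.Binary.PropositionalEquality as ≡ using (_≡_; _≢_)
open import Relation.Nullary using (Dec; yes; no; ¬_; does; contradiction)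
open import Relation.Nullary.Decidable as Dec using (_×-dec_; recompute)

-- Partitions are handled as lists of column heights of a fixed length L, bounded by the number n of
-- variables, because vs and sk are products over adjacent columns and can be treated one column at
-- a time. Such a truncation is exact only if everything that occurs fits into the box. The degree
-- bounds `< L` ensure this: they force the last column to be 0 and so leave room for an added
-- vertical strip. Since 0⁻¹ = 0, the sums `R` make sense at any vector of field elements, and
-- straightening holds there even for equal entries. Distinctness matters only when indeterminates
-- are specialized. Setting a variable to 0 is not defined on all rational functions, so
-- specialization is a relation between a function and its value; the same relation serves for
-- rescaling. The recursion for q_{μ,k} needs P_∅ = 1. The sum over all permutations behind P_∅ is
-- never evaluated: homogeneity of the structure constants makes P_∅² a multiple of P_∅, and the
-- case of no variables shows that the factor is 1.

record RingHom (A B : CommutativeRing 0ℓ 0ℓ) : Set where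
  private
    module A = CommutativeRing A
    module B = CommutativeRing B
  field
    ⟦_⟧    : A.Carrier → B.Carrier
    ⟦⟧-cong : ∀ {a b} → a A.≈ b → ⟦ a ⟧ B.≈ ⟦ b ⟧
    +-homo : ∀ a b → ⟦ a A.+ b ⟧ B.≈ ⟦ a ⟧ B.+ ⟦ b ⟧
    *-homo : ∀ a b → ⟦ a A.* b ⟧ B.≈ ⟦ a ⟧ B.* ⟦ b ⟧
    1-homo : ⟦ A.1# ⟧ B.≈ B.1#

  0-homo : ⟦ A.0# ⟧ B.≈ B.0#
  0-homo = RingProperties.+-cancelˡ _ _ _ (B.trans (B.sym (+-homo A.0# A.0#))
    (B.trans (⟦⟧-cong (A.+-identityˡ A.0#)) (B.sym (B.+-identityʳ _))))
    where module RingProperties = Algebra.Properties.Ring B.ring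

  neg-homo : ∀ a → ⟦ A.- a ⟧ B.≈ B.- ⟦ a ⟧
  neg-homo a = RingProperties.+-cancelˡ ⟦ a ⟧ _ _ (B.trans (B.sym (+-homo a (A.- a)))
    (B.trans (⟦⟧-cong (A.-‿inverseʳ a)) (B.trans 0-homo (B.sym (B.-‿inverseʳ ⟦ a ⟧)))))
    where module RingProperties = Algebra.Properties.Ring B.ring

idHom : ∀ A → RingHom A A
idHom A = record
  { ⟦_⟧ = λ a → a ; ⟦⟧-cong = λ e → e ; +-homo = λ _ _ → refl ; *-homo = λ _ _ → refl ; 1-homo = refl }
  where open CommutativeRing A

-- Finite sums and products over lists.

module Sums (A : CommutativeRing 0ℓ 0ℓ) where
  open CommutativeRing A hiding (zero)
  open Operations A
  open import Relation.Binary.Reasoning.Setoid setoid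
  module S = Algebra.Solver.Ring.NaturalCoefficients.Default commutativeSemiring

  -- An Iverson bracket. Side conditions become factors of the summand, so the ranges of nested sums
  -- stay independent and the sums can be interchanged.
  χ : {P : Set} → Dec P → Carrier
  χ d = if does d then 1# else 0#

  χ-yes : {P : Set} (d : Dec P) → P → χ d ≈ 1#
  χ-yes (yes _) _ = refl
  χ-yes (no ¬p) p = contradiction p ¬p

  χ-no : {P : Set} (d : Dec P) → ¬ P → χ d ≈ 0#
  χ-no (yes p) ¬p = contradiction p ¬p
  χ-no (no _)  _  = refl

  χ-cong : {P Q : Set} (d : Dec P) (e : Dec Q) → (P → Q) → (Q → P) → χ d ≈ χ e
  χ-cong (yes p) e f g = sym (χ-yes e (f p))
  χ-cong (no ¬p) e f g = sym (χ-no e (¬p ∘ g))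

  χ-*-cong : {P : Set} (d : Dec P) {a b : Carrier} → (P → a ≈ b) → χ d * a ≈ χ d * b
  χ-*-cong (yes p) f = *-congˡ (f p)
  χ-*-cong (no _)  f = trans (zeroˡ _) (sym (zeroˡ _))

  χ-yes-* : {P : Set} (d : Dec P) {a : Carrier} → P → χ d * a ≈ a
  χ-yes-* d p = trans (*-congʳ (χ-yes d p)) (*-identityˡ _)

  χ-no-* : {P : Set} (d : Dec P) {a : Carrier} → ¬ P → χ d * a ≈ 0#
  χ-no-* d ¬p = trans (*-congʳ (χ-no d ¬p)) (zeroˡ _)

  module _ {X : Set} where
    ∑-cong∈ : ∀ (xs : List X) {f g : X → Carrier} → (∀ {a} → a ∈ xs → f a ≈ g a) → ∑ xs f ≈ ∑ xs g
    ∑-cong∈ []       h = refl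
    ∑-cong∈ (x ∷ xs) h = +-cong (h (here ≡.refl)) (∑-cong∈ xs (h ∘ there))

    ∑-cong : ∀ (xs : List X) {f g : X → Carrier} → (∀ a → f a ≈ g a) → ∑ xs f ≈ ∑ xs g
    ∑-cong xs h = ∑-cong∈ xs (λ {a} _ → h a)

    ∑-zero∈ : ∀ (xs : List X) {f : X → Carrier} → (∀ {a} → a ∈ xs → f a ≈ 0#) → ∑ xs f ≈ 0#
    ∑-zero∈ []       h = refl
    ∑-zero∈ (x ∷ xs) h = trans (+-cong (h (here ≡.refl)) (∑-zero∈ xs (h ∘ there))) (+-identityˡ 0#)

    ∑-zero : ∀ (xs : List X) {f : X → Carrier} → (∀ a → f a ≈ 0#) → ∑ xs f ≈ 0#
    ∑-zero xs h = ∑-zero∈ xs (λ {a} _ → h a)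

    ∑-+ : ∀ (xs : List X) (f g : X → Carrier) → ∑ xs (λ a → f a + g a) ≈ ∑ xs f + ∑ xs g
    ∑-+ []       f g = sym (+-identityˡ 0#)
    ∑-+ (x ∷ xs) f g = trans (+-congˡ (∑-+ xs f g))
      (S.solve 4 (λ a b c d → (a S.:+ b) S.:+ (c S.:+ d) S.:= (a S.:+ c) S.:+ (b S.:+ d))
        refl (f x) (g x) (∑ xs f) (∑ xs g))

    *-∑ : ∀ a (xs : List X) (f : X → Carrier) → a * ∑ xs f ≈ ∑ xs (λ x → a * f x)
    *-∑ a []       f = zeroʳ a
    *-∑ a (x ∷ xs) f = trans (distribˡ a _ _) (+-congˡ (*-∑ a xs f))

    ∑-* : ∀ a (xs : List X) (f : X → Carrier) → ∑ xs f * a ≈ ∑ xs (λ x → f x * a)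
    ∑-* a xs f = trans (*-comm _ a) (trans (*-∑ a xs f) (∑-cong xs (λ x → *-comm a (f x))))

    ∑-++ : ∀ (xs ys : List X) (f : X → Carrier) → ∑ (xs ++ ys) f ≈ ∑ xs f + ∑ ys f
    ∑-++ []       ys f = sym (+-identityˡ _)
    ∑-++ (x ∷ xs) ys f = trans (+-congˡ (∑-++ xs ys f)) (sym (+-assoc _ _ _))

    ∑-filter : ∀ {P : X → Set} (P? : ∀ x → Dec (P x)) (xs : List X) (f : X → Carrier) →
      ∑ (filter P? xs) f ≈ ∑ xs (λ x → χ (P? x) * f x)
    ∑-filter P? []       f = refl
    ∑-filter P? (x ∷ xs) f with P? x
    ... | yes _ = +-cong (sym (*-identityˡ _)) (∑-filter P? xs f)
    ... | no _  = trans (∑-filter P? xs f) (trans (sym (+-identityˡ _)) (+-congʳ (sym (zeroˡ _))))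

    ∏-cong : ∀ (xs : List X) {f g : X → Carrier} → (∀ a → f a ≈ g a) → ∏ xs f ≈ ∏ xs g
    ∏-cong []       h = refl
    ∏-cong (x ∷ xs) h = *-cong (h x) (∏-cong xs h)

    ∏-++ : ∀ (xs ys : List X) (f : X → Carrier) → ∏ (xs ++ ys) f ≈ ∏ xs f * ∏ ys f
    ∏-++ []       ys f = sym (*-identityˡ _)
    ∏-++ (x ∷ xs) ys f = trans (*-congˡ (∏-++ xs ys f)) (sym (*-assoc _ _ _))

    ∏-* : ∀ (xs : List X) (f g : X → Carrier) → ∏ xs (λ a → f a * g a) ≈ ∏ xs f * ∏ xs g
    ∏-* []       f g = sym (*-identityˡ 1#)
    ∏-* (x ∷ xs) f g = trans (*-congˡ (∏-* xs f g))
      (S.solve 4 (λ a b c d → (a S.:* b) S.:* (c S.:* d) S.:= (a S.:* c) S.:* (b S.:* d))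
        refl (f x) (g x) (∏ xs f) (∏ xs g))

  ∑-map : ∀ {X Y : Set} (h : X → Y) (xs : List X) (f : Y → Carrier) → ∑ (map h xs) f ≡ ∑ xs (f ∘ h)
  ∑-map h []       f = ≡.refl
  ∑-map h (x ∷ xs) f = ≡.cong (f (h x) +_) (∑-map h xs f)

  ∏-map : ∀ {X Y : Set} (h : X → Y) (xs : List X) (f : Y → Carrier) → ∏ (map h xs) f ≡ ∏ xs (f ∘ h)
  ∏-map h []       f = ≡.refl
  ∏-map h (x ∷ xs) f = ≡.cong (f (h x) *_) (∏-map h xs f)

  ∑-concatMap : ∀ {X Y : Set} (h : X → List Y) (xs : List X) (f : Y → Carrier) →
    ∑ (concatMap h xs) f ≈ ∑ xs (λ x → ∑ (h x) f)
  ∑-concatMap h []       f = refl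
  ∑-concatMap h (x ∷ xs) f = trans (∑-++ (h x) (concatMap h xs) f) (+-congˡ (∑-concatMap h xs f))

  ∑-swap : ∀ {X Y : Set} (xs : List X) (ys : List Y) (f : X → Y → Carrier) →
    ∑ xs (λ x → ∑ ys (f x)) ≈ ∑ ys (λ y → ∑ xs (λ x → f x y))
  ∑-swap []       ys f = sym (∑-zero ys (λ _ → refl))
  ∑-swap (x ∷ xs) ys f = trans (+-congˡ (∑-swap xs ys f)) (sym (∑-+ ys (f x) _))

  module _ {X : Set} (_≟ₓ_ : (x y : X) → Dec (x ≡ y)) where
    ∑-χ-∉ : ∀ (xs : List X) a (f : X → Carrier) → a ∉ xs → ∑ xs (λ b → χ (a ≟ₓ b) * f b) ≈ 0#
    ∑-χ-∉ xs a f a∉ = ∑-zero∈ xs λ {b} b∈ →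
      χ-no-* (a ≟ₓ b) (λ a≡b → a∉ (≡.subst (_∈ xs) (≡.sym a≡b) b∈))

    ∑-χ : ∀ {xs : List X} → Unique xs → ∀ a (f : X → Carrier) → a ∈ xs →
      ∑ xs (λ b → χ (a ≟ₓ b) * f b) ≈ f a
    ∑-χ {x ∷ xs} (x∉ AP.∷ u) a f (here ≡.refl) = trans
      (+-cong (χ-yes-* (a ≟ₓ a) ≡.refl) (∑-χ-∉ xs a f (λ a∈ → All.lookup x∉ a∈ ≡.refl)))
      (+-identityʳ _)
    ∑-χ {x ∷ xs} (x∉ AP.∷ u) a f (there a∈) = trans
      (+-cong (χ-no-* (a ≟ₓ x) (λ a≡x → All.lookup x∉ a∈ (≡.sym a≡x))) (∑-χ u a f a∈))
      (+-identityˡ _)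

    -- A finite sum comes with an unspecified list, so its value must be independent of that list.
    -- Each summand is expanded over the other list by a Kronecker delta, and the order of summation
    -- is exchanged.
    ∑-support : ∀ {xs ys : List X} → Unique xs → Unique ys → (f : X → Carrier) →
      (∀ a → a ∉ xs → f a ≈ 0#) → (∀ a → a ∉ ys → f a ≈ 0#) → ∑ xs f ≈ ∑ ys f
    ∑-support {xs} {ys} uxs uys f hx hy = begin
      ∑ xs f                                        ≈⟨ ∑-cong xs (λ a → expand uys a (hy a)) ⟨
      ∑ xs (λ a → ∑ ys (λ b → χ (a ≟ₓ b) * f b))    ≈⟨ ∑-swap xs ys _ ⟩
      ∑ ys (λ b → ∑ xs (λ a → χ (a ≟ₓ b) * f b))
        ≈⟨ ∑-cong ys (λ b → ∑-cong xs (λ a → transpose a b)) ⟩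
      ∑ ys (λ b → ∑ xs (λ a → χ (b ≟ₓ a) * f a))    ≈⟨ ∑-cong ys (λ b → expand uxs b (hx b)) ⟩
      ∑ ys f                                        ∎
      where
      expand : ∀ {zs} → Unique zs → ∀ a → (a ∉ zs → f a ≈ 0#) → ∑ zs (λ b → χ (a ≟ₓ b) * f b) ≈ f a
      expand {zs} u a h with any? (a ≟ₓ_) zs
      ... | yes a∈ = ∑-χ u a f a∈
      ... | no a∉  = trans (∑-χ-∉ zs a f a∉) (sym (h a∉))
      transpose : ∀ a b → χ (a ≟ₓ b) * f b ≈ χ (b ≟ₓ a) * f a
      transpose a b with a ≟ₓ b
      ... | yes ≡.refl = sym (χ-*-cong (a ≟ₓ a) (λ _ → refl) ⟨ trans ⟩ χ-yes-* (a ≟ₓ a) ≡.refl ⟨ trans ⟩ sym (*-identityˡ _))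
      ... | no a≢b     = trans (zeroˡ _) (sym (χ-no-* (b ≟ₓ a) (a≢b ∘ ≡.sym)))

  ∑-upTo-suc : ∀ n (f : ℕ → Carrier) → ∑ (upTo (suc n)) f ≈ f 0 + ∑ (upTo n) (f ∘ suc)
  ∑-upTo-suc n f = +-congˡ (reflexive (≡.trans
    (≡.cong (λ xs → ∑ xs f) (≡.sym (map-upTo suc n))) (∑-map suc (upTo n) f)))

  ∑-upTo-last : ∀ n (f : ℕ → Carrier) → ∑ (upTo (suc n)) f ≈ ∑ (upTo n) f + f n
  ∑-upTo-last n f = trans (reflexive (≡.cong (λ xs → ∑ xs f) (≡.sym (upTo-∷ʳ n))))
    (trans (∑-++ (upTo n) (n ∷ []) f) (+-congˡ (+-identityʳ _)))

  ∑-upTo-cong : ∀ n {f g : ℕ → Carrier} → (∀ {i} → i < n → f i ≈ g i) → ∑ (upTo n) f ≈ ∑ (upTo n) g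
  ∑-upTo-cong n h = ∑-cong∈ (upTo n) (h ∘ ∈-upTo⁻)

  ∑-upTo-reverse : ∀ n (f : ℕ → Carrier) → ∑ (upTo (suc n)) f ≈ ∑ (upTo (suc n)) (λ i → f (n ∸ i))
  ∑-upTo-reverse zero    f = refl
  ∑-upTo-reverse (suc n) f = begin
    ∑ (upTo (2 ℕ.+ n)) f                                         ≈⟨ ∑-upTo-last (suc n) f ⟩
    ∑ (upTo (suc n)) f + f (suc n)                               ≈⟨ +-comm _ _ ⟩
    f (suc n) + ∑ (upTo (suc n)) f                               ≈⟨ +-congˡ (∑-upTo-reverse n f) ⟩
    f (suc n) + ∑ (upTo (suc n)) (λ i → f (n ∸ i))               ≈⟨ ∑-upTo-suc (suc n) _ ⟨
    ∑ (upTo (2 ℕ.+ n)) (λ i → f (suc n ∸ i))                     ∎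

  ∏-upTo-suc : ∀ n (f : ℕ → Carrier) → ∏ (upTo (suc n)) f ≈ f 0 * ∏ (upTo n) (f ∘ suc)
  ∏-upTo-suc n f = *-congˡ (reflexive (≡.trans
    (≡.cong (λ xs → ∏ xs f) (≡.sym (map-upTo suc n))) (∏-map suc (upTo n) f)))

  ∏-upTo-last : ∀ n (f : ℕ → Carrier) → ∏ (upTo (suc n)) f ≈ ∏ (upTo n) f * f n
  ∏-upTo-last n f = trans (reflexive (≡.cong (λ xs → ∏ xs f) (≡.sym (upTo-∷ʳ n))))
    (trans (∏-++ (upTo n) (n ∷ []) f) (*-congˡ (*-identityʳ _)))

module _ {A B : CommutativeRing 0ℓ 0ℓ} (h : RingHom A B) where
  private
    module A = CommutativeRing A
    module B = CommutativeRing B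
    module OA = Operations A
    module OB = Operations B
  open RingHom h

  ∑-homo : ∀ {X : Set} (xs : List X) f → ⟦ OA.∑ xs f ⟧ B.≈ OB.∑ xs (λ x → ⟦ f x ⟧)
  ∑-homo []       f = 0-homo
  ∑-homo (x ∷ xs) f = B.trans (+-homo _ _) (B.+-congˡ (∑-homo xs f))

  ∏-homo : ∀ {X : Set} (xs : List X) f → ⟦ OA.∏ xs f ⟧ B.≈ OB.∏ xs (λ x → ⟦ f x ⟧)
  ∏-homo []       f = 1-homo
  ∏-homo (x ∷ xs) f = B.trans (*-homo _ _) (B.*-congˡ (∏-homo xs f))

  ^-homo : ∀ a n → ⟦ a OA.^ n ⟧ B.≈ ⟦ a ⟧ OB.^ n
  ^-homo a zero    = 1-homo
  ^-homo a (suc n) = B.trans (*-homo _ _) (B.*-congˡ (^-homo a n))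

  χ-homo : {P : Set} (d : Dec P) → ⟦ Sums.χ A d ⟧ B.≈ Sums.χ B d
  χ-homo (yes _) = 1-homo
  χ-homo (no _)  = 0-homo

ℕ+-left-comm : ∀ a b c → a ℕ.+ (b ℕ.+ c) ≡ b ℕ.+ (a ℕ.+ c)
ℕ+-left-comm a b c = ≡.trans (≡.sym (ℕ.+-assoc a b c))
  (≡.trans (≡.cong (ℕ._+ c) (ℕ.+-comm a b)) (ℕ.+-assoc b a c))

-- Fields with a total inverse.

module FieldLemmas (K : Field) where
  open Field K hiding (zero)
  open FieldOperations K
  open Sums commutativeRing
  open Algebra.Properties.Ring ring
  open Algebra.Properties.CommutativeSemiring.Exp commutativeSemiring using (^-distrib-*; ^-congˡ)
  open import Relation.Binary.Reasoning.Setoid setoid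

  *-cancelʳ : ∀ {a b c} → ¬ (c ≈ 0#) → a * c ≈ b * c → a ≈ b
  *-cancelʳ {a} {b} {c} c≉0 e = begin
    a              ≈⟨ *-identityʳ a ⟨
    a * 1#         ≈⟨ *-congˡ (⁻¹-inverse c≉0) ⟨
    a * (c * c ⁻¹) ≈⟨ *-assoc _ _ _ ⟨
    a * c * c ⁻¹   ≈⟨ *-congʳ e ⟩
    b * c * c ⁻¹   ≈⟨ *-assoc _ _ _ ⟩
    b * (c * c ⁻¹) ≈⟨ *-congˡ (⁻¹-inverse c≉0) ⟩
    b * 1#         ≈⟨ *-identityʳ b ⟩
    b              ∎

  *-cancelˡ : ∀ {a b c} → ¬ (c ≈ 0#) → c * a ≈ c * b → a ≈ b
  *-cancelˡ c≉0 e = *-cancelʳ c≉0 (trans (*-comm _ _) (trans e (*-comm _ _)))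

  *-zero⇒ : ∀ {a b} → ¬ (a ≈ 0#) → a * b ≈ 0# → b ≈ 0#
  *-zero⇒ a≉0 e = *-cancelˡ a≉0 (trans e (sym (zeroʳ _)))

  ⁻¹-unique : ∀ {a b} → a * b ≈ 1# → b ≈ a ⁻¹
  ⁻¹-unique {a} {b} e = *-cancelˡ a≉0 (trans e (sym (⁻¹-inverse a≉0)))
    where
    a≉0 : ¬ (a ≈ 0#)
    a≉0 a≈0 = 1≉0 (trans (sym e) (trans (*-congʳ a≈0) (zeroˡ b)))

  ⁻¹-nonzero : ∀ {a} → ¬ (a ≈ 0#) → ¬ (a ⁻¹ ≈ 0#)
  ⁻¹-nonzero a≉0 e = 1≉0 (trans (sym (⁻¹-inverse a≉0)) (trans (*-congˡ e) (zeroʳ _)))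

  -- The case a = 0 is included, so that `transposition` can replace (y - x)⁻¹ by -(x - y)⁻¹ without
  -- knowing that x and y differ.
  ⁻¹-neg : ∀ a → (- a) ⁻¹ ≈ - (a ⁻¹)
  ⁻¹-neg a with a ≟ 0#
  ... | yes a≈0 = begin
    (- a) ⁻¹   ≈⟨ ⁻¹-cong (trans (-‿cong a≈0) -0#≈0#) ⟩
    0# ⁻¹      ≈⟨ ⁻¹-zero ⟩
    0#         ≈⟨ -0#≈0# ⟨
    - 0#       ≈⟨ -‿cong (trans (⁻¹-cong a≈0) ⁻¹-zero) ⟨
    - (a ⁻¹)   ∎
  ... | no a≉0  = sym (⁻¹-unique (begin
    - a * - (a ⁻¹)     ≈⟨ -‿distribˡ-* a _ ⟨
    - (a * - (a ⁻¹))   ≈⟨ -‿cong (sym (-‿distribʳ-* a _)) ⟩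
    - - (a * a ⁻¹)     ≈⟨ -‿involutive _ ⟩
    a * a ⁻¹           ≈⟨ ⁻¹-inverse a≉0 ⟩
    1#                 ∎))

  -- For b = 0 both sides are 0 by convention. The scaling argument takes for b a difference of two
  -- entries, which may vanish.
  ⁻¹-distrib-* : ∀ {a} → ¬ (a ≈ 0#) → ∀ b → (a * b) ⁻¹ ≈ a ⁻¹ * b ⁻¹
  ⁻¹-distrib-* {a} a≉0 b with b ≟ 0#
  ... | yes b≈0 = trans (⁻¹-cong (trans (*-congˡ b≈0) (zeroʳ a))) (trans ⁻¹-zero
    (sym (trans (*-congˡ (trans (⁻¹-cong b≈0) ⁻¹-zero)) (zeroʳ _))))
  ... | no b≉0  = sym (⁻¹-unique (begin
    a * b * (a ⁻¹ * b ⁻¹)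
      ≈⟨ S.solve 4 (λ a b c d → (a S.:* b) S.:* (c S.:* d) S.:= (a S.:* c) S.:* (b S.:* d)) refl a b (a ⁻¹) (b ⁻¹) ⟩
    a * a ⁻¹ * (b * b ⁻¹)  ≈⟨ *-cong (⁻¹-inverse a≉0) (⁻¹-inverse b≉0) ⟩
    1# * 1#                ≈⟨ *-identityˡ 1# ⟩
    1#                     ∎))

  ∏-nonzero : ∀ {X : Set} (xs : List X) {f : X → Carrier} → (∀ x → ¬ (f x ≈ 0#)) → ¬ (∏ xs f ≈ 0#)
  ∏-nonzero []       h = 1≉0
  ∏-nonzero (x ∷ xs) h = *-nonzero (h x) (∏-nonzero xs h)

  ^-nonzero : ∀ {a} n → ¬ (a ≈ 0#) → ¬ (a ^ n ≈ 0#)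
  ^-nonzero zero    a≉0 = 1≉0
  ^-nonzero (suc n) a≉0 = *-nonzero a≉0 (^-nonzero n a≉0)

  ⁻¹-^ : ∀ {a} n → ¬ (a ≈ 0#) → a ^ n * (a ⁻¹) ^ n ≈ 1#
  ⁻¹-^ {a} n a≉0 = trans (sym (^-distrib-* a (a ⁻¹) n)) (trans (^-congˡ n (⁻¹-inverse a≉0)) (one n))
    where
    one : ∀ n → 1# ^ n ≈ 1#
    one zero    = refl
    one (suc n) = trans (*-identityˡ _) (one n)

  telescope : ∀ a b c → (a - b) + (b - c) ≈ a - c
  telescope a b c = begin
    (a - b) + (b - c)      ≈⟨ +-assoc a (- b) (b - c) ⟩
    a + (- b + (b - c))    ≈⟨ +-congˡ (sym (+-assoc (- b) b (- c))) ⟩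
    a + (- b + b - c)      ≈⟨ +-congˡ (+-congʳ (-‿inverseˡ b)) ⟩
    a + (0# - c)           ≈⟨ +-congˡ (+-identityˡ _) ⟩
    a - c                  ∎

  *-distribˡ-sub : ∀ a b c → a * (b - c) ≈ a * b - a * c
  *-distribˡ-sub a b c = trans (distribˡ a b (- c)) (+-congˡ (sym (-‿distribʳ-* a c)))

-- Gaussian binomials and the q-binomial theorem.

[1+n]C2 : ∀ n → suc n C 2 ≡ n ℕ.+ n C 2
[1+n]C2 n = ≡.trans (≡.sym (nCk+nC[k+1]≡[n+1]C[k+1] n 1)) (≡.cong (ℕ._+ n C 2) (nC1≡n n))

module QBinomial (K : Field) (q : Field.Carrier K)
  (1-qᵏ≉0 : ∀ k → ¬ (Field._≈_ K (Field._-_ K (Field.1# K) (FieldOperations._^_ K q (suc k))) (Field.0# K)))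
  where
  open Field K hiding (zero)
  open FieldOperations K
  open HallLittlewood K q using (vₘ)
  open Sums commutativeRing
  open FieldLemmas K
  open Algebra.Properties.CommutativeSemiring.Exp commutativeSemiring using (^-homo-*)
  open import Relation.Binary.Reasoning.Setoid setoid

  private
    g = gaussianBinomial q

    N : ℕ → ℕ → Carrier
    N a b = ∏ (upTo b) (λ i → 1# - q ^ (a ∸ i))

    D : ℕ → Carrier
    D b = ∏ (upTo b) (λ i → 1# - q ^ suc i)

    D≉0 : ∀ b → ¬ (D b ≈ 0#)
    D≉0 b = ∏-nonzero (upTo b) (λ i → 1-qᵏ≉0 i)

    D-⁻¹ : ∀ b → D (suc b) ⁻¹ * (1# - q ^ suc b) ≈ D b ⁻¹
    D-⁻¹ b = ⁻¹-unique (begin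
      D b * (D (suc b) ⁻¹ * (1# - q ^ suc b))
        ≈⟨ S.solve 3 (λ x y z → x S.:* (y S.:* z) S.:= (x S.:* z) S.:* y) refl (D b) (D (suc b) ⁻¹) (1# - q ^ suc b) ⟩
      D b * (1# - q ^ suc b) * D (suc b) ⁻¹   ≈⟨ *-congʳ (∏-upTo-last b _) ⟨
      D (suc b) * D (suc b) ⁻¹                ≈⟨ ⁻¹-inverse (D≉0 (suc b)) ⟩
      1#                                      ∎)

  gaussian-0 : ∀ a → g a 0 ≈ 1#
  gaussian-0 a = ⁻¹-inverse 1≉0

  gaussian-suc : ∀ a b → g (suc a) (suc b) * (1# - q ^ suc b) ≈ (1# - q ^ suc a) * g a b
  gaussian-suc a b = trans (*-assoc _ _ _) (trans (*-cong (∏-upTo-suc b _) (D-⁻¹ b)) (*-assoc _ _ _))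

  gaussian-last : ∀ a b → g a (suc b) * (1# - q ^ suc b) ≈ g a b * (1# - q ^ (a ∸ b))
  gaussian-last a b = trans (*-assoc _ _ _) (trans (*-cong (∏-upTo-last b _) (D-⁻¹ b))
    (S.solve 3 (λ x y z → (x S.:* y) S.:* z S.:= (x S.:* z) S.:* y) refl (N a b) (1# - q ^ (a ∸ b)) (D b ⁻¹)))

  -- The truncated exponent `a ∸ i` reaches 0 at i = a < b, which makes one factor of the numerator
  -- 1 - q⁰.
  gaussian-> : ∀ {a b} → a < b → g a b ≈ 0#
  gaussian-> {a} {suc b} (s≤s a≤b) = trans (*-congʳ (N≈0 a b a≤b)) (zeroˡ _)
    where
    N≈0 : ∀ a b → a ≤ b → N a (suc b) ≈ 0#
    N≈0 zero    b       _         = trans (∏-upTo-suc b _) (trans (*-congʳ (-‿inverseʳ 1#)) (zeroˡ _))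
    N≈0 (suc a) (suc b) (s≤s a≤b) = trans (∏-upTo-suc (suc b) _) (trans (*-congˡ (N≈0 a b a≤b)) (zeroʳ _))

  private
    split : ∀ x y → 1# - x * y ≈ (1# - x) + x * (1# - y)
    split x y = sym (trans (+-congˡ (trans (*-distribˡ-sub x 1# y) (+-congʳ (*-identityʳ x)))) (telescope 1# x (x * y)))

    q-split : ∀ {a b} → b ≤ a → q ^ suc a ≈ q ^ suc b * q ^ (a ∸ b)
    q-split {a} {b} b≤a = trans (reflexive (≡.cong (q ^_) (≡.cong suc (≡.sym (ℕ.m+[n∸m]≡n b≤a)))))
      (^-homo-* q (suc b) (a ∸ b))

  -- Multiplied by 1 - Q, the identity comes from 1 - Q R = (1 - Q) + Q (1 - R), where Q = q^(b+1)
  -- and Q R = q^(a+1).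
  pascal : ∀ a b → g (suc a) (suc b) ≈ g a b + q ^ suc b * g a (suc b)
  pascal a b with b ℕ.≤? a
  ... | no b≰a = trans (gaussian-> (s≤s (ℕ.≰⇒> b≰a))) (sym (trans
    (+-cong (gaussian-> (ℕ.≰⇒> b≰a)) (trans (*-congˡ (gaussian-> (ℕ.m<n⇒m<1+n (ℕ.≰⇒> b≰a)))) (zeroʳ _)))
    (+-identityˡ _)))
  ... | yes b≤a = *-cancelʳ (1-qᵏ≉0 b) (begin
    g (suc a) (suc b) * (1# - Q)              ≈⟨ gaussian-suc a b ⟩
    (1# - q ^ suc a) * g a b                  ≈⟨ *-congʳ (+-congˡ (-‿cong (q-split b≤a))) ⟩
    (1# - Q * R) * g a b                      ≈⟨ *-congʳ (split Q R) ⟩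
    ((1# - Q) + Q * (1# - R)) * g a b
      ≈⟨ S.solve 4 (λ x y z w → (x S.:+ y S.:* z) S.:* w S.:= w S.:* x S.:+ y S.:* (w S.:* z)) refl (1# - Q) Q (1# - R) (g a b) ⟩
    g a b * (1# - Q) + Q * (g a b * (1# - R)) ≈⟨ +-congˡ (*-congˡ (gaussian-last a b)) ⟨
    g a b * (1# - Q) + Q * (g a (suc b) * (1# - Q))
      ≈⟨ S.solve 4 (λ x y z w → x S.:* y S.:+ z S.:* (w S.:* y) S.:= (x S.:+ z S.:* w) S.:* y) refl (g a b) (1# - Q) Q (g a (suc b)) ⟩
    (g a b + Q * g a (suc b)) * (1# - Q)      ∎)
    where
    Q = q ^ suc b
    R = q ^ (a ∸ b)

  -- The same splitting with Q and R exchanged. This form is applied at t⁻¹, when the last factor of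
  -- ∏ (y + tⁱ) is split off.
  pascal′ : ∀ a b → g (suc a) (suc b) ≈ q ^ (a ∸ b) * g a b + g a (suc b)
  pascal′ a b with b ℕ.≤? a
  ... | no b≰a = trans (gaussian-> (s≤s (ℕ.≰⇒> b≰a))) (sym (trans
    (+-cong (trans (*-congˡ (gaussian-> (ℕ.≰⇒> b≰a))) (zeroʳ _)) (gaussian-> (ℕ.m<n⇒m<1+n (ℕ.≰⇒> b≰a))))
    (+-identityˡ _)))
  ... | yes b≤a = *-cancelʳ (1-qᵏ≉0 b) (begin
    g (suc a) (suc b) * (1# - Q)              ≈⟨ gaussian-suc a b ⟩
    (1# - q ^ suc a) * g a b                  ≈⟨ *-congʳ (+-congˡ (-‿cong (trans (q-split b≤a) (*-comm Q R)))) ⟩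
    (1# - R * Q) * g a b                      ≈⟨ *-congʳ (split R Q) ⟩
    ((1# - R) + R * (1# - Q)) * g a b
      ≈⟨ S.solve 4 (λ x y z w → (x S.:+ y S.:* z) S.:* w S.:= w S.:* x S.:+ y S.:* w S.:* z) refl (1# - R) R (1# - Q) (g a b) ⟩
    g a b * (1# - R) + R * g a b * (1# - Q)   ≈⟨ +-congʳ (gaussian-last a b) ⟨
    g a (suc b) * (1# - Q) + R * g a b * (1# - Q)
      ≈⟨ S.solve 3 (λ x y z → x S.:* y S.:+ z S.:* y S.:= (z S.:+ x) S.:* y) refl (g a (suc b)) (1# - Q) (R * g a b) ⟩
    (R * g a b + g a (suc b)) * (1# - Q)      ∎)
    where
    Q = q ^ suc b
    R = q ^ (a ∸ b)

  1-q≉0 : ¬ (1# - q ≈ 0#)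
  1-q≉0 e = 1-qᵏ≉0 0 (trans (+-congˡ (-‿cong (*-identityʳ q))) e)

  vₘ≉0 : ∀ m → ¬ (vₘ m ≈ 0#)
  vₘ≉0 m = ∏-nonzero (upTo m) (λ i → *-nonzero (1-qᵏ≉0 i) (⁻¹-nonzero 1-q≉0))

  -- `vₘ` is the q-factorial. This formula links the Gaussian binomials of the Pieri coefficients to
  -- the normalization v_σ(t).
  gaussian-factorial : ∀ b c → g (b ℕ.+ c) b * (vₘ b * vₘ c) ≈ vₘ (b ℕ.+ c)
  gaussian-factorial zero    c = trans (*-cong (gaussian-0 c) (*-identityˡ _)) (*-identityˡ _)
  gaussian-factorial (suc b) c = begin
    g (suc (b ℕ.+ c)) (suc b) * (vₘ (suc b) * vₘ c)
      ≈⟨ *-congˡ (*-congʳ (∏-upTo-last b _)) ⟩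
    g (suc (b ℕ.+ c)) (suc b) * (vₘ b * ((1# - q ^ suc b) * i) * vₘ c)
      ≈⟨ S.solve 5 (λ x y z w u → x S.:* (y S.:* (z S.:* w) S.:* u) S.:= (x S.:* z) S.:* (w S.:* (y S.:* u))) refl
           (g (suc (b ℕ.+ c)) (suc b)) (vₘ b) (1# - q ^ suc b) i (vₘ c) ⟩
    (g (suc (b ℕ.+ c)) (suc b) * (1# - q ^ suc b)) * (i * (vₘ b * vₘ c))
      ≈⟨ *-congʳ (gaussian-suc (b ℕ.+ c) b) ⟩
    (1# - q ^ suc (b ℕ.+ c)) * g (b ℕ.+ c) b * (i * (vₘ b * vₘ c))
      ≈⟨ S.solve 4 (λ x y z w → (x S.:* y) S.:* (z S.:* w) S.:= (y S.:* w) S.:* (x S.:* z)) refl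
           (1# - q ^ suc (b ℕ.+ c)) (g (b ℕ.+ c) b) i (vₘ b * vₘ c) ⟩
    g (b ℕ.+ c) b * (vₘ b * vₘ c) * ((1# - q ^ suc (b ℕ.+ c)) * i)
      ≈⟨ *-congʳ (gaussian-factorial b c) ⟩
    vₘ (b ℕ.+ c) * ((1# - q ^ suc (b ℕ.+ c)) * i)
      ≈⟨ ∏-upTo-last (b ℕ.+ c) _ ⟨
    vₘ (suc (b ℕ.+ c)) ∎
    where i = (1# - q) ⁻¹

  gaussian-diagonal : ∀ b → g b b ≈ 1#
  gaussian-diagonal b = *-cancelʳ (vₘ≉0 b) (trans (*-cong (reflexive (≡.cong (λ a → g a b) (≡.sym (ℕ.+-identityʳ b)))) (sym (*-identityʳ _)))
    (trans (gaussian-factorial b 0) (trans (reflexive (≡.cong vₘ (ℕ.+-identityʳ b))) (sym (*-identityˡ _)))))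

  -- Both sides are the q-multinomial v_{k+b+e} / (v_k v_b v_e).
  trinomial : ∀ k e b → g (k ℕ.+ (b ℕ.+ e)) k * g (b ℕ.+ e) b ≈ g (b ℕ.+ (k ℕ.+ e)) b * g (k ℕ.+ e) k
  trinomial k e b = *-cancelʳ (*-nonzero (vₘ≉0 k) (*-nonzero (vₘ≉0 b) (vₘ≉0 e))) (begin
    g (k ℕ.+ (b ℕ.+ e)) k * g (b ℕ.+ e) b * (vₘ k * (vₘ b * vₘ e))
      ≈⟨ S.solve 4 (λ x y z w → (x S.:* y) S.:* (z S.:* w) S.:= x S.:* (z S.:* (y S.:* w))) refl _ (g (b ℕ.+ e) b) _ _ ⟩
    g (k ℕ.+ (b ℕ.+ e)) k * (vₘ k * (g (b ℕ.+ e) b * (vₘ b * vₘ e)))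
      ≈⟨ *-congˡ (*-congˡ (gaussian-factorial b e)) ⟩
    g (k ℕ.+ (b ℕ.+ e)) k * (vₘ k * vₘ (b ℕ.+ e))
      ≈⟨ gaussian-factorial k (b ℕ.+ e) ⟩
    vₘ (k ℕ.+ (b ℕ.+ e))
      ≈⟨ reflexive (≡.cong vₘ (ℕ+-left-comm k b e)) ⟩
    vₘ (b ℕ.+ (k ℕ.+ e))
      ≈⟨ gaussian-factorial b (k ℕ.+ e) ⟨
    g (b ℕ.+ (k ℕ.+ e)) b * (vₘ b * vₘ (k ℕ.+ e))
      ≈⟨ *-congˡ (*-congˡ (gaussian-factorial k e)) ⟨
    g (b ℕ.+ (k ℕ.+ e)) b * (vₘ b * (g (k ℕ.+ e) k * (vₘ k * vₘ e)))
      ≈⟨ S.solve 5 (λ x y z w u → x S.:* (y S.:* (z S.:* (w S.:* u))) S.:= (x S.:* z) S.:* (w S.:* (y S.:* u))) refl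
           (g (b ℕ.+ (k ℕ.+ e)) b) (vₘ b) (g (k ℕ.+ e) k) (vₘ k) (vₘ e) ⟩
    g (b ℕ.+ (k ℕ.+ e)) b * g (k ℕ.+ e) k * (vₘ k * (vₘ b * vₘ e)) ∎)

  module _ {A : CommutativeRing 0ℓ 0ℓ} (h : RingHom commutativeRing A) (y : CommutativeRing.Carrier A) where
    private
      module A = CommutativeRing A
      module OA = Operations A
      module SA = Sums A
      open RingHom h

    -- The shift a is there because, for μ = ∅, a column of λ yields the factors y + qⁱ only from
    -- the height of the next column on. Induction splits off the last factor y + q^(a+m) and uses
    -- Pascal's rule. The values lie in a second ring because y is -1 in K in one application and
    -- the indeterminate of K[y] in the other.
    q-binomial : ∀ a m →
      OA.∑ (upTo (suc m)) (λ k → ⟦ g m k * q ^ ((a ℕ.+ (m ∸ k)) C 2) ⟧ A.* y OA.^ k)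
        A.≈ ⟦ q ^ (a C 2) ⟧ A.* OA.∏ (upTo m) (λ i → y A.+ ⟦ q ^ (a ℕ.+ i) ⟧)
    q-binomial a zero = A.trans (A.+-identityʳ _) (A.*-congʳ (⟦⟧-cong (trans (*-congʳ (gaussian-0 0))
      (trans (*-identityˡ _) (reflexive (≡.cong (λ n → q ^ (n C 2)) (ℕ.+-identityʳ a)))))))
    q-binomial a (suc m) =
      A.trans (SA.∑-upTo-suc (suc m) _)
      (A.trans (A.+-cong first (A.trans (SA.∑-cong∈ (upTo (suc m)) (λ k∈ → rest _ (∈-upTo⁻ k∈)))
        (A.trans (SA.∑-+ (upTo (suc m)) _ _) (A.+-cong (A.sym (SA.*-∑ y (upTo (suc m)) (H m))) (A.sym (SA.*-∑ c (upTo (suc m)) (H m ∘ suc)))))))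
      (A.trans (SA.S.solve 5 (λ c h y s r → c SA.S.:* h SA.S.:+ (y SA.S.:* s SA.S.:+ c SA.S.:* r) SA.S.:= y SA.S.:* s SA.S.:+ c SA.S.:* (h SA.S.:+ r)) A.refl c (H m 0) y _ _)
      (A.trans (A.+-congˡ (A.*-congˡ (A.trans (A.sym (SA.∑-upTo-suc (suc m) (H m))) (A.trans (SA.∑-upTo-last (suc m) (H m)) (A.trans (A.+-congˡ vanish) (A.+-identityʳ _))))))
      (A.trans (A.sym (A.distribʳ _ y c))
      (A.trans (A.*-congˡ (q-binomial a m))
      (A.trans (SA.S.solve 3 (λ u v w → u SA.S.:* (v SA.S.:* w) SA.S.:= v SA.S.:* (w SA.S.:* u)) A.refl (y A.+ c) _ _)
      (A.*-congˡ (A.sym (SA.∏-upTo-last m _)))))))))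
      where
      H : ℕ → ℕ → A.Carrier
      H m k = ⟦ g m k * q ^ ((a ℕ.+ (m ∸ k)) C 2) ⟧ A.* y OA.^ k
      c = ⟦ q ^ (a ℕ.+ m) ⟧
      vanish : H m (suc m) A.≈ A.0#
      vanish = A.trans (A.*-congʳ (A.trans (⟦⟧-cong (trans (*-congʳ (gaussian-> {m} ℕ.≤-refl)) (zeroˡ _))) 0-homo)) (A.zeroˡ _)
      step : ∀ b n → q ^ ((a ℕ.+ suc n) C 2) * q ^ b ≈ q ^ (b ℕ.+ (a ℕ.+ n)) * q ^ ((a ℕ.+ n) C 2)
      step b n = begin
        q ^ ((a ℕ.+ suc n) C 2) * q ^ b
          ≈⟨ *-congʳ (reflexive (≡.cong (q ^_) (≡.trans (≡.cong (_C 2) (ℕ.+-suc a n)) ([1+n]C2 (a ℕ.+ n))))) ⟩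
        q ^ (a ℕ.+ n ℕ.+ (a ℕ.+ n) C 2) * q ^ b
          ≈⟨ *-congʳ (^-homo-* q (a ℕ.+ n) _) ⟩
        q ^ (a ℕ.+ n) * q ^ ((a ℕ.+ n) C 2) * q ^ b
          ≈⟨ S.solve 3 (λ x y z → (x S.:* y) S.:* z S.:= (z S.:* x) S.:* y) refl _ _ _ ⟩
        q ^ b * q ^ (a ℕ.+ n) * q ^ ((a ℕ.+ n) C 2)
          ≈⟨ *-congʳ (^-homo-* q b _) ⟨
        q ^ (b ℕ.+ (a ℕ.+ n)) * q ^ ((a ℕ.+ n) C 2) ∎
      first : H (suc m) 0 A.≈ c A.* H m 0
      first = A.trans (A.*-congʳ (A.trans (⟦⟧-cong (begin
        g (suc m) 0 * q ^ ((a ℕ.+ suc m) C 2)  ≈⟨ trans (*-congʳ (gaussian-0 (suc m))) (*-comm _ _) ⟩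
        q ^ ((a ℕ.+ suc m) C 2) * 1#           ≈⟨ step 0 m ⟩
        q ^ (a ℕ.+ m) * q ^ ((a ℕ.+ m) C 2)    ≈⟨ *-congˡ (trans (*-congʳ (gaussian-0 m)) (*-identityˡ _)) ⟨
        q ^ (a ℕ.+ m) * (g m 0 * q ^ ((a ℕ.+ m) C 2)) ∎)) (*-homo _ _))) (A.*-assoc _ _ _)
      rest : ∀ k → k < suc m → H (suc m) (suc k) A.≈ y A.* H m k A.+ c A.* H m (suc k)
      rest k k<1+m = A.trans (A.*-congʳ (⟦⟧-cong (trans (*-congʳ (pascal m k)) (distribʳ _ _ _))))
        (A.trans (A.*-congʳ (+-homo _ _)) (A.trans (A.distribʳ _ _ _) (A.+-cong
          (SA.S.solve 3 (λ u v w → u SA.S.:* (v SA.S.:* w) SA.S.:= v SA.S.:* (u SA.S.:* w)) A.refl _ _ _)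
          (A.trans (A.*-congʳ (A.trans (⟦⟧-cong shift) (*-homo _ _))) (A.*-assoc _ _ _)))))
        where
        shift : q ^ suc k * g m (suc k) * q ^ ((a ℕ.+ (m ∸ k)) C 2) ≈ q ^ (a ℕ.+ m) * (g m (suc k) * q ^ ((a ℕ.+ (m ∸ suc k)) C 2))
        shift with suc k ℕ.≤? m
        ... | no k≰m = trans (trans (*-congʳ (trans (*-congˡ z) (zeroʳ _))) (zeroˡ _))
                (sym (trans (*-congˡ (trans (*-congʳ z) (zeroˡ _))) (zeroʳ _)))
          where z = gaussian-> (ℕ.≰⇒> k≰m)
        ... | yes k<m = begin
          q ^ suc k * g m (suc k) * q ^ ((a ℕ.+ (m ∸ k)) C 2)
            ≈⟨ S.solve 3 (λ x y z → (x S.:* y) S.:* z S.:= y S.:* (z S.:* x)) refl _ _ _ ⟩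
          g m (suc k) * (q ^ ((a ℕ.+ (m ∸ k)) C 2) * q ^ suc k)
            ≈⟨ *-congˡ (*-congʳ (reflexive (≡.cong (λ n → q ^ ((a ℕ.+ n) C 2)) m∸k))) ⟩
          g m (suc k) * (q ^ ((a ℕ.+ suc (m ∸ suc k)) C 2) * q ^ suc k)
            ≈⟨ *-congˡ (step (suc k) (m ∸ suc k)) ⟩
          g m (suc k) * (q ^ (suc k ℕ.+ (a ℕ.+ (m ∸ suc k))) * q ^ ((a ℕ.+ (m ∸ suc k)) C 2))
            ≈⟨ S.solve 3 (λ x y z → x S.:* (y S.:* z) S.:= y S.:* (x S.:* z)) refl _ _ _ ⟩
          q ^ (suc k ℕ.+ (a ℕ.+ (m ∸ suc k))) * (g m (suc k) * q ^ ((a ℕ.+ (m ∸ suc k)) C 2))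
            ≈⟨ *-congʳ (reflexive (≡.cong (q ^_) total)) ⟩
          q ^ (a ℕ.+ m) * (g m (suc k) * q ^ ((a ℕ.+ (m ∸ suc k)) C 2)) ∎
          where
          m∸k : m ∸ k ≡ suc (m ∸ suc k)
          m∸k = ≡.sym (≡.trans (≡.sym (ℕ.+-∸-assoc 1 k<m)) ≡.refl)
          total : suc k ℕ.+ (a ℕ.+ (m ∸ suc k)) ≡ a ℕ.+ m
          total = ≡.trans (ℕ+-left-comm (suc k) a (m ∸ suc k)) (≡.cong (a ℕ.+_) (ℕ.m+[n∸m]≡n k<m))

-- Symmetrization, straightening, and special values of the sums `R`.

module _ {X : Set} where
  -- Choosing one entry and keeping the others in order is one step of a permutation. Iterating it
  -- turns sums over the symmetric group into a recursion on n.
  select : ∀ {n} → Vec X (suc n) → List (X × Vec X n)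
  select {zero}  (x ∷ [])  = (x , []) ∷ []
  select {suc n} (x ∷ xs)  = (x , xs) ∷ map (λ (y , r) → y , x ∷ r) (select xs)

  -- Each pair of positions occurs once, in increasing order, so that the two terms of a
  -- symmetrization which differ by a swap of their first two arguments can be added.
  pairs : ∀ {n} → Vec X (2 ℕ.+ n) → List (X × X × Vec X n)
  pairs {zero}  (x ∷ y ∷ []) = (x , y , []) ∷ []
  pairs {suc n} (x ∷ xs)     =
    map (λ (y , r) → x , y , r) (select xs) ++ map (λ (y , z , r) → y , z , x ∷ r) (pairs xs)

  select-∷ : ∀ {n} (P : X → Vec X (suc n) → Set) {x xs} → P x xs →
    (∀ {y r} → (y , r) ∈ select xs → P y (x ∷ r)) → ∀ {y r} → (y , r) ∈ select (x ∷ xs) → P y r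
  select-∷ P p h (here ≡.refl) = p
  select-∷ P p h (there y∈) with ∈-map⁻ _ y∈
  ... | _ , z∈ , ≡.refl = h z∈

  select-All : ∀ {P : X → Set} {n} {xs : Vec X (suc n)} → VAll.All P xs →
    ∀ {y r} → (y , r) ∈ select xs → P y × VAll.All P r
  select-All {n = zero}  {x ∷ []} (px VAll.∷ _)  (here ≡.refl) = px , VAll.[]
  select-All {P = P} {n = suc n} {x ∷ xs} (px VAll.∷ ps) =
    select-∷ (λ y r → P y × VAll.All P r) (px , ps)
      (λ y∈ → let py , pr = select-All ps y∈ in py , px VAll.∷ pr)

select-map : ∀ {X Y : Set} (f : X → Y) {n} (xs : Vec X (suc n)) →
  select (Vec.map f xs) ≡ map (λ (x , r) → f x , Vec.map f r) (select xs)
select-map f {zero}  (x ∷ []) = ≡.refl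
select-map f {suc n} (x ∷ xs) = ≡.cong ((f x , Vec.map f xs) ∷_) (≡.trans (≡.cong (map _) (select-map f xs))
  (≡.trans (≡.sym (map-∘ (select xs))) (map-∘ (select xs))))

-- T α Φ is the sum of Φ (α + ε) over ε ∈ {0,1}ⁿ.
module BinarySums (A : CommutativeRing 0ℓ 0ℓ) where
  open CommutativeRing A hiding (zero)
  open Sums A

  T : List ℕ → (List ℕ → Carrier) → Carrier
  T []      Φ = Φ []
  T (a ∷ α) Φ = T α (Φ ∘ (a ∷_)) + T α (Φ ∘ (suc a ∷_))

  T-cong : ∀ α {Φ Ψ} → (∀ β → length β ≡ length α → Φ β ≈ Ψ β) → T α Φ ≈ T α Ψ
  T-cong []      h = h [] ≡.refl
  T-cong (a ∷ α) h = +-cong (T-cong α (λ β e → h _ (≡.cong suc e))) (T-cong α (λ β e → h _ (≡.cong suc e)))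

  *-T : ∀ c α Φ → c * T α Φ ≈ T α (λ β → c * Φ β)
  *-T c []      Φ = refl
  *-T c (a ∷ α) Φ = trans (distribˡ c _ _) (+-cong (*-T c α _) (*-T c α _))

  T-++ : ∀ α β Φ → T (α ++ β) Φ ≈ T α (λ α′ → T β (λ β′ → Φ (α′ ++ β′)))
  T-++ []      β Φ = refl
  T-++ (a ∷ α) β Φ = +-cong (T-++ α β _) (T-++ α β _)

  T-+ : ∀ α Φ Ψ → T α (λ β → Φ β + Ψ β) ≈ T α Φ + T α Ψ
  T-+ []      Φ Ψ = refl
  T-+ (a ∷ α) Φ Ψ = trans (+-cong (T-+ α _ _) (T-+ α _ _))
    (S.solve 4 (λ a b c d → (a S.:+ b) S.:+ (c S.:+ d) S.:= (a S.:+ c) S.:+ (b S.:+ d)) refl _ _ _ _)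

module Symmetrization (F : Field) (t : Field.Carrier F) where
  open Field F hiding (zero)
  open FieldOperations F
  open Sums commutativeRing
  open BinarySums commutativeRing
  open FieldLemmas F
  open Algebra.Properties.Ring ring
  open Algebra.Properties.CommutativeSemiring.Exp commutativeSemiring using (^-distrib-*; ^-homo-*)
  open import Relation.Binary.Reasoning.Setoid setoid

  symm : ∀ n → (Vec Carrier n → Carrier) → Vec Carrier n → Carrier
  symm zero    G _  = G []
  symm (suc n) G xs = ∑ (select xs) (λ (x , r) → symm n (λ ys → G (x ∷ ys)) r)

  symm-cong : ∀ n {G H} → (∀ ys → G ys ≈ H ys) → ∀ xs → symm n G xs ≈ symm n H xs
  symm-cong zero    h xs = h []
  symm-cong (suc n) h xs = ∑-cong (select xs) (λ (x , r) → symm-cong n (λ ys → h (x ∷ ys)) r)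

  symm-+ : ∀ n G H xs → symm n (λ ys → G ys + H ys) xs ≈ symm n G xs + symm n H xs
  symm-+ zero    G H xs = refl
  symm-+ (suc n) G H xs = trans (∑-cong (select xs) (λ (x , r) → symm-+ n _ _ r)) (∑-+ (select xs) _ _)

  symm-* : ∀ n a G xs → symm n (λ ys → a * G ys) xs ≈ a * symm n G xs
  symm-* zero    a G xs = refl
  symm-* (suc n) a G xs = trans (∑-cong (select xs) (λ (x , r) → symm-* n a _ r)) (sym (*-∑ a (select xs) _))

  -- Invariance under moving any entry to the front, required again of the tails for each fixed
  -- head. These are the moves that `symm` makes, so `symm-symmetric` follows by the same recursion.
  Symmetric : ∀ n → (Vec Carrier n → Carrier) → Set
  Symmetric zero    C = ⊤
  Symmetric (suc n) C = (∀ xs {x r} → (x , r) ∈ select xs → C (x ∷ r) ≈ C xs) × (∀ x → Symmetric n (λ ys → C (x ∷ ys)))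

  symmetric-+ : ∀ n {B C} → Symmetric n B → Symmetric n C → Symmetric n (λ ys → B ys + C ys)
  symmetric-+ zero    _        _          = tt
  symmetric-+ (suc n) (p , q) (p′ , q′) = (λ xs x∈ → +-cong (p xs x∈) (p′ xs x∈)) , λ x → symmetric-+ n (q x) (q′ x)

  symmetric-* : ∀ n a {C} → Symmetric n C → Symmetric n (λ ys → a * C ys)
  symmetric-* zero    a _       = tt
  symmetric-* (suc n) a (p , q) = (λ xs x∈ → *-congˡ (p xs x∈)) , λ x → symmetric-* n a (q x)

  symmetric-const : ∀ n a → Symmetric n (λ _ → a)
  symmetric-const zero    a = tt
  symmetric-const (suc n) a = (λ _ _ → refl) , λ _ → symmetric-const n a

  symm-symmetric : ∀ n {C} G → Symmetric n C → ∀ xs → symm n (λ ys → C ys * G ys) xs ≈ C xs * symm n G xs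
  symm-symmetric zero    G _       [] = refl
  symm-symmetric (suc n) G (p , q) xs = trans
    (∑-cong∈ (select xs) (λ {(x , r)} x∈ → trans (symm-symmetric n _ (q x) r) (*-congʳ (p xs x∈))))
    (sym (*-∑ _ (select xs) _))

  product : (Carrier → Carrier) → ∀ {n} → Vec Carrier n → Carrier
  product h []       = 1#
  product h (x ∷ xs) = h x * product h xs

  product-symmetric : ∀ h n → Symmetric n (product h)
  product-symmetric h zero    = tt
  product-symmetric h (suc n) = invariant , λ x → symmetric-* n (h x) (product-symmetric h n)
    where
    invariant : ∀ {n} (xs : Vec Carrier (suc n)) {x r} → (x , r) ∈ select xs → product h (x ∷ r) ≈ product h xs
    invariant {zero}  (x ∷ [])     (here ≡.refl) = refl
    invariant {suc n} (x ∷ xs) = select-∷ (λ y r → product h (y ∷ r) ≈ product h (x ∷ xs)) refl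
      λ {y} {r} y∈ → trans
        (S.solve 3 (λ a b c → a S.:* (b S.:* c) S.:= b S.:* (a S.:* c)) refl (h y) (h x) (product h r))
        (*-congˡ (invariant xs y∈))

  elementary : ℕ → ∀ {n} → Vec Carrier n → Carrier
  elementary zero    xs       = 1#
  elementary (suc r) []       = 0#
  elementary (suc r) (x ∷ xs) = elementary (suc r) xs + x * elementary r xs

  elementary-symmetric : ∀ r n → Symmetric n (elementary r)
  elementary-symmetric zero    n       = symmetric-const n 1#
  elementary-symmetric (suc r) zero    = tt
  elementary-symmetric (suc r) (suc n) = invariant (suc r) ,
    λ x → symmetric-+ n (elementary-symmetric (suc r) n) (symmetric-* n x (elementary-symmetric r n))
    where
    swap : ∀ r {n} x y (xs : Vec Carrier n) → elementary r (x ∷ y ∷ xs) ≈ elementary r (y ∷ x ∷ xs)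
    swap zero          x y xs = refl
    swap (suc zero)    x y xs =
      S.solve 3 (λ a x y → (a S.:+ y S.:* S.con 1) S.:+ x S.:* S.con 1 S.:= (a S.:+ x S.:* S.con 1) S.:+ y S.:* S.con 1) refl
        (elementary 1 xs) x y
    swap (suc (suc r)) x y xs =
      S.solve 5 (λ a b c x y → (a S.:+ y S.:* b) S.:+ x S.:* (b S.:+ y S.:* c)
        S.:= (a S.:+ x S.:* b) S.:+ y S.:* (b S.:+ x S.:* c)) refl
        (elementary (2 ℕ.+ r) xs) (elementary (suc r) xs) (elementary r xs) x y
    invariant : ∀ r {n} (xs : Vec Carrier (suc n)) {x s} → (x , s) ∈ select xs → elementary r (x ∷ s) ≈ elementary r xs
    invariant zero    xs x∈ = refl
    invariant (suc r) {zero}  (x ∷ []) (here ≡.refl) = refl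
    invariant (suc r) {suc n} (x ∷ xs) = select-∷ (λ y s → elementary (suc r) (y ∷ s) ≈ elementary (suc r) (x ∷ xs)) refl
      λ {y} {s} y∈ → trans (swap (suc r) y x s) (+-cong (invariant (suc r) xs y∈) (*-congˡ (invariant r xs y∈)))

  φ : ∀ {n} → Carrier → Vec Carrier n → Carrier
  φ x = product (λ y → (x - t * y) ÷ (x - y))

  hd : List ℕ → ℕ
  hd α = entry α 0

  tl : List ℕ → List ℕ
  tl []      = []
  tl (a ∷ α) = α

  -- Missing exponents count as 0.
  term : List ℕ → ∀ {n} → Vec Carrier n → Carrier
  term α []       = 1#
  term α (x ∷ xs) = x ^ hd α * (φ x xs * term (tl α) xs)

  -- The Hall-Littlewood sum before normalization, with exponents in any order and arbitrary field
  -- elements in place of the variables.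
  R : ∀ {n} → List ℕ → Vec Carrier n → Carrier
  R α = symm _ (term α)

  -- The product `φ x` is symmetric in the remaining variables and therefore leaves the inner
  -- symmetrization. Inductions on the number of variables use this recursion.
  R-expand : ∀ {n} α (xs : Vec Carrier (suc n)) →
    R α xs ≈ ∑ (select xs) (λ (x , r) → x ^ hd α * (φ x r * R (tl α) r))
  R-expand {n} α xs = ∑-cong (select xs) (λ (x , r) →
    trans (symm-* n _ _ r) (*-congˡ (symm-symmetric n _ (product-symmetric _ n) r)))

  R-++-0 : ∀ α k {n} (xs : Vec Carrier n) → R (α ++ replicate k 0) xs ≈ R α xs
  R-++-0 α k {n} xs = symm-cong n (term-++-0 α) xs
    where
    term-0 : ∀ k {n} (xs : Vec Carrier n) → term (replicate k 0) xs ≡ term [] xs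
    term-0 zero    xs       = ≡.refl
    term-0 (suc k) []       = ≡.refl
    term-0 (suc k) (x ∷ xs) = ≡.cong (λ z → 1# * (φ x xs * z)) (term-0 k xs)
    term-++-0 : ∀ α {n} (xs : Vec Carrier n) → term (α ++ replicate k 0) xs ≈ term α xs
    term-++-0 []      xs       = reflexive (term-0 k xs)
    term-++-0 (a ∷ α) []       = refl
    term-++-0 (a ∷ α) (x ∷ xs) = *-congˡ (*-congˡ (term-++-0 α xs))

  -- The choices of a first and a second entry are grouped in twos by their pair of positions. The
  -- pairs containing the head combine over `select xs`, and the others are left to the induction.
  ∑∑-select : ∀ {n} (H : Carrier → Carrier → Vec Carrier n → Carrier) xs →
    ∑ (select xs) (λ (x , r) → ∑ (select r) (λ (y , s) → H x y s))
      ≈ ∑ (pairs xs) (λ (x , y , s) → H x y s + H y x s)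
  ∑∑-select {zero}  H (x ∷ y ∷ []) = S.solve 2 (λ a b → (a S.:+ S.con 0) S.:+ ((b S.:+ S.con 0) S.:+ S.con 0) S.:= (a S.:+ b) S.:+ S.con 0)
    refl (H x y []) (H y x [])
  ∑∑-select {suc n} H (x ∷ xs) = begin
    ∑ (select xs) (λ (y , r) → H x y r) + ∑ (map _ (select xs)) (λ (y , r) → ∑ (select r) (λ (z , s) → H y z s))
      ≈⟨ +-congˡ (reflexive (∑-map _ (select xs) _)) ⟩
    ∑ (select xs) (λ (y , r) → H x y r) + ∑ (select xs) (λ (y , r) → H y x r + ∑ (map _ (select r)) (λ (z , s) → H y z s))
      ≈⟨ +-congˡ (∑-cong (select xs) (λ (y , r) → +-congˡ (reflexive (∑-map _ (select r) _)))) ⟩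
    ∑ (select xs) (λ (y , r) → H x y r) + ∑ (select xs) (λ (y , r) → H y x r + ∑ (select r) (λ (z , s) → H y z (x ∷ s)))
      ≈⟨ +-congˡ (∑-+ (select xs) _ _) ⟩
    ∑ (select xs) (λ (y , r) → H x y r) + (∑ (select xs) (λ (y , r) → H y x r) + ∑ (select xs) (λ (y , r) → ∑ (select r) (λ (z , s) → H y z (x ∷ s))))
      ≈⟨ trans (sym (+-assoc _ _ _)) (+-cong (sym (∑-+ (select xs) _ _)) (∑∑-select (λ y z s → H y z (x ∷ s)) xs)) ⟩
    ∑ (select xs) (λ (y , r) → H x y r + H y x r) + ∑ (pairs xs) (λ (y , z , s) → H y z (x ∷ s) + H z y (x ∷ s))
      ≡⟨ ≡.cong₂ _+_ (∑-map _ (select xs) _) (∑-map _ (pairs xs) _) ⟨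
    ∑ (map (λ (y , r) → x , y , r) (select xs)) _ + ∑ (map (λ (y , z , s) → y , z , x ∷ s) (pairs xs)) _
      ≈⟨ ∑-++ (map (λ (y , r) → x , y , r) (select xs)) _ _ ⟨
    ∑ (pairs (x ∷ xs)) (λ (y , z , s) → H y z s + H z y s) ∎

  private
    -- With u = (x - y)⁻¹, both sides equal t u (x² - y²). No step cancels x - y, so x = y is
    -- allowed.
    transposition : ∀ x y → (x - t * y) ÷ (x - y) * y + (y - t * x) ÷ (y - x) * x
      ≈ t * ((x - t * y) ÷ (x - y) * x + (y - t * x) ÷ (y - x) * y)
    transposition x y = begin
      (x - t * y) * u * y + (y - t * x) * (y - x) ⁻¹ * x
        ≈⟨ +-congˡ (*-congʳ (trans (*-congˡ u′) (neg-swap y (t * x)))) ⟩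
      (x - t * y) * u * y + (t * x - y) * u * x
        ≈⟨ S.solve 5 (λ a b u x y → (a S.:* u) S.:* y S.:+ (b S.:* u) S.:* x S.:= u S.:* (x S.:* b S.:+ y S.:* a)) refl (x - t * y) (t * x - y) u x y ⟩
      u * (x * (t * x - y) + y * (x - t * y))
        ≈⟨ *-congˡ (+-cong (*-distribˡ-sub x (t * x) y) (trans (*-distribˡ-sub y x (t * y)) (+-congʳ (*-comm y x)))) ⟩
      u * ((x * (t * x) - x * y) + (x * y - y * (t * y)))
        ≈⟨ *-congˡ (telescope _ _ _) ⟩
      u * (x * (t * x) - y * (t * y))
        ≈⟨ *-congˡ (+-cong (left-comm x) (-‿cong (left-comm y))) ⟩
      u * (t * (x * x) - t * (y * y))
        ≈⟨ *-congˡ (*-distribˡ-sub t _ _) ⟨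
      u * (t * (x * x - y * y))
        ≈⟨ *-congˡ (*-congˡ (telescope _ _ _)) ⟨
      u * (t * ((x * x - x * (t * y)) + (x * (t * y) - y * y)))
        ≈⟨ *-congˡ (*-congˡ (+-cong (*-distribˡ-sub x x (t * y)) (trans (*-distribˡ-sub y (t * x) y) (+-congʳ
             (S.solve 3 (λ t x y → y S.:* (t S.:* x) S.:= x S.:* (t S.:* y)) refl t x y))))) ⟨
      u * (t * (x * (x - t * y) + y * (t * x - y)))
        ≈⟨ S.solve 6 (λ a b u x y t → t S.:* ((a S.:* u) S.:* x S.:+ (b S.:* u) S.:* y) S.:= u S.:* (t S.:* (x S.:* a S.:+ y S.:* b))) refl (x - t * y) (t * x - y) u x y t ⟨
      t * ((x - t * y) * u * x + (t * x - y) * u * y)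
        ≈⟨ *-congˡ (+-congˡ (*-congʳ (trans (*-congˡ u′) (neg-swap y (t * x))))) ⟨
      t * ((x - t * y) * u * x + (y - t * x) * (y - x) ⁻¹ * y) ∎
      where
      u = (x - y) ⁻¹
      left-comm : ∀ x → x * (t * x) ≈ t * (x * x)
      left-comm x = S.solve 2 (λ t x → x S.:* (t S.:* x) S.:= t S.:* (x S.:* x)) refl t x
      neg-flip : ∀ a b → - (a - b) ≈ b - a
      neg-flip a b = trans (sym (-‿+-comm a (- b))) (trans (+-comm _ _) (+-congʳ (-‿involutive b)))
      u′ : (y - x) ⁻¹ ≈ - u
      u′ = trans (⁻¹-cong (sym (neg-flip x y))) (⁻¹-neg (x - y))
      neg-swap : ∀ a b → (a - b) * - u ≈ (b - a) * u
      neg-swap a b = trans (sym (-‿distribʳ-* _ u)) (trans (-‿distribˡ-* _ u) (*-congʳ (neg-flip a b)))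

    -- Apart from their own quotient and one extra power, the first two variables enter
    -- symmetrically. That common factor is taken out for each pair, and `transposition` treats the
    -- rest.
    straighten₂ : ∀ {n} a γ (xs : Vec Carrier (2 ℕ.+ n)) → R (a ∷ suc a ∷ γ) xs ≈ t * R (suc a ∷ a ∷ γ) xs
    straighten₂ {n} a γ xs = begin
      R (a ∷ suc a ∷ γ) xs ≈⟨ ∑∑-select _ xs ⟩
      ∑ (pairs xs) _
        ≈⟨ ∑-cong (pairs xs) (λ (x , y , s) → trans (sym (symm-+ n _ _ s)) (trans (symm-cong n (pointwise x y) s)
             (trans (symm-* n t _ s) (*-congˡ (symm-+ n _ _ s))))) ⟩
      ∑ (pairs xs) _       ≈⟨ *-∑ t (pairs xs) _ ⟨
      t * ∑ (pairs xs) _   ≈⟨ *-congˡ (∑∑-select _ xs) ⟨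
      t * R (suc a ∷ a ∷ γ) xs ∎
      where
      pointwise : ∀ x y (zs : Vec Carrier n) →
        term (a ∷ suc a ∷ γ) (x ∷ y ∷ zs) + term (a ∷ suc a ∷ γ) (y ∷ x ∷ zs)
          ≈ t * (term (suc a ∷ a ∷ γ) (x ∷ y ∷ zs) + term (suc a ∷ a ∷ γ) (y ∷ x ∷ zs))
      pointwise x y zs = begin
        term (a ∷ suc a ∷ γ) (x ∷ y ∷ zs) + term (a ∷ suc a ∷ γ) (y ∷ x ∷ zs)
          ≈⟨ S.solve 9 (λ x y u v p q f h g →
               p S.:* ((u S.:* f) S.:* ((y S.:* q) S.:* (h S.:* g))) S.:+ q S.:* ((v S.:* h) S.:* ((x S.:* p) S.:* (f S.:* g)))
               S.:= (p S.:* q S.:* f S.:* h S.:* g) S.:* (u S.:* y S.:+ v S.:* x)) refl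
               x y ((x - t * y) ÷ (x - y)) ((y - t * x) ÷ (y - x)) (x ^ a) (y ^ a) (φ x zs) (φ y zs) (term γ zs) ⟩
        (x ^ a * y ^ a * φ x zs * φ y zs * term γ zs) * ((x - t * y) ÷ (x - y) * y + (y - t * x) ÷ (y - x) * x)
          ≈⟨ *-congˡ (transposition x y) ⟩
        (x ^ a * y ^ a * φ x zs * φ y zs * term γ zs) * (t * ((x - t * y) ÷ (x - y) * x + (y - t * x) ÷ (y - x) * y))
          ≈⟨ S.solve 10 (λ x y u v p q f h g t →
               t S.:* ((x S.:* p) S.:* ((u S.:* f) S.:* (q S.:* (h S.:* g))) S.:+ (y S.:* q) S.:* ((v S.:* h) S.:* (p S.:* (f S.:* g))))
               S.:= (p S.:* q S.:* f S.:* h S.:* g) S.:* (t S.:* (u S.:* x S.:+ v S.:* y))) refl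
               x y ((x - t * y) ÷ (x - y)) ((y - t * x) ÷ (y - x)) (x ^ a) (y ^ a) (φ x zs) (φ y zs) (term γ zs) t ⟨
        t * (term (suc a ∷ a ∷ γ) (x ∷ y ∷ zs) + term (suc a ∷ a ∷ γ) (y ∷ x ∷ zs)) ∎

  -- The equality of lengths guarantees that both exchanged exponents belong to variables. The
  -- exponents before them are peeled off with `R-expand`.
  straighten : ∀ {n} α a γ (xs : Vec Carrier n) → length (α ++ a ∷ suc a ∷ γ) ≡ n →
    R (α ++ a ∷ suc a ∷ γ) xs ≈ t * R (α ++ suc a ∷ a ∷ γ) xs
  straighten {suc (suc n)} []      a γ xs _ = straighten₂ a γ xs
  straighten {suc n}       (p ∷ α) a γ xs e = begin
    R (p ∷ α ++ a ∷ suc a ∷ γ) xs ≈⟨ R-expand (p ∷ α ++ a ∷ suc a ∷ γ) xs ⟩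
    ∑ (select xs) (λ (x , r) → x ^ p * (φ x r * R (α ++ a ∷ suc a ∷ γ) r))
      ≈⟨ ∑-cong (select xs) (λ (x , r) → trans (*-congˡ (*-congˡ (straighten α a γ r (ℕ.suc-injective e))))
           (S.solve 4 (λ x y t z → x S.:* (y S.:* (t S.:* z)) S.:= t S.:* (x S.:* (y S.:* z))) refl (x ^ p) (φ x r) t _)) ⟩
    ∑ (select xs) (λ (x , r) → t * (x ^ p * (φ x r * R (α ++ suc a ∷ a ∷ γ) r)))
      ≈⟨ *-∑ t (select xs) _ ⟨
    t * ∑ (select xs) (λ (x , r) → x ^ p * (φ x r * R (α ++ suc a ∷ a ∷ γ) r))
      ≈⟨ *-congˡ (R-expand (p ∷ α ++ suc a ∷ a ∷ γ) xs) ⟨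
    t * R (p ∷ α ++ suc a ∷ a ∷ γ) xs ∎

  private
    -- The 0-1 vectors with r ones are singled out by the degree of the raised exponents, so no
    -- count of ones is carried. If the first exponent stays, the other variables contribute e_r; if
    -- it is raised, they contribute e_{r-1}.
    elementary-term : ∀ r α {n} (xs : Vec Carrier n) → length α ≡ n →
      elementary r xs * term α xs ≈ T α (λ β → χ (sum β ℕ.≟ r ℕ.+ sum α) * term β xs)
    elementary-term zero    []      [] _ = refl
    elementary-term (suc r) []      [] _ = refl
    elementary-term r (a ∷ α) (x ∷ xs) e = sym (begin
      T α (λ β → χ (a ℕ.+ sum β ℕ.≟ r ℕ.+ (a ℕ.+ sum α)) * (x ^ a * (φ x xs * term β xs)))
        + T α (λ β → χ (suc a ℕ.+ sum β ℕ.≟ r ℕ.+ (a ℕ.+ sum α)) * (x * x ^ a * (φ x xs * term β xs)))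
        ≈⟨ +-cong stay (raise r) ⟩
      c * (elementary r xs * term α xs) + c * (x * lower r * term α xs)
        ≈⟨ S.solve 6 (λ p f e x l g → (p S.:* f) S.:* (e S.:* g) S.:+ (p S.:* f) S.:* ((x S.:* l) S.:* g) S.:= (e S.:+ x S.:* l) S.:* (p S.:* (f S.:* g)))
             refl (x ^ a) (φ x xs) (elementary r xs) x (lower r) (term α xs) ⟩
      (elementary r xs + x * lower r) * term (a ∷ α) (x ∷ xs)
        ≈⟨ *-congʳ (elementary-∷ r) ⟩
      elementary r (x ∷ xs) * term (a ∷ α) (x ∷ xs) ∎)
      where
      c = x ^ a * φ x xs
      e′ = ℕ.suc-injective e
      -- This is e_{r-1}, taken to be 0 for r = 0.
      lower : ℕ → Carrier
      lower zero    = 0#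
      lower (suc r) = elementary r xs
      elementary-∷ : ∀ r → elementary r xs + x * lower r ≈ elementary r (x ∷ xs)
      elementary-∷ zero    = trans (+-congˡ (zeroʳ x)) (+-identityʳ _)
      elementary-∷ (suc r) = refl
      stay : T α (λ β → χ (a ℕ.+ sum β ℕ.≟ r ℕ.+ (a ℕ.+ sum α)) * (x ^ a * (φ x xs * term β xs))) ≈ c * (elementary r xs * term α xs)
      stay = trans (T-cong α (λ β _ → trans (*-cong
          (χ-cong (a ℕ.+ sum β ℕ.≟ r ℕ.+ (a ℕ.+ sum α)) (sum β ℕ.≟ r ℕ.+ sum α)
            (λ p → ℕ.+-cancelˡ-≡ a _ _ (≡.trans p (ℕ+-left-comm r a _)))
            (λ p → ≡.trans (≡.cong (a ℕ.+_) p) (ℕ+-left-comm a r _)))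
          (sym (*-assoc _ _ _)))
          (S.solve 3 (λ x y z → x S.:* (y S.:* z) S.:= y S.:* (x S.:* z)) refl (χ (sum β ℕ.≟ r ℕ.+ sum α)) c (term β xs))))
        (trans (sym (*-T c α _)) (*-congˡ (sym (elementary-term r α xs e′))))
      raise : ∀ r → T α (λ β → χ (suc a ℕ.+ sum β ℕ.≟ r ℕ.+ (a ℕ.+ sum α)) * (x * x ^ a * (φ x xs * term β xs))) ≈ c * (x * lower r * term α xs)
      -- Raising an exponent pushes the degree above that of the original exponents, so for r = 0 no
      -- term survives.
      raise zero = trans (vanish α (λ β β≥ → χ-no-* (suc a ℕ.+ sum β ℕ.≟ a ℕ.+ sum α)
          (λ p → ℕ.<⇒≢ (s≤s (ℕ.+-monoʳ-≤ a β≥)) (≡.sym p))))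
        (sym (trans (*-congˡ (trans (*-congʳ (zeroʳ x)) (zeroˡ _))) (zeroʳ c)))
        where
        vanish : ∀ α {Φ} → (∀ β → sum α ≤ sum β → Φ β ≈ 0#) → T α Φ ≈ 0#
        vanish []      h = h [] z≤n
        vanish (a ∷ α) h = trans (+-cong
          (vanish α (λ β p → h (a ∷ β) (ℕ.+-monoʳ-≤ a p)))
          (vanish α (λ β p → h (suc a ∷ β) (ℕ.m≤n⇒m≤1+n (ℕ.+-monoʳ-≤ a p))))) (+-identityˡ 0#)
      raise (suc r) = trans (T-cong α (λ β _ → trans (*-cong
          (χ-cong (suc a ℕ.+ sum β ℕ.≟ suc r ℕ.+ (a ℕ.+ sum α)) (sum β ℕ.≟ r ℕ.+ sum α)
            (λ p → ℕ.+-cancelˡ-≡ a _ _ (≡.trans (ℕ.suc-injective p) (ℕ+-left-comm r a _)))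
            (λ p → ≡.cong suc (≡.trans (≡.cong (a ℕ.+_) p) (ℕ+-left-comm a r _))))
          (S.solve 4 (λ x p f g → (x S.:* p) S.:* (f S.:* g) S.:= ((p S.:* f) S.:* x) S.:* g) refl x (x ^ a) (φ x xs) (term β xs)))
          (S.solve 3 (λ x y z → x S.:* (y S.:* z) S.:= y S.:* (x S.:* z)) refl (χ (sum β ℕ.≟ r ℕ.+ sum α)) (c * x) (term β xs))))
        (trans (sym (*-T (c * x) α _)) (trans (*-congˡ (sym (elementary-term r α xs e′)))
          (S.solve 4 (λ c x l g → (c S.:* x) S.:* (l S.:* g) S.:= c S.:* ((x S.:* l) S.:* g)) refl c x _ _)))

  private
    symm-T : ∀ n α (K : List ℕ → Vec Carrier n → Carrier) xs →
      symm n (λ ys → T α (λ β → K β ys)) xs ≈ T α (λ β → symm n (K β) xs)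
    symm-T n []      K xs = refl
    symm-T n (a ∷ α) K xs = trans (symm-+ n _ _ xs) (+-cong (symm-T n α _ xs) (symm-T n α _ xs))

  elementary-R : ∀ r α {n} (xs : Vec Carrier n) → length α ≡ n →
    elementary r xs * R α xs ≈ T α (λ β → χ (sum β ℕ.≟ r ℕ.+ sum α) * R β xs)
  elementary-R r α {n} xs e = begin
    elementary r xs * R α xs
      ≈⟨ symm-symmetric n (term α) (elementary-symmetric r n) xs ⟨
    symm n (λ ys → elementary r ys * term α ys) xs
      ≈⟨ symm-cong n (λ ys → elementary-term r α ys e) xs ⟩
    symm n (λ ys → T α (λ β → χ (sum β ℕ.≟ r ℕ.+ sum α) * term β ys)) xs
      ≈⟨ symm-T n α _ xs ⟩
    T α (λ β → symm n (λ ys → χ (sum β ℕ.≟ r ℕ.+ sum α) * term β ys) xs)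
      ≈⟨ T-cong α (λ β _ → symm-* n _ (term β) xs) ⟩
    T α (λ β → χ (sum β ℕ.≟ r ℕ.+ sum α) * R β xs) ∎

  R-map-suc : ∀ α {n} (xs : Vec Carrier n) → length α ≡ n → R (map suc α) xs ≈ product (λ x → x) xs * R α xs
  R-map-suc α {n} xs e = trans (symm-cong n (λ ys → term-map-suc α ys e) xs)
    (symm-symmetric n (term α) (product-symmetric (λ x → x) n) xs)
    where
    term-map-suc : ∀ α {n} (xs : Vec Carrier n) → length α ≡ n → term (map suc α) xs ≈ product (λ x → x) xs * term α xs
    term-map-suc []      []       _ = sym (*-identityˡ _)
    term-map-suc (a ∷ α) (x ∷ xs) e = trans (*-congˡ (*-congˡ (term-map-suc α xs (ℕ.suc-injective e))))
      (S.solve 5 (λ x p f π g → (x S.:* p) S.:* (f S.:* (π S.:* g)) S.:= (x S.:* π) S.:* (p S.:* (f S.:* g))) refl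
        x (x ^ a) (φ x xs) (product (λ x → x) xs) (term α xs))

  geometric : ℕ → Carrier
  geometric k = ∑ (upTo k) (t ^_)

  geometric-1-t : ∀ k → (1# - t) * geometric k ≈ 1# - t ^ k
  geometric-1-t zero    = trans (zeroʳ _) (sym (-‿inverseʳ 1#))
  geometric-1-t (suc k) = begin
    (1# - t) * geometric (suc k)                   ≈⟨ *-congˡ (∑-upTo-last k _) ⟩
    (1# - t) * (geometric k + t ^ k)               ≈⟨ distribˡ _ _ _ ⟩
    (1# - t) * geometric k + (1# - t) * t ^ k
      ≈⟨ +-cong (geometric-1-t k) (trans (*-comm _ _) (trans (*-distribˡ-sub (t ^ k) 1# t) (+-cong (*-identityʳ _) (-‿cong (*-comm _ _))))) ⟩
    (1# - t ^ k) + (t ^ k - t ^ suc k)             ≈⟨ telescope _ _ _ ⟩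
    1# - t ^ suc k                                 ∎

  private
    φ-0∷ : ∀ {n x} (xs : Vec Carrier n) → ¬ (x ≈ 0#) → φ x (0# ∷ xs) ≈ φ x xs
    φ-0∷ {x = x} xs x≉0 = trans (*-congʳ (trans (*-cong
      (trans (+-congˡ (trans (-‿cong (zeroʳ t)) -0#≈0#)) (+-identityʳ x))
      (⁻¹-cong (trans (+-congˡ -0#≈0#) (+-identityʳ x)))) (⁻¹-inverse x≉0))) (*-identityˡ _)

    φ-0 : ∀ {n} (xs : Vec Carrier n) → VAll.All (λ x → ¬ (x ≈ 0#)) xs → φ 0# xs ≈ t ^ n
    φ-0 []       _                   = refl
    φ-0 (x ∷ xs) (x≉0 VAll.∷ xs≉0) = *-cong (begin
      (0# - t * x) * (0# - x) ⁻¹  ≈⟨ *-cong (+-identityˡ _) (trans (⁻¹-cong (+-identityˡ _)) (⁻¹-neg x)) ⟩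
      - (t * x) * - (x ⁻¹)        ≈⟨ trans (sym (-‿distribˡ-* _ _)) (trans (-‿cong (sym (-‿distribʳ-* _ _))) (-‿involutive _)) ⟩
      t * x * x ⁻¹                ≈⟨ trans (*-assoc _ _ _) (trans (*-congˡ (⁻¹-inverse x≉0)) (*-identityʳ t)) ⟩
      t                           ∎) (φ-0 xs xs≉0)

  -- The variable 0 contributes only where its exponent is 0, that is, in one of the last k + 1
  -- positions. Variables before it give the factor 1 by `φ-0∷`, and i variables after it give tⁱ by
  -- `φ-0`. Summing over the positions yields 1 + t + ... + tᵏ.
  R-0∷ : ∀ β k {n} (xs : Vec Carrier n) → length β ℕ.+ k ≡ n → VAll.All (λ x → ¬ (x ≈ 0#)) xs →
    R (map suc β ++ replicate (suc k) 0) (0# ∷ xs) ≈ geometric (suc k) * R (map suc β ++ replicate k 0) xs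
  R-0∷ []      zero    []  _ _    = trans (+-identityʳ _) (*-cong (sym (+-identityʳ 1#)) (*-identityˡ _))
  R-0∷ []      (suc k) {suc n} xs e xs≉0 = begin
    R (0 ∷ zs) (0# ∷ xs)
      ≈⟨ R-expand (0 ∷ zs) (0# ∷ xs) ⟩
    1# * (φ 0# xs * R zs xs) + ∑ (map _ (select xs)) (λ (x , r) → 1# * (φ x r * R zs r))
      ≈⟨ +-cong (trans (*-identityˡ _) (*-congʳ (trans (φ-0 xs xs≉0) (reflexive (≡.cong (t ^_) (≡.sym e))))))
           (reflexive (∑-map _ (select xs) _)) ⟩
    t ^ suc k * R zs xs + ∑ (select xs) (λ (x , r) → 1# * (φ x (0# ∷ r) * R zs (0# ∷ r)))
      ≈⟨ +-congˡ (∑-cong∈ (select xs) (λ {(x , r)} x∈ → let x≉0 , r≉0 = select-All xs≉0 x∈ in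
           trans (*-congˡ (*-cong (φ-0∷ r x≉0) (R-0∷ [] k r (ℕ.suc-injective e) r≉0)))
             (S.solve 4 (λ a b c d → a S.:* (b S.:* (c S.:* d)) S.:= c S.:* (a S.:* (b S.:* d))) refl 1# (φ x r) (geometric (suc k)) _))) ⟩
    t ^ suc k * R zs xs + ∑ (select xs) (λ (x , r) → geometric (suc k) * (1# * (φ x r * R (replicate k 0) r)))
      ≈⟨ +-congˡ (trans (sym (*-∑ (geometric (suc k)) (select xs) _)) (*-congˡ (sym (R-expand zs xs)))) ⟩
    t ^ suc k * R zs xs + geometric (suc k) * R zs xs
      ≈⟨ trans (sym (distribʳ _ _ _)) (*-congʳ (trans (+-comm _ _) (sym (∑-upTo-last (suc k) _)))) ⟩
    geometric (2 ℕ.+ k) * R zs xs ∎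
    where zs = replicate (suc k) 0
  R-0∷ (b ∷ β) k {suc n} xs e xs≉0 = begin
    R (suc b ∷ α) (0# ∷ xs)
      ≈⟨ R-expand (suc b ∷ α) (0# ∷ xs) ⟩
    0# ^ suc b * (φ 0# xs * R α xs) + ∑ (map _ (select xs)) (λ (x , r) → x ^ suc b * (φ x r * R α r))
      ≈⟨ +-cong (trans (*-congʳ (zeroˡ _)) (zeroˡ _)) (reflexive (∑-map _ (select xs) _)) ⟩
    0# + ∑ (select xs) (λ (x , r) → x ^ suc b * (φ x (0# ∷ r) * R α (0# ∷ r)))
      ≈⟨ +-identityˡ _ ⟩
    ∑ (select xs) (λ (x , r) → x ^ suc b * (φ x (0# ∷ r) * R α (0# ∷ r)))
      ≈⟨ ∑-cong∈ (select xs) (λ {(x , r)} x∈ → let x≉0 , r≉0 = select-All xs≉0 x∈ in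
           trans (*-congˡ (*-cong (φ-0∷ r x≉0) (R-0∷ β k r (ℕ.suc-injective e) r≉0)))
             (S.solve 4 (λ a b c d → a S.:* (b S.:* (c S.:* d)) S.:= c S.:* (a S.:* (b S.:* d))) refl (x ^ suc b) (φ x r) (geometric (suc k)) _)) ⟩
    ∑ (select xs) (λ (x , r) → geometric (suc k) * (x ^ suc b * (φ x r * R (map suc β ++ replicate k 0) r)))
      ≈⟨ *-∑ (geometric (suc k)) (select xs) _ ⟨
    geometric (suc k) * ∑ (select xs) (λ (x , r) → x ^ suc b * (φ x r * R (map suc β ++ replicate k 0) r))
      ≈⟨ *-congˡ (R-expand (suc b ∷ map suc β ++ replicate k 0) xs) ⟨
    geometric (suc k) * R (suc b ∷ map suc β ++ replicate k 0) xs ∎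
    where α = map suc β ++ replicate (suc k) 0

  -- The quotients (x - t y) / (x - y) are homogeneous of degree 0, so only the monomials feel the
  -- scaling.
  R-scale : ∀ {c} → ¬ (c ≈ 0#) → ∀ α {n} (xs : Vec Carrier n) → length α ≡ n →
    R α (Vec.map (c *_) xs) ≈ c ^ sum α * R α xs
  R-scale {c} c≉0 []      []        _ = sym (*-identityˡ _)
  R-scale {c} c≉0 (a ∷ α) {suc n} xs e = begin
    R (a ∷ α) (Vec.map (c *_) xs)
      ≈⟨ R-expand (a ∷ α) (Vec.map (c *_) xs) ⟩
    ∑ (select (Vec.map (c *_) xs)) (λ (x , r) → x ^ a * (φ x r * R α r))
      ≡⟨ ≡.trans (≡.cong (λ l → ∑ l _) (select-map (c *_) xs)) (∑-map _ (select xs) _) ⟩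
    ∑ (select xs) (λ (x , r) → (c * x) ^ a * (φ (c * x) (Vec.map (c *_) r) * R α (Vec.map (c *_) r)))
      ≈⟨ ∑-cong (select xs) (λ (x , r) → trans
           (*-cong (^-distrib-* c x a) (*-cong (φ-scale x r) (R-scale c≉0 α r (ℕ.suc-injective e))))
           (trans (S.solve 5 (λ p q f u v → (p S.:* q) S.:* (f S.:* (u S.:* v)) S.:= (p S.:* u) S.:* (q S.:* (f S.:* v))) refl _ _ _ _ _)
             (*-congʳ (sym (^-homo-* c a (sum α)))))) ⟩
    ∑ (select xs) (λ (x , r) → c ^ (a ℕ.+ sum α) * (x ^ a * (φ x r * R α r)))
      ≈⟨ *-∑ _ (select xs) _ ⟨
    c ^ (a ℕ.+ sum α) * ∑ (select xs) (λ (x , r) → x ^ a * (φ x r * R α r))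
      ≈⟨ *-congˡ (R-expand (a ∷ α) xs) ⟨
    c ^ (a ℕ.+ sum α) * R (a ∷ α) xs ∎
    where
    φ-scale : ∀ x {n} (r : Vec Carrier n) → φ (c * x) (Vec.map (c *_) r) ≈ φ x r
    φ-scale x []      = refl
    φ-scale x (y ∷ r) = *-cong (begin
      (c * x - t * (c * y)) * (c * x - c * y) ⁻¹
        ≈⟨ *-cong (trans (+-congˡ (-‿cong (S.solve 3 (λ t c y → t S.:* (c S.:* y) S.:= c S.:* (t S.:* y)) refl t c y))) (sym (*-distribˡ-sub c x (t * y))))
             (trans (⁻¹-cong (sym (*-distribˡ-sub c x y))) (⁻¹-distrib-* c≉0 (x - y))) ⟩
      (c * (x - t * y)) * (c ⁻¹ * (x - y) ⁻¹)
        ≈⟨ S.solve 4 (λ c a i b → (c S.:* a) S.:* (i S.:* b) S.:= (c S.:* i) S.:* (a S.:* b)) refl c (x - t * y) (c ⁻¹) ((x - y) ⁻¹) ⟩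
      (c * c ⁻¹) * ((x - t * y) * (x - y) ⁻¹)
        ≈⟨ trans (*-congʳ (⁻¹-inverse c≉0)) (*-identityˡ _) ⟩
      (x - t * y) * (x - y) ⁻¹ ∎) (φ-scale x r)

-- Partitions as lists of column heights.

applyUpTo-cong : ∀ {X : Set} n {f g : ℕ → X} → (∀ {i} → i < n → f i ≡ g i) → applyUpTo f n ≡ applyUpTo g n
applyUpTo-cong zero    h = ≡.refl
applyUpTo-cong (suc n) h = ≡.cong₂ _∷_ (h (s≤s z≤n)) (applyUpTo-cong n (h ∘ s≤s))

applyUpTo-+ : ∀ {X : Set} (f : ℕ → X) m n → applyUpTo f (m ℕ.+ n) ≡ applyUpTo f m ++ applyUpTo (λ i → f (m ℕ.+ i)) n
applyUpTo-+ f zero    n = ≡.refl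
applyUpTo-+ f (suc m) n = ≡.cong (f 0 ∷_) (applyUpTo-+ (f ∘ suc) m n)

applyUpTo-const : ∀ {X : Set} (x : X) n → applyUpTo (λ _ → x) n ≡ replicate n x
applyUpTo-const x zero    = ≡.refl
applyUpTo-const x (suc n) = ≡.cong (x ∷_) (applyUpTo-const x n)

count≥ : ℕ → List ℕ → ℕ
count≥ j as = length (filter (j ℕ.≤?_) as)

-- The conjugate of a partition, cut off or padded with zeros to length n.
transpose : ℕ → List ℕ → List ℕ
transpose n as = applyUpTo (λ i → count≥ (suc i) as) n

-- Carrying the bound makes the tail an instance of the same predicate, with the head as its bound.
-- For the columns of a partition the outermost bound is the number of variables.
Decreasing : ℕ → List ℕ → Set
Decreasing n []       = ⊤
Decreasing n (c ∷ cs) = c ≤ n × Decreasing c cs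

decreasing-mono : ∀ {m n} cs → m ≤ n → Decreasing m cs → Decreasing n cs
decreasing-mono []       m≤n _         = tt
decreasing-mono (c ∷ cs) m≤n (c≤m , d) = ℕ.≤-trans c≤m m≤n , d

decreasing-lower : ∀ {m n} cs → entry cs 0 ≤ m → Decreasing n cs → Decreasing m cs
decreasing-lower []       _   _       = tt
decreasing-lower (c ∷ cs) c≤m (_ , d) = c≤m , d

decreasing⇒head≤ : ∀ {n} cs → Decreasing n cs → entry cs 0 ≤ n
decreasing⇒head≤ []       _         = z≤n
decreasing⇒head≤ (c ∷ cs) (c≤n , _) = c≤n

count≥-accept : ∀ j {a} as → j ≤ a → count≥ j (a ∷ as) ≡ suc (count≥ j as)
count≥-accept j as j≤a = ≡.cong length (filter-accept (j ℕ.≤?_) j≤a)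

count≥-reject : ∀ j {a} as → a < j → count≥ j (a ∷ as) ≡ count≥ j as
count≥-reject j as a<j = ≡.cong length (filter-reject (j ℕ.≤?_) (ℕ.<⇒≱ a<j))

count≥-none : ∀ {n} cs → Decreasing n cs → ∀ {j} → n < j → count≥ j cs ≡ 0
count≥-none []       _         n<j = ≡.refl
count≥-none (c ∷ cs) (c≤n , d) n<j = ≡.trans (count≥-reject _ cs (ℕ.≤-<-trans c≤n n<j)) (count≥-none cs (decreasing-mono cs c≤n d) n<j)

transpose-+ : ∀ c k cs → Decreasing c cs → transpose (c ℕ.+ k) cs ≡ transpose c cs ++ replicate k 0
transpose-+ c k cs d = ≡.trans (applyUpTo-+ _ c k) (≡.cong (transpose c cs ++_)
  (≡.trans (applyUpTo-cong k (λ {i} _ → count≥-none cs d (s≤s (ℕ.m≤m+n c i)))) (applyUpTo-const 0 k)))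

-- The first column adds one box to each of the first c rows, the rest of these rows has the columns
-- `cs`, and the rows below are empty. The recursions on columns rest on this decomposition.
transpose-∷ : ∀ n c cs → c ≤ n → Decreasing c cs → transpose n (c ∷ cs) ≡ map suc (transpose c cs) ++ replicate (n ∸ c) 0
transpose-∷ n c cs c≤n d = ≡.trans (≡.cong (λ m → transpose m (c ∷ cs)) (≡.sym (ℕ.m+[n∸m]≡n c≤n)))
  (≡.trans (transpose-+ c (n ∸ c) (c ∷ cs) (ℕ.≤-refl , d)) (≡.cong (_++ replicate (n ∸ c) 0)
    (≡.trans (applyUpTo-cong c (λ {i} i<c → count≥-accept (suc i) cs i<c)) (≡.sym (map-applyUpTo _ suc c)))))

length-transpose : ∀ n as → length (transpose n as) ≡ n
length-transpose n as = length-applyUpTo _ n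

sum-map-suc : ∀ as → sum (map suc as) ≡ length as ℕ.+ sum as
sum-map-suc []       = ≡.refl
sum-map-suc (a ∷ as) = ≡.cong suc (≡.trans (≡.cong (a ℕ.+_) (sum-map-suc as)) (ℕ+-left-comm a (length as) (sum as)))

sum-replicate-0 : ∀ n → sum (replicate n 0) ≡ 0
sum-replicate-0 zero    = ≡.refl
sum-replicate-0 (suc n) = sum-replicate-0 n

sum-transpose : ∀ n cs → Decreasing n cs → sum (transpose n cs) ≡ sum cs
sum-transpose n []       _         = ≡.trans (≡.cong sum (applyUpTo-const 0 n)) (sum-replicate-0 n)
sum-transpose n (c ∷ cs) (c≤n , d) = ≡.trans (≡.cong sum (transpose-∷ n c cs c≤n d))
  (≡.trans (sum-++ (map suc (transpose c cs)) _) (≡.trans (≡.cong₂ ℕ._+_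
    (≡.trans (sum-map-suc (transpose c cs)) (≡.cong₂ ℕ._+_ (length-transpose c cs) (sum-transpose c cs d))) (sum-replicate-0 (n ∸ c)))
    (ℕ.+-identityʳ _)))

-- The partitions in a box with n rows and L columns. Padding with zeros gives all of them lists of
-- one length, so that λ, ν and μ can be traversed together.
columns : ℕ → ℕ → List (List ℕ)
columns n zero    = [] ∷ []
columns n (suc L) = concatMap (λ c → map (c ∷_) (columns c L)) (upTo (suc n))

∈-columns⁻ : ∀ n L {cs} → cs ∈ columns n L → Decreasing n cs × length cs ≡ L
∈-columns⁻ n zero    (here ≡.refl) = tt , ≡.refl
∈-columns⁻ n (suc L) cs∈ with find (∈-concatMap⁻ (λ c → map (c ∷_) (columns c L)) {xs = upTo (suc n)} cs∈)
... | c , c∈ , cs∈′ with ∈-map⁻ (c ∷_) cs∈′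
... | ds , ds∈ , ≡.refl with ∈-columns⁻ c L ds∈
... | d , e = (ℕ.s≤s⁻¹ (∈-upTo⁻ c∈) , d) , ≡.cong suc e

∈-columns⁺ : ∀ n L {cs} → Decreasing n cs → length cs ≡ L → cs ∈ columns n L
∈-columns⁺ n zero    {[]}     _         _ = here ≡.refl
∈-columns⁺ n (suc L) {c ∷ cs} (c≤n , d) e =
  ∈-concatMap⁺ (λ c → map (c ∷_) (columns c L)) (lose (∈-upTo⁺ (s≤s c≤n)) (∈-map⁺ (c ∷_) (∈-columns⁺ c L d (ℕ.suc-injective e))))

unique-columns : ∀ n L → Unique (columns n L)
unique-columns n zero    = [] AP.∷ AP.[]
unique-columns n (suc L) = unique-concatMap (upTo (suc n)) (Unique.upTo⁺ (suc n))
  where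
  unique-concatMap : ∀ cs → Unique cs → Unique (concatMap (λ c → map (c ∷_) (columns c L)) cs)
  unique-concatMap []       _           = AP.[]
  unique-concatMap (c ∷ cs) (c∉ AP.∷ u) = Unique.++⁺ (Unique.map⁺ ∷-injectiveʳ (unique-columns c L)) (unique-concatMap cs u) disjoint
    where
    disjoint : ∀ {v} → ¬ (v ∈ map (c ∷_) (columns c L) × v ∈ concatMap (λ c → map (c ∷_) (columns c L)) cs)
    disjoint (v∈ , v∈′) with ∈-map⁻ (c ∷_) v∈ | find (∈-concatMap⁻ (λ c → map (c ∷_) (columns c L)) {xs = cs} v∈′)
    ... | _ , _ , ≡.refl | b , b∈ , w∈ with ∈-map⁻ (b ∷_) w∈
    ... | _ , _ , ≡.refl = All.lookup c∉ b∈ ≡.refl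

module ColumnSums (A : CommutativeRing 0ℓ 0ℓ) where
  open CommutativeRing A hiding (zero)
  open Operations A
  open Sums A
  open import Relation.Binary.Reasoning.Setoid setoid

  ∑-columns-suc : ∀ n L (f : List ℕ → Carrier) →
    ∑ (columns n (suc L)) f ≈ ∑ (upTo (suc n)) (λ c → ∑ (columns c L) (λ cs → f (c ∷ cs)))
  ∑-columns-suc n L f = trans (∑-concatMap (λ c → map (c ∷_) (columns c L)) (upTo (suc n)) f)
    (∑-cong (upTo (suc n)) (λ c → reflexive (∑-map (c ∷_) (columns c L) f)))

  ∑-upTo-≤ : ∀ {m n} → m ≤ n → (f : ℕ → Carrier) → (∀ {c} → m < c → c ≤ n → f c ≈ 0#) → ∑ (upTo (suc n)) f ≈ ∑ (upTo (suc m)) f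
  ∑-upTo-≤ {m} {n} m≤n f h with ℕ.m≤n⇒m<n∨m≡n m≤n
  ... | inj₂ ≡.refl = refl
  ∑-upTo-≤ {m} {suc n} m≤n f h | inj₁ m<n = trans (∑-upTo-last (suc n) f)
    (trans (+-cong (∑-upTo-≤ (ℕ.s≤s⁻¹ m<n) f (λ m<c c≤n → h m<c (ℕ.m≤n⇒m≤1+n c≤n))) (h m<n ℕ.≤-refl)) (+-identityʳ _))

  ∑-upTo-from : ∀ {m n} → m ≤ n → (f : ℕ → Carrier) →
    ∑ (upTo (suc n)) (λ d → χ (m ℕ.≤? d) * f d) ≈ ∑ (upTo (suc (n ∸ m))) (λ k → f (m ℕ.+ k))
  ∑-upTo-from {zero}  {n}     _         f = ∑-cong (upTo (suc n)) (λ d → χ-yes-* (0 ℕ.≤? d) z≤n)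
  ∑-upTo-from {suc m} {suc n} (s≤s m≤n) f = begin
    ∑ (upTo (2 ℕ.+ n)) (λ d → χ (suc m ℕ.≤? d) * f d)
      ≈⟨ ∑-upTo-suc (suc n) _ ⟩
    χ (suc m ℕ.≤? 0) * f 0 + ∑ (upTo (suc n)) (λ d → χ (suc m ℕ.≤? suc d) * f (suc d))
      ≈⟨ +-cong (χ-no-* (suc m ℕ.≤? 0) (λ ())) (∑-cong (upTo (suc n)) (λ d →
           *-congʳ (χ-cong (suc m ℕ.≤? suc d) (m ℕ.≤? d) ℕ.s≤s⁻¹ s≤s))) ⟩
    0# + ∑ (upTo (suc n)) (λ d → χ (m ℕ.≤? d) * f (suc d))
      ≈⟨ trans (+-identityˡ _) (∑-upTo-from m≤n (f ∘ suc)) ⟩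
    ∑ (upTo (suc (n ∸ m))) (λ k → f (suc m ℕ.+ k)) ∎

  ∑-columns-≤ : ∀ {m n} L → m ≤ n → (f : List ℕ → Carrier) → (∀ cs → cs ∈ columns n L → m < entry cs 0 → f cs ≈ 0#) →
    ∑ (columns n L) f ≈ ∑ (columns m L) f
  ∑-columns-≤         zero    m≤n f h = refl
  ∑-columns-≤ {m} {n} (suc L) m≤n f h = trans (∑-columns-suc n L f)
    (trans (∑-upTo-≤ m≤n _ (λ {c} m<c c≤n → ∑-zero∈ (columns c L) (λ {cs} cs∈ → let d , e = ∈-columns⁻ c L cs∈ in
      h (c ∷ cs) (∈-columns⁺ n (suc L) (c≤n , d) (≡.cong suc e)) m<c))) (sym (∑-columns-suc m L f)))

-- The coefficients vs and sk as products over adjacent columns.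

∸-telescope : ∀ {a b c} → a ≤ b → b ≤ c → (c ∸ b) ℕ.+ (b ∸ a) ≡ c ∸ a
∸-telescope {a} {b} a≤b b≤c = ≡.trans (≡.sym (ℕ.+-∸-assoc _ a≤b)) (≡.cong (_∸ a) (ℕ.m∸n+n≡m b≤c))

-- This concerns the last entry of n ∷ cs. If it were positive, adding a vertical strip could open a
-- new column, which a list of the same length cannot record.
Last≡0 : ℕ → List ℕ → Set
Last≡0 n []       = n ≡ 0
Last≡0 n (c ∷ cs) = Last≡0 c cs

-- A partition λ is given here by its columns λᶜ₁ ≥ λᶜ₂ ≥ …, padded with zeros to a common length.
module ColumnCoefficients (K : Field) (q : Field.Carrier K)
  (1-qᵏ≉0 : ∀ k → ¬ (Field._≈_ K (Field._-_ K (Field.1# K) (FieldOperations._^_ K q (suc k))) (Field.0# K)))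
  where
  open Field K hiding (zero)
  open FieldOperations K
  open HallLittlewood K q using (vₘ)
  open QBinomial K q 1-qᵏ≉0
  open FieldLemmas K
  open Sums commutativeRing
  open import Relation.Binary.Reasoning.Setoid setoid

  g : ℕ → ℕ → Carrier
  g = gaussianBinomial q

  -- The bracket enforces ν ⊆ λ, which truncated subtraction would not detect. The strip condition
  -- λᶜⱼ₊₁ ≤ νᶜⱼ is enforced by the vanishing of the Gaussian binomial.
  verticalCoefficient : List ℕ → List ℕ → Carrier
  verticalCoefficient (d ∷ ds) (c ∷ cs) =
    χ (c ℕ.≤? d) * g (d ∸ entry ds 0) (d ∸ c) * verticalCoefficient ds cs
  verticalCoefficient _ _ = 1#

  -- The number `c ∸ entry cs 0` is m_j(μ), and the power of t in sk is distributed over the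
  -- columns.
  skewCoefficient : List ℕ → List ℕ → Carrier
  skewCoefficient (d ∷ ds) (c ∷ cs) =
    χ (c ℕ.≤? d) * (q ^ ((d ∸ c) C 2) * g (d ∸ entry cs 0) (c ∸ entry cs 0)) * skewCoefficient ds cs
  skewCoefficient _ _ = 1#

  -- The coefficient of R_ds in e_r R_cs.
  rawCoefficient : List ℕ → ℕ → List ℕ → Carrier
  rawCoefficient (c ∷ cs) n (d ∷ ds) = χ (c ℕ.≤? d) * (g (n ∸ c) (d ∸ c) * rawCoefficient cs c ds)
  rawCoefficient _ _ _ = 1#

  -- v_σ(t) in n variables.
  normalization : List ℕ → ℕ → Carrier
  normalization []       n = vₘ n
  normalization (d ∷ ds) n = vₘ (n ∸ d) * normalization ds d

  normalization≉0 : ∀ ds n → ¬ (normalization ds n ≈ 0#)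
  normalization≉0 []       n = vₘ≉0 n
  normalization≉0 (d ∷ ds) n = *-nonzero (vₘ≉0 (n ∸ d)) (normalization≉0 ds d)

  private
    -- The normalization without the factor of the empty rows, which is the only factor that depends
    -- on n.
    trailing : List ℕ → Carrier
    trailing []       = 1#
    trailing (d ∷ ds) = normalization ds d

    normalization-split : ∀ ds n → normalization ds n ≈ vₘ (n ∸ entry ds 0) * trailing ds
    normalization-split []       n = sym (*-identityʳ _)
    normalization-split (d ∷ ds) n = refl

  rawCoefficient-vanish : ∀ {n} cs ds → Decreasing n cs → length ds ≡ length cs → n < entry ds 0 → rawCoefficient cs n ds ≈ 0#
  rawCoefficient-vanish (c ∷ cs) (d ∷ ds) (c≤n , _) e n<d =
    trans (*-congˡ (trans (*-congʳ (gaussian-> (ℕ.∸-monoˡ-< n<d c≤n))) (zeroˡ _))) (zeroʳ _)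

  -- Let d′ be the next column of `ds`. One column is converted by two factorial formulas:
  -- [n-c, d-c] v_{d-c} v_{n-d} = v_{n-c} and [d-d′, d-c] v_{d-c} v_{c-d′} = v_{d-d′}. If d < c or c
  -- < d′, both sides vanish.
  rawCoefficient-normalization : ∀ n cs ds → Decreasing n cs → Decreasing n ds → length ds ≡ length cs →
    rawCoefficient cs n ds * normalization ds n ≈ normalization cs n * verticalCoefficient ds cs
  rawCoefficient-normalization n []       []       _           _           _ = *-comm _ _
  rawCoefficient-normalization n (c ∷ cs) (d ∷ ds) (c≤n , dcs) (d≤n , dds) e with c ℕ.≤? d
  ... | no c≰d  = trans (trans (*-congʳ (χ-no-* (c ℕ.≤? d) c≰d)) (zeroˡ _))
    (sym (trans (*-congˡ (trans (*-congʳ (χ-no-* (c ℕ.≤? d) c≰d)) (zeroˡ _))) (zeroʳ _)))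
  ... | yes c≤d with entry ds 0 ℕ.≤? c
  ... | no d′≰c = trans
    (trans (*-congʳ (trans (*-congˡ (trans (*-congˡ (rawCoefficient-vanish cs ds dcs (ℕ.suc-injective e) (ℕ.≰⇒> d′≰c))) (zeroʳ _))) (zeroʳ _))) (zeroˡ _))
    (sym (trans (*-congˡ (trans (*-congʳ (trans (*-congˡ (gaussian-> (ℕ.∸-monoʳ-< (ℕ.≰⇒> d′≰c) (decreasing⇒head≤ ds dds)))) (zeroʳ _))) (zeroˡ _))) (zeroʳ _)))
  -- The extra factor v_{d-c} lets both factorial formulas be used without division.
  ... | yes d′≤c = *-cancelʳ (vₘ≉0 (d ∸ c)) (begin
    χ (c ℕ.≤? d) * (G * raw) * (vₘ (n ∸ d) * normalization ds d) * vₘ (d ∸ c)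
      ≈⟨ *-congʳ (*-cong (χ-yes-* (c ℕ.≤? d) c≤d) (*-congˡ (normalization-split ds d))) ⟩
    G * raw * (vₘ (n ∸ d) * (vₘ (d ∸ entry ds 0) * trailing ds)) * vₘ (d ∸ c)
      ≈⟨ S.solve 6 (λ G r a b c d → (G S.:* r) S.:* (a S.:* (b S.:* c)) S.:* d S.:= (G S.:* (d S.:* a)) S.:* (r S.:* (b S.:* c))) refl
           G raw (vₘ (n ∸ d)) (vₘ (d ∸ entry ds 0)) (trailing ds) (vₘ (d ∸ c)) ⟩
    G * (vₘ (d ∸ c) * vₘ (n ∸ d)) * (raw * (vₘ (d ∸ entry ds 0) * trailing ds))
      ≈⟨ *-cong (factor (d ∸ c) (n ∸ d) (≡.trans (ℕ.+-comm (d ∸ c) _) (∸-telescope c≤d d≤n))) (*-congˡ (*-congʳ (sym (factor (d ∸ c) (c ∸ entry ds 0) (∸-telescope d′≤c c≤d))))) ⟩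
    vₘ (n ∸ c) * (raw * (H * (vₘ (d ∸ c) * vₘ (c ∸ entry ds 0)) * trailing ds))
      ≈⟨ S.solve 6 (λ a r H b c t → a S.:* (r S.:* ((H S.:* (b S.:* c)) S.:* t)) S.:= (a S.:* (r S.:* (c S.:* t))) S.:* (H S.:* b)) refl
           (vₘ (n ∸ c)) raw H (vₘ (d ∸ c)) (vₘ (c ∸ entry ds 0)) (trailing ds) ⟩
    vₘ (n ∸ c) * (raw * (vₘ (c ∸ entry ds 0) * trailing ds)) * (H * vₘ (d ∸ c))
      ≈⟨ *-congʳ (*-congˡ (trans (*-congˡ (sym (normalization-split ds c)))
           (rawCoefficient-normalization c cs ds dcs (decreasing-lower ds d′≤c dds) (ℕ.suc-injective e)))) ⟩
    vₘ (n ∸ c) * (normalization cs c * verticalCoefficient ds cs) * (H * vₘ (d ∸ c))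
      ≈⟨ S.solve 5 (λ a b c H d → (a S.:* (b S.:* c)) S.:* (H S.:* d) S.:= ((a S.:* b) S.:* (H S.:* c)) S.:* d) refl
           (vₘ (n ∸ c)) (normalization cs c) (verticalCoefficient ds cs) H (vₘ (d ∸ c)) ⟩
    vₘ (n ∸ c) * normalization cs c * (H * verticalCoefficient ds cs) * vₘ (d ∸ c)
      ≈⟨ *-congʳ (*-congˡ (*-congʳ (χ-yes-* (c ℕ.≤? d) c≤d))) ⟨
    vₘ (n ∸ c) * normalization cs c * (χ (c ℕ.≤? d) * H * verticalCoefficient ds cs) * vₘ (d ∸ c) ∎)
    where
    G = g (n ∸ c) (d ∸ c)
    H = g (d ∸ entry ds 0) (d ∸ c)
    raw = rawCoefficient cs c ds
    factor : ∀ {a} b c → b ℕ.+ c ≡ a → gaussianBinomial q a b * (vₘ b * vₘ c) ≈ vₘ a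
    factor b c ≡.refl = gaussian-factorial b c

-- The Pieri rule for functions that satisfy the straightening rule.

module Pieri (K : Field) (q : Field.Carrier K)
  (1-qᵏ≉0 : ∀ k → ¬ (Field._≈_ K (Field._-_ K (Field.1# K) (FieldOperations._^_ K q (suc k))) (Field.0# K)))
  {F : CommutativeRing 0ℓ 0ℓ} (s : RingHom (Field.commutativeRing K) F)
  where
  private
    module K = Field K
    module KO = FieldOperations K
  open QBinomial K q 1-qᵏ≉0
  open ColumnCoefficients K q 1-qᵏ≉0
  open RingHom s
  open CommutativeRing F hiding (zero)
  open Operations F
  open Sums F
  open ColumnSums F
  open BinarySums F
  open import Relation.Binary.Reasoning.Setoid setoid

  -- The rule is stated for arbitrary functions of exponent lists, because the argument repeatedly
  -- fixes a prefix or a suffix of the list and works on the rest.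
  Straight : ℕ → (List ℕ → Carrier) → Set
  Straight n Φ = ∀ α a γ → length (α ++ a ∷ suc a ∷ γ) ≡ n → Φ (α ++ a ∷ suc a ∷ γ) ≈ ⟦ q ⟧ * Φ (α ++ suc a ∷ a ∷ γ)

  T-map-suc : ∀ α Φ → T (map suc α) Φ ≈ T α (Φ ∘ map suc)
  T-map-suc []      Φ = refl
  T-map-suc (a ∷ α) Φ = +-cong (T-map-suc α _) (T-map-suc α _)

  T-∑ : ∀ {X : Set} α (xs : List X) (Φ : X → List ℕ → Carrier) → T α (λ β → ∑ xs (λ x → Φ x β)) ≈ ∑ xs (λ x → T α (Φ x))
  T-∑ []      xs Φ = refl
  T-∑ (a ∷ α) xs Φ = trans (+-cong (T-∑ α xs _) (T-∑ α xs _)) (sym (∑-+ xs _ _))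

  private
    block : ℕ → ℕ → List ℕ
    block k j = replicate k 1 ++ replicate j 0

    -- The 0 passes the k ones one at a time, at the cost of one factor q each.
    move : ∀ Φ k j {n} → Straight n Φ → suc k ℕ.+ j ≡ n → Φ (0 ∷ block k j) ≈ ⟦ q KO.^ k ⟧ * Φ (block k (suc j))
    move Φ zero    j st e = sym (trans (*-congʳ 1-homo) (*-identityˡ _))
    move Φ (suc k) j st ≡.refl = begin
      Φ (0 ∷ 1 ∷ block k j)
        ≈⟨ st [] 0 (block k j) (≡.cong (2 ℕ.+_) (≡.trans (length-++ (replicate k 1)) (≡.cong₂ ℕ._+_ (length-replicate k) (length-replicate j)))) ⟩
      ⟦ q ⟧ * Φ (1 ∷ 0 ∷ block k j)
        ≈⟨ *-congˡ (move (Φ ∘ (1 ∷_)) k j (λ α a γ e → st (1 ∷ α) a γ (≡.cong suc e)) ≡.refl) ⟩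
      ⟦ q ⟧ * (⟦ q KO.^ k ⟧ * Φ (1 ∷ block k (suc j)))
        ≈⟨ trans (sym (*-assoc _ _ _)) (*-congʳ (sym (*-homo _ _))) ⟩
      ⟦ q K.* q KO.^ k ⟧ * Φ (1 ∷ block k (suc j)) ∎

    -- Sorting a 0-1 vector costs one factor q per inversion, and the inversions of the vectors with
    -- k ones are counted by the Gaussian binomial. The induction on the first entry sees this as
    -- Pascal's rule.
    T-block : ∀ m {Φ} → Straight m Φ →
      T (replicate m 0) Φ ≈ ∑ (upTo (suc m)) (λ k → ⟦ g m k ⟧ * Φ (block k (m ∸ k)))
    T-block zero    st = sym (trans (+-identityʳ _) (trans (*-congʳ (trans (⟦⟧-cong (gaussian-0 0)) 1-homo)) (*-identityˡ _)))
    T-block (suc m) {Φ} st = begin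
      T (replicate m 0) (Φ ∘ (0 ∷_)) + T (replicate m 0) (Φ ∘ (1 ∷_))
        ≈⟨ +-cong (T-block m (λ α a γ e → st (0 ∷ α) a γ (≡.cong suc e))) (T-block m (λ α a γ e → st (1 ∷ α) a γ (≡.cong suc e))) ⟩
      ∑ (upTo (suc m)) (λ k → ⟦ g m k ⟧ * Φ (0 ∷ block k (m ∸ k))) + ∑ (upTo (suc m)) (λ k → ⟦ g m k ⟧ * Φ (block (suc k) (m ∸ k)))
        ≈⟨ +-congʳ (∑-upTo-cong (suc m) (λ {k} k≤m → trans (*-congˡ (moved k (ℕ.s≤s⁻¹ k≤m))) (trans (sym (*-assoc _ _ _)) (*-congʳ (trans (sym (*-homo _ _)) (⟦⟧-cong (K.*-comm _ _))))))) ⟩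
      ∑ (upTo (suc m)) H + ∑ (upTo (suc m)) (λ k → ⟦ g m k ⟧ * Φ (block (suc k) (m ∸ k)))
        -- The sum over vectors starting with 0 is extended by the vanishing term k = m + 1 and
        -- shifted by one, to match the vectors starting with 1.
        ≈⟨ +-congʳ (trans (sym (+-identityʳ _)) (trans (+-congˡ (sym H-last)) (trans (sym (∑-upTo-last (suc m) H)) (∑-upTo-suc (suc m) H)))) ⟩
      H 0 + ∑ (upTo (suc m)) (H ∘ suc) + ∑ (upTo (suc m)) (λ k → ⟦ g m k ⟧ * Φ (block (suc k) (m ∸ k)))
        ≈⟨ trans (+-assoc _ _ _) (+-congˡ (sym (∑-+ (upTo (suc m)) _ _))) ⟩
      H 0 + ∑ (upTo (suc m)) (λ k → H (suc k) + ⟦ g m k ⟧ * Φ (block (suc k) (m ∸ k)))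
        ≈⟨ +-cong (*-congʳ (⟦⟧-cong (K.trans (K.*-identityˡ _) (K.trans (gaussian-0 m) (K.sym (gaussian-0 (suc m)))))))
             (∑-cong (upTo (suc m)) (λ k → trans (sym (distribʳ _ _ _)) (*-congʳ (trans (sym (+-homo _ _)) (⟦⟧-cong (K.trans (K.+-comm _ _) (K.sym (pascal m k)))))))) ⟩
      ⟦ g (suc m) 0 ⟧ * Φ (block 0 (suc m)) + ∑ (upTo (suc m)) (λ k → ⟦ g (suc m) (suc k) ⟧ * Φ (block (suc k) (m ∸ k)))
        ≈⟨ ∑-upTo-suc (suc m) _ ⟨
      ∑ (upTo (2 ℕ.+ m)) (λ k → ⟦ g (suc m) k ⟧ * Φ (block k (suc m ∸ k))) ∎
      where
      H : ℕ → Carrier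
      H k = ⟦ q KO.^ k K.* g m k ⟧ * Φ (block k (suc m ∸ k))
      H-last : H (suc m) ≈ 0#
      H-last = trans (*-congʳ (trans (⟦⟧-cong (K.trans (K.*-congˡ (gaussian-> {m} ℕ.≤-refl)) (K.zeroʳ _))) 0-homo)) (zeroˡ _)
      moved : ∀ k → k ≤ m → Φ (0 ∷ block k (m ∸ k)) ≈ ⟦ q KO.^ k ⟧ * Φ (block k (suc m ∸ k))
      moved k k≤m = trans (move Φ k (m ∸ k) st (≡.cong suc (ℕ.m+[n∸m]≡n k≤m)))
        (*-congˡ (reflexive (≡.cong (Φ ∘ block k) (≡.sym (ℕ.+-∸-assoc 1 k≤m)))))

  -- Straightening the n - c exponents 0 lengthens the first column from c to c + k. The first c
  -- rows, with one box removed from each, are straightened recursively. This reproduces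
  -- `rawCoefficient` one column at a time.
  T-columns : ∀ n cs {Φ} → Decreasing n cs → Last≡0 n cs → Straight n Φ →
    T (transpose n cs) Φ ≈ ∑ (columns n (length cs)) (λ ds → ⟦ rawCoefficient cs n ds ⟧ * Φ (transpose n ds))
  T-columns .0 []       _         ≡.refl st = sym (trans (+-identityʳ _) (trans (*-congʳ 1-homo) (*-identityˡ _)))
  T-columns n  (c ∷ cs) {Φ} (c≤n , d) last st = begin
    T (transpose n (c ∷ cs)) Φ
      ≡⟨ ≡.cong (λ α → T α Φ) (transpose-∷ n c cs c≤n d) ⟩
    T (map suc (transpose c cs) ++ replicate m 0) Φ
      ≈⟨ trans (T-++ (map suc (transpose c cs)) (replicate m 0) Φ) (T-map-suc (transpose c cs) _) ⟩
    T (transpose c cs) (λ α → T (replicate m 0) (λ β → Φ (map suc α ++ β)))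
      ≈⟨ T-cong (transpose c cs) (λ α e → T-block m (straight-++ Φ (map suc α) st
           (≡.trans (≡.cong (ℕ._+ m) (≡.trans (length-map suc α) (≡.trans e (length-transpose c cs)))) (ℕ.m+[n∸m]≡n c≤n)))) ⟩
    T (transpose c cs) (λ α → ∑ (upTo (suc m)) (λ k → ⟦ g m k ⟧ * Φ (map suc α ++ block k (m ∸ k))))
      ≈⟨ T-∑ (transpose c cs) (upTo (suc m)) _ ⟩
    ∑ (upTo (suc m)) (λ k → T (transpose c cs) (λ α → ⟦ g m k ⟧ * Φ (map suc α ++ block k (m ∸ k))))
      ≈⟨ ∑-upTo-cong (suc m) (λ {k} k≤m → trans (sym (*-T ⟦ g m k ⟧ (transpose c cs) _)) (trans (*-congˡ
           (trans (T-columns c cs d last (straight-map-suc Φ (block k (m ∸ k)) st (length-block k (ℕ.s≤s⁻¹ k≤m))))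
             (∑-cong∈ (columns c L) (λ {ds} ds∈ → *-congˡ (reflexive (≡.cong Φ (≡.sym (transpose-c+k k (ℕ.s≤s⁻¹ k≤m) ds (proj₁ (∈-columns⁻ c L ds∈))))))))))
           (trans (*-∑ _ (columns c L) _) (∑-cong (columns c L) (λ ds → sym (*-assoc _ _ _)))))) ⟩
    ∑ (upTo (suc m)) (λ k → ∑ (columns c L) (λ ds → ⟦ g m k ⟧ * ⟦ rawCoefficient cs c ds ⟧ * Φ (transpose n (c ℕ.+ k ∷ ds))))
      -- The index set asks the later columns to be at most c + k, whereas the recursion gives at
      -- most c; in between the raw coefficient vanishes.
      ≈⟨ ∑-cong (upTo (suc m)) (λ k → sym (trans (vanishing k) (∑-cong (columns c L) (λ ds →
           *-congʳ (*-congʳ (reflexive (≡.cong (⟦_⟧ ∘ g m) (ℕ.m+n∸m≡n c k)))))))) ⟩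
    ∑ (upTo (suc m)) (λ k → ∑ (columns (c ℕ.+ k) L) (λ ds → ⟦ g m (c ℕ.+ k ∸ c) ⟧ * ⟦ rawCoefficient cs c ds ⟧ * Φ (transpose n (c ℕ.+ k ∷ ds))))
      ≈⟨ ∑-upTo-from c≤n (λ e → ∑ (columns e L) (λ ds → ⟦ g m (e ∸ c) ⟧ * ⟦ rawCoefficient cs c ds ⟧ * Φ (transpose n (e ∷ ds)))) ⟨
    ∑ (upTo (suc n)) (λ e → χ (c ℕ.≤? e) * ∑ (columns e L) (λ ds → ⟦ g m (e ∸ c) ⟧ * ⟦ rawCoefficient cs c ds ⟧ * Φ (transpose n (e ∷ ds))))
      ≈⟨ ∑-cong (upTo (suc n)) (λ e → trans (*-∑ _ (columns e L) _) (∑-cong (columns e L) (λ ds → trans (sym (*-assoc _ _ _))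
           (*-congʳ (sym (trans (*-homo _ _) (*-cong (χ-homo s (c ℕ.≤? e)) (*-homo _ _)))))))) ⟩
    ∑ (upTo (suc n)) (λ e → ∑ (columns e L) (λ ds → ⟦ rawCoefficient (c ∷ cs) n (e ∷ ds) ⟧ * Φ (transpose n (e ∷ ds))))
      ≈⟨ ∑-columns-suc n L _ ⟨
    ∑ (columns n (suc L)) (λ ds → ⟦ rawCoefficient (c ∷ cs) n ds ⟧ * Φ (transpose n ds)) ∎
    where
    m = n ∸ c
    L = length cs
    vanishing : ∀ k →
      ∑ (columns (c ℕ.+ k) L) (λ ds → ⟦ g m (c ℕ.+ k ∸ c) ⟧ * ⟦ rawCoefficient cs c ds ⟧ * Φ (transpose n (c ℕ.+ k ∷ ds)))
        ≈ ∑ (columns c L) (λ ds → ⟦ g m (c ℕ.+ k ∸ c) ⟧ * ⟦ rawCoefficient cs c ds ⟧ * Φ (transpose n (c ℕ.+ k ∷ ds)))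
    vanishing k = ∑-columns-≤ L (ℕ.m≤m+n c k) _ (λ ds ds∈ c<d → trans (*-congʳ (trans (*-congˡ (trans (⟦⟧-cong
      (rawCoefficient-vanish cs ds d (proj₂ (∈-columns⁻ (c ℕ.+ k) L ds∈)) c<d)) 0-homo)) (zeroʳ _))) (zeroˡ _))
    length-block : ∀ k → k ≤ m → c ℕ.+ length (block k (m ∸ k)) ≡ n
    length-block k k≤m = ≡.trans (≡.cong (c ℕ.+_) (≡.trans (length-++ (replicate k 1))
      (≡.trans (≡.cong₂ ℕ._+_ (length-replicate k) (length-replicate (m ∸ k))) (ℕ.m+[n∸m]≡n k≤m)))) (ℕ.m+[n∸m]≡n c≤n)
    straight-++ : ∀ Φ α {m n} → Straight n Φ → length α ℕ.+ m ≡ n → Straight m (λ β → Φ (α ++ β))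
    straight-++ Φ []      st ≡.refl = st
    straight-++ Φ (x ∷ α) {m} st ≡.refl = straight-++ (Φ ∘ (x ∷_)) α {m} (λ β a γ e → st (x ∷ β) a γ (≡.cong suc e)) ≡.refl
    straight-map-suc : ∀ Φ β {m n} → Straight n Φ → m ℕ.+ length β ≡ n → Straight m (λ α → Φ (map suc α ++ β))
    straight-map-suc Φ β st e α a γ e′ = trans (reflexive (≡.cong Φ (shape a (suc a))))
      (trans (st (map suc α) (suc a) (map suc γ ++ β) (≡.trans (≡.cong length (≡.sym (shape a (suc a))))
        (≡.trans (length-++ (map suc (α ++ a ∷ suc a ∷ γ))) (≡.trans (≡.cong (ℕ._+ length β) (≡.trans (length-map suc (α ++ a ∷ suc a ∷ γ)) e′)) e))))
      (*-congˡ (reflexive (≡.cong Φ (≡.sym (shape (suc a) a))))))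
      where
      shape : ∀ x y → map suc (α ++ x ∷ y ∷ γ) ++ β ≡ map suc α ++ suc x ∷ suc y ∷ (map suc γ ++ β)
      shape x y = ≡.trans (≡.cong (_++ β) (map-++ suc α (x ∷ y ∷ γ))) (++-assoc (map suc α) _ β)
    transpose-c+k : ∀ k → k ≤ m → ∀ ds → Decreasing c ds →
      transpose n (c ℕ.+ k ∷ ds) ≡ map suc (transpose c ds) ++ block k (m ∸ k)
    transpose-c+k k k≤m ds d = ≡.trans (transpose-∷ n (c ℕ.+ k) ds (≡.subst (c ℕ.+ k ≤_) (ℕ.m+[n∸m]≡n c≤n) (ℕ.+-monoʳ-≤ c k≤m))
        (decreasing-mono ds (ℕ.m≤m+n c k) d))
      (≡.trans (≡.cong₂ (λ xs j → map suc xs ++ replicate j 0) (transpose-+ c k ds d) (≡.sym (ℕ.∸-+-assoc n c k)))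
      (≡.trans (≡.cong (_++ replicate (m ∸ k) 0) (≡.trans (map-++ suc (transpose c ds) _) (≡.cong (map suc (transpose c ds) ++_) (map-replicate suc k 0))))
      (++-assoc (map suc (transpose c ds)) _ _)))

-- Factorization of the sum over ν, and its values at y = -1 and at μ = ∅.

deficit : List ℕ → List ℕ → ℕ
deficit (d ∷ ds) (c ∷ cs) = d ∸ c ℕ.+ deficit ds cs
deficit _ _ = 0

module SkewSums (K : Field) (q : Field.Carrier K)
  (1-qᵏ≉0 : ∀ k → ¬ (Field._≈_ K (Field._-_ K (Field.1# K) (FieldOperations._^_ K q (suc k))) (Field.0# K)))
  {A : CommutativeRing 0ℓ 0ℓ} (h : RingHom (Field.commutativeRing K) A) (y : CommutativeRing.Carrier A)
  where
  private
    module K = Field K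
    module KO = FieldOperations K
    module KS = Sums K.commutativeRing
  open QBinomial K q 1-qᵏ≉0
  open ColumnCoefficients K q 1-qᵏ≉0
  open RingHom h
  open CommutativeRing A hiding (zero)
  open Operations A
  open Sums A
  open ColumnSums A
  open Algebra.Properties.CommutativeSemiring.Exp commutativeSemiring using (^-homo-*)
  private module KE = Algebra.Properties.CommutativeSemiring.Exp K.commutativeSemiring
  open import Relation.Binary.Reasoning.Setoid setoid

  weight : List ℕ → List ℕ → List ℕ → Carrier
  weight λs νs μs = ⟦ verticalCoefficient λs νs K.* skewCoefficient νs μs ⟧ * y ^ deficit λs νs

  private
    -- The part of the weight that depends on one column b of ν; a and a′ are adjacent columns of λ,
    -- c and c′ adjacent columns of μ.
    factor : ℕ → ℕ → ℕ → ℕ → ℕ → Carrier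
    factor a a′ c c′ b =
      ⟦ KS.χ (b ℕ.≤? a) K.* g (a ∸ a′) (a ∸ b) K.* (KS.χ (c ℕ.≤? b) K.* (q KO.^ ((b ∸ c) C 2) K.* g (b ∸ c′) (c ∸ c′))) ⟧ * y ^ (a ∸ b)

    weight-∷ : ∀ a as b bs c cs →
      weight (a ∷ as) (b ∷ bs) (c ∷ cs) ≈ factor a (entry as 0) c (entry cs 0) b * weight as bs cs
    weight-∷ a as b bs c cs = trans (*-cong
      (trans (⟦⟧-cong (KS.S.solve 4 (λ x u z v → (x KS.S.:* u) KS.S.:* (z KS.S.:* v) KS.S.:= (x KS.S.:* z) KS.S.:* (u KS.S.:* v)) K.refl _ (verticalCoefficient as bs) _ (skewCoefficient bs cs)))
        (*-homo _ _)) (^-homo-* y (a ∸ b) _))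
      (S.solve 4 (λ a b c d → (a S.:* b) S.:* (c S.:* d) S.:= (a S.:* c) S.:* (b S.:* d)) refl _ _ (y ^ (a ∸ b)) (y ^ deficit as bs))

    factor-> : ∀ {a a′ c c′ b} → a < b → factor a a′ c c′ b ≈ 0#
    factor-> {a} {b = b} a<b = trans (*-congʳ (trans (⟦⟧-cong (K.trans (K.*-congʳ (KS.χ-no-* (b ℕ.≤? a) (ℕ.<⇒≱ a<b))) (K.zeroˡ _))) 0-homo)) (zeroˡ _)

    factor-< : ∀ {a a′ c c′ b} → a′ ≤ a → b < a′ → factor a a′ c c′ b ≈ 0#
    factor-< a′≤a b<a′ = trans (*-congʳ (trans (⟦⟧-cong (K.trans (K.*-congʳ (K.trans (K.*-congˡ (gaussian-> (ℕ.∸-monoʳ-< b<a′ a′≤a))) (K.zeroʳ _))) (K.zeroˡ _))) 0-homo)) (zeroˡ _)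

    columnSum : ℕ → ℕ → ℕ → ℕ → Carrier
    columnSum a a′ c c′ = ∑ (upTo (suc a)) (factor a a′ c c′)

  columnProduct : List ℕ → List ℕ → Carrier
  columnProduct (a ∷ as) (c ∷ cs) = columnSum a (entry as 0) c (entry cs 0) * columnProduct as cs
  columnProduct _ _ = 1#

  -- The columns of ν interact only by being decreasing. A nonzero factor already forces λᶜⱼ₊₁ ≤ νᶜⱼ
  -- ≤ λᶜⱼ, and these ranges lie one below the other, so the columns of ν can be summed
  -- independently.
  ∑-weight : ∀ {n} as cs → Decreasing n as → length cs ≡ length as →
    ∑ (columns n (length as)) (λ bs → weight as bs cs) ≈ columnProduct as cs
  ∑-weight []       []       _          _ = trans (+-identityʳ _) (trans (*-identityʳ _) (trans (⟦⟧-cong (K.*-identityˡ _)) 1-homo))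
  ∑-weight {n} (a ∷ as) (c ∷ cs) (a≤n , d) e = begin
    ∑ (columns n (suc L)) (λ bs → weight (a ∷ as) bs (c ∷ cs))
      ≈⟨ ∑-columns-suc n L _ ⟩
    ∑ (upTo (suc n)) (λ b → ∑ (columns b L) (λ bs → weight (a ∷ as) (b ∷ bs) (c ∷ cs)))
      ≈⟨ ∑-cong (upTo (suc n)) (λ b → trans (∑-cong (columns b L) (λ bs → weight-∷ a as b bs c cs)) (sym (*-∑ _ (columns b L) _))) ⟩
    ∑ (upTo (suc n)) (λ b → f b * ∑ (columns b L) (λ bs → weight as bs cs))
      ≈⟨ ∑-upTo-≤ a≤n _ (λ {b} a<b _ → trans (*-congʳ (factor-> {a} {entry as 0} {c} {entry cs 0} a<b)) (zeroˡ _)) ⟩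
    ∑ (upTo (suc a)) (λ b → f b * ∑ (columns b L) (λ bs → weight as bs cs))
      ≈⟨ ∑-cong (upTo (suc a)) inner ⟩
    ∑ (upTo (suc a)) (λ b → f b * columnProduct as cs)
      ≈⟨ ∑-* _ (upTo (suc a)) f ⟨
    columnProduct (a ∷ as) (c ∷ cs) ∎
    where
    L = length as
    f = factor a (entry as 0) c (entry cs 0)
    inner : ∀ b → f b * ∑ (columns b L) (λ bs → weight as bs cs) ≈ f b * columnProduct as cs
    inner b with entry as 0 ℕ.≤? b
    -- The tail of λ is bounded by a′, hence also by b, so the induction hypothesis applies with the
    -- bound b and gives the same product.
    ... | yes a′≤b = *-congˡ (∑-weight as cs (decreasing-lower as a′≤b d) (ℕ.suc-injective e))
    ... | no a′≰b  = trans (trans (*-congʳ z) (zeroˡ _)) (sym (trans (*-congʳ z) (zeroˡ _)))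
      where z = factor-< {a} {entry as 0} {c} {entry cs 0} (decreasing⇒head≤ as d) (ℕ.≰⇒> a′≰b)

  ∏-upTo-+ : ∀ m n (f : ℕ → Carrier) → ∏ (upTo (m ℕ.+ n)) f ≈ ∏ (upTo m) f * ∏ (upTo n) (λ i → f (m ℕ.+ i))
  ∏-upTo-+ zero    n f = sym (*-identityˡ _)
  ∏-upTo-+ (suc m) n f = trans (∏-upTo-suc (m ℕ.+ n) f) (trans (*-congˡ (∏-upTo-+ m n (f ∘ suc)))
    (trans (sym (*-assoc _ _ _)) (*-congʳ (sym (∏-upTo-suc m f)))))

  private
    -- Here λ and μ have the same next column a′. By `trinomial`, [a-a′, a-b] [b-a′, c-a′] =
    -- [a-a′, c-a′] [a-c, a-b]; the first factor leaves the sum over b, and the second gives the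
    -- q-binomial theorem.
    columnSum-≤ : ∀ {a a′ c} → a′ ≤ c → c ≤ a →
      columnSum a a′ c a′ ≈ ⟦ g (a ∸ a′) (c ∸ a′) ⟧ * ∏ (upTo (a ∸ c)) (λ i → y + ⟦ q KO.^ i ⟧)
    columnSum-≤ {a} {a′} {c} a′≤c c≤a = begin
      ∑ (upTo (suc a)) (factor a a′ c a′)
        ≈⟨ ∑-upTo-cong (suc a) (λ {b} b<1+a → guard b (ℕ.s≤s⁻¹ b<1+a)) ⟩
      ∑ (upTo (suc a)) (λ b → χ (c ℕ.≤? b) * f b)
        ≈⟨ ∑-upTo-from c≤a f ⟩
      ∑ (upTo (suc m)) (λ k → f (c ℕ.+ k))
        ≈⟨ ∑-upTo-reverse m _ ⟩
      ∑ (upTo (suc m)) (λ k → f (c ℕ.+ (m ∸ k)))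
        ≈⟨ ∑-upTo-cong (suc m) (λ {k} k<1+m → term k (ℕ.s≤s⁻¹ k<1+m)) ⟩
      ∑ (upTo (suc m)) (λ k → ⟦ g (a ∸ a′) (c ∸ a′) ⟧ * (⟦ g m k K.* q KO.^ ((0 ℕ.+ (m ∸ k)) C 2) ⟧ * y ^ k))
        ≈⟨ *-∑ _ (upTo (suc m)) _ ⟨
      ⟦ g (a ∸ a′) (c ∸ a′) ⟧ * ∑ (upTo (suc m)) (λ k → ⟦ g m k K.* q KO.^ ((0 ℕ.+ (m ∸ k)) C 2) ⟧ * y ^ k)
        ≈⟨ *-congˡ (trans (q-binomial h y 0 m) (trans (*-congʳ 1-homo) (*-identityˡ _))) ⟩
      ⟦ g (a ∸ a′) (c ∸ a′) ⟧ * ∏ (upTo m) (λ i → y + ⟦ q KO.^ i ⟧) ∎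
      where
      m = a ∸ c
      f : ℕ → Carrier
      f b = ⟦ g (a ∸ a′) (a ∸ b) K.* (q KO.^ ((b ∸ c) C 2) K.* g (b ∸ a′) (c ∸ a′)) ⟧ * y ^ (a ∸ b)
      guard : ∀ b → b ≤ a → factor a a′ c a′ b ≈ χ (c ℕ.≤? b) * f b
      guard b b≤a = trans (*-congʳ (trans (⟦⟧-cong (K.trans (K.*-congʳ (KS.χ-yes-* (b ℕ.≤? a) b≤a))
          (KS.S.solve 3 (λ x y z → x KS.S.:* (y KS.S.:* z) KS.S.:= y KS.S.:* (x KS.S.:* z)) K.refl _ (KS.χ (c ℕ.≤? b)) _)))
          (trans (*-homo _ _) (*-congʳ (χ-homo h (c ℕ.≤? b)))))) (*-assoc _ _ _)
      term : ∀ k → k ≤ m → f (c ℕ.+ (m ∸ k)) ≈ ⟦ g (a ∸ a′) (c ∸ a′) ⟧ * (⟦ g m k K.* q KO.^ ((0 ℕ.+ (m ∸ k)) C 2) ⟧ * y ^ k)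
      term k k≤m = trans (*-cong (trans (⟦⟧-cong (K.trans (K.reflexive (≡.cong₂ K._*_ (≡.cong₂ g A≡ B≡) (≡.cong₂ (λ i j → q KO.^ (i C 2) K.* g j b) (ℕ.m+n∸m≡n c e) C≡)))
          (K.trans (KS.S.solve 3 (λ x y z → x KS.S.:* (y KS.S.:* z) KS.S.:= (x KS.S.:* z) KS.S.:* y) K.refl _ _ _)
          (K.trans (K.*-congʳ (K.trans (trinomial k e b) (K.reflexive (≡.cong₂ K._*_ (≡.cong (λ i → g i b) D≡) (≡.cong (λ i → g i k) E≡)))))
            (K.*-assoc _ _ _))))) (*-homo _ _)) (reflexive (≡.cong (y ^_) B≡))) (*-assoc _ _ _)
        where
        e = m ∸ k
        b = c ∸ a′
        E≡ : k ℕ.+ e ≡ m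
        E≡ = ℕ.m+[n∸m]≡n k≤m
        D≡ : b ℕ.+ (k ℕ.+ e) ≡ a ∸ a′
        D≡ = ≡.trans (≡.cong (b ℕ.+_) E≡) (≡.trans (ℕ.+-comm b m) (∸-telescope a′≤c c≤a))
        A≡ : a ∸ a′ ≡ k ℕ.+ (b ℕ.+ e)
        A≡ = ≡.trans (≡.sym D≡) (ℕ+-left-comm b k e)
        C≡ : c ℕ.+ e ∸ a′ ≡ b ℕ.+ e
        C≡ = ℕ.+-∸-comm e a′≤c
        B≡ : a ∸ (c ℕ.+ e) ≡ k
        B≡ = ≡.trans (≡.sym (ℕ.∸-+-assoc a c e)) (ℕ.m∸[m∸n]≡n k≤m)

    columnSum-> : ∀ {a a′ c c′} → a < c → columnSum a a′ c c′ ≈ 0#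
    columnSum-> {a} {a′} {c} {c′} a<c = ∑-zero∈ (upTo (suc a)) (λ {b} b∈ → trans (*-congʳ (trans (⟦⟧-cong (K.trans (K.*-congˡ
      (KS.χ-no-* (c ℕ.≤? b) (λ c≤b → ℕ.<⇒≱ a<c (ℕ.≤-trans c≤b (ℕ.s≤s⁻¹ (∈-upTo⁻ b∈)))))) (K.zeroʳ _))) 0-homo)) (zeroˡ _))

    -- Only b ≥ a′ contributes, because [a-a′, a-b] vanishes otherwise. This is the origin of the
    -- shift a′ in `q-binomial`.
    columnSum-0 : ∀ {a a′} → a′ ≤ a →
      columnSum a a′ 0 0 ≈ ⟦ q KO.^ (a′ C 2) ⟧ * ∏ (upTo (a ∸ a′)) (λ i → y + ⟦ q KO.^ (a′ ℕ.+ i) ⟧)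
    columnSum-0 {a} {a′} a′≤a = begin
      ∑ (upTo (suc a)) (factor a a′ 0 0)
        ≈⟨ ∑-upTo-reverse a _ ⟩
      ∑ (upTo (suc a)) (λ k → factor a a′ 0 0 (a ∸ k))
        ≈⟨ ∑-upTo-≤ (ℕ.m∸n≤m a a′) _ (λ {k} m<k k≤a → vanish k m<k k≤a) ⟩
      ∑ (upTo (suc m)) (λ k → factor a a′ 0 0 (a ∸ k))
        ≈⟨ ∑-upTo-cong (suc m) (λ {k} k<1+m → term k (ℕ.s≤s⁻¹ k<1+m)) ⟩
      ∑ (upTo (suc m)) (λ k → ⟦ g m k K.* q KO.^ ((a′ ℕ.+ (m ∸ k)) C 2) ⟧ * y ^ k)
        ≈⟨ q-binomial h y a′ m ⟩
      ⟦ q KO.^ (a′ C 2) ⟧ * ∏ (upTo m) (λ i → y + ⟦ q KO.^ (a′ ℕ.+ i) ⟧) ∎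
      where
      m = a ∸ a′
      vanish : ∀ k → m < k → k ≤ a → factor a a′ 0 0 (a ∸ k) ≈ 0#
      vanish k m<k k≤a = trans (*-congʳ (trans (⟦⟧-cong (K.trans (K.*-congʳ (K.trans (K.*-congˡ (gaussian->
        (≡.subst (m <_) (≡.sym (ℕ.m∸[m∸n]≡n k≤a)) m<k))) (K.zeroʳ _))) (K.zeroˡ _))) 0-homo)) (zeroˡ _)
      term : ∀ k → k ≤ m → factor a a′ 0 0 (a ∸ k) ≈ ⟦ g m k K.* q KO.^ ((a′ ℕ.+ (m ∸ k)) C 2) ⟧ * y ^ k
      term k k≤m = *-cong (⟦⟧-cong (K.*-cong
        (K.trans (KS.χ-yes-* (a ∸ k ℕ.≤? a) (ℕ.m∸n≤m a k)) (K.reflexive (≡.cong (g m) a∸)))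
        (K.trans (KS.χ-yes-* (0 ℕ.≤? a ∸ k) z≤n) (K.trans (K.*-congˡ (gaussian-0 (a ∸ k))) (K.trans (K.*-identityʳ _)
          (K.reflexive (≡.cong (λ n → q KO.^ (n C 2)) (≡.trans (≡.cong (_∸ k) (≡.sym (ℕ.m+[n∸m]≡n a′≤a))) (ℕ.+-∸-assoc a′ k≤m)))))))))
        (reflexive (≡.cong (y ^_) a∸))
        where
        a∸ : a ∸ (a ∸ k) ≡ k
        a∸ = ℕ.m∸[m∸n]≡n (ℕ.≤-trans k≤m (ℕ.m∸n≤m a a′))

  -- The columns contribute the factors y + qⁱ for a′ ≤ i < a, and these ranges fit together to 0 ≤
  -- i < λᶜ₁. Each column contributes the power of q of the next one, so the first column is missing
  -- from the exponent.
  columnProduct-0 : ∀ {n} as → Decreasing n as →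
    columnProduct as (replicate (length as) 0)
      ≈ ⟦ q KO.^ sum (map (_C 2) (drop 1 as)) ⟧ * ∏ (upTo (entry as 0)) (λ i → y + ⟦ q KO.^ i ⟧)
  columnProduct-0 []       _       = sym (trans (*-congʳ 1-homo) (*-identityˡ _))
  columnProduct-0 (a ∷ as) (_ , d) = begin
    columnSum a a′ 0 (entry (replicate (length as) 0) 0) * columnProduct as (replicate (length as) 0)
      ≈⟨ *-cong (trans (reflexive (≡.cong (columnSum a a′ 0) (head-0 (length as)))) (columnSum-0 (decreasing⇒head≤ as d))) (columnProduct-0 as d) ⟩
    ⟦ q KO.^ (a′ C 2) ⟧ * ∏ (upTo (a ∸ a′)) _ * (⟦ q KO.^ sum (map (_C 2) (drop 1 as)) ⟧ * ∏ (upTo a′) _)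
      ≈⟨ S.solve 4 (λ a b c d → (a S.:* b) S.:* (c S.:* d) S.:= (a S.:* c) S.:* (d S.:* b)) refl _ _ _ _ ⟩
    ⟦ q KO.^ (a′ C 2) ⟧ * ⟦ q KO.^ sum (map (_C 2) (drop 1 as)) ⟧ * (∏ (upTo a′) _ * ∏ (upTo (a ∸ a′)) _)
      ≈⟨ *-cong (trans (sym (*-homo _ _)) (⟦⟧-cong (K.trans (K.sym (KE.^-homo-* q (a′ C 2) _)) (K.reflexive (≡.cong (q KO.^_) (split as))))))
           (trans (sym (∏-upTo-+ a′ (a ∸ a′) _)) (reflexive (≡.cong (λ n → ∏ (upTo n) _) (ℕ.m+[n∸m]≡n (decreasing⇒head≤ as d))))) ⟩
    ⟦ q KO.^ sum (map (_C 2) as) ⟧ * ∏ (upTo a) (λ i → y + ⟦ q KO.^ i ⟧) ∎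
    where
    a′ = entry as 0
    head-0 : ∀ L → entry (replicate L 0) 0 ≡ 0
    head-0 zero    = ≡.refl
    head-0 (suc L) = ≡.refl
    split : ∀ as → (entry as 0 C 2) ℕ.+ sum (map (_C 2) (drop 1 as)) ≡ sum (map (_C 2) as)
    split []       = ≡.refl
    split (a ∷ as) = ≡.refl

  -- By induction the later columns give 0 unless λ and μ agree there. If they do, the two next
  -- columns are equal and `columnSum-≤` applies for c ≤ a; the case a < c leaves no admissible
  -- column of ν.
  columnProduct-χ : y + 1# ≈ 0# → ∀ {n} as cs → Decreasing n as → Decreasing n cs → length cs ≡ length as →
    columnProduct as cs ≈ χ (≡-dec ℕ._≟_ as cs)
  columnProduct-χ y+1≈0 []       []       _       _        _ = refl
  columnProduct-χ y+1≈0 (a ∷ as) (c ∷ cs) (_ , d) (_ , d′) e = by-cases (≡-dec ℕ._≟_ as cs) (a ℕ.≟ c)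
    where
    bound = a ℕ.⊔ c
    tails : columnProduct as cs ≈ χ (≡-dec ℕ._≟_ as cs)
    tails = columnProduct-χ y+1≈0 {bound} as cs (decreasing-mono as (ℕ.m≤m⊔n a c) d) (decreasing-mono cs (ℕ.m≤n⊔m a c) d′) (ℕ.suc-injective e)
    by-cases : Dec (as ≡ cs) → Dec (a ≡ c) →
      columnSum a (entry as 0) c (entry cs 0) * columnProduct as cs ≈ χ (≡-dec ℕ._≟_ (a ∷ as) (c ∷ cs))
    by-cases (no as≢cs) _ = trans (*-congˡ (trans tails (χ-no (≡-dec ℕ._≟_ as cs) as≢cs)))
      (trans (zeroʳ _) (sym (χ-no (≡-dec ℕ._≟_ (a ∷ as) (c ∷ cs)) (as≢cs ∘ ∷-injectiveʳ))))
    by-cases (yes ≡.refl) (yes ≡.refl) = trans (*-cong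
        (trans (columnSum-≤ (decreasing⇒head≤ as d) ℕ.≤-refl) (*-cong (trans (⟦⟧-cong (gaussian-diagonal (a ∸ entry as 0))) 1-homo)
          (reflexive (≡.cong (λ n → ∏ (upTo n) (λ i → y + ⟦ q KO.^ i ⟧)) (ℕ.n∸n≡0 a)))))
        (trans tails (χ-yes (≡-dec ℕ._≟_ as as) ≡.refl)))
      (trans (*-identityʳ _) (trans (*-identityʳ _) (sym (χ-yes (≡-dec ℕ._≟_ (a ∷ as) (a ∷ as)) ≡.refl))))
    by-cases (yes ≡.refl) (no a≢c) = trans (*-congʳ vanish) (trans (zeroˡ _)
        (sym (χ-no (≡-dec ℕ._≟_ (a ∷ as) (c ∷ as)) (a≢c ∘ ∷-injectiveˡ))))
      where
      vanish : columnSum a (entry as 0) c (entry as 0) ≈ 0#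
      vanish with ℕ.<-cmp a c
      ... | tri< a<c _ _ = columnSum-> {a} {entry as 0} {c} {entry as 0} a<c
      ... | tri≈ _ a≡c _ = contradiction a≡c a≢c
      -- The product is nonempty, and its factor with i = 0 is y + 1.
      ... | tri> _ _ c<a = trans (columnSum-≤ (decreasing⇒head≤ as d′) (ℕ.<⇒≤ c<a)) (trans (*-congˡ (trans
        (reflexive (≡.cong (λ n → ∏ (upTo n) (λ i → y + ⟦ q KO.^ i ⟧)) (≡.sym (ℕ.suc-pred (a ∸ c) {{ℕ.>-nonZero (ℕ.m<n⇒0<n∸m c<a)}}))))
        (trans (∏-upTo-suc (ℕ.pred (a ∸ c)) (λ i → y + ⟦ q KO.^ i ⟧)) (trans (*-congʳ (trans (+-congˡ 1-homo) y+1≈0)) (zeroˡ _))))) (zeroʳ _))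

-- Evaluation of polynomials and specialization of rational functions.

module Evaluation (D : IntegralDomain) {L : CommutativeRing 0ℓ 0ℓ}
  (h : RingHom (IntegralDomain.commutativeRing D) L) (u : CommutativeRing.Carrier L) where
  private
    module D = IntegralDomain D
    module h = RingHom h
  open Polynomials D
  open CommutativeRing L hiding (zero)
  private module S = Algebra.Solver.Ring.NaturalCoefficients.Default commutativeSemiring

  eval : Poly → Carrier
  eval []      = 0#
  eval (a ∷ p) = h.⟦ a ⟧ + u * eval p

  private
    -- Equality of polynomials disregards trailing zeros, so evaluation has to respect this.
    eval-0 : ∀ p → (∀ k → coeff p k D.≈ D.0#) → eval p ≈ 0#
    eval-0 []      e = refl
    eval-0 (a ∷ p) e = trans (+-cong (trans (h.⟦⟧-cong (e 0)) h.0-homo) (trans (*-congˡ (eval-0 p (e ∘ suc))) (zeroʳ u))) (+-identityˡ 0#)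

    eval-cong : ∀ p q → (∀ k → coeff p k D.≈ coeff q k) → eval p ≈ eval q
    eval-cong []      q       e = sym (eval-0 q (λ k → D.sym (e k)))
    eval-cong (a ∷ p) []      e = eval-0 (a ∷ p) e
    eval-cong (a ∷ p) (b ∷ q) e = +-cong (h.⟦⟧-cong (e 0)) (*-congˡ (eval-cong p q (e ∘ suc)))

    eval-+ : ∀ p q → eval (p +ₚ q) ≈ eval p + eval q
    eval-+ []      q       = sym (+-identityˡ _)
    eval-+ (a ∷ p) []      = sym (+-identityʳ _)
    eval-+ (a ∷ p) (b ∷ q) = trans (+-cong (h.+-homo a b) (*-congˡ (eval-+ p q)))
      (S.solve 5 (λ a b p q u → (a S.:+ b) S.:+ u S.:* (p S.:+ q) S.:= (a S.:+ u S.:* p) S.:+ (b S.:+ u S.:* q)) refl _ _ _ _ u)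

    eval-· : ∀ a p → eval (a · p) ≈ h.⟦ a ⟧ * eval p
    eval-· a []      = sym (zeroʳ _)
    eval-· a (b ∷ p) = trans (+-cong (h.*-homo a b) (*-congˡ (eval-· a p)))
      (S.solve 4 (λ a b p u → a S.:* b S.:+ u S.:* (a S.:* p) S.:= a S.:* (b S.:+ u S.:* p)) refl _ _ _ u)

    eval-* : ∀ p q → eval (p *ₚ q) ≈ eval p * eval q
    eval-* []      q = sym (zeroˡ _)
    eval-* (a ∷ p) q = trans (eval-+ (a · q) _) (trans (+-cong (eval-· a q) (trans (+-cong h.0-homo (*-congˡ (eval-* p q))) (+-identityˡ _)))
      (S.solve 4 (λ a p q u → a S.:* q S.:+ u S.:* (p S.:* q) S.:= (a S.:+ u S.:* p) S.:* q) refl _ _ _ u))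

  eval-const : ∀ a → eval (constₚ a) ≈ h.⟦ a ⟧
  eval-const a = trans (+-congˡ (zeroʳ u)) (+-identityʳ _)

  eval-X : eval X ≈ u
  eval-X = trans (+-cong h.0-homo (*-congˡ (trans (eval-const D.1#) h.1-homo))) (trans (+-identityˡ _) (*-identityʳ u))

  evalHom : RingHom commutativeRingₚ L
  evalHom = record
    { ⟦_⟧ = eval ; ⟦⟧-cong = λ {p} {q} e → eval-cong p q (at e) ; +-homo = eval-+ ; *-homo = eval-*
    ; 1-homo = trans (eval-const D.1#) h.1-homo }

module FractionLemmas (D : IntegralDomain) where
  private module D = IntegralDomain D
  open Fractions D
  open Field fractionField

  ιHom : RingHom D.commutativeRing commutativeRing
  ιHom = record
    { ⟦_⟧ = ι
    ; ⟦⟧-cong = λ e → mk≈ (D.*-congʳ e)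
    ; +-homo = λ a b → mk≈ (D.*-cong (D.+-cong (D.sym (D.*-identityʳ a)) (D.sym (D.*-identityʳ b))) (D.*-identityʳ D.1#))
    ; *-homo = λ a b → mk≈ (D.*-congˡ (D.*-identityʳ D.1#))
    ; 1-homo = refl }

  ι-injective : ∀ {a b} → ι a ≈ ι b → a D.≈ b
  ι-injective e = D.trans (D.sym (D.*-identityʳ _)) (D.trans (cross e) (D.*-identityʳ _))

-- The place of the fraction field of D determined by a homomorphism ev from D to a field: x ⇝ b means that
-- x is regular at the place and has value b there.
module Specialization (D : IntegralDomain) (L : Field)
  (ev : RingHom (IntegralDomain.commutativeRing D) (Field.commutativeRing L)) where
  private
    module D = IntegralDomain D
    module L = Field L
    module S = Field (Fractions.fractionField D)
    module LL = FieldLemmas L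
    module SL = FieldLemmas (Fractions.fractionField D)
    module SOp = FieldOperations (Fractions.fractionField D)
    module LOp = FieldOperations L
    module SS = Sums S.commutativeRing
    module LS = Sums L.commutativeRing
    module LR = Algebra.Properties.Ring L.ring
    module SR = Algebra.Properties.Ring S.ring
  open RingHom ev
  open Fractions D using (ι)
  open FractionLemmas D
  private module ι = RingHom ιHom

  infix 4 _⇝_
  record _⇝_ (x : S.Carrier) (b : L.Carrier) : Set where
    constructor ratio
    field
      p q : D.Carrier
      q≉0 : ¬ (⟦ q ⟧ L.≈ L.0#)
      x≈  : x S.* ι q S.≈ ι p
      b≈  : b L.* ⟦ q ⟧ L.≈ ⟦ p ⟧

  ⇝-resp : ∀ {x y b c} → x S.≈ y → b L.≈ c → x ⇝ b → y ⇝ c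
  ⇝-resp x≈y b≈c (ratio p q q≉0 e f) =
    ratio p q q≉0 (S.trans (S.*-congʳ {ι q} (S.sym x≈y)) e) (L.trans (L.*-congʳ (L.sym b≈c)) f)

  ⇝-ι : ∀ p → ι p ⇝ ⟦ p ⟧
  ⇝-ι p = ratio p D.1# (λ e → L.1≉0 (L.trans (L.sym 1-homo) e)) (S.*-identityʳ (ι p)) (L.trans (L.*-congˡ 1-homo) (L.*-identityʳ _))

  ⇝-0 : S.0# ⇝ L.0#
  ⇝-0 = ⇝-resp S.refl 0-homo (⇝-ι D.0#)

  ⇝-1 : S.1# ⇝ L.1#
  ⇝-1 = ⇝-resp S.refl 1-homo (⇝-ι D.1#)

  ⇝-* : ∀ {x y b c} → x ⇝ b → y ⇝ c → x S.* y ⇝ b L.* c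
  ⇝-* {x} {y} {b} {c} (ratio p q q≉0 e f) (ratio p′ q′ q′≉0 e′ f′) = ratio (p D.* p′) (q D.* q′)
    ((λ z → L.*-nonzero q≉0 q′≉0 (L.trans (L.sym (*-homo q q′)) z)))
    (S.trans (S.*-congˡ {x S.* y} (ι.*-homo q q′)) (S.trans (SS.S.solve 4 (λ x y a b → (x SS.S.:* y) SS.S.:* (a SS.S.:* b) SS.S.:= (x SS.S.:* a) SS.S.:* (y SS.S.:* b)) S.refl x y (ι q) (ι q′))
        (S.trans (S.*-cong e e′) (S.sym (ι.*-homo p p′)))))
    (L.trans (L.*-congˡ (*-homo q q′)) (L.trans (LS.S.solve 4 (λ x y a b → (x LS.S.:* y) LS.S.:* (a LS.S.:* b) LS.S.:= (x LS.S.:* a) LS.S.:* (y LS.S.:* b)) L.refl b c ⟦ q ⟧ ⟦ q′ ⟧)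
        (L.trans (L.*-cong f f′) (L.sym (*-homo p p′)))))

  ⇝-+ : ∀ {x y b c} → x ⇝ b → y ⇝ c → x S.+ y ⇝ b L.+ c
  ⇝-+ {x} {y} {b} {c} (ratio p q q≉0 e f) (ratio p′ q′ q′≉0 e′ f′) = ratio (p D.* q′ D.+ p′ D.* q) (q D.* q′)
    ((λ z → L.*-nonzero q≉0 q′≉0 (L.trans (L.sym (*-homo q q′)) z)))
    (S.trans (S.*-congˡ {x S.+ y} (ι.*-homo q q′)) (S.trans (SS.S.solve 4 (λ x y a b → (x SS.S.:+ y) SS.S.:* (a SS.S.:* b) SS.S.:= (x SS.S.:* a) SS.S.:* b SS.S.:+ (y SS.S.:* b) SS.S.:* a) S.refl x y (ι q) (ι q′))
        (S.trans (S.+-cong (S.trans (S.*-congʳ {ι q′} e) (S.sym (ι.*-homo p q′))) (S.trans (S.*-congʳ {ι q} e′) (S.sym (ι.*-homo p′ q)))) (S.sym (ι.+-homo _ _)))))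
    (L.trans (L.*-congˡ (*-homo q q′)) (L.trans (LS.S.solve 4 (λ x y a b → (x LS.S.:+ y) LS.S.:* (a LS.S.:* b) LS.S.:= (x LS.S.:* a) LS.S.:* b LS.S.:+ (y LS.S.:* b) LS.S.:* a) L.refl b c ⟦ q ⟧ ⟦ q′ ⟧)
        (L.trans (L.+-cong (L.trans (L.*-congʳ f) (L.sym (*-homo p q′))) (L.trans (L.*-congʳ f′) (L.sym (*-homo p′ q)))) (L.sym (+-homo _ _)))))

  ⇝-neg : ∀ {x b} → x ⇝ b → S.- x ⇝ L.- b
  ⇝-neg {x} {b} (ratio p q q≉0 e f) = ratio (D.- p) (q)
    q≉0
    (S.trans (S.sym (SR.-‿distribˡ-* x (ι q))) (S.trans (S.-‿cong e) (S.sym (ι.neg-homo p))))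
    (L.trans (L.sym (LR.-‿distribˡ-* b _)) (L.trans (L.-‿cong f) (L.sym (neg-homo p))))

  -- For x = 0 the numerator is 0 already in D, hence so is its value; the denominator has a nonzero
  -- value and can be cancelled.
  ⇝-zero : ∀ {x b} → x S.≈ S.0# → x ⇝ b → b L.≈ L.0#
  ⇝-zero x≈0 (ratio p q q≉0 e f) = LL.*-cancelʳ q≉0 (L.trans f (L.trans (L.trans (⟦⟧-cong p≈0) 0-homo) (L.sym (L.zeroˡ _))))
    where
    p≈0 : p D.≈ D.0#
    p≈0 = ι-injective (S.trans (S.sym e) (S.trans (S.*-congʳ {ι q} x≈0) (S.zeroˡ (ι q))))

  -- Identities of rational functions are specialized by this: each side is given a value
  -- separately, and the two values must agree.
  ⇝-unique : ∀ {x y b c} → x S.≈ y → x ⇝ b → y ⇝ c → b L.≈ c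
  ⇝-unique {x} {y} {b} {c} x≈y x⇝b y⇝c = LR.x∙y⁻¹≈ε⇒x≈y b c (⇝-zero {x S.- y} (S.trans (S.+-congʳ {S.- y} x≈y) (S.-‿inverseʳ y)) (⇝-+ x⇝b (⇝-neg y⇝c)))

  ⇝-⁻¹ : ∀ {x b} → ¬ (b L.≈ L.0#) → x ⇝ b → x S.⁻¹ ⇝ b L.⁻¹
  ⇝-⁻¹ {x} {b} b≉0 x⇝b@(ratio p q q≉0 e f) = ratio (q) (p)
    ((λ z → L.*-nonzero b≉0 q≉0 (L.trans f z)))
    (SL.*-cancelˡ x≉0 (S.trans (S.sym (S.*-assoc x (x S.⁻¹) (ι p))) (S.trans (S.*-congʳ {ι p} (S.⁻¹-inverse x≉0)) (S.trans (S.*-identityˡ (ι p)) (S.sym e)))))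
    (LL.*-cancelˡ b≉0 (L.trans (L.sym (L.*-assoc b _ _)) (L.trans (L.*-congʳ (L.⁻¹-inverse b≉0)) (L.trans (L.*-identityˡ _) (L.sym f)))))
    where
    x≉0 : ¬ (x S.≈ S.0#)
    x≉0 x≈0 = b≉0 (⇝-zero x≈0 x⇝b)

  ⇝-^ : ∀ {x b} n → x ⇝ b → x SOp.^ n ⇝ b LOp.^ n
  ⇝-^ zero    r = ⇝-1
  ⇝-^ (suc n) r = ⇝-* r (⇝-^ n r)

  ⇝-∑ : ∀ {X : Set} (xs : List X) {f : X → S.Carrier} {f′ : X → L.Carrier} → (∀ {a} → a ∈ xs → f a ⇝ f′ a) → SOp.∑ xs f ⇝ LOp.∑ xs f′
  ⇝-∑ []       r = ⇝-0
  ⇝-∑ (x ∷ xs) r = ⇝-+ (r (here ≡.refl)) (⇝-∑ xs (r ∘ there))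

  Z : Set
  Z = ∃ λ ((x , b) : S.Carrier × L.Carrier) → x ⇝ b

  src : Z → S.Carrier
  src ((x , _) , _) = x

  tgt : Z → L.Carrier
  tgt ((_ , b) , _) = b

  -- Distinct values keep the denominators xᵢ - xⱼ in `φ` invertible at the place.
  Distinct : ∀ {n} → Vec Z n → Set
  Distinct []       = ⊤
  Distinct (z ∷ zs) = VAll.All (λ w → ¬ (tgt z L.≈ tgt w)) zs × Distinct zs

  distinct-tabulate : ∀ {n} (f : Fin n → Z) → (∀ i j → i ≢ j → ¬ (tgt (f i) L.≈ tgt (f j))) → Distinct (Vec.tabulate f)
  distinct-tabulate {zero}  f d = tt
  distinct-tabulate {suc n} f d = VAll.tabulate⁺ (λ i → d fzero (fsuc i) (λ ())) ,
    distinct-tabulate (f ∘ fsuc) (λ i j i≢j → d (fsuc i) (fsuc j) (i≢j ∘ Fin.suc-injective))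

  module _ {tS : S.Carrier} {tL : L.Carrier} (t⇝ : tS ⇝ tL) where
    private
      module RS = Symmetrization (Fractions.fractionField D) tS
      module RL = Symmetrization L tL

    private
      select-Distinct : ∀ {n} (zs : Vec Z (suc n)) → Distinct zs → ∀ {z r} → (z , r) ∈ select zs →
        VAll.All (λ w → ¬ (tgt z L.≈ tgt w)) r × Distinct r
      select-Distinct {zero}  (z ∷ []) d (here ≡.refl) = d
      select-Distinct {suc n} (z ∷ zs) (z∉ , d) = select-∷ (λ y r → VAll.All (λ w → ¬ (tgt y L.≈ tgt w)) r × Distinct r) (z∉ , d)
        λ y∈ → let y∉ , d′ = select-Distinct zs d y∈ ; z≉y , z∉r = select-All z∉ y∈ in
          (z≉y ∘ L.sym) VAll.∷ y∉ , z∉r , d′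

      φ-⇝ : ∀ {n} z (zs : Vec Z n) → VAll.All (λ w → ¬ (tgt z L.≈ tgt w)) zs → RS.φ (src z) (Vec.map src zs) ⇝ RL.φ (tgt z) (Vec.map tgt zs)
      φ-⇝ z []       _           = ⇝-1
      φ-⇝ z@((x , b) , x⇝b) (((y , c) , y⇝c) ∷ zs) (z≉w VAll.∷ z∉) = ⇝-* (⇝-* (⇝-+ x⇝b (⇝-neg (⇝-* t⇝ y⇝c)))
        (⇝-⁻¹ (λ e → z≉w (LR.x∙y⁻¹≈ε⇒x≈y b c e)) (⇝-+ x⇝b (⇝-neg y⇝c)))) (φ-⇝ z zs z∉)

    R-⇝ : ∀ α {n} (zs : Vec Z n) → Distinct zs → RS.R α (Vec.map src zs) ⇝ RL.R α (Vec.map tgt zs)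
    R-⇝ α []            _ = ⇝-1
    R-⇝ α {suc n} zs@(_ ∷ _) d = ⇝-resp (S.sym (S.trans (RS.R-expand α (Vec.map src zs)) (expand-S zs)))
      (L.sym (L.trans (RL.R-expand α (Vec.map tgt zs)) (expand-L zs)))
      (⇝-∑ (select zs) λ {(z , r)} z∈ → let z∉ , d′ = select-Distinct zs d z∈ in
        ⇝-* (⇝-^ (RS.hd α) (proj₂ z)) (⇝-* (φ-⇝ z r z∉) (R-⇝ (RS.tl α) r d′)))
      where
      expand-S : ∀ zs → SOp.∑ (select (Vec.map src zs)) (λ (x , r) → x SOp.^ RS.hd α S.* (RS.φ x r S.* RS.R (RS.tl α) r))
        S.≈ SOp.∑ (select zs) (λ (z , r) → src z SOp.^ RS.hd α S.* (RS.φ (src z) (Vec.map src r) S.* RS.R (RS.tl α) (Vec.map src r)))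
      expand-S zs = S.reflexive (≡.trans (≡.cong (λ l → SOp.∑ l _) (select-map src zs)) (SS.∑-map _ (select zs) _))
      expand-L : ∀ zs → LOp.∑ (select (Vec.map tgt zs)) (λ (x , r) → x LOp.^ RL.hd α L.* (RL.φ x r L.* RL.R (RL.tl α) r))
        L.≈ LOp.∑ (select zs) (λ (z , r) → tgt z LOp.^ RL.hd α L.* (RL.φ (tgt z) (Vec.map tgt r) L.* RL.R (RL.tl α) (Vec.map tgt r)))
      expand-L zs = L.reflexive (≡.trans (≡.cong (λ l → LOp.∑ l _) (select-map tgt zs)) (LS.∑-map _ (select zs) _))

_∘ₕ_ : ∀ {A B C : CommutativeRing 0ℓ 0ℓ} → RingHom B C → RingHom A B → RingHom A C
_∘ₕ_ {C = C} g f = record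
  { ⟦_⟧ = g.⟦_⟧ ∘ f.⟦_⟧
  ; ⟦⟧-cong = g.⟦⟧-cong ∘ f.⟦⟧-cong
  ; +-homo = λ a b → trans (g.⟦⟧-cong (f.+-homo a b)) (g.+-homo _ _)
  ; *-homo = λ a b → trans (g.⟦⟧-cong (f.*-homo a b)) (g.*-homo _ _)
  ; 1-homo = trans (g.⟦⟧-cong f.1-homo) g.1-homo }
  where
  open CommutativeRing C using (trans)
  module g = RingHom g
  module f = RingHom f

module Variables (K : Field) where
  open RationalFunctions K
  private module K = Field K

  constHom : ∀ (D : IntegralDomain) → RingHom (IntegralDomain.commutativeRing D) (Polynomials.commutativeRingₚ D)
  constHom D = record
    { ⟦_⟧ = constₚ
    ; ⟦⟧-cong = λ e → mk≈ λ { zero → e ; (suc k) → D.refl }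
    ; +-homo = λ a b → mk≈ λ _ → D.refl
    ; *-homo = λ a b → mk≈ λ { zero → D.sym (D.+-identityʳ _) ; (suc k) → D.refl }
    ; 1-homo = mk≈ λ _ → D.refl }
    where
    module D = IntegralDomain D
    open Polynomials D

  constantHom : ∀ n → RingHom K.commutativeRing (IntegralDomain.commutativeRing (K[x] n))
  constantHom zero    = idHom K.commutativeRing
  constantHom (suc n) = constHom (K[x] n) ∘ₕ constantHom n

  constant-≡ : ∀ n a → RingHom.⟦_⟧ (constantHom n) a ≡ constant n a
  constant-≡ zero    a = ≡.refl
  constant-≡ (suc n) a = ≡.cong (Polynomials.constₚ (K[x] n)) (constant-≡ n a)

  constant-injective : ∀ n {a} → IntegralDomain._≈_ (K[x] n) (constant n a) (IntegralDomain.0# (K[x] n)) → a K.≈ K.0#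
  constant-injective zero    e = e
  constant-injective (suc n) e = constant-injective n (Polynomials.at e 0)

  module _ (n : ℕ) where
    private
      module F = Field (K⟨x⟩ n)
      module h = RingHom (constantHom n)
      module D = IntegralDomain (K[x] n)
      open FractionLemmas (K[x] n)
      module ι = RingHom ιHom
      ≈constant : ∀ a → h.⟦ a ⟧ D.≈ constant n a
      ≈constant a = D.reflexive (constant-≡ n a)

    scalarHom : RingHom K.commutativeRing F.commutativeRing
    scalarHom = record
      { ⟦_⟧ = scalar n
      ; ⟦⟧-cong = λ {a} {b} e → ι.⟦⟧-cong (D.trans (D.sym (≈constant a)) (D.trans (h.⟦⟧-cong e) (≈constant b)))
      ; +-homo = λ a b → F.trans (ι.⟦⟧-cong (D.trans (D.sym (≈constant _)) (D.trans (h.+-homo a b) (D.+-cong (≈constant a) (≈constant b))))) (ι.+-homo (constant n a) (constant n b))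
      ; *-homo = λ a b → F.trans (ι.⟦⟧-cong (D.trans (D.sym (≈constant _)) (D.trans (h.*-homo a b) (D.*-cong (≈constant a) (≈constant b))))) (ι.*-homo (constant n a) (constant n b))
      ; 1-homo = F.trans (ι.⟦⟧-cong (D.trans (D.sym (≈constant _)) h.1-homo)) ι.1-homo }

    scalar-injective : ∀ {a} → scalar n a F.≈ F.0# → a K.≈ K.0#
    scalar-injective e = constant-injective n (ι-injective e)

    vars : Vec F.Carrier n
    vars = Vec.tabulate (var n)

  private
    variable≉0 : ∀ n i → ¬ (IntegralDomain._≈_ (K[x] n) (variableₚ n i) (IntegralDomain.0# (K[x] n)))
    variable≉0 (suc n) fzero    e = IntegralDomain.1≉0 (K[x] n) (Polynomials.at e 1)
    variable≉0 (suc n) (fsuc i) e = variable≉0 n i (Polynomials.at e 0)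

    variable-distinct : ∀ n i j → i ≢ j → ¬ (IntegralDomain._≈_ (K[x] n) (variableₚ n i) (variableₚ n j))
    variable-distinct (suc n) fzero    fzero    i≢j e = i≢j ≡.refl
    variable-distinct (suc n) fzero    (fsuc j) i≢j e = IntegralDomain.1≉0 (K[x] n) (Polynomials.at e 1)
    variable-distinct (suc n) (fsuc i) fzero    i≢j e = IntegralDomain.1≉0 (K[x] n) (IntegralDomain.sym (K[x] n) (Polynomials.at e 1))
    variable-distinct (suc n) (fsuc i) (fsuc j) i≢j e = variable-distinct n i j (i≢j ∘ ≡.cong fsuc) (Polynomials.at e 0)

  var≉0 : ∀ n i → ¬ (Field._≈_ (K⟨x⟩ n) (var n i) (Field.0# (K⟨x⟩ n)))
  var≉0 n i e = variable≉0 n i (FractionLemmas.ι-injective (K[x] n) e)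

  var-distinct : ∀ n i j → i ≢ j → ¬ (Field._≈_ (K⟨x⟩ n) (var n i) (var n j))
  var-distinct n i j i≢j e = variable-distinct n i j i≢j (FractionLemmas.ι-injective (K[x] n) e)

  module ZeroSpecialization (n : ℕ) where
    open Evaluation (K[x] n) (FractionLemmas.ιHom (K[x] n)) (Field.0# (K⟨x⟩ n))
    open Specialization (K[x] (suc n)) (K⟨x⟩ n) evalHom public
    private
      module S = Field (K⟨x⟩ (suc n))
      module L = Field (K⟨x⟩ n)

    ⇝-scalar : ∀ a → scalar (suc n) a ⇝ scalar n a
    ⇝-scalar a = ⇝-resp S.refl (eval-const (constant n a)) (⇝-ι (constant (suc n) a))

    -- The first variable goes to 0 and the others to the n variables of the smaller field. These
    -- values are distinct because variables are nonzero and pairwise different.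
    ⇝-R : ∀ t α → Symmetrization.R (K⟨x⟩ (suc n)) (scalar (suc n) t) α (vars (suc n))
      ⇝ Symmetrization.R (K⟨x⟩ n) (scalar n t) α (Field.0# (K⟨x⟩ n) ∷ vars n)
    ⇝-R t α = ≡.subst₂ Related src-zs tgt-zs (R-⇝ (⇝-scalar t) α zs
      (VAll.tabulate⁺ (λ i e → var≉0 n i (L.sym e)) , distinct-tabulate z (var-distinct n)))
      where
      Related : Vec S.Carrier (suc n) → Vec L.Carrier (suc n) → Set
      Related xs us = Symmetrization.R (K⟨x⟩ (suc n)) (scalar (suc n) t) α xs ⇝ Symmetrization.R (K⟨x⟩ n) (scalar n t) α us
      z₀ : Z
      z₀ = (var (suc n) fzero , L.0#) , ⇝-resp S.refl eval-X (⇝-ι (variableₚ (suc n) fzero))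
      z : Fin n → Z
      z i = (var (suc n) (fsuc i) , var n i) , ⇝-resp S.refl (eval-const (variableₚ n i)) (⇝-ι (variableₚ (suc n) (fsuc i)))
      zs : Vec Z (suc n)
      zs = z₀ ∷ Vec.tabulate z
      src-zs : Vec.map src zs ≡ vars (suc n)
      src-zs = ≡.cong (var (suc n) fzero ∷_) (≡.sym (Vec.tabulate-∘ src z))
      tgt-zs : Vec.map tgt zs ≡ L.0# ∷ vars n
      tgt-zs = ≡.cong (L.0# ∷_) (≡.sym (Vec.tabulate-∘ tgt z))

  module Scaling (n : ℕ) (c : Field.Carrier (K⟨x⟩ n)) (c≉0 : ¬ (Field._≈_ (K⟨x⟩ n) c (Field.0# (K⟨x⟩ n)))) where
    private
      module L = Field (K⟨x⟩ n)
      module h = RingHom (scalarHom n)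

      -- The number m of substituted variables is separate from n, so that the recursion can remove
      -- variables while the target field stays fixed.
      evalAll : ∀ m (u : Fin m → L.Carrier) → RingHom (IntegralDomain.commutativeRing (K[x] m)) L.commutativeRing
      evalAll zero    u = scalarHom n
      evalAll (suc m) u = Evaluation.evalHom (K[x] m) (evalAll m (u ∘ fsuc)) (u fzero)

      evalAll-constant : ∀ m u a → RingHom.⟦_⟧ (evalAll m u) (constant m a) L.≈ scalar n a
      evalAll-constant zero    u a = L.refl
      evalAll-constant (suc m) u a = L.trans (Evaluation.eval-const (K[x] m) (evalAll m (u ∘ fsuc)) (u fzero) _) (evalAll-constant m (u ∘ fsuc) a)

      evalAll-variable : ∀ m u i → RingHom.⟦_⟧ (evalAll m u) (variableₚ m i) L.≈ u i
      evalAll-variable (suc m) u fzero    = Evaluation.eval-X (K[x] m) (evalAll m (u ∘ fsuc)) (u fzero)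
      evalAll-variable (suc m) u (fsuc i) = L.trans (Evaluation.eval-const (K[x] m) (evalAll m (u ∘ fsuc)) (u fzero) _) (evalAll-variable m (u ∘ fsuc) i)

    open Specialization (K[x] n) (K⟨x⟩ n) (evalAll n (λ i → c L.* var n i)) public

    ⇝-scalar : ∀ a → scalar n a ⇝ scalar n a
    ⇝-scalar a = ⇝-resp L.refl (evalAll-constant n _ a) (⇝-ι (constant n a))

    ⇝-R : ∀ t α → length α ≡ n → Symmetrization.R (K⟨x⟩ n) (scalar n t) α (vars n)
      ⇝ FieldOperations._^_ (K⟨x⟩ n) c (sum α) L.* Symmetrization.R (K⟨x⟩ n) (scalar n t) α (vars n)
    ⇝-R t α e = ⇝-resp L.refl scaled (≡.subst₂ Related src-zs tgt-zs (R-⇝ (⇝-scalar t) α zs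
      (distinct-tabulate z (λ i j i≢j e → var-distinct n i j i≢j (FieldLemmas.*-cancelˡ (K⟨x⟩ n) c≉0 e)))))
      where
      Related : Vec L.Carrier n → Vec L.Carrier n → Set
      Related xs us = Symmetrization.R (K⟨x⟩ n) (scalar n t) α xs ⇝ Symmetrization.R (K⟨x⟩ n) (scalar n t) α us
      scaled : Symmetrization.R (K⟨x⟩ n) (scalar n t) α (Vec.map (c L.*_) (vars n))
        L.≈ FieldOperations._^_ (K⟨x⟩ n) c (sum α) L.* Symmetrization.R (K⟨x⟩ n) (scalar n t) α (vars n)
      scaled = Symmetrization.R-scale (K⟨x⟩ n) (scalar n t) c≉0 α (vars n) e
      z : Fin n → Z
      z i = (var n i , c L.* var n i) , ⇝-resp L.refl (evalAll-variable n (λ i → c L.* var n i) i) (⇝-ι (variableₚ n i))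
      zs : Vec Z n
      zs = Vec.tabulate z
      src-zs : Vec.map src zs ≡ vars n
      src-zs = ≡.sym (Vec.tabulate-∘ src z)
      tgt-zs : Vec.map tgt zs ≡ Vec.map (c L.*_) (vars n)
      tgt-zs = ≡.trans (≡.sym (Vec.tabulate-∘ tgt z)) (Vec.tabulate-∘ (c L.*_) (var n))

-- Hall-Littlewood polynomials as multiples of `R`.

if-yes : ∀ {P X : Set} (d : Dec P) {x y : X} → P → (if does d then x else y) ≡ x
if-yes (yes _) p = ≡.refl
if-yes (no ¬p) p = contradiction p ¬p

if-no : ∀ {P X : Set} (d : Dec P) {x y : X} → ¬ P → (if does d then x else y) ≡ y
if-no (yes p) ¬p = contradiction p ¬p
if-no (no _)  ¬p = ≡.refl

module PermutationSums (K : Field) (q : Field.Carrier K) (F : Field) (t : Field.Carrier F) where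
  open Field F hiding (zero)
  open FieldOperations F
  open Sums commutativeRing
  open Symmetrization F t
  open HallLittlewood K q using (permutations)
  open import Relation.Binary.Reasoning.Setoid setoid

  private
    allFin-suc : ∀ n → allFin (suc n) ≡ fzero ∷ map fsuc (allFin n)
    allFin-suc n = ≡.cong (fzero ∷_) (≡.sym (map-tabulate (λ i → i) fsuc))

  select-tabulate : ∀ {X : Set} {n} (x : Fin (suc n) → X) →
    select (Vec.tabulate x) ≡ map (λ j → x j , Vec.tabulate (x ∘ punchIn j)) (allFin (suc n))
  select-tabulate {n = zero}  x = ≡.refl
  select-tabulate {n = suc n} x = ≡.sym (≡.trans (≡.cong (map _) (allFin-suc (suc n)))
    (≡.cong ((x fzero , Vec.tabulate (x ∘ fsuc)) ∷_) (≡.trans (≡.sym (map-∘ (allFin (suc n))))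
      (≡.trans (map-∘ (allFin (suc n))) (≡.cong (map _) (≡.sym (select-tabulate (x ∘ fsuc))))))))

  -- The permutation `insert fzero j w` sends 0 to j and the later indices to `punchIn j` of the
  -- values of w, which is the choice of entry j made by `select`.
  ∑-permutations : ∀ n (H : Vec Carrier n → Carrier) (x : Fin n → Carrier) →
    ∑ (permutations n) (λ w → H (Vec.tabulate (λ i → x (w ⟨$⟩ʳ i)))) ≈ symm n H (Vec.tabulate x)
  ∑-permutations zero    H x = +-identityʳ _
  ∑-permutations (suc n) H x = begin
    ∑ (permutations (suc n)) (λ w → H (Vec.tabulate (λ i → x (w ⟨$⟩ʳ i))))
      ≈⟨ ∑-concatMap (λ j → map (insert fzero j) (permutations n)) (allFin (suc n)) _ ⟩
    ∑ (allFin (suc n)) (λ j → ∑ (map (insert fzero j) (permutations n)) (λ w → H (Vec.tabulate (λ i → x (w ⟨$⟩ʳ i)))))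
      ≈⟨ ∑-cong (allFin (suc n)) (λ j → trans (reflexive (∑-map (insert fzero j) (permutations n) _)) (∑-cong (permutations n) (λ w →
           reflexive (≡.cong (λ xs → H (x j ∷ xs)) (Vec.tabulate-cong (λ i → ≡.cong x (insert-punchIn fzero j w i))))))) ⟩
    ∑ (allFin (suc n)) (λ j → ∑ (permutations n) (λ w → H (x j ∷ Vec.tabulate (λ i → x (punchIn j (w ⟨$⟩ʳ i))))))
      ≈⟨ ∑-cong (allFin (suc n)) (λ j → ∑-permutations n (λ ys → H (x j ∷ ys)) (x ∘ punchIn j)) ⟩
    ∑ (allFin (suc n)) (λ j → symm n (λ ys → H (x j ∷ ys)) (Vec.tabulate (x ∘ punchIn j)))
      ≡⟨ ≡.trans (≡.cong (λ l → ∑ l _) (select-tabulate x)) (∑-map _ (allFin (suc n)) _) ⟨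
    symm (suc n) H (Vec.tabulate x) ∎

  -- The pairs i < j with i = 0 form `φ` of the first variable. The pairs with i > 0 form the same
  -- product for the remaining variables.
  term-tabulate : ∀ α n (x : Fin n → Carrier) →
    ∏ (allFin n) (λ i → x i ^ entry α (toℕ i)) *
    ∏ (allFin n) (λ i → ∏ (filter (i Fin.<?_) (allFin n)) (λ j → (x i - t * x j) ÷ (x i - x j)))
      ≈ term α (Vec.tabulate x)
  term-tabulate α zero    x = *-identityˡ _
  term-tabulate α (suc n) x = begin
    ∏ (allFin (suc n)) (λ i → x i ^ entry α (toℕ i)) * ∏ (allFin (suc n)) (λ i → ψ (suc n) x i)
      ≡⟨ ≡.cong (λ l → ∏ l (λ i → x i ^ entry α (toℕ i)) * ∏ l (ψ (suc n) x)) (allFin-suc n) ⟩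
    x fzero ^ entry α 0 * ∏ (map fsuc (allFin n)) _ * (ψ (suc n) x fzero * ∏ (map fsuc (allFin n)) _)
      ≈⟨ *-cong (*-congˡ (trans (reflexive (∏-map fsuc (allFin n) _)) (∏-cong (allFin n) (λ i → reflexive (≡.cong (x (fsuc i) ^_) (entry-suc α (toℕ i)))))))
           (*-cong first (trans (reflexive (∏-map fsuc (allFin n) _)) (∏-cong (allFin n) rest))) ⟩
    x fzero ^ entry α 0 * ∏ (allFin n) (λ i → x (fsuc i) ^ entry (tl α) (toℕ i)) * (φ (x fzero) (Vec.tabulate (x ∘ fsuc)) * ∏ (allFin n) (ψ n (x ∘ fsuc)))
      ≈⟨ S.solve 4 (λ a b c d → (a S.:* b) S.:* (c S.:* d) S.:= a S.:* (c S.:* (b S.:* d))) refl _ _ _ _ ⟩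
    x fzero ^ entry α 0 * (φ (x fzero) (Vec.tabulate (x ∘ fsuc)) * (∏ (allFin n) (λ i → x (fsuc i) ^ entry (tl α) (toℕ i)) * ∏ (allFin n) (ψ n (x ∘ fsuc))))
      ≈⟨ *-congˡ (*-congˡ (term-tabulate (tl α) n (x ∘ fsuc))) ⟩
    term α (Vec.tabulate x) ∎
    where
    ψ : ∀ n (x : Fin n → Carrier) → Fin n → Carrier
    ψ n x i = ∏ (filter (i Fin.<?_) (allFin n)) (λ j → (x i - t * x j) ÷ (x i - x j))
    entry-suc : ∀ α i → entry α (suc i) ≡ entry (tl α) i
    entry-suc []      i = ≡.refl
    entry-suc (a ∷ α) i = ≡.refl
    quotient : ∀ {n} → Carrier → (Fin n → Carrier) → Fin n → Carrier
    quotient y x j = (y - t * x j) ÷ (y - x j)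
    φ-tabulate : ∀ y n (x : Fin n → Carrier) → ∏ (allFin n) (quotient y x) ≈ φ y (Vec.tabulate x)
    φ-tabulate y zero    x = refl
    φ-tabulate y (suc n) x = trans (reflexive (≡.trans (≡.cong (λ l → ∏ l (quotient y x)) (allFin-suc n)) (≡.cong (quotient y x fzero *_) (∏-map fsuc (allFin n) (quotient y x)))))
      (*-congˡ (φ-tabulate y n (x ∘ fsuc)))
    first : ψ (suc n) x fzero ≈ φ (x fzero) (Vec.tabulate (x ∘ fsuc))
    first = trans (reflexive (≡.trans (≡.cong (λ l → ∏ l (quotient (x fzero) x)) (≡.trans (≡.cong (filter (fzero {n} Fin.<?_)) (allFin-suc n))
        (≡.trans (filter-reject (fzero {n} Fin.<?_) {x = fzero} {xs = map fsuc (allFin n)} (λ ())) (filter-all (fzero {n} Fin.<?_) (All.map⁺ (universal (λ _ → s≤s z≤n) (allFin n)))))))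
        (∏-map fsuc (allFin n) (quotient (x fzero) x)))) (φ-tabulate (x fzero) n (x ∘ fsuc))
    filter-map-fsuc : ∀ {n} (i : Fin n) (js : List (Fin n)) → filter (fsuc i Fin.<?_) (map fsuc js) ≡ map fsuc (filter (i Fin.<?_) js)
    filter-map-fsuc i []       = ≡.refl
    filter-map-fsuc i (j ∷ js) = by-cases (i Fin.<? j)
      where
      by-cases : Dec (toℕ i < toℕ j) → filter (fsuc i Fin.<?_) (map fsuc (j ∷ js)) ≡ map fsuc (filter (i Fin.<?_) (j ∷ js))
      by-cases (yes i<j) = ≡.trans (filter-accept (fsuc i Fin.<?_) (s≤s i<j))
        (≡.trans (≡.cong (fsuc j ∷_) (filter-map-fsuc i js)) (≡.sym (≡.cong (map fsuc) (filter-accept (i Fin.<?_) i<j))))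
      by-cases (no i≮j)  = ≡.trans (filter-reject (fsuc i Fin.<?_) (i≮j ∘ ℕ.s≤s⁻¹))
        (≡.trans (filter-map-fsuc i js) (≡.sym (≡.cong (map fsuc) (filter-reject (i Fin.<?_) i≮j))))
    rest : ∀ i → ψ (suc n) x (fsuc i) ≈ ψ n (x ∘ fsuc) i
    rest i = reflexive (≡.trans (≡.cong (λ l → ∏ l (quotient (x (fsuc i)) x))
        (≡.trans (≡.cong (filter (fsuc i Fin.<?_)) (allFin-suc n))
          (≡.trans (filter-reject (fsuc i Fin.<?_) {x = fzero} {xs = map fsuc (allFin n)} (λ ())) (filter-map-fsuc {n} i (allFin n)))))
      (∏-map fsuc (filter (i Fin.<?_) (allFin n)) (quotient (x (fsuc i)) x)))

module HallLittlewoodPolynomials (K : Field) (t : Field.Carrier K) where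
  open RationalFunctions K
  open Variables K public
  open HallLittlewood K t using (P⟨_vars⟩; v; permutations)

  R⟨_⟩ : ∀ n → List ℕ → Field.Carrier (K⟨x⟩ n)
  R⟨ n ⟩ α = Symmetrization.R (K⟨x⟩ n) (scalar n t) α (vars n)

  P-R : ∀ n σ → ℓ σ ≤ n → Field._≈_ (K⟨x⟩ n) (P⟨ n vars⟩ σ)
    (Field._*_ (K⟨x⟩ n) (Field._⁻¹ (K⟨x⟩ n) (scalar n (v n σ))) (R⟨ n ⟩ (parts σ)))
  P-R n σ ℓ≤n = F.trans (F.reflexive (if-yes (ℓ σ ℕ.≤? n) ℓ≤n)) (F.*-congˡ {scalar n (v n σ) F.⁻¹} (F.trans
    (FS.∑-cong (permutations n) (λ w → PS.term-tabulate (parts σ) n (λ i → var n (w ⟨$⟩ʳ i))))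
    (PS.∑-permutations n (Symmetrization.term (K⟨x⟩ n) (scalar n t) (parts σ)) (var n))))
    where
    module F = Field (K⟨x⟩ n)
    module FS = Sums F.commutativeRing
    module PS = PermutationSums K t (K⟨x⟩ n) (scalar n t)

  P-zero : ∀ n σ → ¬ (ℓ σ ≤ n) → Field._≈_ (K⟨x⟩ n) (P⟨ n vars⟩ σ) (Field.0# (K⟨x⟩ n))
  P-zero n σ ℓ≰n = Field.reflexive (K⟨x⟩ n) (if-no (ℓ σ ℕ.≤? n) ℓ≰n)

-- Linear independence of the sums `R` indexed by partitions.

module Independence (K : Field) (t : Field.Carrier K)
  (1-tᵏ≉0 : ∀ k → ¬ (Field._≈_ K (Field._-_ K (Field.1# K) (FieldOperations._^_ K t (suc k))) (Field.0# K)))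
  where
  private
    module K = Field K
    module SK = Symmetrization K t
  open RationalFunctions K
  open HallLittlewoodPolynomials K t

  private
    geometric≉0 : ∀ k → ¬ (SK.geometric (suc k) K.≈ K.0#)
    geometric≉0 k e = 1-tᵏ≉0 k (K.trans (K.sym (SK.geometric-1-t (suc k))) (K.trans (K.*-congˡ e) (K.zeroʳ _)))

    geometric-scalar : ∀ n k → Field._≈_ (K⟨x⟩ n) (scalar n (SK.geometric k)) (Symmetrization.geometric (K⟨x⟩ n) (scalar n t) k)
    geometric-scalar n k = F.trans (∑-homo (scalarHom n) (upTo k) (λ i → FieldOperations._^_ K t i))
      (FS.∑-cong (upTo k) (λ i → ^-homo (scalarHom n) t i))
      where
      module F = Field (K⟨x⟩ n)
      module FS = Sums F.commutativeRing

    -- A first column of height c ≤ n leaves n + 1 - c exponents equal to 0, which by `R-0∷` gives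
    -- the factor 1 + t + ... + t^(n-c).
    R-last-zero : ∀ n cs → Decreasing n cs → Field._≈_ (K⟨x⟩ n)
      (Symmetrization.R (K⟨x⟩ n) (scalar n t) (transpose (suc n) cs) (Field.0# (K⟨x⟩ n) ∷ vars n))
      (Field._*_ (K⟨x⟩ n) (scalar n (SK.geometric (suc (n ∸ entry cs 0)))) (R⟨ n ⟩ (transpose n cs)))
    R-last-zero n cs d = by-shape cs d
      where
      module F = Field (K⟨x⟩ n)
      module RF = Symmetrization (K⟨x⟩ n) (scalar n t)
      general : ∀ β k → length β ℕ.+ k ≡ n →
        RF.R (map suc β ++ replicate (suc k) 0) (F.0# ∷ vars n) F.≈ scalar n (SK.geometric (suc k)) F.* RF.R (map suc β ++ replicate k 0) (vars n)
      general β k e = F.trans (RF.R-0∷ β k (vars n) e (VAll.tabulate⁺ (var≉0 n)))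
        (F.*-congʳ {RF.R (map suc β ++ replicate k 0) (vars n)} (F.sym (geometric-scalar n (suc k))))
      by-shape : ∀ cs → Decreasing n cs → RF.R (transpose (suc n) cs) (F.0# ∷ vars n)
        F.≈ scalar n (SK.geometric (suc (n ∸ entry cs 0))) F.* RF.R (transpose n cs) (vars n)
      by-shape []       _         = ≡.subst₂ (λ α β → RF.R α (F.0# ∷ vars n) F.≈ scalar n (SK.geometric (suc n)) F.* RF.R β (vars n))
        (≡.sym (applyUpTo-const 0 (suc n))) (≡.sym (applyUpTo-const 0 n)) (general [] n ≡.refl)
      by-shape (c ∷ cs) (c≤n , d) = ≡.subst₂ (λ α β → RF.R α (F.0# ∷ vars n) F.≈ scalar n (SK.geometric (suc (n ∸ c))) F.* RF.R β (vars n))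
        (≡.sym (≡.trans (transpose-∷ (suc n) c cs (ℕ.m≤n⇒m≤1+n c≤n) d) (≡.cong (λ k → map suc (transpose c cs) ++ replicate k 0) (ℕ.+-∸-assoc 1 c≤n))))
        (≡.sym (transpose-∷ n c cs c≤n d))
        (general (transpose c cs) (n ∸ c) (≡.trans (≡.cong (ℕ._+ (n ∸ c)) (length-transpose c cs)) (ℕ.m+[n∸m]≡n c≤n)))

    transpose-full : ∀ n cs → Decreasing n cs → transpose n (n ∷ cs) ≡ map suc (transpose n cs)
    transpose-full n cs d = ≡.trans (transpose-∷ n n cs ℕ.≤-refl d) (≡.trans (≡.cong (λ k → map suc (transpose n cs) ++ replicate k 0) (ℕ.n∸n≡0 n)) (++-identityʳ _))

    -- A column of full height makes all exponents positive, so the product of the variables splits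
    -- off, and one of them is 0.
    R-full-zero : ∀ n cs → Decreasing (suc n) cs → n < entry cs 0 → Field._≈_ (K⟨x⟩ n)
      (Symmetrization.R (K⟨x⟩ n) (scalar n t) (transpose (suc n) cs) (Field.0# (K⟨x⟩ n) ∷ vars n)) (Field.0# (K⟨x⟩ n))
    R-full-zero n (c ∷ cs) (c≤1+n , d) n<c = ≡.subst (λ α → RF.R α xs F.≈ F.0#) (≡.sym shape)
      (F.trans (RF.R-map-suc (transpose (suc n) cs) xs (length-transpose (suc n) cs))
        (F.trans (F.*-congʳ {RF.R (transpose (suc n) cs) xs} (F.zeroˡ (RF.product (λ x → x) (vars n)))) (F.zeroˡ (RF.R (transpose (suc n) cs) xs))))
      where
      module F = Field (K⟨x⟩ n)
      module RF = Symmetrization (K⟨x⟩ n) (scalar n t)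
      xs = F.0# ∷ vars n
      c≡1+n : c ≡ suc n
      c≡1+n = ℕ.≤-antisym c≤1+n n<c
      shape : transpose (suc n) (c ∷ cs) ≡ map suc (transpose (suc n) cs)
      shape = ≡.trans (≡.cong (λ c → transpose (suc n) (c ∷ cs)) c≡1+n) (transpose-full (suc n) cs (≡.subst (λ c → Decreasing c cs) c≡1+n d))

    combination : ∀ n → List (List ℕ) → (List ℕ → K.Carrier) → Field.Carrier (K⟨x⟩ n)
    combination n css a = Operations.∑ (Field.commutativeRing (K⟨x⟩ n)) css (λ cs → Field._*_ (K⟨x⟩ n) (scalar n (a cs)) (R⟨ n ⟩ (transpose n cs)))

    -- Setting a variable to zero kills the terms with a column of full height n + 1.
    restrict : ∀ n L a → Field._≈_ (K⟨x⟩ (suc n)) (combination (suc n) (columns (suc n) L) a) (Field.0# (K⟨x⟩ (suc n))) →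
      Field._≈_ (K⟨x⟩ n) (combination n (columns n L) (λ cs → a cs K.* SK.geometric (suc (n ∸ entry cs 0)))) (Field.0# (K⟨x⟩ n))
    restrict n L a e = F.trans (F.sym specialized) (⇝-zero e (⇝-∑ (columns (suc n) L) (λ {cs} _ → ⇝-* (⇝-scalar (a cs)) (⇝-R t (transpose (suc n) cs)))))
      where
      open ZeroSpecialization n
      module F = Field (K⟨x⟩ n)
      module FS = Sums F.commutativeRing
      module FC = ColumnSums F.commutativeRing
      module s = RingHom (scalarHom n)
      open Operations F.commutativeRing using (∑)
      f : List ℕ → F.Carrier
      f cs = scalar n (a cs) F.* Symmetrization.R (K⟨x⟩ n) (scalar n t) (transpose (suc n) cs) (F.0# ∷ vars n)
      vanish : ∀ {cs} → cs ∈ columns (suc n) L → n < entry cs 0 → f cs F.≈ F.0#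
      vanish {cs} cs∈ n<c = F.trans (F.*-congˡ {scalar n (a cs)} (R-full-zero n cs (proj₁ (∈-columns⁻ (suc n) L cs∈)) n<c)) (F.zeroʳ (scalar n (a cs)))
      rewritten : ∀ {cs} → cs ∈ columns n L → f cs F.≈ scalar n (a cs K.* SK.geometric (suc (n ∸ entry cs 0))) F.* R⟨ n ⟩ (transpose n cs)
      rewritten {cs} cs∈ = F.trans (F.*-congˡ {scalar n (a cs)} (R-last-zero n cs (proj₁ (∈-columns⁻ n L cs∈))))
        (F.trans (F.sym (F.*-assoc (scalar n (a cs)) (scalar n (SK.geometric (suc (n ∸ entry cs 0)))) (R⟨ n ⟩ (transpose n cs))))
          (F.*-congʳ {R⟨ n ⟩ (transpose n cs)} (F.sym (s.*-homo (a cs) (SK.geometric (suc (n ∸ entry cs 0)))))))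
      specialized : ∑ (columns (suc n) L) f F.≈ combination n (columns n L) (λ cs → a cs K.* SK.geometric (suc (n ∸ entry cs 0)))
      specialized = F.trans (FC.∑-columns-≤ L (ℕ.n≤1+n n) f (λ cs cs∈ n<c → vanish cs∈ n<c)) (FS.∑-cong∈ (columns n L) rewritten)

    -- Without variables the box contains only the list of zeros, and the combination is a single
    -- scalar.
    R-independent-0 : ∀ L a → Field._≈_ (K⟨x⟩ 0) (combination 0 (columns 0 L) a) (Field.0# (K⟨x⟩ 0)) → ∀ {cs} → cs ∈ columns 0 L → a cs K.≈ K.0#
    R-independent-0 zero a e (here ≡.refl) = scalar-injective 0 (F.trans (F.sym (F.trans (F.+-identityʳ (x F.* F.1#)) (F.*-identityʳ x))) e)
      where
      module F = Field (K⟨x⟩ 0)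
      x = scalar 0 (a [])
    R-independent-0 (suc L) a e cs∈ = by-shape (∈-columns⁻ 0 (suc L) cs∈)
      where
      module F = Field (K⟨x⟩ 0)
      module FC = ColumnSums F.commutativeRing
      tails : combination 0 (columns 0 L) (a ∘ (0 ∷_)) F.≈ F.0#
      tails = F.trans (F.sym (F.trans (FC.∑-columns-suc 0 L (λ cs → scalar 0 (a cs) F.* R⟨ 0 ⟩ (transpose 0 cs))) (F.+-identityʳ _))) e
      by-shape : ∀ {cs} → Decreasing 0 cs × length cs ≡ suc L → a cs K.≈ K.0#
      by-shape {c ∷ cs} ((z≤n , d) , e) = R-independent-0 L (a ∘ (0 ∷_)) tails (∈-columns⁺ 0 L d (ℕ.suc-injective e))

  -- The outer induction is on n and the inner one on L. The outer step yields the coefficients with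
  -- first column at most n, up to a nonzero factor `geometric`. Only then are the remaining terms
  -- divisible by the product of the variables, which removes one column.
  R-independent : ∀ n L a → Field._≈_ (K⟨x⟩ n) (combination n (columns n L) a) (Field.0# (K⟨x⟩ n)) → ∀ {cs} → cs ∈ columns n L → a cs K.≈ K.0#
  R-independent zero    L a e cs∈ = R-independent-0 L a e cs∈
  R-independent (suc n) L a e {cs} cs∈ = by-size L a e (∈-columns⁻ (suc n) L cs∈) (entry cs 0 ℕ.≤? n)
    where
    module F = Field (K⟨x⟩ (suc n))
    module FS = Sums F.commutativeRing
    module FC = ColumnSums F.commutativeRing
    module s = RingHom (scalarHom (suc n))
    module RF = Symmetrization (K⟨x⟩ (suc n)) (scalar (suc n) t)
    open Operations F.commutativeRing using (∑)
    small : ∀ L a → combination (suc n) (columns (suc n) L) a F.≈ F.0# →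
      ∀ {cs} → Decreasing (suc n) cs × length cs ≡ L → entry cs 0 ≤ n → a cs K.≈ K.0#
    small L a e {cs} (d , l) c≤n = FieldLemmas.*-cancelʳ K (geometric≉0 (n ∸ entry cs 0)) (K.trans
      (R-independent n L (λ cs → a cs K.* SK.geometric (suc (n ∸ entry cs 0))) (restrict n L a e) (∈-columns⁺ n L (decreasing-lower cs c≤n d) l)) (K.sym (K.zeroˡ _)))
    by-size : ∀ L a → combination (suc n) (columns (suc n) L) a F.≈ F.0# →
      ∀ {cs} → Decreasing (suc n) cs × length cs ≡ L → Dec (entry cs 0 ≤ n) → a cs K.≈ K.0#
    by-size L       a e d (yes c≤n) = small L a e d c≤n
    by-size zero    a e {[]} d (no c≰n) = contradiction z≤n c≰n
    by-size (suc L) a e {c ∷ cs} ((c≤1+n , d) , l) (no c≰n) = ≡.subst (λ c → a (c ∷ cs) K.≈ K.0#) (≡.sym c≡1+n)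
      (by-size L (a ∘ (suc n ∷_)) tails (≡.subst (λ c → Decreasing c cs) c≡1+n d , ℕ.suc-injective l) (entry cs 0 ℕ.≤? n))
      where
      c≡1+n : c ≡ suc n
      c≡1+n = ℕ.≤-antisym c≤1+n (ℕ.≰⇒> c≰n)
      Π : F.Carrier
      Π = RF.product (λ x → x) (vars (suc n))
      product≉0 : ∀ {m} {xs : Vec F.Carrier m} → VAll.All (λ x → ¬ (x F.≈ F.0#)) xs → ¬ (RF.product (λ x → x) xs F.≈ F.0#)
      product≉0 VAll.[]          = F.1≉0
      product≉0 (x≉0 VAll.∷ xs≉0) = F.*-nonzero x≉0 (product≉0 xs≉0)
      f : List ℕ → F.Carrier
      f cs = scalar (suc n) (a cs) F.* R⟨ suc n ⟩ (transpose (suc n) cs)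
      lower : ∀ {c} → c ∈ upTo (suc n) → ∑ (columns c L) (f ∘ (c ∷_)) F.≈ F.0#
      lower {c} c∈ = FS.∑-zero∈ (columns c L) (λ {cs} cs∈ → let d , l = ∈-columns⁻ c L cs∈ ; c≤n = ℕ.s≤s⁻¹ (∈-upTo⁻ c∈) in
        F.trans (F.*-congʳ {R⟨ suc n ⟩ (transpose (suc n) (c ∷ cs))} (F.trans (s.⟦⟧-cong (small (suc L) a e {c ∷ cs} ((ℕ.m≤n⇒m≤1+n c≤n , d) , ≡.cong suc l) c≤n)) s.0-homo))
          (F.zeroˡ (R⟨ suc n ⟩ (transpose (suc n) (c ∷ cs)))))
      top : ∑ (columns (suc n) L) (f ∘ (suc n ∷_)) F.≈ F.0#
      top = F.trans (F.sym (F.+-identityˡ (∑ (columns (suc n) L) (f ∘ (suc n ∷_)))))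
        (F.trans (F.+-congʳ {∑ (columns (suc n) L) (f ∘ (suc n ∷_))} (F.sym (FS.∑-zero∈ (upTo (suc n)) {λ c → ∑ (columns c L) (f ∘ (c ∷_))} lower)))
          (F.trans (F.sym (F.trans (FC.∑-columns-suc (suc n) L f) (FS.∑-upTo-last (suc n) (λ c → ∑ (columns c L) (f ∘ (c ∷_)))))) e))
      full : ∀ {cs} → cs ∈ columns (suc n) L → f (suc n ∷ cs) F.≈ Π F.* (scalar (suc n) (a (suc n ∷ cs)) F.* R⟨ suc n ⟩ (transpose (suc n) cs))
      full {cs} cs∈ = F.trans (F.*-congˡ {scalar (suc n) (a (suc n ∷ cs))} (F.trans
          (F.reflexive (≡.cong (R⟨ suc n ⟩) (transpose-full (suc n) cs (proj₁ (∈-columns⁻ (suc n) L cs∈)))))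
          (RF.R-map-suc (transpose (suc n) cs) (vars (suc n)) (length-transpose (suc n) cs))))
        (FS.S.solve 3 (λ x y z → x FS.S.:* (y FS.S.:* z) FS.S.:= y FS.S.:* (x FS.S.:* z)) F.refl
          (scalar (suc n) (a (suc n ∷ cs))) Π (R⟨ suc n ⟩ (transpose (suc n) cs)))
      tails : combination (suc n) (columns (suc n) L) (a ∘ (suc n ∷_)) F.≈ F.0#
      -- Division by the product of the variables, which is a nonzero rational function.
      tails = FieldLemmas.*-zero⇒ (K⟨x⟩ (suc n)) {Π} (product≉0 (VAll.tabulate⁺ (var≉0 (suc n))))
        (F.trans (FS.*-∑ Π (columns (suc n) L) (λ cs → scalar (suc n) (a (suc n ∷ cs)) F.* R⟨ suc n ⟩ (transpose (suc n) cs)))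
          (F.trans (F.sym (FS.∑-cong∈ (columns (suc n) L) full)) top))

-- Conversion between partitions and column heights.

pad : ℕ → List ℕ → List ℕ
pad n       []       = replicate n 0
pad zero    (a ∷ as) = []
pad (suc n) (a ∷ as) = a ∷ pad n as

pad-exact : ∀ {n} as → length as ≡ n → pad n as ≡ as
pad-exact []       ≡.refl = ≡.refl
pad-exact (a ∷ as) ≡.refl = ≡.cong (a ∷_) (pad-exact as ≡.refl)

pad-++ : ∀ {n} as → length as ≤ n → pad n as ≡ as ++ replicate (n ∸ length as) 0
pad-++ []       _       = ≡.refl
pad-++ (a ∷ as) (s≤s l) = ≡.cong (a ∷_) (pad-++ as l)

private
  count≥-shift : ∀ i as k → count≥ (2 ℕ.+ i) (map suc as ++ replicate k 0) ≡ count≥ (suc i) as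
  count≥-shift i []       zero    = ≡.refl
  count≥-shift i []       (suc k) = count≥-shift i [] k
  count≥-shift i (a ∷ as) k       = by-cases (suc i ℕ.≤? a)
    where
    by-cases : Dec (suc i ≤ a) → count≥ (2 ℕ.+ i) (suc a ∷ map suc as ++ replicate k 0) ≡ count≥ (suc i) (a ∷ as)
    by-cases (yes i<a) = ≡.trans (count≥-accept (2 ℕ.+ i) _ (s≤s i<a)) (≡.trans (≡.cong suc (count≥-shift i as k)) (≡.sym (count≥-accept (suc i) as i<a)))
    by-cases (no i≮a)  = ≡.trans (count≥-reject (2 ℕ.+ i) _ (s≤s (ℕ.≰⇒> i≮a))) (≡.trans (count≥-shift i as k) (≡.sym (count≥-reject (suc i) as (ℕ.≰⇒> i≮a))))

  count≥-1 : ∀ as k → count≥ 1 (map suc as ++ replicate k 0) ≡ length as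
  count≥-1 []       zero    = ≡.refl
  count≥-1 []       (suc k) = count≥-1 [] k
  count≥-1 (a ∷ as) k       = ≡.cong suc (count≥-1 as k)

-- The first row a makes exactly a columns nonzero, which `count≥-1` counts. Removing it lowers
-- these columns by one, and `count≥-shift` identifies the remaining rows.
transpose-transpose : ∀ n L as → Decreasing L as → transpose n (transpose L as) ≡ pad n as
transpose-transpose zero    L []       _         = ≡.refl
transpose-transpose zero    L (a ∷ as) _         = ≡.refl
transpose-transpose (suc n) L []       _         = ≡.trans (≡.cong (transpose (suc n)) (applyUpTo-const 0 L))
  (≡.trans (applyUpTo-cong (suc n) (λ {i} _ → none i L)) (applyUpTo-const 0 (suc n)))
  where
  none : ∀ i L → count≥ (suc i) (replicate L 0) ≡ 0
  none i zero    = ≡.refl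
  none i (suc L) = none i L
transpose-transpose (suc n) L (a ∷ as) (a≤L , d) = ≡.trans (≡.cong (transpose (suc n)) (transpose-∷ L a as a≤L d))
  (≡.cong₂ _∷_ (≡.trans (count≥-1 (transpose a as) (L ∸ a)) (length-transpose a as))
    (≡.trans (applyUpTo-cong n (λ {i} _ → count≥-shift i (transpose a as) (L ∸ a))) (transpose-transpose n a as d)))

-- Together with its converse `entry-count≥` this is the correspondence i < σᶜⱼ iff j ≤ σᵢ for i
-- counted from 0. It translates containment between rows and columns.
count≥-entry : ∀ j as i → suc j ≤ entry as i → ∀ {n} → Decreasing n as → i < count≥ (suc j) as
count≥-entry j (a ∷ as) zero    j<a (_ , d) = ≡.subst (0 <_) (≡.sym (count≥-accept (suc j) as j<a)) (s≤s z≤n)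
count≥-entry j (a ∷ as) (suc i) j<e (_ , d) = ≡.subst (suc i <_) (≡.sym (count≥-accept (suc j) as (ℕ.≤-trans j<e (entry≤ as i d))))
  (s≤s (count≥-entry j as i j<e d))
  where
  entry≤ : ∀ {n} as i → Decreasing n as → entry as i ≤ n
  entry≤ []       i       _         = z≤n
  entry≤ (a ∷ as) zero    (a≤n , _) = a≤n
  entry≤ (a ∷ as) (suc i) (a≤n , d) = ℕ.≤-trans (entry≤ as i d) a≤n

entry-count≥ : ∀ j as i → i < count≥ (suc j) as → ∀ {n} → Decreasing n as → suc j ≤ entry as i
entry-count≥ j (a ∷ as) i i<c (_ , d) = by-cases (suc j ℕ.≤? a) i i<c
  where
  by-cases : Dec (suc j ≤ a) → ∀ i → i < count≥ (suc j) (a ∷ as) → suc j ≤ entry (a ∷ as) i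
  by-cases (yes j<a) zero    _   = j<a
  by-cases (yes j<a) (suc i) i<c = entry-count≥ j as i (ℕ.s≤s⁻¹ (≡.subst (suc i <_) (count≥-accept (suc j) as j<a) i<c)) d
  by-cases (no j≮a)  i       i<c = contradiction (≡.subst (i <_) (≡.trans (count≥-reject (suc j) as (ℕ.≰⇒> j≮a)) (count≥-none as d (ℕ.≰⇒> j≮a))) i<c) (λ ())

count≥-length : ∀ j as → count≥ j as ≤ length as
count≥-length j as = length-filter (j ℕ.≤?_) as

count≥-antitone : ∀ j as → count≥ (suc j) as ≤ count≥ j as
count≥-antitone j []       = z≤n
count≥-antitone j (a ∷ as) = by-cases (suc j ℕ.≤? a) (j ℕ.≤? a)
  where
  by-cases : Dec (suc j ≤ a) → Dec (j ≤ a) → count≥ (suc j) (a ∷ as) ≤ count≥ j (a ∷ as)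
  by-cases (yes j<a) _         = ≡.subst₂ _≤_ (≡.sym (count≥-accept (suc j) as j<a)) (≡.sym (count≥-accept j as (ℕ.<⇒≤ j<a))) (s≤s (count≥-antitone j as))
  by-cases (no j≮a)  (yes j≤a) = ≡.subst₂ _≤_ (≡.sym (count≥-reject (suc j) as (ℕ.≰⇒> j≮a))) (≡.sym (count≥-accept j as j≤a)) (ℕ.m≤n⇒m≤1+n (count≥-antitone j as))
  by-cases (no j≮a)  (no j≰a)  = ≡.subst₂ _≤_ (≡.sym (count≥-reject (suc j) as (ℕ.≰⇒> j≮a))) (≡.sym (count≥-reject j as (ℕ.≰⇒> j≰a))) (count≥-antitone j as)

decreasing-applyUpTo : ∀ {n} L (f : ℕ → ℕ) → f 0 ≤ n → (∀ i → f (suc i) ≤ f i) → Decreasing n (applyUpTo f L)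
decreasing-applyUpTo zero    f f0≤n h = tt
decreasing-applyUpTo (suc L) f f0≤n h = f0≤n , decreasing-applyUpTo L (f ∘ suc) (h 0) (h ∘ suc)

decreasing-transpose : ∀ L as → Decreasing (length as) (transpose L as)
decreasing-transpose L as = decreasing-applyUpTo L _ (count≥-length 1 as) (λ i → count≥-antitone (suc i) as)

Linked⇒Decreasing : ∀ as → Linked _≥_ as → Decreasing (entry as 0) as
Linked⇒Decreasing []           _         = tt
Linked⇒Decreasing (a ∷ [])     _         = ℕ.≤-refl , tt
Linked⇒Decreasing (a ∷ b ∷ as) (a≥b ∷ l) = ℕ.≤-refl , decreasing-mono (b ∷ as) a≥b (Linked⇒Decreasing (b ∷ as) l)

Decreasing⇒Linked : ∀ {n} as → Decreasing n as → Linked _≥_ as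
Decreasing⇒Linked []           _               = []
Decreasing⇒Linked (a ∷ [])     _               = [-]
Decreasing⇒Linked (a ∷ b ∷ as) (_ , b≤a , d) = b≤a ∷ Decreasing⇒Linked (b ∷ as) (b≤a , d)

parts-injective : ∀ {σ τ} → parts σ ≡ parts τ → σ ≡ τ
parts-injective {partition as _ _} {partition .as _ _} ≡.refl = ≡.refl

_≟ₚ_ : (σ τ : Partition) → Dec (σ ≡ τ)
σ ≟ₚ τ = Dec.map′ parts-injective (≡.cong parts) (≡-dec ℕ._≟_ (parts σ) (parts τ))

-- A partition stores its ordering as an irrelevant proof; deciding the ordering again gives one
-- that can be used.
parts-decreasing : ∀ σ {L} → part σ 0 ≤ L → Decreasing L (parts σ)
parts-decreasing (partition as d _) σ₁≤L = decreasing-mono as σ₁≤L (Linked⇒Decreasing as (recompute (linked? ℕ._≥?_ as) d))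

parts-positive : ∀ σ → All (0 <_) (parts σ)
parts-positive (partition as _ p) = recompute (all? (0 ℕ.<?_) as) p

toColumns : ℕ → Partition → List ℕ
toColumns L σ = transpose L (parts σ)

-- The first column is the number of rows to keep, so that all parts are positive.
fromColumns : List ℕ → Partition
fromColumns cs = partition (transpose (entry cs 0) cs)
  (Decreasing⇒Linked (transpose (entry cs 0) cs) (decreasing-transpose (entry cs 0) cs))
  (All.applyUpTo⁺₁ _ (entry cs 0) (λ {i} → positive cs i))
  where
  positive : ∀ cs i → i < entry cs 0 → 0 < count≥ (suc i) cs
  positive (c ∷ cs) i i<c = ≡.subst (0 <_) (≡.sym (count≥-accept (suc i) cs i<c)) (s≤s z≤n)

to-from : ∀ {n L cs} → cs ∈ columns n L → toColumns L (fromColumns cs) ≡ cs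
to-from {n} {L} {cs} cs∈ = let d , l = ∈-columns⁻ n L cs∈ in
  ≡.trans (transpose-transpose L (entry cs 0) cs (decreasing-lower cs ℕ.≤-refl d)) (pad-exact cs l)

entry-toColumns : ∀ {L} σ → part σ 0 ≤ L → entry (toColumns L σ) 0 ≡ ℓ σ
entry-toColumns {L} σ@(partition [] _ _)       σ₁≤L = ≡.trans (≡.cong (λ cs → entry cs 0) (applyUpTo-const 0 L)) (head-0 L)
  where
  head-0 : ∀ L → entry (replicate L 0) 0 ≡ 0
  head-0 zero    = ≡.refl
  head-0 (suc L) = ≡.refl
entry-toColumns {zero}  σ@(partition (a ∷ as) _ _) σ₁≤0 = contradiction (ℕ.≤-trans (All.head (parts-positive σ)) σ₁≤0) (λ ())
entry-toColumns {suc L} σ _ = ≡.cong length (filter-all (1 ℕ.≤?_) (parts-positive σ))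

from-to : ∀ {L} σ → part σ 0 ≤ L → fromColumns (toColumns L σ) ≡ σ
from-to {L} σ σ₁≤L = parts-injective (≡.trans (≡.cong (λ n → transpose n (toColumns L σ)) (entry-toColumns σ σ₁≤L))
  (≡.trans (transpose-transpose (ℓ σ) L (parts σ) (parts-decreasing σ σ₁≤L)) (pad-exact (parts σ) ≡.refl)))

toColumns∈ : ∀ {n L} σ → ℓ σ ≤ n → part σ 0 ≤ L → toColumns L σ ∈ columns n L
toColumns∈ {n} {L} σ ℓ≤n σ₁≤L = ∈-columns⁺ n L (decreasing-mono (toColumns L σ) ℓ≤n (decreasing-transpose L (parts σ))) (length-transpose L (parts σ))

size-toColumns : ∀ {L} σ → part σ 0 ≤ L → sum (toColumns L σ) ≡ size σ
size-toColumns {L} σ σ₁≤L = sum-transpose L (parts σ) (parts-decreasing σ σ₁≤L)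

private
  sum-C2 : ∀ as k → sum (map (_C 2) (map suc as ++ replicate k 0)) ≡ sum as ℕ.+ sum (map (_C 2) as)
  sum-C2 []       zero    = ≡.refl
  sum-C2 []       (suc k) = sum-C2 [] k
  sum-C2 (a ∷ as) k       = ≡.trans (≡.cong₂ ℕ._+_ ([1+n]C2 a) (sum-C2 as k))
    (+-interchange a (a C 2) (sum as) (sum (map (_C 2) as)))
    where
    +-interchange : ∀ a b c d → (a ℕ.+ b) ℕ.+ (c ℕ.+ d) ≡ (a ℕ.+ c) ℕ.+ (b ℕ.+ d)
    +-interchange a b c d = ≡.trans (ℕ.+-assoc a b (c ℕ.+ d)) (≡.trans (≡.cong (a ℕ.+_) (ℕ+-left-comm b c d)) (≡.sym (ℕ.+-assoc a c (b ℕ.+ d))))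

  n-list : List ℕ → ℕ
  n-list as = sum (zipWith ℕ._*_ (upTo (length as)) as)

  sum-zipWith-suc : ∀ (f : ℕ → ℕ) as → sum (zipWith ℕ._*_ (applyUpTo (suc ∘ f) (length as)) as) ≡ sum as ℕ.+ sum (zipWith ℕ._*_ (applyUpTo f (length as)) as)
  sum-zipWith-suc f []       = ≡.refl
  sum-zipWith-suc f (a ∷ as) = ≡.trans (≡.cong ((a ℕ.+ f 0 ℕ.* a) ℕ.+_) (sum-zipWith-suc (f ∘ suc) as))
    (≡.trans (ℕ.+-assoc a (f 0 ℕ.* a) _) (≡.trans (≡.cong (a ℕ.+_) (ℕ+-left-comm (f 0 ℕ.* a) (sum as) _)) (≡.sym (ℕ.+-assoc a (sum as) _))))

  n-transpose : ∀ L as → Decreasing L as → sum (map (_C 2) (transpose L as)) ≡ n-list as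
  n-transpose L []       _         = ≡.trans (≡.cong (λ cs → sum (map (_C 2) cs)) (applyUpTo-const 0 L)) (sum-C2 [] L)
  n-transpose L (a ∷ as) (a≤L , d) = ≡.trans (≡.cong (λ cs → sum (map (_C 2) cs)) (transpose-∷ L a as a≤L d))
    (≡.trans (sum-C2 (transpose a as) (L ∸ a)) (≡.trans (≡.cong₂ ℕ._+_ (sum-transpose a as d) (n-transpose a as d)) (≡.sym (sum-zipWith-suc (λ i → i) as))))

-- Each box of row i contributes i - 1 to n(σ). Summed along a column of height h, this is C(h, 2).
n-toColumns : ∀ {L} σ → part σ 0 ≤ L → sum (map (_C 2) (toColumns L σ)) ≡ n⟨ σ ⟩
n-toColumns {L} σ σ₁≤L = n-transpose L (parts σ) (parts-decreasing σ σ₁≤L)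

mult-conj : ∀ σ j → mult σ j ≡ conj σ j ∸ conj σ (suc j)
mult-conj σ j = ≡.trans (≡.sym (ℕ.m+n∸n≡m (mult σ j) (conj σ (suc j)))) (≡.cong (_∸ conj σ (suc j)) (split (parts σ)))
  where
  split : ∀ as → length (filter (j ℕ.≟_) as) ℕ.+ count≥ (suc j) as ≡ count≥ j as
  split []       = ≡.refl
  split (a ∷ as) = by-cases (ℕ.<-cmp j a)
    where
    by-cases : Tri (j < a) (j ≡ a) (a < j) → length (filter (j ℕ.≟_) (a ∷ as)) ℕ.+ count≥ (suc j) (a ∷ as) ≡ count≥ j (a ∷ as)
    by-cases (tri< j<a j≢a _) = ≡.trans (≡.cong₂ ℕ._+_ (≡.cong length (filter-reject (j ℕ.≟_) j≢a)) (count≥-accept (suc j) as j<a))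
      (≡.trans (ℕ.+-suc _ _) (≡.trans (≡.cong suc (split as)) (≡.sym (count≥-accept j as (ℕ.<⇒≤ j<a)))))
    by-cases (tri≈ _ ≡.refl _) = ≡.trans (≡.cong₂ ℕ._+_ (≡.cong length (filter-accept (j ℕ.≟_) ≡.refl)) (count≥-reject (suc j) as ℕ.≤-refl))
      (≡.trans (≡.cong suc (split as)) (≡.sym (count≥-accept j as ℕ.≤-refl)))
    by-cases (tri> _ j≢a a<j) = ≡.trans (≡.cong₂ ℕ._+_ (≡.cong length (filter-reject (j ℕ.≟_) j≢a)) (count≥-reject (suc j) as (ℕ.m<n⇒m<1+n a<j)))
      (≡.trans (split as) (≡.sym (count≥-reject j as a<j)))

⊆⇒conj≤ : ∀ {μ ν} → μ ⊆ ν → ∀ j → conj μ (suc j) ≤ conj ν (suc j)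
⊆⇒conj≤ {μ} {ν} μ⊆ν j = ℕ.≮⇒≥ λ d<c → ℕ.<-irrefl ≡.refl (count≥-entry j (parts ν) (conj ν (suc j))
  (ℕ.≤-trans (entry-count≥ j (parts μ) (conj ν (suc j)) d<c (parts-decreasing μ ℕ.≤-refl)) (μ⊆ν (conj ν (suc j)))) (parts-decreasing ν ℕ.≤-refl))

conj≤⇒⊆ : ∀ {μ ν} → (∀ j → conj μ (suc j) ≤ conj ν (suc j)) → μ ⊆ ν
conj≤⇒⊆ {μ} {ν} h i = bound (part μ i) ≡.refl
  where
  bound : ∀ p → part μ i ≡ p → p ≤ part ν i
  bound zero    _ = z≤n
  bound (suc j) e = entry-count≥ j (parts ν) i (ℕ.≤-trans (count≥-entry j (parts μ) i (ℕ.≤-reflexive (≡.sym e)) (parts-decreasing μ ℕ.≤-refl)) (h j)) (parts-decreasing ν ℕ.≤-refl)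

conj-0 : ∀ σ {j} → part σ 0 ≤ j → conj σ (suc j) ≡ 0
conj-0 σ σ₁≤j = count≥-none (parts σ) (parts-decreasing σ ℕ.≤-refl) (s≤s σ₁≤j)

⊆⇒ℓ≤ : ∀ {μ ν} → μ ⊆ ν → ℓ μ ≤ ℓ ν
⊆⇒ℓ≤ {μ} {ν} μ⊆ν = ≡.subst₂ _≤_ (ones μ) (ones ν) (⊆⇒conj≤ {μ} {ν} μ⊆ν 0)
  where
  ones : ∀ σ → conj σ 1 ≡ ℓ σ
  ones σ = ≡.cong length (filter-all (1 ℕ.≤?_) (parts-positive σ))

part≤size : ∀ σ i → part σ i ≤ size σ
part≤size σ i = entry≤sum (parts σ) i
  where
  entry≤sum : ∀ as i → entry as i ≤ sum as
  entry≤sum []       i       = z≤n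
  entry≤sum (a ∷ as) zero    = ℕ.m≤m+n a (sum as)
  entry≤sum (a ∷ as) (suc i) = ℕ.≤-trans (entry≤sum as i) (ℕ.m≤n+m (sum as) a)

ℓ≤size : ∀ σ → ℓ σ ≤ size σ
ℓ≤size σ = length≤sum (parts-positive σ)
  where
  length≤sum : ∀ {as} → All (0 <_) as → length as ≤ sum as
  length≤sum []       = z≤n
  length≤sum (p ∷ ps) = ℕ.+-mono-≤ p (length≤sum ps)

box : ℕ → ℕ → List Partition
box n L = map fromColumns (columns n L)

∈-box : ∀ {n L} σ → ℓ σ ≤ n → part σ 0 ≤ L → σ ∈ box n L
∈-box {n} {L} σ ℓ≤n σ₁≤L = ≡.subst (_∈ box n L) (from-to σ σ₁≤L) (∈-map⁺ fromColumns (toColumns∈ σ ℓ≤n σ₁≤L))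

unique-box : ∀ n L → Unique (box n L)
unique-box n L = unique-map (columns n L) (λ cs∈ → cs∈) (unique-columns n L)
  where
  unique-map : ∀ css → (∀ {cs} → cs ∈ css → cs ∈ columns n L) → Unique css → Unique (map fromColumns css)
  unique-map []         _ _           = AP.[]
  unique-map (cs ∷ css) h (c∉ AP.∷ u) = All.map⁺ (All.tabulate (λ ds∈ e → All.lookup c∉ ds∈
    (≡.trans (≡.sym (to-from (h (here ≡.refl)))) (≡.trans (≡.cong (toColumns L) e) (to-from (h (there ds∈))))))) AP.∷ unique-map css (h ∘ there) u

private
  unique-boundedLists : ∀ k b → Unique (boundedLists k b)
  unique-boundedLists zero    b = [] AP.∷ AP.[]
  unique-boundedLists (suc k) b = All.tabulate []∉ AP.∷ unique-concatMap (upTo (suc b)) (Unique.upTo⁺ (suc b))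
    where
    F : ℕ → List (List ℕ)
    F a = map (a ∷_) (boundedLists k b)
    []∉ : ∀ {v} → v ∈ concatMap F (upTo (suc b)) → [] ≢ v
    []∉ v∈ e with find (∈-concatMap⁻ F {xs = upTo (suc b)} v∈)
    ... | a , _ , v∈′ with ∈-map⁻ (a ∷_) v∈′
    []∉ v∈ () | a , _ , v∈′ | _ , _ , ≡.refl
    unique-concatMap : ∀ as → Unique as → Unique (concatMap F as)
    unique-concatMap []       _           = AP.[]
    unique-concatMap (a ∷ as) (a∉ AP.∷ u) = Unique.++⁺ (Unique.map⁺ ∷-injectiveʳ (unique-boundedLists k b)) (unique-concatMap as u) disjoint
      where
      disjoint : ∀ {v} → ¬ (v ∈ F a × v ∈ concatMap F as)
      disjoint (v∈ , v∈′) with ∈-map⁻ (a ∷_) v∈ | find (∈-concatMap⁻ F {xs = as} v∈′)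
      ... | _ , _ , ≡.refl | c , c∈ , w∈ with ∈-map⁻ (c ∷_) w∈
      ... | _ , _ , ≡.refl = All.lookup a∉ c∈ ≡.refl

  ∈-boundedLists : ∀ k b {as} → length as ≤ k → All (_≤ b) as → as ∈ boundedLists k b
  ∈-boundedLists zero    b {[]}     _       _        = here ≡.refl
  ∈-boundedLists (suc k) b {[]}     _       _        = here ≡.refl
  ∈-boundedLists (suc k) b {a ∷ as} (s≤s l) (p ∷ ps) = there (∈-concatMap⁺ (λ a → map (a ∷_) (boundedLists k b))
    (lose (∈-upTo⁺ (s≤s p)) (∈-map⁺ (a ∷_) (∈-boundedLists k b l ps))))

  toPartition-parts : ∀ {as σ} → toPartition as ≡ just σ → parts σ ≡ as
  toPartition-parts {as} e with linked? ℕ._≥?_ as | all? (0 ℕ.<?_) as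
  toPartition-parts ≡.refl | yes _ | yes _ = ≡.refl

  toPartition-just : ∀ σ → toPartition (parts σ) ≡ just σ
  toPartition-just σ with linked? ℕ._≥?_ (parts σ) | all? (0 ℕ.<?_) (parts σ)
  ... | yes _ | yes _ = ≡.refl
  ... | yes _ | no ¬p = contradiction (parts-positive σ) ¬p
  ... | no ¬d | _     = contradiction (Decreasing⇒Linked (parts σ) (parts-decreasing σ ℕ.≤-refl)) ¬d

  ∈-mapMaybe⁺ : ∀ {ass as} σ → as ∈ ass → toPartition as ≡ just σ → σ ∈ mapMaybe toPartition ass
  ∈-mapMaybe⁺ {as ∷ ass} σ (here ≡.refl) e rewrite e = here ≡.refl
  ∈-mapMaybe⁺ {bs ∷ ass} σ (there as∈)   e with toPartition bs
  ... | just _  = there (∈-mapMaybe⁺ σ as∈ e)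
  ... | nothing = ∈-mapMaybe⁺ σ as∈ e

  ∈-mapMaybe⁻ : ∀ ass {σ} → σ ∈ mapMaybe toPartition ass → parts σ ∈ ass
  ∈-mapMaybe⁻ (as ∷ ass) σ∈ with toPartition as in e
  ∈-mapMaybe⁻ (as ∷ ass) (here ≡.refl) | just _  = here (toPartition-parts e)
  ∈-mapMaybe⁻ (as ∷ ass) (there σ∈)    | just _  = there (∈-mapMaybe⁻ ass σ∈)
  ∈-mapMaybe⁻ (as ∷ ass) σ∈            | nothing = there (∈-mapMaybe⁻ ass σ∈)

  unique-mapMaybe : ∀ ass → Unique ass → Unique (mapMaybe toPartition ass)
  unique-mapMaybe []         _           = AP.[]
  unique-mapMaybe (as ∷ ass) (a∉ AP.∷ u) with toPartition as in e
  ... | nothing = unique-mapMaybe ass u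
  ... | just σ  = All.tabulate (λ τ∈ σ≡τ → All.lookup a∉ (∈-mapMaybe⁻ ass τ∈) (≡.trans (≡.sym (toPartition-parts e)) (≡.cong parts σ≡τ)))
    AP.∷ unique-mapMaybe ass u

unique-interval : ∀ μ ρ → Unique (interval μ ρ)
unique-interval μ ρ = Unique.filter⁺ _ (unique-mapMaybe _ (unique-boundedLists (ℓ ρ) (part ρ 0)))

∈-interval⁻ : ∀ {μ ρ ν} → ν ∈ interval μ ρ → μ ⊆ ν × ν ⊆ ρ
∈-interval⁻ {μ} {ρ} ν∈ = proj₂ (∈-filter⁻ (λ ν → (μ ⊆? ν) ×-dec (ν ⊆? ρ)) {xs = mapMaybe toPartition (boundedLists (ℓ ρ) (part ρ 0))} ν∈)

∈-interval⁺ : ∀ {μ ρ ν} → μ ⊆ ν → ν ⊆ ρ → ν ∈ interval μ ρ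
∈-interval⁺ {μ} {ρ} {ν} μ⊆ν ν⊆ρ = ∈-filter⁺ (λ ν → (μ ⊆? ν) ×-dec (ν ⊆? ρ)) {xs = mapMaybe toPartition (boundedLists (ℓ ρ) (part ρ 0))}
  (∈-mapMaybe⁺ ν (∈-boundedLists (ℓ ρ) (part ρ 0) (⊆⇒ℓ≤ {ν} {ρ} ν⊆ρ) (bounded (parts ν) (parts-decreasing ν (ν⊆ρ 0)))) (toPartition-just ν))
  (μ⊆ν , ν⊆ρ)
  where
  bounded : ∀ {n} as → Decreasing n as → All (_≤ n) as
  bounded []       _         = []
  bounded (a ∷ as) (a≤n , d) = a≤n ∷ bounded as (decreasing-mono as a≤n d)

-- The definitions of v, vs and sk in terms of columns.

module PartitionCoefficients (K : Field) (q : Field.Carrier K)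
  (1-qᵏ≉0 : ∀ k → ¬ (Field._≈_ K (Field._-_ K (Field.1# K) (FieldOperations._^_ K q (suc k))) (Field.0# K)))
  where
  open Field K hiding (zero)
  open FieldOperations K
  open HallLittlewood K q using (vₘ; v; vs; sk)
  open QBinomial K q 1-qᵏ≉0
  open ColumnCoefficients K q 1-qᵏ≉0
  open FieldLemmas K
  open Sums commutativeRing
  open Algebra.Properties.CommutativeSemiring.Exp commutativeSemiring using (^-homo-*)
  open import Relation.Binary.Reasoning.Setoid setoid

  private
    ∏-upTo-≤ : ∀ {m n} → m ≤ n → (f : ℕ → Carrier) → (∀ {i} → m ≤ i → f i ≈ 1#) → ∏ (upTo n) f ≈ ∏ (upTo m) f
    ∏-upTo-≤ {m} {n} m≤n f h with ℕ.m≤n⇒m<n∨m≡n m≤n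
    ... | inj₂ ≡.refl = refl
    ∏-upTo-≤ {m} {suc n} m≤n f h | inj₁ m<n = trans (∏-upTo-last n f)
      (trans (*-cong (∏-upTo-≤ (ℕ.s≤s⁻¹ m<n) f h) (h (ℕ.s≤s⁻¹ m<n))) (*-identityʳ _))

    ∏-upTo-0 : ∀ {j n} → j < n → (f : ℕ → Carrier) → f j ≈ 0# → ∏ (upTo n) f ≈ 0#
    ∏-upTo-0 {zero}  {suc n} _         f e = trans (∏-upTo-suc n f) (trans (*-congʳ e) (zeroˡ _))
    ∏-upTo-0 {suc j} {suc n} (s≤s j<n) f e = trans (∏-upTo-suc n f) (trans (*-congˡ (∏-upTo-0 j<n (f ∘ suc) e)) (zeroʳ _))

    entry-applyUpTo : ∀ (f : ℕ → ℕ) L → f L ≡ 0 → entry (applyUpTo f L) 0 ≡ f 0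
    entry-applyUpTo f zero    e = ≡.sym e
    entry-applyUpTo f (suc L) e = ≡.refl

    normalization-applyUpTo : ∀ n L (f : ℕ → ℕ) → f L ≡ 0 →
      normalization (applyUpTo f L) n ≈ vₘ (n ∸ f 0) * ∏ (upTo L) (λ i → vₘ (f i ∸ f (suc i)))
    normalization-applyUpTo n zero    f e = trans (reflexive (≡.cong (λ k → vₘ (n ∸ k)) (≡.sym e))) (sym (*-identityʳ _))
    normalization-applyUpTo n (suc L) f e = *-congˡ (trans (normalization-applyUpTo (f 0) L (f ∘ suc) e) (sym (∏-upTo-suc L _)))

    vertical-applyUpTo : ∀ L (f h : ℕ → ℕ) → (∀ i → h i ≤ f i) → f L ≡ 0 →
      verticalCoefficient (applyUpTo f L) (applyUpTo h L) ≈ ∏ (upTo L) (λ i → g (f i ∸ f (suc i)) (f i ∸ h i))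
    vertical-applyUpTo zero    f h h≤f e = refl
    vertical-applyUpTo (suc L) f h h≤f e = trans (*-cong
      (trans (χ-yes-* (h 0 ℕ.≤? f 0) (h≤f 0)) (reflexive (≡.cong (λ k → g (f 0 ∸ k) (f 0 ∸ h 0)) (entry-applyUpTo (f ∘ suc) L e))))
      (vertical-applyUpTo L (f ∘ suc) (h ∘ suc) (h≤f ∘ suc) e)) (sym (∏-upTo-suc L _))

    skew-applyUpTo : ∀ L (f h : ℕ → ℕ) → (∀ i → h i ≤ f i) → h L ≡ 0 →
      skewCoefficient (applyUpTo f L) (applyUpTo h L)
        ≈ ∏ (upTo L) (λ i → q ^ ((f i ∸ h i) C 2) * g (f i ∸ h (suc i)) (h i ∸ h (suc i)))
    skew-applyUpTo zero    f h h≤f e = refl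
    skew-applyUpTo (suc L) f h h≤f e = trans (*-cong
      (trans (χ-yes-* (h 0 ℕ.≤? f 0) (h≤f 0)) (reflexive (≡.cong (λ k → q ^ ((f 0 ∸ h 0) C 2) * g (f 0 ∸ k) (h 0 ∸ k)) (entry-applyUpTo (h ∘ suc) L e))))
      (skew-applyUpTo L (f ∘ suc) (h ∘ suc) (h≤f ∘ suc) e)) (sym (∏-upTo-suc L _))

    -- Containment is read off contrapositively: a nonzero coefficient needs all its brackets to be
    -- 1.
    vertical≉0 : ∀ L (f h : ℕ → ℕ) → ¬ (verticalCoefficient (applyUpTo f L) (applyUpTo h L) ≈ 0#) → ∀ {i} → i < L → h i ≤ f i
    vertical≉0 (suc L) f h c≉0 {zero}  _         = Dec.decidable-stable (h 0 ℕ.≤? f 0) (λ h≰f → c≉0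
      (trans (*-congʳ (trans (*-congʳ (χ-no (h 0 ℕ.≤? f 0) h≰f)) (zeroˡ _))) (zeroˡ _)))
    vertical≉0 (suc L) f h c≉0 {suc i} (s≤s i<L) = vertical≉0 L (f ∘ suc) (h ∘ suc) (λ e → c≉0 (trans (*-congˡ e) (zeroʳ _))) i<L

    skew≉0 : ∀ L (f h : ℕ → ℕ) → ¬ (skewCoefficient (applyUpTo f L) (applyUpTo h L) ≈ 0#) → ∀ {i} → i < L → h i ≤ f i
    skew≉0 (suc L) f h c≉0 {zero}  _         = Dec.decidable-stable (h 0 ℕ.≤? f 0) (λ h≰f → c≉0
      (trans (*-congʳ (trans (*-congʳ (χ-no (h 0 ℕ.≤? f 0) h≰f)) (zeroˡ _))) (zeroˡ _)))
    skew≉0 (suc L) f h c≉0 {suc i} (s≤s i<L) = skew≉0 L (f ∘ suc) (h ∘ suc) (λ e → c≉0 (trans (*-congˡ e) (zeroʳ _))) i<L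

    below⇒⊆ : ∀ {L} μ ν → part μ 0 ≤ L → (∀ {i} → i < L → conj μ (suc i) ≤ conj ν (suc i)) → μ ⊆ ν
    below⇒⊆ {L} μ ν μ₁≤L h = conj≤⇒⊆ {μ} {ν} (λ j → by-cases j (j ℕ.<? L))
      where
      by-cases : ∀ j → Dec (j < L) → conj μ (suc j) ≤ conj ν (suc j)
      by-cases j (yes j<L) = h j<L
      by-cases j (no j≮L)  = ≡.subst (_≤ conj ν (suc j)) (≡.sym (conj-0 μ (ℕ.≤-trans μ₁≤L (ℕ.≮⇒≥ j≮L)))) z≤n

  vertical-⊈ : ∀ {L} σ ν → part ν 0 ≤ L → ¬ (ν ⊆ σ) → verticalCoefficient (toColumns L σ) (toColumns L ν) ≈ 0#
  vertical-⊈ {L} σ ν ν₁≤L ν⊈σ = Dec.decidable-stable (_ ≟ 0#) (λ c≉0 → ν⊈σ (below⇒⊆ ν σ ν₁≤L (vertical≉0 L _ _ c≉0)))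

  skew-⊈ : ∀ {L} ν μ → part μ 0 ≤ L → ¬ (μ ⊆ ν) → skewCoefficient (toColumns L ν) (toColumns L μ) ≈ 0#
  skew-⊈ {L} ν μ μ₁≤L μ⊈ν = Dec.decidable-stable (_ ≟ 0#) (λ c≉0 → μ⊈ν (below⇒⊆ μ ν μ₁≤L (skew≉0 L _ _ c≉0)))

  v-columns : ∀ n {L} σ → part σ 0 ≤ L → v n σ ≈ normalization (toColumns L σ) n
  v-columns n {L} σ σ₁≤L = begin
    vₘ (n ∸ ℓ σ) * ∏ (upTo (part σ 0)) (λ i → vₘ (mult σ (suc i)))
      ≈⟨ *-cong (reflexive (≡.cong (λ k → vₘ (n ∸ k)) (≡.sym (≡.cong length (filter-all (1 ℕ.≤?_) (parts-positive σ))))))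
           (sym (∏-upTo-≤ σ₁≤L _ (λ {i} σ₁≤i → reflexive (≡.cong vₘ (≡.trans (mult-conj σ (suc i)) (≡.trans (≡.cong (_∸ conj σ (2 ℕ.+ i)) (conj-0 σ σ₁≤i)) (ℕ.0∸n≡0 (conj σ (2 ℕ.+ i))))))))) ⟩
    vₘ (n ∸ conj σ 1) * ∏ (upTo L) (λ i → vₘ (mult σ (suc i)))
      ≈⟨ *-congˡ (∏-cong (upTo L) (λ i → reflexive (≡.cong vₘ (mult-conj σ (suc i))))) ⟩
    vₘ (n ∸ conj σ 1) * ∏ (upTo L) (λ i → vₘ (conj σ (suc i) ∸ conj σ (2 ℕ.+ i)))
      ≈⟨ normalization-applyUpTo n L (conj σ ∘ suc) (conj-0 σ σ₁≤L) ⟨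
    normalization (toColumns L σ) n ∎

  -- The product of binomials detects the strip condition: if it is nonzero, `strip` derives the
  -- condition. Hence both sides vanish together when the strip is not vertical.
  vs-columns : ∀ {L} σ ν → part σ 0 ≤ L → ν ⊆ σ → vs σ ν ≈ verticalCoefficient (toColumns L σ) (toColumns L ν)
  vs-columns {L} σ ν σ₁≤L ν⊆σ = trans (by-cases (verticalStrip? σ ν) (∏ (upTo (part σ 0)) f ≟ 0#))
    (trans (sym (∏-upTo-≤ σ₁≤L f (λ {i} σ₁≤i → trans (reflexive (≡.cong (λ c → g (c ∸ conj σ (2 ℕ.+ i)) (c ∸ conj ν (suc i))) (conj-0 σ σ₁≤i)))
        (trans (reflexive (≡.cong₂ g (ℕ.0∸n≡0 (conj σ (2 ℕ.+ i))) (ℕ.0∸n≡0 (conj ν (suc i))))) (gaussian-0 0)))))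
      (sym (vertical-applyUpTo L (conj σ ∘ suc) (conj ν ∘ suc) (⊆⇒conj≤ {ν} {σ} ν⊆σ) (conj-0 σ σ₁≤L))))
    where
    f : ℕ → Carrier
    f i = g (conj σ (suc i) ∸ conj σ (2 ℕ.+ i)) (conj σ (suc i) ∸ conj ν (suc i))
    -- If σᵢ > νᵢ + 1, then the factor with index j = νᵢ + 1 vanishes because νᶜⱼ < σᶜⱼ₊₁.
    strip : ¬ (∏ (upTo (part σ 0)) f ≈ 0#) → VerticalStrip σ ν
    strip f≉0 i = Dec.decidable-stable (part σ i ℕ.≤? part ν i ℕ.+ 1) λ σᵢ≰ → f≉0 (vanish (≡.subst (_< part σ i) (ℕ.+-comm (part ν i) 1) (ℕ.≰⇒> σᵢ≰)))
      where
      part≤ : ∀ as {n} → Decreasing n as → ∀ i → entry as i ≤ n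
      part≤ []       _         i       = z≤n
      part≤ (a ∷ as) (a≤n , _) zero    = a≤n
      part≤ (a ∷ as) (a≤n , d) (suc i) = ℕ.≤-trans (part≤ as d i) a≤n
      vanish : suc (part ν i) < part σ i → ∏ (upTo (part σ 0)) f ≈ 0#
      vanish νᵢ+1<σᵢ = ∏-upTo-0 (ℕ.<-≤-trans (ℕ.<⇒≤ νᵢ+1<σᵢ) (part≤ (parts σ) (parts-decreasing σ ℕ.≤-refl) i)) f
        (gaussian-> (ℕ.∸-monoʳ-< (ℕ.≤-<-trans νᶜ≤i (count≥-entry (suc (part ν i)) (parts σ) i νᵢ+1<σᵢ (parts-decreasing σ ℕ.≤-refl)))
          (count≥-antitone (suc (part ν i)) (parts σ))))
        where
        νᶜ≤i : conj ν (suc (part ν i)) ≤ i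
        νᶜ≤i = ℕ.≮⇒≥ (λ i< → ℕ.<-irrefl ≡.refl (entry-count≥ (part ν i) (parts ν) i i< (parts-decreasing ν ℕ.≤-refl)))
    by-cases : (d : Dec (VerticalStrip σ ν)) → Dec (∏ (upTo (part σ 0)) f ≈ 0#) → (if does d then ∏ (upTo (part σ 0)) f else 0#) ≈ ∏ (upTo (part σ 0)) f
    by-cases (yes _) _         = refl
    by-cases (no _)  (yes z)   = sym z
    by-cases (no ¬s) (no ¬z)   = contradiction (strip ¬z) ¬s

  sk-columns : ∀ {L} ν μ → part ν 0 ≤ L → μ ⊆ ν → sk ν μ ≈ skewCoefficient (toColumns L ν) (toColumns L μ)
  sk-columns {L} ν μ ν₁≤L μ⊆ν = begin
    q ^ sum (map e (upTo (part ν 0))) * ∏ (upTo (part ν 0)) (λ i → g (conj ν (suc i) ∸ conj μ (2 ℕ.+ i)) (mult μ (suc i)))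
      ≈⟨ *-cong (^-sum (upTo (part ν 0))) (∏-cong (upTo (part ν 0)) (λ i → reflexive (≡.cong (g (conj ν (suc i) ∸ conj μ (2 ℕ.+ i))) (mult-conj μ (suc i))))) ⟩
    ∏ (upTo (part ν 0)) (λ i → q ^ e i) * ∏ (upTo (part ν 0)) G
      ≈⟨ ∏-* (upTo (part ν 0)) (λ i → q ^ e i) G ⟨
    ∏ (upTo (part ν 0)) (λ i → q ^ e i * G i)
      ≈⟨ ∏-upTo-≤ ν₁≤L (λ i → q ^ e i * G i) (λ {i} ν₁≤i → trans (*-cong
           (reflexive (≡.cong (λ k → q ^ (k C 2)) (≡.trans (≡.cong (_∸ conj μ (suc i)) (conj-0 ν ν₁≤i)) (ℕ.0∸n≡0 (conj μ (suc i))))))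
           (trans (reflexive (≡.cong₂ g ≡.refl (≡.trans (≡.cong (_∸ conj μ (2 ℕ.+ i)) (conj-0 μ (ℕ.≤-trans (μ⊆ν 0) ν₁≤i))) (ℕ.0∸n≡0 (conj μ (2 ℕ.+ i)))))) (gaussian-0 (conj ν (suc i) ∸ conj μ (2 ℕ.+ i))))) (*-identityˡ 1#)) ⟨
    ∏ (upTo L) (λ i → q ^ e i * G i)
      ≈⟨ skew-applyUpTo L (conj ν ∘ suc) (conj μ ∘ suc) (⊆⇒conj≤ {μ} {ν} μ⊆ν) (conj-0 μ (ℕ.≤-trans (μ⊆ν 0) ν₁≤L)) ⟨
    skewCoefficient (toColumns L ν) (toColumns L μ) ∎
    where
    e : ℕ → ℕ
    e i = (conj ν (suc i) ∸ conj μ (suc i)) C 2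
    G : ℕ → Carrier
    G i = g (conj ν (suc i) ∸ conj μ (2 ℕ.+ i)) (conj μ (suc i) ∸ conj μ (2 ℕ.+ i))
    ^-sum : ∀ xs → q ^ sum (map e xs) ≈ ∏ xs (λ i → q ^ e i)
    ^-sum []       = refl
    ^-sum (x ∷ xs) = trans (^-homo-* q (e x) _) (*-congˡ (^-sum xs))

-- The skew Pieri expansion in a fixed number of variables.

-- A list of positive entries has a sum at least equal to its length, so some column is 0, and then
-- so is the last one.
last≡0 : ∀ n cs → Decreasing n cs → sum cs < length cs → Last≡0 n cs
last≡0 n (zero ∷ cs) (_ , d) _ = zeros cs d
  where
  zeros : ∀ cs → Decreasing 0 cs → Last≡0 0 cs
  zeros []       _         = ≡.refl
  zeros (0 ∷ cs) (z≤n , d) = zeros cs d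
last≡0 n (suc c ∷ cs) (_ , d) (s≤s c+s<l) = last≡0 (suc c) cs d (ℕ.≤-<-trans (ℕ.m≤n+m (sum cs) c) c+s<l)

decreasing-replicate-0 : ∀ n L → Decreasing n (replicate L 0)
decreasing-replicate-0 n zero    = tt
decreasing-replicate-0 n (suc L) = z≤n , decreasing-replicate-0 0 L

module ColumnSupport (K : Field) (q : Field.Carrier K)
  (1-qᵏ≉0 : ∀ k → ¬ (Field._≈_ K (Field._-_ K (Field.1# K) (FieldOperations._^_ K q (suc k))) (Field.0# K)))
  where
  open Field K hiding (zero)
  open Sums commutativeRing
  open ColumnCoefficients K q 1-qᵏ≉0

  -- The truncated differences in `deficit` measure |λ/ν| only for ν ⊆ λ, and the coefficient
  -- vanishes in the other case. The alternative lets degree arguments run over all ν in the box.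
  vertical-sum : ∀ λs νs → length λs ≡ length νs → verticalCoefficient λs νs ≈ 0# ⊎ sum λs ≡ deficit λs νs ℕ.+ sum νs
  vertical-sum []       []       _ = inj₂ ≡.refl
  vertical-sum (d ∷ ds) (c ∷ cs) e with c ℕ.≤? d | vertical-sum ds cs (ℕ.suc-injective e)
  ... | no c≰d | _      = inj₁ (trans (*-congʳ (trans (*-congʳ (χ-no (c ℕ.≤? d) c≰d)) (zeroˡ _))) (zeroˡ _))
  ... | yes _  | inj₁ z = inj₁ (trans (*-congˡ z) (zeroʳ _))
  ... | yes c≤d | inj₂ e′ = inj₂ (≡.trans (≡.cong₂ ℕ._+_ (≡.sym (ℕ.m∸n+n≡m c≤d)) e′)
    (≡.trans (ℕ.+-assoc (d ∸ c) c _) (≡.trans (≡.cong ((d ∸ c) ℕ.+_) (ℕ+-left-comm c (deficit ds cs) (sum cs))) (≡.sym (ℕ.+-assoc (d ∸ c) (deficit ds cs) _)))))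

  skew-sum : ∀ νs μs → length νs ≡ length μs → skewCoefficient νs μs ≈ 0# ⊎ sum μs ≤ sum νs
  skew-sum []       []       _ = inj₂ z≤n
  skew-sum (d ∷ ds) (c ∷ cs) e with c ℕ.≤? d | skew-sum ds cs (ℕ.suc-injective e)
  ... | no c≰d | _       = inj₁ (trans (*-congʳ (trans (*-congʳ (χ-no (c ℕ.≤? d) c≰d)) (zeroˡ _))) (zeroˡ _))
  ... | yes _  | inj₁ z  = inj₁ (trans (*-congˡ z) (zeroʳ _))
  ... | yes c≤d | inj₂ p = inj₂ (ℕ.+-mono-≤ c≤d p)

module SkewPieri (K : Field) (t : Field.Carrier K)
  (1-tᵏ≉0 : ∀ k → ¬ (Field._≈_ K (Field._-_ K (Field.1# K) (FieldOperations._^_ K t (suc k))) (Field.0# K)))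
  (F : Field) (s : RingHom (Field.commutativeRing K) (Field.commutativeRing F))
  {n : ℕ} (L : ℕ) (xs : Vec (Field.Carrier F) n)
  where
  open ColumnCoefficients K t 1-tᵏ≉0
  open ColumnSupport K t 1-tᵏ≉0
  private
    module K = Field K
    module KO = FieldOperations K
    module KS = Sums K.commutativeRing
    y = K.- K.1#
    module W = SkewSums K t 1-tᵏ≉0 (idHom K.commutativeRing) y
  open RingHom s
  open Field F hiding (zero)
  open FieldOperations F
  open FieldLemmas F
  open Sums commutativeRing
  open BinarySums commutativeRing
  open Algebra.Properties.Ring ring using (+-cancelʳ)
  open Symmetrization F ⟦ t ⟧
  open Pieri K t 1-tᵏ≉0 s
  open import Relation.Binary.Reasoning.Setoid setoid

  private
    N : List ℕ → Carrier
    N cs = ⟦ normalization cs n ⟧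

    N≉0 : ∀ cs → ¬ (N cs ≈ 0#)
    N≉0 cs e = 1≉0 (trans (sym 1-homo) (trans (⟦⟧-cong (K.sym (K.⁻¹-inverse (normalization≉0 cs n))))
      (trans (*-homo _ _) (trans (*-congʳ e) (zeroˡ _)))))

    box′ = columns n L

  P : List ℕ → Carrier
  P cs = N cs ⁻¹ * R (transpose n cs) xs

  private
    N-P : ∀ cs → N cs * P cs ≈ R (transpose n cs) xs
    N-P cs = trans (sym (*-assoc _ _ _)) (trans (*-congʳ (⁻¹-inverse (N≉0 cs))) (*-identityˡ _))

    straight : ∀ r → Straight n (λ β → χ (sum β ℕ.≟ r) * R β xs)
    straight r α a γ e = trans (*-cong (χ-cong (sum (α ++ a ∷ suc a ∷ γ) ℕ.≟ r) (sum (α ++ suc a ∷ a ∷ γ) ℕ.≟ r) (≡.trans (≡.sym sums)) (≡.trans sums))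
        (straighten α a γ xs e))
      (S.solve 3 (λ x y z → x S.:* (y S.:* z) S.:= y S.:* (x S.:* z)) refl (χ (sum (α ++ suc a ∷ a ∷ γ) ℕ.≟ r)) ⟦ t ⟧ (R (α ++ suc a ∷ a ∷ γ) xs))
      where
      sums : sum (α ++ a ∷ suc a ∷ γ) ≡ sum (α ++ suc a ∷ a ∷ γ)
      sums = ≡.trans (sum-++ α _) (≡.trans (≡.cong (sum α ℕ.+_) (ℕ+-left-comm a (suc a) (sum γ))) (≡.sym (sum-++ α _)))

  scalar-P : ∀ a cs → ⟦ a ⟧ * P cs ≈ ⟦ a K.* normalization cs n K.⁻¹ ⟧ * R (transpose n cs) xs
  scalar-P a cs = trans (sym (*-assoc _ _ _)) (*-congʳ (sym (trans (*-homo _ _) (*-congˡ (⁻¹-unique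
    (trans (sym (*-homo _ _)) (trans (⟦⟧-cong (K.⁻¹-inverse (normalization≉0 cs n))) 1-homo)))))))

  -- After multiplication by the normalization, `T-columns` applies to `R`, and
  -- `rawCoefficient-normalization` converts its coefficients to vs. The bound on the degree makes
  -- the last column 0.
  pieri : ∀ r {cs} → cs ∈ box′ → sum cs < L →
    elementary r xs * P cs ≈ ∑ box′ (λ ds → χ (sum ds ℕ.≟ r ℕ.+ sum cs) * (⟦ verticalCoefficient ds cs ⟧ * P ds))
  pieri r {cs} cs∈ |cs|<L = *-cancelˡ (N≉0 cs) (begin
    N cs * (elementary r xs * P cs)
      ≈⟨ S.solve 3 (λ x y z → x S.:* (y S.:* z) S.:= y S.:* (x S.:* z)) refl (N cs) (elementary r xs) (P cs) ⟩
    elementary r xs * (N cs * P cs)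
      ≈⟨ *-congˡ (N-P cs) ⟩
    elementary r xs * R (transpose n cs) xs
      ≈⟨ elementary-R r (transpose n cs) xs (length-transpose n cs) ⟩
    T (transpose n cs) Φ
      ≈⟨ T-columns n cs d (last≡0 n cs d (≡.subst (sum cs <_) (≡.sym l) |cs|<L)) (straight (r ℕ.+ sum (transpose n cs))) ⟩
    ∑ (columns n (length cs)) (λ ds → ⟦ rawCoefficient cs n ds ⟧ * Φ (transpose n ds))
      ≡⟨ ≡.cong (λ l → ∑ (columns n l) (λ ds → ⟦ rawCoefficient cs n ds ⟧ * Φ (transpose n ds))) l ⟩
    ∑ box′ (λ ds → ⟦ rawCoefficient cs n ds ⟧ * Φ (transpose n ds))
      ≈⟨ ∑-cong∈ box′ term-wise ⟩
    ∑ box′ (λ ds → N cs * (χ (sum ds ℕ.≟ r ℕ.+ sum cs) * (⟦ verticalCoefficient ds cs ⟧ * P ds)))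
      ≈⟨ *-∑ (N cs) box′ _ ⟨
    N cs * ∑ box′ (λ ds → χ (sum ds ℕ.≟ r ℕ.+ sum cs) * (⟦ verticalCoefficient ds cs ⟧ * P ds)) ∎)
    where
    d = proj₁ (∈-columns⁻ n L cs∈)
    l = proj₂ (∈-columns⁻ n L cs∈)
    Φ : List ℕ → Carrier
    Φ β = χ (sum β ℕ.≟ r ℕ.+ sum (transpose n cs)) * R β xs
    term-wise : ∀ {ds} → ds ∈ box′ → ⟦ rawCoefficient cs n ds ⟧ * Φ (transpose n ds)
      ≈ N cs * (χ (sum ds ℕ.≟ r ℕ.+ sum cs) * (⟦ verticalCoefficient ds cs ⟧ * P ds))
    term-wise {ds} ds∈ = begin
      ⟦ rawCoefficient cs n ds ⟧ * Φ (transpose n ds)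
        ≈⟨ *-congˡ (*-cong (reflexive (≡.cong₂ (λ a b → χ (a ℕ.≟ r ℕ.+ b)) (sum-transpose n ds d′) (sum-transpose n cs d))) (sym (N-P ds))) ⟩
      ⟦ rawCoefficient cs n ds ⟧ * (c * (N ds * P ds))
        ≈⟨ S.solve 4 (λ a c N p → a S.:* (c S.:* (N S.:* p)) S.:= (a S.:* N) S.:* (c S.:* p)) refl ⟦ rawCoefficient cs n ds ⟧ c (N ds) (P ds) ⟩
      (⟦ rawCoefficient cs n ds ⟧ * N ds) * (c * P ds)
        ≈⟨ *-congʳ (trans (sym (*-homo _ _)) (trans (⟦⟧-cong (rawCoefficient-normalization n cs ds d d′ (≡.trans l′ (≡.sym l)))) (*-homo _ _))) ⟩
      (N cs * ⟦ verticalCoefficient ds cs ⟧) * (c * P ds)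
        ≈⟨ S.solve 4 (λ N v c p → (N S.:* v) S.:* (c S.:* p) S.:= N S.:* (c S.:* (v S.:* p))) refl (N cs) ⟦ verticalCoefficient ds cs ⟧ c (P ds) ⟩
      N cs * (c * (⟦ verticalCoefficient ds cs ⟧ * P ds)) ∎
      where
      c = χ (sum ds ℕ.≟ r ℕ.+ sum cs)
      d′ = proj₁ (∈-columns⁻ n L ds∈)
      l′ = proj₂ (∈-columns⁻ n L ds∈)

  -- The coefficient of yᵐ in ∑_ν vs_{λ/ν} sk_{ν/μ} y^{|λ/ν|}.
  M : ℕ → List ℕ → List ℕ → K.Carrier
  M m λs μs = KO.∑ box′ (λ νs → KS.χ (sum λs ℕ.≟ m ℕ.+ sum νs) K.* (verticalCoefficient λs νs K.* skewCoefficient νs μs))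

  -- This turns out to be hₖ P_μ.
  Q : List ℕ → ℕ → Carrier
  Q μs k = ∑ box′ (λ νs → χ (sum νs ℕ.≟ k ℕ.+ sum μs) * (⟦ skewCoefficient νs μs ⟧ * P νs))

  -- The Pieri rule is applied to each P_ν, where the bracket |ν| = k + |μ| supplies the required
  -- bound on |ν|. Summing over ν first then produces `M`.
  elementary-Q : ∀ m μs k → k ℕ.+ sum μs < L →
    elementary m xs * Q μs k ≈ ∑ box′ (λ λs → χ (sum λs ℕ.≟ m ℕ.+ (k ℕ.+ sum μs)) * (⟦ M m λs μs ⟧ * P λs))
  elementary-Q m μs k bound = begin
    elementary m xs * Q μs k
      ≈⟨ *-∑ _ box′ _ ⟩
    ∑ box′ (λ νs → elementary m xs * (χ (sum νs ℕ.≟ a) * (⟦ skewCoefficient νs μs ⟧ * P νs)))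
      ≈⟨ ∑-cong∈ box′ (λ {νs} νs∈ → trans
           (S.solve 4 (λ e c k p → e S.:* (c S.:* (k S.:* p)) S.:= c S.:* (k S.:* (e S.:* p))) refl (elementary m xs) (χ (sum νs ℕ.≟ a)) ⟦ skewCoefficient νs μs ⟧ (P νs))
           (trans (χ-*-cong (sum νs ℕ.≟ a) (λ e → trans (*-congˡ (pieri m νs∈ (≡.subst (_< L) (≡.sym e) bound))) (*-∑ _ box′ _))) (*-∑ _ box′ _))) ⟩
    ∑ box′ (λ νs → ∑ box′ (λ λs → χ (sum νs ℕ.≟ a) * (⟦ skewCoefficient νs μs ⟧ * (χ (sum λs ℕ.≟ m ℕ.+ sum νs) * (⟦ verticalCoefficient λs νs ⟧ * P λs)))))
      ≈⟨ ∑-swap box′ box′ _ ⟩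
    ∑ box′ (λ λs → ∑ box′ (λ νs → χ (sum νs ℕ.≟ a) * (⟦ skewCoefficient νs μs ⟧ * (χ (sum λs ℕ.≟ m ℕ.+ sum νs) * (⟦ verticalCoefficient λs νs ⟧ * P λs)))))
      ≈⟨ ∑-cong box′ (λ λs → trans (∑-cong box′ (rearrange λs)) (sym (collect λs))) ⟩
    ∑ box′ (λ λs → χ (sum λs ℕ.≟ m ℕ.+ a) * (⟦ M m λs μs ⟧ * P λs)) ∎
    where
    a = k ℕ.+ sum μs
    χ-shift : ∀ l v → χ (v ℕ.≟ a) * χ (l ℕ.≟ m ℕ.+ v) ≈ χ (l ℕ.≟ m ℕ.+ a) * χ (l ℕ.≟ m ℕ.+ v)
    χ-shift l v = trans (*-comm _ _) (trans (χ-*-cong (l ℕ.≟ m ℕ.+ v) (λ e →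
      χ-cong (v ℕ.≟ a) (l ℕ.≟ m ℕ.+ a) (λ v≡a → ≡.trans e (≡.cong (m ℕ.+_) v≡a)) (λ l≡ → ℕ.+-cancelˡ-≡ m v a (≡.trans (≡.sym e) l≡)))) (*-comm _ _))
    summand : List ℕ → List ℕ → Carrier
    summand λs νs = χ (sum λs ℕ.≟ m ℕ.+ a) * (⟦ KS.χ (sum λs ℕ.≟ m ℕ.+ sum νs) K.* (verticalCoefficient λs νs K.* skewCoefficient νs μs) ⟧ * P λs)
    rearrange : ∀ λs νs → χ (sum νs ℕ.≟ a) * (⟦ skewCoefficient νs μs ⟧ * (χ (sum λs ℕ.≟ m ℕ.+ sum νs) * (⟦ verticalCoefficient λs νs ⟧ * P λs))) ≈ summand λs νs
    rearrange λs νs = begin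
      c * (sc * (c′ * (vc * P λs)))
        ≈⟨ S.solve 5 (λ c s d v p → c S.:* (s S.:* (d S.:* (v S.:* p))) S.:= (c S.:* d) S.:* (v S.:* (s S.:* p))) refl c sc c′ vc (P λs) ⟩
      (c * c′) * (vc * (sc * P λs))
        ≈⟨ *-congʳ (χ-shift (sum λs) (sum νs)) ⟩
      (c″ * c′) * (vc * (sc * P λs))
        ≈⟨ S.solve 5 (λ c s d v p → (c S.:* d) S.:* (v S.:* (s S.:* p)) S.:= c S.:* ((d S.:* (v S.:* s)) S.:* p)) refl c″ sc c′ vc (P λs) ⟩
      c″ * ((c′ * (vc * sc)) * P λs)
        ≈⟨ *-congˡ (*-congʳ (trans (*-homo _ _) (*-cong (χ-homo s (sum λs ℕ.≟ m ℕ.+ sum νs)) (*-homo _ _)))) ⟨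
      summand λs νs ∎
      where
      c = χ (sum νs ℕ.≟ a)
      c′ = χ (sum λs ℕ.≟ m ℕ.+ sum νs)
      c″ = χ (sum λs ℕ.≟ m ℕ.+ a)
      sc = ⟦ skewCoefficient νs μs ⟧
      vc = ⟦ verticalCoefficient λs νs ⟧
    collect : ∀ λs → χ (sum λs ℕ.≟ m ℕ.+ a) * (⟦ M m λs μs ⟧ * P λs) ≈ ∑ box′ (summand λs)
    collect λs = trans (*-congˡ (trans (*-congʳ (∑-homo s box′ _)) (∑-* (P λs) box′ _))) (*-∑ _ box′ _)

  M-zero : ∀ m {λs μs} → μs ∈ box′ → sum λs < m ℕ.+ sum μs → M m λs μs K.≈ K.0#
  M-zero m {λs} {μs} μs∈ bound = KS.∑-zero∈ box′ (λ {νs} νs∈ → by-cases νs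
    (skew-sum νs μs (≡.trans (proj₂ (∈-columns⁻ n L νs∈)) (≡.sym (proj₂ (∈-columns⁻ n L μs∈))))))
    where
    by-cases : ∀ νs → skewCoefficient νs μs K.≈ K.0# ⊎ sum μs ≤ sum νs →
      KS.χ (sum λs ℕ.≟ m ℕ.+ sum νs) K.* (verticalCoefficient λs νs K.* skewCoefficient νs μs) K.≈ K.0#
    by-cases νs (inj₁ z) = K.trans (K.*-congˡ (K.trans (K.*-congˡ z) (K.zeroʳ _))) (K.zeroʳ _)
    by-cases νs (inj₂ p) = KS.χ-no-* (sum λs ℕ.≟ m ℕ.+ sum νs) (λ e → ℕ.<⇒≱ bound (≡.subst (m ℕ.+ sum μs ≤_) (≡.sym e) (ℕ.+-monoʳ-≤ m p)))

  private
    -- At y = -1 the matrix of ∑_ν vs_{λ/ν} sk_{ν/μ} y^{|λ/ν|} is the identity.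
    M-alternating : ∀ k {λs μs} → λs ∈ box′ → μs ∈ box′ → sum λs ≡ k ℕ.+ sum μs →
      KO.∑ (upTo (suc k)) (λ r → y KO.^ r K.* M r λs μs) K.≈ KS.χ (≡-dec ℕ._≟_ λs μs)
    M-alternating k {λs} {μs} λs∈ μs∈ |λ|≡ = K.trans
      (K.trans (KS.∑-cong (upTo (suc k)) (λ r → KS.*-∑ (y KO.^ r) box′ _)) (K.trans (KS.∑-swap (upTo (suc k)) box′ _)
        (KS.∑-cong∈ box′ (λ {νs} νs∈ → inner νs (proj₂ (∈-columns⁻ n L νs∈))))))
      (K.trans (K.reflexive (≡.cong (λ l → KO.∑ (columns n l) (λ νs → W.weight λs νs μs)) (≡.sym lλ)))
        (K.trans (W.∑-weight λs μs (proj₁ (∈-columns⁻ n L λs∈)) (≡.trans lμ (≡.sym lλ)))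
          (W.columnProduct-χ (K.-‿inverseˡ K.1#) λs μs (proj₁ (∈-columns⁻ n L λs∈)) (proj₁ (∈-columns⁻ n L μs∈)) (≡.trans lμ (≡.sym lλ)))))
      where
      lλ = proj₂ (∈-columns⁻ n L λs∈)
      lμ = proj₂ (∈-columns⁻ n L μs∈)
      inner : ∀ νs → length νs ≡ L →
        KO.∑ (upTo (suc k)) (λ r → y KO.^ r K.* (KS.χ (sum λs ℕ.≟ r ℕ.+ sum νs) K.* (verticalCoefficient λs νs K.* skewCoefficient νs μs)))
          K.≈ W.weight λs νs μs
      inner νs lν = by-cases (vertical-sum λs νs (≡.trans lλ (≡.sym lν))) (skew-sum νs μs (≡.trans lν (≡.sym lμ)))
        where
        c = verticalCoefficient λs νs K.* skewCoefficient νs μs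
        trivial : c K.≈ K.0# → KO.∑ (upTo (suc k)) (λ r → y KO.^ r K.* (KS.χ (sum λs ℕ.≟ r ℕ.+ sum νs) K.* c)) K.≈ c K.* y KO.^ deficit λs νs
        trivial z = K.trans (KS.∑-zero (upTo (suc k)) (λ r → K.trans (K.*-congˡ (K.trans (K.*-congˡ z) (K.zeroʳ _))) (K.zeroʳ _)))
          (K.sym (K.trans (K.*-congʳ z) (K.zeroˡ _)))
        by-cases : verticalCoefficient λs νs K.≈ K.0# ⊎ sum λs ≡ deficit λs νs ℕ.+ sum νs → skewCoefficient νs μs K.≈ K.0# ⊎ sum μs ≤ sum νs →
          KO.∑ (upTo (suc k)) (λ r → y KO.^ r K.* (KS.χ (sum λs ℕ.≟ r ℕ.+ sum νs) K.* c)) K.≈ c K.* y KO.^ deficit λs νs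
        by-cases (inj₁ z) _        = trivial (K.trans (K.*-congʳ z) (K.zeroˡ _))
        by-cases (inj₂ _) (inj₁ z) = trivial (K.trans (K.*-congˡ z) (K.zeroʳ _))
        -- Only r = |λ/ν| survives. It lies in the range up to k because |ν| ≥ |μ|.
        by-cases (inj₂ e) (inj₂ p) = K.trans (KS.∑-cong (upTo (suc k)) (λ r → K.trans
            (KS.S.solve 3 (λ a b c → a KS.S.:* (b KS.S.:* c) KS.S.:= b KS.S.:* (c KS.S.:* a)) K.refl (y KO.^ r) (KS.χ (sum λs ℕ.≟ r ℕ.+ sum νs)) c)
            (K.*-congʳ (KS.χ-cong (sum λs ℕ.≟ r ℕ.+ sum νs) (D ℕ.≟ r) (λ e′ → ℕ.+-cancelʳ-≡ (sum νs) D r (≡.trans (≡.sym e) e′)) (λ D≡r → ≡.trans e (≡.cong (ℕ._+ sum νs) D≡r))))))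
          (KS.∑-χ ℕ._≟_ (Unique.upTo⁺ (suc k)) D (λ r → c K.* y KO.^ r) (∈-upTo⁺ (s≤s D≤k)))
          where
          D = deficit λs νs
          D≤k : D ≤ k
          D≤k = ℕ.+-cancelʳ-≤ (sum μs) D k (ℕ.≤-trans (ℕ.+-monoʳ-≤ D p) (ℕ.≤-reflexive (≡.trans (≡.sym e) |λ|≡)))

    -- The coefficient of zᵏ in the product of the series ∑ (-1)ʳ e_r zʳ and ∑ a_k zᵏ.
    alternating : (ℕ → Carrier) → ℕ → Carrier
    alternating a k = ∑ (upTo (suc k)) (λ r → ⟦ y KO.^ r ⟧ * (elementary r xs * a (k ∸ r)))

    alternating-Q : ∀ {μs} → μs ∈ box′ → ∀ k → k ℕ.+ sum μs < L → alternating (Q μs) k ≈ χ (k ℕ.≟ 0) * P μs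
    alternating-Q {μs} μs∈ k bound = begin
      alternating (Q μs) k
        ≈⟨ ∑-upTo-cong (suc k) (λ {r} r≤k → trans (*-congˡ (trans
             (elementary-Q r μs (k ∸ r) (ℕ.≤-<-trans (ℕ.+-monoˡ-≤ (sum μs) (ℕ.m∸n≤m k r)) bound))
             (∑-cong box′ (λ λs → *-congʳ (reflexive (≡.cong (λ a → χ (sum λs ℕ.≟ a))
               (≡.trans (≡.sym (ℕ.+-assoc r (k ∸ r) (sum μs))) (≡.cong (ℕ._+ sum μs) (ℕ.m+[n∸m]≡n (ℕ.s≤s⁻¹ r≤k)))))))))) (*-∑ _ box′ _)) ⟩
      ∑ (upTo (suc k)) (λ r → ∑ box′ (λ λs → ⟦ y KO.^ r ⟧ * (χ (sum λs ℕ.≟ k ℕ.+ sum μs) * (⟦ M r λs μs ⟧ * P λs))))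
        ≈⟨ ∑-swap (upTo (suc k)) box′ _ ⟩
      ∑ box′ (λ λs → ∑ (upTo (suc k)) (λ r → ⟦ y KO.^ r ⟧ * (χ (sum λs ℕ.≟ k ℕ.+ sum μs) * (⟦ M r λs μs ⟧ * P λs))))
        ≈⟨ ∑-cong∈ box′ inner ⟩
      ∑ box′ (λ λs → χ (≡-dec ℕ._≟_ μs λs) * (χ (sum λs ℕ.≟ k ℕ.+ sum μs) * P λs))
        ≈⟨ ∑-χ (≡-dec ℕ._≟_) (unique-columns n L) μs _ μs∈ ⟩
      χ (sum μs ℕ.≟ k ℕ.+ sum μs) * P μs
        ≈⟨ *-congʳ (χ-cong (sum μs ℕ.≟ k ℕ.+ sum μs) (k ℕ.≟ 0) (λ e → ≡.sym (ℕ.+-cancelʳ-≡ (sum μs) 0 k e)) (λ e → ≡.cong (ℕ._+ sum μs) (≡.sym e))) ⟩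
      χ (k ℕ.≟ 0) * P μs ∎
      where
      inner : ∀ {λs} → λs ∈ box′ → ∑ (upTo (suc k)) (λ r → ⟦ y KO.^ r ⟧ * (χ (sum λs ℕ.≟ k ℕ.+ sum μs) * (⟦ M r λs μs ⟧ * P λs)))
        ≈ χ (≡-dec ℕ._≟_ μs λs) * (χ (sum λs ℕ.≟ k ℕ.+ sum μs) * P λs)
      inner {λs} λs∈ = begin
        ∑ (upTo (suc k)) (λ r → ⟦ y KO.^ r ⟧ * (c * (⟦ M r λs μs ⟧ * P λs)))
          ≈⟨ ∑-cong (upTo (suc k)) (λ r → trans (S.solve 4 (λ a c m p → a S.:* (c S.:* (m S.:* p)) S.:= (a S.:* m) S.:* (c S.:* p)) refl ⟦ y KO.^ r ⟧ c ⟦ M r λs μs ⟧ (P λs))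
               (*-congʳ (sym (*-homo _ _)))) ⟩
        ∑ (upTo (suc k)) (λ r → ⟦ y KO.^ r K.* M r λs μs ⟧ * (c * P λs))
          ≈⟨ ∑-* (c * P λs) (upTo (suc k)) _ ⟨
        ∑ (upTo (suc k)) (λ r → ⟦ y KO.^ r K.* M r λs μs ⟧) * (c * P λs)
          ≈⟨ *-congʳ (∑-homo s (upTo (suc k)) _) ⟨
        ⟦ KO.∑ (upTo (suc k)) (λ r → y KO.^ r K.* M r λs μs) ⟧ * (c * P λs)
          ≈⟨ S.solve 3 (λ a b c → a S.:* (b S.:* c) S.:= b S.:* (a S.:* c)) refl ⟦ KO.∑ (upTo (suc k)) (λ r → y KO.^ r K.* M r λs μs) ⟧ c (P λs) ⟩
        c * (⟦ KO.∑ (upTo (suc k)) (λ r → y KO.^ r K.* M r λs μs) ⟧ * P λs)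
          ≈⟨ χ-*-cong (sum λs ℕ.≟ k ℕ.+ sum μs) (λ e → *-congʳ (trans (⟦⟧-cong (M-alternating k λs∈ μs∈ e)) (trans (χ-homo s (≡-dec ℕ._≟_ λs μs))
               (χ-cong (≡-dec ℕ._≟_ λs μs) (≡-dec ℕ._≟_ μs λs) ≡.sym ≡.sym)))) ⟩
        c * (χ (≡-dec ℕ._≟_ μs λs) * P λs)
          ≈⟨ S.solve 3 (λ a b c → a S.:* (b S.:* c) S.:= b S.:* (a S.:* c)) refl c (χ (≡-dec ℕ._≟_ μs λs)) (P λs) ⟩
        χ (≡-dec ℕ._≟_ μs λs) * (c * P λs) ∎
        where c = χ (sum λs ℕ.≟ k ℕ.+ sum μs)

    -- Since e₀ = 1, the term r = 0 is a_k itself, and the other terms involve smaller indices. The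
    -- convolution is therefore triangular with unit diagonal.
    alternating-injective : ∀ B (a b : ℕ → Carrier) → (∀ k → k < B → alternating a k ≈ alternating b k) → ∀ k → k < B → a k ≈ b k
    alternating-injective (suc B) a b h k k<1+B with ℕ.m≤n⇒m<n∨m≡n (ℕ.s≤s⁻¹ k<1+B)
    ... | inj₁ k<B    = alternating-injective B a b (λ k k<B → h k (ℕ.m<n⇒m<1+n k<B)) k k<B
    ... | inj₂ ≡.refl = trans (sym (unit (a k))) (trans (+-cancelʳ _ _ _ (trans (sym (∑-upTo-suc k (f a))) (trans (h k ℕ.≤-refl)
        (trans (∑-upTo-suc k (f b)) (+-congˡ (sym rest)))))) (unit (b k)))
      where
      f : (ℕ → Carrier) → ℕ → Carrier
      f a r = ⟦ y KO.^ r ⟧ * (elementary r xs * a (k ∸ r))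
      unit : ∀ x → ⟦ K.1# ⟧ * (1# * x) ≈ x
      unit x = trans (*-cong 1-homo (*-identityˡ x)) (*-identityˡ x)
      rest : ∑ (upTo k) (f a ∘ suc) ≈ ∑ (upTo k) (f b ∘ suc)
      rest = ∑-upTo-cong k (λ {r} r<k → *-congˡ (*-congˡ (alternating-injective B a b (λ k k<B → h k (ℕ.m<n⇒m<1+n k<B)) (k ∸ suc r)
        (ℕ.∸-monoʳ-< (s≤s z≤n) r<k))))

  ∅ : List ℕ
  ∅ = replicate L 0

  ∅∈ : ∅ ∈ box′
  ∅∈ = ∈-columns⁺ n L (decreasing-replicate-0 n L) (length-replicate L)

  module _ (P-∅ : P ∅ ≈ 1#) where
    -- Both sides have the convolution δ_{k0} P_μ. For the right-hand side this is the case μ = ∅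
    -- multiplied by P_μ, and here P_∅ = 1 enters.
    Q-multiplicative : ∀ {μs} → μs ∈ box′ → ∀ k → k ℕ.+ sum μs < L → Q μs k ≈ Q ∅ k * P μs
    Q-multiplicative {μs} μs∈ k bound = alternating-injective (suc k) (Q μs) (λ k → Q ∅ k * P μs) agree k ℕ.≤-refl
      where
      agree : ∀ j → j < suc k → alternating (Q μs) j ≈ alternating (λ k → Q ∅ k * P μs) j
      agree j j≤k = begin
        alternating (Q μs) j         ≈⟨ alternating-Q μs∈ j j-bound ⟩
        χ (j ℕ.≟ 0) * P μs           ≈⟨ *-congʳ (trans (*-congˡ P-∅) (*-identityʳ _)) ⟨
        χ (j ℕ.≟ 0) * P ∅ * P μs     ≈⟨ *-congʳ (alternating-Q ∅∈ j (≡.subst (λ z → j ℕ.+ z < L) (≡.sym (sum-replicate-0 L))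
                                          (ℕ.≤-<-trans (ℕ.+-monoʳ-≤ j z≤n) j-bound))) ⟨
        alternating (Q ∅) j * P μs   ≈⟨ trans (∑-* (P μs) (upTo (suc j)) _) (∑-cong (upTo (suc j)) (λ r → trans (*-assoc _ _ _) (*-congˡ (*-assoc _ _ _)))) ⟩
        alternating (λ k → Q ∅ k * P μs) j ∎
        where
        j-bound : j ℕ.+ sum μs < L
        j-bound = ℕ.≤-<-trans (ℕ.+-monoˡ-≤ (sum μs) (ℕ.s≤s⁻¹ j≤k)) bound

    -- Both sums expand e_m Q_{∅,k} P_μ = e_m Q_{μ,k}. Fixing k together with m keeps the identity
    -- homogeneous, so the degree bound is available throughout.
    product-expansion : ∀ m k {μs} → μs ∈ box′ → k ℕ.+ sum μs < L →
      ∑ box′ (λ σs → χ (sum σs ℕ.≟ m ℕ.+ k) * (⟦ M m σs ∅ ⟧ * (P σs * P μs)))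
        ≈ ∑ box′ (λ λs → χ (sum λs ℕ.≟ m ℕ.+ (k ℕ.+ sum μs)) * (⟦ M m λs μs ⟧ * P λs))
    product-expansion m k {μs} μs∈ bound = begin
      ∑ box′ (λ σs → χ (sum σs ℕ.≟ m ℕ.+ k) * (⟦ M m σs ∅ ⟧ * (P σs * P μs)))
        ≈⟨ ∑-cong box′ (λ σs → trans (*-cong (reflexive (≡.cong (λ z → χ (sum σs ℕ.≟ m ℕ.+ z)) (≡.sym k+0))) (sym (*-assoc _ _ _))) (sym (*-assoc _ _ _))) ⟩
      ∑ box′ (λ σs → χ (sum σs ℕ.≟ m ℕ.+ (k ℕ.+ sum ∅)) * (⟦ M m σs ∅ ⟧ * P σs) * P μs)
        ≈⟨ ∑-* (P μs) box′ _ ⟨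
      ∑ box′ (λ σs → χ (sum σs ℕ.≟ m ℕ.+ (k ℕ.+ sum ∅)) * (⟦ M m σs ∅ ⟧ * P σs)) * P μs
        ≈⟨ *-congʳ (elementary-Q m ∅ k (≡.subst (_< L) (≡.sym k+0) (ℕ.m+n≤o⇒m≤o (suc k) bound))) ⟨
      elementary m xs * Q ∅ k * P μs
        ≈⟨ trans (*-assoc _ _ _) (*-congˡ (sym (Q-multiplicative μs∈ k bound))) ⟩
      elementary m xs * Q μs k
        ≈⟨ elementary-Q m μs k bound ⟩
      ∑ box′ (λ λs → χ (sum λs ℕ.≟ m ℕ.+ (k ℕ.+ sum μs)) * (⟦ M m λs μs ⟧ * P λs)) ∎
      where
      k+0 : k ℕ.+ sum ∅ ≡ k
      k+0 = ≡.trans (≡.cong (k ℕ.+_) (sum-replicate-0 L)) (ℕ.+-identityʳ k)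

-- Structure constants: homogeneity, and comparison of coefficients.

module StructureConstants (K : Field) (t : Field.Carrier K)
  (t≉0 : ¬ (Field._≈_ K t (Field.0# K)))
  (1-tᵏ≉0 : ∀ k → ¬ (Field._≈_ K (Field._-_ K (Field.1# K) (FieldOperations._^_ K t (suc k))) (Field.0# K)))
  where
  open HallLittlewood K t using (P⟨_vars⟩; v; IsStructureConstants; module Families)
  open HallLittlewoodPolynomials K t
  open Independence K t 1-tᵏ≉0
  open ColumnCoefficients K t 1-tᵏ≉0 using (normalization; normalization≉0)
  open PartitionCoefficients K t 1-tᵏ≉0
  open RationalFunctions K
  private
    module K = Field K
    module KO = FieldOperations K
    module KS = Sums K.commutativeRing
    module KL = FieldLemmas K
    module KR = Algebra.Properties.Ring K.ring

    -- Equal powers with different exponents would make t a root of unity.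
    ^-injective : ∀ a b → t KO.^ a K.≈ t KO.^ b → a ≡ b
    ^-injective zero    zero    e = ≡.refl
    ^-injective zero    (suc b) e = ⊥-elim (1-tᵏ≉0 b (K.trans (K.+-congˡ (K.-‿cong (K.sym e))) (K.-‿inverseʳ K.1#)))
    ^-injective (suc a) zero    e = ⊥-elim (1-tᵏ≉0 a (K.trans (K.+-congˡ (K.-‿cong e)) (K.-‿inverseʳ K.1#)))
    ^-injective (suc a) (suc b) e = ≡.cong suc (^-injective a b (KL.*-cancelˡ t≉0 e))

  module _ (n L : ℕ) where
    private
      module F = Field (K⟨x⟩ n)
      module FO = FieldOperations (K⟨x⟩ n)
      module FS = Sums F.commutativeRing
      module FR = Algebra.Properties.Ring F.ring
      module s = RingHom (scalarHom n)
    open SkewPieri K t 1-tᵏ≉0 (K⟨x⟩ n) (scalarHom n) L (vars n) public using (P; scalar-P; M; M-zero; ∅; ∅∈; product-expansion)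

    P-independent : ∀ (a : List ℕ → K.Carrier) → FO.∑ (columns n L) (λ cs → scalar n (a cs) F.* P cs) F.≈ F.0# → ∀ {cs} → cs ∈ columns n L → a cs K.≈ K.0#
    P-independent a e {cs} cs∈ = KL.*-cancelʳ (KL.⁻¹-nonzero (normalization≉0 cs n)) (K.trans
      (R-independent n L (λ cs → a cs K.* normalization cs n K.⁻¹)
        (F.trans (F.sym (FS.∑-cong (columns n L) {λ cs → scalar n (a cs) F.* P cs} (λ cs → scalar-P (a cs) cs))) e) cs∈)
      (K.sym (K.zeroˡ _)))

    P-coefficients : ∀ (a b : List ℕ → K.Carrier) → FO.∑ (columns n L) (λ cs → scalar n (a cs) F.* P cs) F.≈ FO.∑ (columns n L) (λ cs → scalar n (b cs) F.* P cs) →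
      ∀ {cs} → cs ∈ columns n L → a cs K.≈ b cs
    P-coefficients a b e {cs} cs∈ = KR.x∙y⁻¹≈ε⇒x≈y (a cs) (b cs) (P-independent (λ cs → a cs K.- b cs)
      (F.trans (FS.∑-cong (columns n L) {λ cs → scalar n (a cs K.- b cs) F.* P cs} {λ cs → f cs F.+ F.- h cs} difference)
        (F.trans (FS.∑-+ (columns n L) f (λ cs → F.- h cs))
          (F.trans (F.+-cong e (∑-neg (columns n L) h)) (F.-‿inverseʳ (FO.∑ (columns n L) h))))) cs∈)
      where
      f h : List ℕ → F.Carrier
      f cs = scalar n (a cs) F.* P cs
      h cs = scalar n (b cs) F.* P cs
      difference : ∀ cs → scalar n (a cs K.- b cs) F.* P cs F.≈ f cs F.+ F.- h cs
      difference cs = F.trans (F.*-congʳ {P cs} (F.trans (s.+-homo (a cs) (K.- b cs)) (F.+-congˡ {scalar n (a cs)} (s.neg-homo (b cs)))))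
        (F.trans (F.distribʳ (P cs) (scalar n (a cs)) (F.- scalar n (b cs))) (F.+-congˡ {f cs} (F.sym (FR.-‿distribˡ-* (scalar n (b cs)) (P cs)))))
      ∑-neg : ∀ css (h : List ℕ → F.Carrier) → FO.∑ css (λ cs → F.- h cs) F.≈ F.- FO.∑ css h
      ∑-neg []         h = F.sym FR.-0#≈0#
      ∑-neg (cs ∷ css) h = F.trans (F.+-congˡ {F.- h cs} (∑-neg css h)) (FR.-‿+-comm (h cs) (FO.∑ css h))

    P-columns : ∀ σ → ℓ σ ≤ n → part σ 0 ≤ L → P⟨ n vars⟩ σ F.≈ P (toColumns L σ)
    P-columns σ ℓ≤n σ₁≤L = F.trans (P-R n σ ℓ≤n) (F.*-cong
      (F.⁻¹-cong {scalar n (v n σ)} {scalar n (normalization (toColumns L σ) n)} (s.⟦⟧-cong (v-columns n σ σ₁≤L)))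
      (F.trans (F.sym (Symmetrization.R-++-0 (K⟨x⟩ n) (scalar n t) (parts σ) (n ∸ ℓ σ) (vars n)))
        (F.reflexive (≡.cong R⟨ n ⟩ (≡.sym (≡.trans (transpose-transpose n L (parts σ) (parts-decreasing σ σ₁≤L)) (pad-++ (parts σ) ℓ≤n)))))))

    P-scaling : ∀ {c} (c≉0 : ¬ (c F.≈ F.0#)) {cs} → cs ∈ columns n L →
      Scaling._⇝_ n c c≉0 (P cs) (c FO.^ sum cs F.* P cs)
    P-scaling {c} c≉0 {cs} cs∈ = ⇝-resp F.refl rearrange (⇝-* (⇝-⁻¹ N≉0 (⇝-scalar (normalization cs n)))
      (⇝-R t (transpose n cs) (length-transpose n cs)))
      where
      open Scaling n c c≉0
      N r : F.Carrier
      N = scalar n (normalization cs n)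
      r = R⟨ n ⟩ (transpose n cs)
      N≉0 : ¬ (N F.≈ F.0#)
      N≉0 e = normalization≉0 cs n (scalar-injective n e)
      rearrange : N F.⁻¹ F.* (c FO.^ sum (transpose n cs) F.* r) F.≈ c FO.^ sum cs F.* (N F.⁻¹ F.* r)
      rearrange = F.trans (FS.S.solve 3 (λ x y z → x FS.S.:* (y FS.S.:* z) FS.S.:= y FS.S.:* (x FS.S.:* z)) F.refl (N F.⁻¹) (c FO.^ sum (transpose n cs)) r)
        (F.*-congʳ {N F.⁻¹ F.* r} (F.reflexive (≡.cong (c FO.^_) (sum-transpose n cs (proj₁ (∈-columns⁻ n L cs∈))))))

  module _ (f : Partition → Partition → Partition → K.Carrier) (structure : IsStructureConstants f) where
    private
      support : ∀ σ μ → List Partition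
      support σ μ = proj₁ (structure σ μ)

    -- The structure constants come with an unspecified finite support. In n variables it may be
    -- exchanged for any list outside which the terms vanish, in particular for a box.
    expansion : ∀ n σ μ {ys} → Unique ys →
      (∀ ρ → ρ ∉ ys → Field._≈_ (K⟨x⟩ n) (Field._*_ (K⟨x⟩ n) (scalar n (f ρ σ μ)) (P⟨ n vars⟩ ρ)) (Field.0# (K⟨x⟩ n))) →
      Field._≈_ (K⟨x⟩ n) (Field._*_ (K⟨x⟩ n) (P⟨ n vars⟩ σ) (P⟨ n vars⟩ μ))
        (FieldOperations.∑ (K⟨x⟩ n) ys (λ ρ → Field._*_ (K⟨x⟩ n) (scalar n (f ρ σ μ)) (P⟨ n vars⟩ ρ)))
    expansion n σ μ {ys} uys h = let xs , uxs , outside , e = structure σ μ in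
      F.trans (e n) (F.trans (F.reflexive (component xs)) (FS.∑-support _≟ₚ_ uxs uys g (λ ρ ρ∉ → outside ρ ρ∉ n) h))
      where
      module F = Field (K⟨x⟩ n)
      module FS = Sums F.commutativeRing
      g : Partition → F.Carrier
      g ρ = scalar n (f ρ σ μ) F.* P⟨ n vars⟩ ρ
      component : ∀ xs → Families.∑ xs (λ ρ n → Field._*_ (K⟨x⟩ n) (scalar n (f ρ σ μ)) (P⟨ n vars⟩ ρ)) n ≡ FieldOperations.∑ (K⟨x⟩ n) xs g
      component []       = ≡.refl
      component (ρ ∷ xs) = ≡.cong (g ρ F.+_) (component xs)

    private
      column-expansion : ∀ n L σ μ → ℓ σ ≤ n → part σ 0 ≤ L → ℓ μ ≤ n → part μ 0 ≤ L → 
        (∀ ρ → ρ ∉ box n L → Field._≈_ (K⟨x⟩ n) (Field._*_ (K⟨x⟩ n) (scalar n (f ρ σ μ)) (P⟨ n vars⟩ ρ)) (Field.0# (K⟨x⟩ n))) →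
        Field._≈_ (K⟨x⟩ n) (Field._*_ (K⟨x⟩ n) (P n L (toColumns L σ)) (P n L (toColumns L μ)))
          (FieldOperations.∑ (K⟨x⟩ n) (columns n L) (λ λs → Field._*_ (K⟨x⟩ n) (scalar n (f (fromColumns λs) σ μ)) (P n L λs)))
      column-expansion n L σ μ ℓσ σ₁ ℓμ μ₁ h = F.trans (F.sym (F.*-cong (P-columns n L σ ℓσ σ₁) (P-columns n L μ ℓμ μ₁)))
        (F.trans (expansion n σ μ (unique-box n L) h) (F.trans (F.reflexive (FS.∑-map fromColumns (columns n L) g))
          (FS.∑-cong∈ (columns n L) {g ∘ fromColumns} {λ λs → scalar n (f (fromColumns λs) σ μ) F.* P n L λs} each)))
        where
        module F = Field (K⟨x⟩ n)
        module FS = Sums F.commutativeRing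
        g : Partition → F.Carrier
        g ρ = scalar n (f ρ σ μ) F.* P⟨ n vars⟩ ρ
        each : ∀ {λs} → λs ∈ columns n L → g (fromColumns λs) F.≈ scalar n (f (fromColumns λs) σ μ) F.* P n L λs
        each {λs} λs∈ = F.*-congˡ {scalar n (f (fromColumns λs) σ μ)} (F.trans (P-columns n L (fromColumns λs) ℓ≤n ρ₁≤L)
          (F.reflexive (≡.cong (P n L) (to-from {n} {L} λs∈))))
          where
          d = proj₁ (∈-columns⁻ n L λs∈)
          ℓ≤n : ℓ (fromColumns λs) ≤ n
          ℓ≤n = ≡.subst (_≤ n) (≡.sym (length-transpose (entry λs 0) λs)) (decreasing⇒head≤ λs d)
          ρ₁≤L : part (fromColumns λs) 0 ≤ L
          ρ₁≤L = ≡.subst (part (fromColumns λs) 0 ≤_) (proj₂ (∈-columns⁻ n L λs∈)) (ℕ.≤-trans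
            (decreasing⇒head≤ (transpose (entry λs 0) λs) (decreasing-transpose (entry λs 0) λs)) ℕ.≤-refl)

      zero-* : ∀ n {a} p → a K.≈ K.0# → Field._≈_ (K⟨x⟩ n) (Field._*_ (K⟨x⟩ n) (scalar n a) p) (Field.0# (K⟨x⟩ n))
      zero-* n p e = F.trans (F.*-congʳ {p} (F.trans (s.⟦⟧-cong e) s.0-homo)) (F.zeroˡ p)
        where
        module F = Field (K⟨x⟩ n)
        module s = RingHom (scalarHom n)

    -- Replacing xᵢ by t xᵢ multiplies P_ρ by t^|ρ|.
    homogeneous : ∀ ρ σ μ → size ρ ≢ size σ ℕ.+ size μ → f ρ σ μ K.≈ K.0#
    homogeneous ρ σ μ |ρ|≢ = Dec.decidable-stable (f ρ σ μ K.≟ K.0#) λ f≉0 → |ρ|≢ (^-injective _ _ (KL.*-cancelˡ f≉0 equal))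
      where
      bound L n D : ℕ
      -- The support is arbitrary, so the width L must cover the first parts of its members. Members
      -- with more than n parts vanish in n variables.
      bound = sum (map (λ τ → part τ 0) (support σ μ))
      L = bound ℕ.+ (size ρ ℕ.+ (size σ ℕ.+ size μ))
      n = size ρ ℕ.+ (size σ ℕ.+ size μ)
      D = size σ ℕ.+ size μ
      module F = Field (K⟨x⟩ n)
      module FO = FieldOperations (K⟨x⟩ n)
      module FS = Sums F.commutativeRing
      module s = RingHom (scalarHom n)
      c : F.Carrier
      c = scalar n t
      c≉0 : ¬ (c F.≈ F.0#)
      c≉0 e = t≉0 (scalar-injective n e)
      open Scaling n c c≉0
      part≤bound : ∀ {τ} xs → τ ∈ xs → part τ 0 ≤ sum (map (λ τ → part τ 0) xs)
      part≤bound (τ ∷ xs) (here ≡.refl) = ℕ.m≤m+n _ _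
      part≤bound (τ ∷ xs) (there τ∈)    = ℕ.≤-trans (part≤bound xs τ∈) (ℕ.m≤n+m _ _)
      n≤L : n ≤ L
      n≤L = ℕ.m≤n+m n bound
      ρ≤n : size ρ ≤ n
      ρ≤n = ℕ.m≤m+n _ _
      σ≤n : size σ ≤ n
      σ≤n = ℕ.≤-trans (ℕ.m≤m+n _ _) (ℕ.m≤n+m _ (size ρ))
      μ≤n : size μ ≤ n
      μ≤n = ℕ.≤-trans (ℕ.m≤n+m _ (size σ)) (ℕ.m≤n+m _ (size ρ))
      columns∈ : ∀ τ → size τ ≤ n → toColumns L τ ∈ columns n L
      columns∈ τ τ≤n = toColumns∈ τ (ℕ.≤-trans (ℓ≤size τ) τ≤n) (ℕ.≤-trans (part≤size τ 0) (ℕ.≤-trans τ≤n n≤L))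
      outside : ∀ τ → τ ∉ box n L → scalar n (f τ σ μ) F.* P⟨ n vars⟩ τ F.≈ F.0#
      outside τ τ∉ = by-cases (ℓ τ ℕ.≤? n)
        where
        by-cases : Dec (ℓ τ ≤ n) → scalar n (f τ σ μ) F.* P⟨ n vars⟩ τ F.≈ F.0#
        by-cases (no ℓ≰n)  = F.trans (F.*-congˡ {scalar n (f τ σ μ)} (P-zero n τ ℓ≰n)) (F.zeroʳ (scalar n (f τ σ μ)))
        by-cases (yes ℓ≤n) = proj₁ (proj₂ (proj₂ (structure σ μ))) τ (λ τ∈ → τ∉ (∈-box τ ℓ≤n (ℕ.≤-trans (part≤bound (support σ μ) τ∈) (ℕ.m≤m+n bound n)))) n
      a : List ℕ → K.Carrier
      a λs = f (fromColumns λs) σ μ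
      Pσ Pμ : F.Carrier
      Pσ = P n L (toColumns L σ)
      Pμ = P n L (toColumns L μ)
      expanded : Pσ F.* Pμ F.≈ FO.∑ (columns n L) (λ λs → scalar n (a λs) F.* P n L λs)
      expanded = column-expansion n L σ μ (ℕ.≤-trans (ℓ≤size σ) σ≤n) (ℕ.≤-trans (part≤size σ 0) (ℕ.≤-trans σ≤n n≤L))
        (ℕ.≤-trans (ℓ≤size μ) μ≤n) (ℕ.≤-trans (part≤size μ 0) (ℕ.≤-trans μ≤n n≤L)) outside
      size≡ : ∀ τ → size τ ≤ n → sum (toColumns L τ) ≡ size τ
      size≡ τ τ≤n = size-toColumns τ (ℕ.≤-trans (part≤size τ 0) (ℕ.≤-trans τ≤n n≤L))
      Pσ′ Pμ′ : F.Carrier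
      Pσ′ = c FO.^ sum (toColumns L σ) F.* Pσ
      Pμ′ = c FO.^ sum (toColumns L μ) F.* Pμ
      summand summand′ : List ℕ → F.Carrier
      summand λs = scalar n (a λs) F.* P n L λs
      summand′ λs = scalar n (a λs) F.* (c FO.^ sum λs F.* P n L λs)
      summand-⇝ : ∀ {λs} → λs ∈ columns n L → summand λs ⇝ summand′ λs
      summand-⇝ {λs} λs∈ = ⇝-* {scalar n (a λs)} {P n L λs} {scalar n (a λs)} {c FO.^ sum λs F.* P n L λs} (⇝-scalar (a λs)) (P-scaling n L c≉0 λs∈)
      product-⇝ : Pσ F.* Pμ ⇝ Pσ′ F.* Pμ′
      product-⇝ = ⇝-* {Pσ} {Pμ} {Pσ′} {Pμ′} (P-scaling n L c≉0 (columns∈ σ σ≤n)) (P-scaling n L c≉0 (columns∈ μ μ≤n))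
      sum-⇝ : FO.∑ (columns n L) summand ⇝ FO.∑ (columns n L) summand′
      sum-⇝ = ⇝-∑ (columns n L) {summand} {summand′} summand-⇝
      scaled : Pσ′ F.* Pμ′ F.≈ FO.∑ (columns n L) summand′
      -- The product and its expansion are the same rational function, so their values after the
      -- substitution agree.
      scaled = ⇝-unique {Pσ F.* Pμ} {FO.∑ (columns n L) summand} {Pσ′ F.* Pμ′} {FO.∑ (columns n L) summand′} expanded product-⇝ sum-⇝
      absorb : ∀ λs k → scalar n (a λs) F.* (c FO.^ k F.* P n L λs) F.≈ scalar n (a λs K.* t KO.^ k) F.* P n L λs
      absorb λs k = F.trans (F.sym (F.*-assoc (scalar n (a λs)) (c FO.^ k) (P n L λs)))
        (F.*-congʳ {P n L λs} (F.trans (F.*-congˡ {scalar n (a λs)} (F.sym (^-homo (scalarHom n) t k))) (F.sym (s.*-homo (a λs) (t KO.^ k)))))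
      cᴰ : c FO.^ D F.* (Pσ F.* Pμ) F.≈ Pσ′ F.* Pμ′
      cᴰ = F.trans (F.*-congʳ {Pσ F.* Pμ} (F.trans (Algebra.Properties.CommutativeSemiring.Exp.^-homo-* F.commutativeSemiring c (size σ) (size μ))
          (F.reflexive (≡.cong₂ (λ i j → c FO.^ i F.* c FO.^ j) (≡.sym (size≡ σ σ≤n)) (≡.sym (size≡ μ μ≤n))))))
        (FS.S.solve 4 (λ x y z w → (x FS.S.:* y) FS.S.:* (z FS.S.:* w) FS.S.:= (x FS.S.:* z) FS.S.:* (y FS.S.:* w)) F.refl
          (c FO.^ sum (toColumns L σ)) (c FO.^ sum (toColumns L μ)) Pσ Pμ)
      two-ways : FO.∑ (columns n L) (λ λs → scalar n (a λs K.* t KO.^ sum λs) F.* P n L λs)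
        F.≈ FO.∑ (columns n L) (λ λs → scalar n (a λs K.* t KO.^ D) F.* P n L λs)
      two-ways = F.trans (FS.∑-cong (columns n L) {λ λs → scalar n (a λs K.* t KO.^ sum λs) F.* P n L λs} (λ λs → F.sym (absorb λs (sum λs))))
        (F.trans (F.sym scaled) (F.trans (F.sym cᴰ) (F.trans (F.*-congˡ {c FO.^ D} expanded)
          (F.trans (FS.*-∑ (c FO.^ D) (columns n L) (λ λs → scalar n (a λs) F.* P n L λs))
            (FS.∑-cong (columns n L) (λ λs → F.trans
              (FS.S.solve 3 (λ x y z → x FS.S.:* (y FS.S.:* z) FS.S.:= y FS.S.:* (x FS.S.:* z)) F.refl (c FO.^ D) (scalar n (a λs)) (P n L λs))
              (absorb λs D)))))))
      equal : f ρ σ μ K.* t KO.^ size ρ K.≈ f ρ σ μ K.* t KO.^ D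
      equal = ≡.subst₂ (λ τ k → f τ σ μ K.* t KO.^ k K.≈ f τ σ μ K.* t KO.^ D)
        (from-to ρ (ℕ.≤-trans (part≤size ρ 0) (ℕ.≤-trans ρ≤n n≤L))) (size≡ ρ ρ≤n)
        (P-coefficients n L (λ λs → a λs K.* t KO.^ sum λs) (λ λs → a λs K.* t KO.^ D) two-ways (columns∈ ρ ρ≤n))

    private
      ∅ₚ : Partition
      ∅ₚ = partition [] [] []

      P-∅-columns : ∀ n L → Field._≈_ (K⟨x⟩ n) (P⟨ n vars⟩ ∅ₚ) (P n L (∅ n L))
      P-∅-columns n L = ≡.subst (λ cs → Field._≈_ (K⟨x⟩ n) (P⟨ n vars⟩ ∅ₚ) (P n L cs)) (applyUpTo-const 0 L) (P-columns n L ∅ₚ z≤n z≤n)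

      unique-∅ : Unique (∅ₚ ∷ [])
      unique-∅ = [] AP.∷ AP.[]

      -- In no variables, P_∅ = 1 and every other P_ρ vanishes.
      f-∅≈1 : f ∅ₚ ∅ₚ ∅ₚ K.≈ K.1#
      f-∅≈1 = KR.x∙y⁻¹≈ε⇒x≈y (f ∅ₚ ∅ₚ ∅ₚ) K.1# (scalar-injective 0 (F.trans (s.+-homo f₀ (K.- K.1#))
        (F.trans (F.+-cong {scalar 0 f₀} {F.1#} f₀≈1 (F.trans (s.neg-homo K.1#) (F.-‿cong {scalar 0 K.1#} {F.1#} s.1-homo))) (F.-‿inverseʳ F.1#))))
        where
        module F = Field (K⟨x⟩ 0)
        module s = RingHom (scalarHom 0)
        f₀ = f ∅ₚ ∅ₚ ∅ₚ
        p : F.Carrier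
        p = P⟨ 0 vars⟩ ∅ₚ
        p≈1 : p F.≈ F.1#
        p≈1 = F.trans (P-∅-columns 0 0) (F.trans (F.*-identityʳ (scalar 0 K.1# F.⁻¹))
          (F.sym (FieldLemmas.⁻¹-unique (K⟨x⟩ 0) {scalar 0 K.1#} {F.1#} (F.trans (F.*-identityʳ (scalar 0 K.1#)) s.1-homo))))
        outside : ∀ ρ → ρ ∉ ∅ₚ ∷ [] → scalar 0 (f ρ ∅ₚ ∅ₚ) F.* P⟨ 0 vars⟩ ρ F.≈ F.0#
        outside ρ ρ∉ = F.trans (F.*-congˡ {scalar 0 (f ρ ∅ₚ ∅ₚ)} (P-zero 0 ρ (λ ℓ≤0 → ρ∉ (here (parts-injective (empty (parts ρ) ℓ≤0))))))
          (F.zeroʳ (scalar 0 (f ρ ∅ₚ ∅ₚ)))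
          where
          empty : ∀ as → length as ≤ 0 → as ≡ []
          empty [] _ = ≡.refl
        f₀≈1 : scalar 0 f₀ F.≈ F.1#
        f₀≈1 = F.trans (F.sym (F.*-identityʳ (scalar 0 f₀))) (F.trans (F.sym (F.*-congˡ {scalar 0 f₀} p≈1))
          (F.trans (F.sym (F.+-identityʳ (scalar 0 f₀ F.* p))) (F.trans (F.sym (expansion 0 ∅ₚ ∅ₚ unique-∅ outside))
            (F.trans (F.*-cong {p} {F.1#} {p} {F.1#} p≈1 p≈1) (F.*-identityʳ F.1#)))))

      -- By `homogeneous` only P_∅ can occur in P_∅², and its coefficient is 1 by `f-∅≈1`. Hence
      -- P_∅² = P_∅, and P_∅ can be cancelled because independence shows that it is nonzero.
      P-∅≈1 : ∀ n L → Field._≈_ (K⟨x⟩ n) (P n L (∅ n L)) (Field.1# (K⟨x⟩ n))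
      P-∅≈1 n L = F.trans (F.sym (P-∅-columns n L)) (FieldLemmas.*-cancelˡ (K⟨x⟩ n) {p} {F.1#} {p} p≉0
        (F.trans (expansion n ∅ₚ ∅ₚ unique-∅ outside) (F.trans (F.+-identityʳ (scalar n f₀ F.* p))
          (F.trans (F.*-congʳ {p} (F.trans (s.⟦⟧-cong f-∅≈1) s.1-homo)) (F.*-comm F.1# p)))))
        where
        module F = Field (K⟨x⟩ n)
        module s = RingHom (scalarHom n)
        f₀ = f ∅ₚ ∅ₚ ∅ₚ
        p : F.Carrier
        p = P⟨ n vars⟩ ∅ₚ
        outside : ∀ ρ → ρ ∉ ∅ₚ ∷ [] → scalar n (f ρ ∅ₚ ∅ₚ) F.* P⟨ n vars⟩ ρ F.≈ F.0#
        outside ρ ρ∉ = zero-* n {f ρ ∅ₚ ∅ₚ} (P⟨ n vars⟩ ρ) (homogeneous ρ ∅ₚ ∅ₚ (λ e → ρ∉ (here (parts-injective (empty ρ e)))))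
          where
          empty : ∀ ρ → size ρ ≡ 0 → parts ρ ≡ []
          empty ρ e with parts ρ | parts-positive ρ
          ... | []          | _ = ≡.refl
          ... | zero ∷ as   | () ∷ _
          empty ρ () | suc a ∷ as | _
        p≉0 : ¬ (p F.≈ F.0#)
        p≉0 e = K.1≉0 (P-independent n 0 (λ _ → K.1#) (F.trans (F.+-identityʳ (scalar n K.1# F.* P n 0 []))
          (F.trans (F.*-congˡ {scalar n K.1#} (F.trans (F.sym (P-∅-columns n 0)) e)) (F.zeroʳ (scalar n K.1#)))) (here ≡.refl))

    module _ (μ ρ : Partition) (B : ℕ) (μ<B : size μ < B) (ρ<B : size ρ < B) where
      private
        μs ρs : List ℕ
        μs = toColumns B μ
        ρs = toColumns B ρ
        below : ∀ τ → size τ < B → part τ 0 ≤ B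
        below τ τ<B = ℕ.≤-trans (part≤size τ 0) (ℕ.<⇒≤ τ<B)
        short : ∀ τ → size τ < B → ℓ τ ≤ B
        short τ τ<B = ℕ.≤-trans (ℓ≤size τ) (ℕ.<⇒≤ τ<B)
        |μ| : sum μs ≡ size μ
        |μ| = size-toColumns μ (below μ μ<B)
        |ρ| : sum ρs ≡ size ρ
        |ρ| = size-toColumns ρ (below ρ ρ<B)
        μs∈ : μs ∈ columns B B
        μs∈ = toColumns∈ μ (short μ μ<B) (below μ μ<B)
        ρs∈ : ρs ∈ columns B B
        ρs∈ = toColumns∈ ρ (short ρ ρ<B) (below ρ ρ<B)

        size-from : ∀ {cs} → cs ∈ columns B B → size (fromColumns cs) ≡ sum cs
        size-from {cs} cs∈ = sum-transpose (entry cs 0) cs (decreasing-lower cs ℕ.≤-refl (proj₁ (∈-columns⁻ B B cs∈)))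

      -- If m + |μ| ≤ |ρ|, let k be determined by m + k + |μ| = |ρ|. The claim is then the
      -- coefficient of P_ρ in `product-expansion`, since by homogeneity only σ with |σ| = m + k
      -- contribute. If m + |μ| > |ρ|, both sides vanish.
      coefficient-identity : ∀ m → KO.∑ (columns B B) (λ σs → M B B m σs (∅ B B) K.* f ρ (fromColumns σs) μ) K.≈ M B B m ρs μs
      coefficient-identity m = by-cases (m ℕ.+ sum μs ℕ.≤? sum ρs)
        where
        f-zero : ∀ {σs} → σs ∈ columns B B → sum ρs ≢ sum σs ℕ.+ sum μs → f ρ (fromColumns σs) μ K.≈ K.0#
        f-zero {σs} σs∈ ne = homogeneous ρ (fromColumns σs) μ (λ e → ne (≡.trans |ρ| (≡.trans e (≡.cong₂ ℕ._+_ (size-from σs∈) (≡.sym |μ|)))))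
        by-cases : Dec (m ℕ.+ sum μs ≤ sum ρs) → KO.∑ (columns B B) (λ σs → M B B m σs (∅ B B) K.* f ρ (fromColumns σs) μ) K.≈ M B B m ρs μs
        by-cases (no ≰ρ) = K.trans (KS.∑-zero∈ (columns B B) (λ {σs} σs∈ → small σs∈ (sum ρs ℕ.≟ sum σs ℕ.+ sum μs)))
          (K.sym (M-zero B B m {ρs} {μs} μs∈ (ℕ.≰⇒> ≰ρ)))
          where
          small : ∀ {σs} → σs ∈ columns B B → Dec (sum ρs ≡ sum σs ℕ.+ sum μs) → M B B m σs (∅ B B) K.* f ρ (fromColumns σs) μ K.≈ K.0#
          small σs∈ (no ne) = K.trans (K.*-congˡ (f-zero σs∈ ne)) (K.zeroʳ _)
          small {σs} σs∈ (yes e) = K.trans (K.*-congʳ (M-zero B B m {σs} {∅ B B} (∅∈ B B) (≡.subst (sum σs <_)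
            (≡.sym (≡.trans (≡.cong (m ℕ.+_) (sum-replicate-0 B)) (ℕ.+-identityʳ m)))
            (ℕ.+-cancelʳ-< (sum μs) (sum σs) m (≡.subst (_< m ℕ.+ sum μs) e (ℕ.≰⇒> ≰ρ)))))) (K.zeroˡ _)
        by-cases (yes ≤ρ) = K.trans (K.sym (KS.∑-cong∈ (columns B B) lhs))
          (K.trans (P-coefficients B B left right two-ways ρs∈) (KS.χ-yes-* (sum ρs ℕ.≟ m ℕ.+ (k ℕ.+ sum μs)) (≡.sym total)))
          where
          module F = Field (K⟨x⟩ B)
          module FO = FieldOperations (K⟨x⟩ B)
          module FS = Sums F.commutativeRing
          module s = RingHom (scalarHom B)
          k = sum ρs ∸ (m ℕ.+ sum μs)
          total : m ℕ.+ (k ℕ.+ sum μs) ≡ sum ρs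
          total = ≡.trans (ℕ+-left-comm m k (sum μs)) (ℕ.m∸n+n≡m ≤ρ)
          bound : k ℕ.+ sum μs < B
          bound = ℕ.≤-<-trans (ℕ.≤-trans (ℕ.m≤n+m (k ℕ.+ sum μs) m) (ℕ.≤-reflexive (≡.trans total |ρ|))) ρ<B
          w : List ℕ → K.Carrier
          w σs = KS.χ (sum σs ℕ.≟ m ℕ.+ k) K.* M B B m σs (∅ B B)
          left right : List ℕ → K.Carrier
          left λs = KO.∑ (columns B B) (λ σs → w σs K.* f (fromColumns λs) (fromColumns σs) μ)
          right λs = KS.χ (sum λs ℕ.≟ m ℕ.+ (k ℕ.+ sum μs)) K.* M B B m λs μs
          P′ : List ℕ → F.Carrier
          P′ = P B B
          lhs : ∀ {σs} → σs ∈ columns B B → w σs K.* f (fromColumns ρs) (fromColumns σs) μ K.≈ M B B m σs (∅ B B) K.* f ρ (fromColumns σs) μ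
          lhs {σs} σs∈ = K.trans (K.*-congˡ (K.reflexive (≡.cong (λ τ → f τ (fromColumns σs) μ) (from-to ρ (below ρ ρ<B)))))
            (drop-χ (sum σs ℕ.≟ m ℕ.+ k))
            where
            drop-χ : (d : Dec (sum σs ≡ m ℕ.+ k)) → KS.χ d K.* M B B m σs (∅ B B) K.* f ρ (fromColumns σs) μ K.≈ M B B m σs (∅ B B) K.* f ρ (fromColumns σs) μ
            drop-χ (yes _) = K.*-congʳ (K.*-identityˡ _)
            drop-χ (no ne) = K.trans (K.*-congˡ z) (K.trans (K.zeroʳ _) (K.sym (K.trans (K.*-congˡ z) (K.zeroʳ _))))
              where
              z = f-zero σs∈ (λ e → ne (ℕ.+-cancelʳ-≡ (sum μs) (sum σs) (m ℕ.+ k) (≡.trans (≡.sym e) (≡.trans (≡.sym total) (≡.sym (ℕ.+-assoc m k (sum μs)))))))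
          scalar-χ : ∀ {Q : Set} (d : Dec Q) a p → scalar B (KS.χ d K.* a) F.* p F.≈ FS.χ d F.* (scalar B a F.* p)
          scalar-χ d a p = F.trans (F.*-congʳ {p} (F.trans (s.*-homo (KS.χ d) a) (F.*-congʳ {scalar B a} (χ-homo (scalarHom B) d))))
            (F.*-assoc (FS.χ d) (scalar B a) p)
          product : ∀ {σs} → σs ∈ columns B B → sum σs ≡ m ℕ.+ k → P′ σs F.* P′ μs F.≈ FO.∑ (columns B B) (λ λs → scalar B (f (fromColumns λs) (fromColumns σs) μ) F.* P′ λs)
          product {σs} σs∈ |σ|≡ = ≡.subst (λ τs → P′ τs F.* P′ μs F.≈ FO.∑ (columns B B) (λ λs → scalar B (f (fromColumns λs) σ μ) F.* P′ λs))
            (to-from {B} {B} σs∈) (column-expansion B B σ μ (short σ σ<B) (below σ σ<B) (short μ μ<B) (below μ μ<B) outside)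
            where
            σ = fromColumns σs
            m+k+μ : (m ℕ.+ k) ℕ.+ sum μs ≡ size ρ
            m+k+μ = ≡.trans (ℕ.+-assoc m k (sum μs)) (≡.trans total |ρ|)
            σ<B : size σ < B
            σ<B = ≡.subst (_< B) (≡.sym (≡.trans (size-from σs∈) |σ|≡)) (ℕ.≤-<-trans (ℕ.m≤m+n (m ℕ.+ k) (sum μs)) (≡.subst (_< B) (≡.sym m+k+μ) ρ<B))
            outside : ∀ τ → τ ∉ box B B → scalar B (f τ σ μ) F.* P⟨ B vars⟩ τ F.≈ F.0#
            -- A nonzero constant would force |τ| = |σ| + |μ| = |ρ| < B, and then τ would lie in the
            -- box.
            outside τ τ∉ = zero-* B {f τ σ μ} (P⟨ B vars⟩ τ) (homogeneous τ σ μ (λ e → inside (≡.trans e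
              (≡.trans (≡.cong₂ ℕ._+_ (≡.trans (size-from σs∈) |σ|≡) (≡.sym |μ|)) m+k+μ))))
              where
              inside : size τ ≢ size ρ
              inside e = τ∉ (∈-box τ (short τ τ<B) (below τ τ<B))
                where
                τ<B : size τ < B
                τ<B = ≡.subst (_< B) (≡.sym e) ρ<B
          term₁ : List ℕ → List ℕ → F.Carrier
          term₁ σs λs = scalar B (w σs K.* f (fromColumns λs) (fromColumns σs) μ) F.* P′ λs
          collect : ∀ λs → scalar B (left λs) F.* P′ λs F.≈ FO.∑ (columns B B) (λ σs → term₁ σs λs)
          collect λs = F.trans (F.*-congʳ {P′ λs} (∑-homo (scalarHom B) (columns B B) (λ σs → w σs K.* f (fromColumns λs) (fromColumns σs) μ)))
            (FS.∑-* (P′ λs) (columns B B) (λ σs → scalar B (w σs K.* f (fromColumns λs) (fromColumns σs) μ)))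
          term₂ : List ℕ → F.Carrier
          term₂ σs = FS.χ (sum σs ℕ.≟ m ℕ.+ k) F.* (scalar B (M B B m σs (∅ B B)) F.* (P′ σs F.* P′ μs))
          expand : ∀ {σs} → σs ∈ columns B B → term₂ σs F.≈ FO.∑ (columns B B) (λ λs → term₁ σs λs)
          expand {σs} σs∈ = F.trans (FS.χ-*-cong (sum σs ℕ.≟ m ℕ.+ k) {scalar B (M B B m σs (∅ B B)) F.* (P′ σs F.* P′ μs)} {scalar B (M B B m σs (∅ B B)) F.* Σ′}
              (λ e → F.*-congˡ {scalar B (M B B m σs (∅ B B))} (product σs∈ e)))
            (F.trans (F.sym (scalar-χ (sum σs ℕ.≟ m ℕ.+ k) (M B B m σs (∅ B B)) Σ′))
              (F.trans (FS.*-∑ (scalar B (w σs)) (columns B B) (λ λs → scalar B (f (fromColumns λs) (fromColumns σs) μ) F.* P′ λs))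
                (FS.∑-cong (columns B B) {λ λs → scalar B (w σs) F.* (scalar B (f (fromColumns λs) (fromColumns σs) μ) F.* P′ λs)} (λ λs → F.trans
                  (F.sym (F.*-assoc (scalar B (w σs)) (scalar B (f (fromColumns λs) (fromColumns σs) μ)) (P′ λs)))
                  (F.*-congʳ {P′ λs} (F.sym (s.*-homo (w σs) (f (fromColumns λs) (fromColumns σs) μ))))))))
            where
            Σ′ : F.Carrier
            Σ′ = FO.∑ (columns B B) (λ λs → scalar B (f (fromColumns λs) (fromColumns σs) μ) F.* P′ λs)
          term₃ : List ℕ → F.Carrier
          term₃ λs = FS.χ (sum λs ℕ.≟ m ℕ.+ (k ℕ.+ sum μs)) F.* (scalar B (M B B m λs μs) F.* P′ λs)
          two-ways : FO.∑ (columns B B) (λ λs → scalar B (left λs) F.* P′ λs) F.≈ FO.∑ (columns B B) (λ λs → scalar B (right λs) F.* P′ λs)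
          two-ways = F.trans (FS.∑-cong (columns B B) {λ λs → scalar B (left λs) F.* P′ λs} collect)
            (F.trans (F.sym (FS.∑-swap (columns B B) (columns B B) term₁))
              (F.trans (F.sym (FS.∑-cong∈ (columns B B) {term₂} expand))
                (F.trans (product-expansion B B (P-∅≈1 B B) m k {μs} μs∈ bound)
                  (F.sym (FS.∑-cong (columns B B) {λ λs → scalar B (right λs) F.* P′ λs} {term₃}
                    (λ λs → scalar-χ (sum λs ℕ.≟ m ℕ.+ (k ℕ.+ sum μs)) (M B B m λs μs) (P′ λs)))))))

-- Coefficients of powers of y and the two forms of the identity.

⊆⇒size≤ : ∀ {μ ν} → μ ⊆ ν → size μ ≤ size ν
⊆⇒size≤ {μ} {ν} μ⊆ν = ≡.subst₂ _≤_ (size-toColumns μ (μ⊆ν 0)) (size-toColumns ν ℕ.≤-refl)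
  (sum-mono (part ν 0) (conj μ ∘ suc) (conj ν ∘ suc) (⊆⇒conj≤ {μ} {ν} μ⊆ν))
  where
  sum-mono : ∀ L (f h : ℕ → ℕ) → (∀ i → f i ≤ h i) → sum (applyUpTo f L) ≤ sum (applyUpTo h L)
  sum-mono zero    f h f≤h = z≤n
  sum-mono (suc L) f h f≤h = ℕ.+-mono-≤ (f≤h 0) (sum-mono L (f ∘ suc) (h ∘ suc) (f≤h ∘ suc))

module Coefficients (K : Field) where
  open Field K hiding (zero)
  open Polynomials integralDomain
  open Sums commutativeRing
  private
    module KO = Operations commutativeRing
    module YO = Operations commutativeRingₚ

  coeff-const-* : ∀ a p m → coeff (constₚ a *ₚ p) m ≈ a * coeff p m
  coeff-const-* a p m = trans (coeff-+ (a · p) (0# ∷ []) m) (trans (+-cong (coeff-· a p m) (zeros m)) (+-identityʳ _))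
    where
    zeros : ∀ m → coeff (0# ∷ []) m ≈ 0#
    zeros zero    = refl
    zeros (suc m) = refl

  private
    shift : Carrier → Poly → ℕ → Carrier
    shift b p zero    = b * coeff p 0
    shift b p (suc m) = coeff p m + b * coeff p (suc m)

  coeff-linear-* : ∀ b p m → coeff ((X +ₚ constₚ b) *ₚ p) m ≈ shift b p m
  coeff-linear-* b p zero    = trans (coeff-+ ((0# + b) · p) _ 0) (trans (+-identityʳ _) (trans (coeff-· (0# + b) p 0) (*-congʳ (+-identityˡ b))))
  coeff-linear-* b p (suc m) = trans (coeff-+ ((0# + b) · p) _ (suc m)) (trans (+-cong
    (trans (coeff-· (0# + b) p (suc m)) (*-congʳ (+-identityˡ b))) (trans (coeff-const-* 1# p m) (*-identityˡ _))) (+-comm _ _))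

  coeff-∑ : ∀ {Y : Set} (xs : List Y) (f : Y → Poly) m → coeff (YO.∑ xs f) m ≈ KO.∑ xs (λ x → coeff (f x) m)
  coeff-∑ []       f m = refl
  coeff-∑ (x ∷ xs) f m = trans (coeff-+ (f x) (YO.∑ xs f) m) (+-congˡ (coeff-∑ xs f m))

  coeff-X^ : ∀ e m → coeff (X YO.^ e) m ≈ χ (e ℕ.≟ m)
  coeff-X^ zero    zero    = refl
  coeff-X^ zero    (suc m) = refl
  coeff-X^ (suc e) m       = trans (coeff-+ (0# · (X YO.^ e)) _ m) (trans (+-congʳ (trans (coeff-· 0# (X YO.^ e) m) (zeroˡ _))) (trans (+-identityˡ _) (shifted m)))
    where
    shifted : ∀ m → coeff (0# ∷ (constₚ 1# *ₚ (X YO.^ e))) m ≈ χ (suc e ℕ.≟ m)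
    shifted zero    = sym (χ-no (suc e ℕ.≟ 0) (λ ()))
    shifted (suc m) = trans (coeff-const-* 1# (X YO.^ e) m) (trans (*-identityˡ _) (trans (coeff-X^ e m)
      (χ-cong (e ℕ.≟ m) (suc e ℕ.≟ suc m) (≡.cong suc) ℕ.suc-injective)))

module SkewPieriTheorem (K : Field) (t : Field.Carrier K)
  (t≉0 : ¬ (Field._≈_ K t (Field.0# K)))
  (1-tᵏ≉0 : ∀ k → ¬ (Field._≈_ K (Field._-_ K (Field.1# K) (FieldOperations._^_ K t (suc k))) (Field.0# K)))
  where
  open Field K hiding (zero)
  open FieldOperations K
  open HallLittlewood K t using (vs; sk; IsStructureConstants; module K[y])
  open Polynomials integralDomain using (X; constₚ; coeff; mk≈; at; _≈ₚ_; _*ₚ_; _+ₚ_; commutativeRingₚ)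
  open Coefficients K
  open FieldLemmas K
  open Sums commutativeRing
  open Algebra.Properties.CommutativeSemiring.Exp commutativeSemiring using (^-homo-*)
  open ColumnCoefficients K t 1-tᵏ≉0
  open ColumnSupport K t 1-tᵏ≉0
  open PartitionCoefficients K t 1-tᵏ≉0
  open StructureConstants K t t≉0 1-tᵏ≉0
  open import Relation.Binary.Reasoning.Setoid setoid

  private
    -- The reason is 1 - t^(k+1) = t^(k+1) ((t⁻¹)^(k+1) - 1).
    t⁻¹-nonroot : ∀ k → ¬ (1# - (t ⁻¹) ^ suc k ≈ 0#)
    t⁻¹-nonroot k e = 1-tᵏ≉0 k (begin
      1# - t ^ suc k                                       ≈⟨ +-cong (⁻¹-^ (suc k) t≉0) (-‿cong (*-identityʳ _)) ⟨
      t ^ suc k * (t ⁻¹) ^ suc k - t ^ suc k * 1#          ≈⟨ *-distribˡ-sub (t ^ suc k) _ _ ⟨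
      t ^ suc k * ((t ⁻¹) ^ suc k - 1#)                    ≈⟨ *-congˡ (trans (+-congˡ (-‿cong (sym 1≈))) (-‿inverseʳ _)) ⟩
      t ^ suc k * 0#                                       ≈⟨ zeroʳ _ ⟩
      0#                                                   ∎)
      where
      1≈ : (t ⁻¹) ^ suc k ≈ 1#
      1≈ = sym (x∙y⁻¹≈ε⇒x≈y 1# ((t ⁻¹) ^ suc k) e)
        where open Algebra.Properties.Ring ring using (x∙y⁻¹≈ε⇒x≈y)

    module G⁻¹ = QBinomial K (t ⁻¹) t⁻¹-nonroot

    g⁻¹ : ℕ → ℕ → Carrier
    g⁻¹ = gaussianBinomial (t ⁻¹)

    -- For m ≤ l this is the elementary symmetric polynomial e_{l-m} at 1, t, ..., t^(l-1).
    c : ℕ → ℕ → Carrier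
    c l m = coeff (K[y].∏ (upTo l) (λ i → X +ₚ constₚ (t ^ i))) m

    linear-product : ∀ l → K[y].∏ (upTo (suc l)) (λ i → X +ₚ constₚ (t ^ i))
      ≈ₚ (X +ₚ constₚ (t ^ l)) *ₚ K[y].∏ (upTo l) (λ i → X +ₚ constₚ (t ^ i))
    linear-product l = K[y].trans (Sums.∏-upTo-last commutativeRingₚ l (λ i → X +ₚ constₚ (t ^ i)))
      (K[y].*-comm (K[y].∏ (upTo l) (λ i → X +ₚ constₚ (t ^ i))) (X +ₚ constₚ (t ^ l)))

    t-lower : ∀ {l m} → m ≤ l → t ^ l * (t ⁻¹) ^ (l ∸ m) ≈ t ^ m
    t-lower {l} {m} m≤l = begin
      t ^ l * (t ⁻¹) ^ (l ∸ m)                       ≡⟨ ≡.cong (λ k → t ^ k * (t ⁻¹) ^ (l ∸ m)) (ℕ.m+[n∸m]≡n m≤l) ⟨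
      t ^ (m ℕ.+ (l ∸ m)) * (t ⁻¹) ^ (l ∸ m)         ≈⟨ *-congʳ (^-homo-* t m (l ∸ m)) ⟩
      t ^ m * t ^ (l ∸ m) * (t ⁻¹) ^ (l ∸ m)         ≈⟨ trans (*-assoc _ _ _) (*-congˡ (⁻¹-^ (l ∸ m) t≉0)) ⟩
      t ^ m * 1#                                     ≈⟨ *-identityʳ _ ⟩
      t ^ m                                          ∎

    t^[1+n]C2 : ∀ n → t ^ (suc n C 2) ≈ t ^ n * t ^ (n C 2)
    t^[1+n]C2 n = trans (reflexive (≡.cong (t ^_) ([1+n]C2 n))) (^-homo-* t n (n C 2))

    -- The powers of t stand on opposite sides to avoid integer exponents. Induction on l splits off
    -- the factor y + tˡ, and the resulting recurrence is Pascal's rule at t⁻¹.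
    c-gaussian : ∀ l m → t ^ (m C 2) * c l m ≈ t ^ (l C 2) * g⁻¹ l m
    c-gaussian zero    zero    = *-congˡ (sym (G⁻¹.gaussian-0 0))
    c-gaussian zero    (suc m) = trans (zeroʳ _) (sym (trans (*-congˡ (G⁻¹.gaussian-> {0} {suc m} (s≤s z≤n))) (zeroʳ _)))
    c-gaussian (suc l) zero    = begin
      1# * c (suc l) 0                     ≈⟨ *-congˡ (trans (at (linear-product l) 0) (coeff-linear-* (t ^ l) (K[y].∏ (upTo l) (λ i → X +ₚ constₚ (t ^ i))) 0)) ⟩
      1# * (t ^ l * c l 0)                 ≈⟨ S.solve 3 (λ a b c → a S.:* (b S.:* c) S.:= b S.:* (a S.:* c)) refl 1# (t ^ l) (c l 0) ⟩
      t ^ l * (1# * c l 0)                 ≈⟨ *-congˡ (c-gaussian l 0) ⟩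
      t ^ l * (t ^ (l C 2) * g⁻¹ l 0)      ≈⟨ *-assoc _ _ _ ⟨
      t ^ l * t ^ (l C 2) * g⁻¹ l 0        ≈⟨ *-cong (sym (t^[1+n]C2 l)) (trans (G⁻¹.gaussian-0 l) (sym (G⁻¹.gaussian-0 (suc l)))) ⟩
      t ^ (suc l C 2) * g⁻¹ (suc l) 0      ∎
    c-gaussian (suc l) (suc m) = begin
      t ^ (suc m C 2) * c (suc l) (suc m)
        ≈⟨ *-congˡ (trans (at (linear-product l) (suc m)) (coeff-linear-* (t ^ l) (K[y].∏ (upTo l) (λ i → X +ₚ constₚ (t ^ i))) (suc m))) ⟩
      t ^ (suc m C 2) * (c l m + t ^ l * c l (suc m))
        ≈⟨ trans (distribˡ _ _ _) (+-cong (trans (*-congʳ (t^[1+n]C2 m)) (*-assoc _ _ _))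
             (S.solve 3 (λ a b c → a S.:* (b S.:* c) S.:= b S.:* (a S.:* c)) refl (t ^ (suc m C 2)) (t ^ l) (c l (suc m)))) ⟩
      t ^ m * (t ^ (m C 2) * c l m) + t ^ l * (t ^ (suc m C 2) * c l (suc m))
        ≈⟨ +-cong (*-congˡ (c-gaussian l m)) (*-congˡ (c-gaussian l (suc m))) ⟩
      t ^ m * (t ^ (l C 2) * g⁻¹ l m) + t ^ l * (t ^ (l C 2) * g⁻¹ l (suc m))
        -- Writing tᵐ = tˡ (t⁻¹)^(l-m) produces the power of t⁻¹ in `pascal′`. For m > l the
        -- binomial is 0.
        ≈⟨ +-congʳ (lower (m ℕ.≤? l)) ⟩
      t ^ l * (t ⁻¹) ^ (l ∸ m) * (t ^ (l C 2) * g⁻¹ l m) + t ^ l * (t ^ (l C 2) * g⁻¹ l (suc m))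
        ≈⟨ S.solve 5 (λ a q b x y → (a S.:* q) S.:* (b S.:* x) S.:+ a S.:* (b S.:* y) S.:= (a S.:* b) S.:* (q S.:* x S.:+ y)) refl
             (t ^ l) ((t ⁻¹) ^ (l ∸ m)) (t ^ (l C 2)) (g⁻¹ l m) (g⁻¹ l (suc m)) ⟩
      t ^ l * t ^ (l C 2) * ((t ⁻¹) ^ (l ∸ m) * g⁻¹ l m + g⁻¹ l (suc m))
        ≈⟨ *-cong (t^[1+n]C2 l) (G⁻¹.pascal′ l m) ⟨
      t ^ (suc l C 2) * g⁻¹ (suc l) (suc m) ∎
      where
      lower : Dec (m ≤ l) → t ^ m * (t ^ (l C 2) * g⁻¹ l m) ≈ t ^ l * (t ⁻¹) ^ (l ∸ m) * (t ^ (l C 2) * g⁻¹ l m)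
      lower (yes m≤l) = *-congʳ (sym (t-lower m≤l))
      lower (no m≰l)  = trans (trans (*-congˡ z) (zeroʳ _)) (sym (trans (*-congˡ z) (zeroʳ _)))
        where z = trans (*-congˡ (G⁻¹.gaussian-> (ℕ.≰⇒> m≰l))) (zeroʳ (t ^ (l C 2)))

    -- Integer powers are treated only through this product, which reduces them to natural powers.
    ^ᶻ-⊖ : ∀ a b → t ^ᶻ (a ⊖ b) * t ^ b ≈ t ^ a
    ^ᶻ-⊖ a       zero    = *-identityʳ _
    ^ᶻ-⊖ zero    (suc b) = trans (*-comm _ _) (⁻¹-^ (suc b) t≉0)
    ^ᶻ-⊖ (suc a) (suc b) = trans (*-congʳ (reflexive (≡.cong (t ^ᶻ_) ([1+m]⊖[1+n]≡m⊖n a b))))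
      (trans (S.solve 3 (λ x y z → x S.:* (y S.:* z) S.:= y S.:* (x S.:* z)) refl _ t (t ^ b)) (*-congˡ (^ᶻ-⊖ a b)))

    -- The exponent n(σ) - C(ℓ(σ), 2) as a natural number: the first column, of height ℓ(σ), is left
    -- out of the sum for n(σ).
    E : List ℕ → ℕ
    E σs = sum (map (_C 2) (drop 1 σs))

    module _ (B : ℕ) where
      private
        module W = SkewSums K t 1-tᵏ≉0 (Variables.constHom K integralDomain) X

      -- The factorization over K[y] gives the generating polynomial of the numbers `M` in closed
      -- form by `columnProduct-0`, and its coefficient of yᵐ is read off.
      M-∅ : ∀ m {σs} → σs ∈ columns B B → M B B m σs (∅ B B) ≈ t ^ E σs * c (entry σs 0) m
      M-∅ m {σs} σs∈ = begin
        M B B m σs (∅ B B)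
          ≈⟨ ∑-cong∈ (columns B B) (λ {νs} νs∈ → term-wise νs (vertical-sum σs νs (≡.trans l (≡.sym (proj₂ (∈-columns⁻ B B νs∈)))))) ⟩
        ∑ (columns B B) (λ νs → coeff (W.weight σs νs (∅ B B)) m)
          ≈⟨ coeff-∑ (columns B B) (λ νs → W.weight σs νs (∅ B B)) m ⟨
        coeff (K[y].∑ (columns B B) (λ νs → W.weight σs νs (∅ B B))) m
          ≈⟨ at closed m ⟩
        coeff (constₚ (t ^ E σs) *ₚ K[y].∏ (upTo (entry σs 0)) (λ i → X +ₚ constₚ (t ^ i))) m
          ≈⟨ coeff-const-* (t ^ E σs) (K[y].∏ (upTo (entry σs 0)) (λ i → X +ₚ constₚ (t ^ i))) m ⟩
        t ^ E σs * c (entry σs 0) m ∎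
        where
        d = proj₁ (∈-columns⁻ B B σs∈)
        l = proj₂ (∈-columns⁻ B B σs∈)
        closed : K[y].∑ (columns B B) (λ νs → W.weight σs νs (∅ B B))
          ≈ₚ constₚ (t ^ E σs) *ₚ K[y].∏ (upTo (entry σs 0)) (λ i → X +ₚ constₚ (t ^ i))
        closed = ≡.subst (λ L → K[y].∑ (columns B L) (λ νs → W.weight σs νs (replicate L 0))
            ≈ₚ constₚ (t ^ E σs) *ₚ K[y].∏ (upTo (entry σs 0)) (λ i → X +ₚ constₚ (t ^ i))) l
          (K[y].trans (W.∑-weight σs (replicate (length σs) 0) d (length-replicate (length σs))) (W.columnProduct-0 σs d))
        term-wise : ∀ νs → verticalCoefficient σs νs ≈ 0# ⊎ sum σs ≡ deficit σs νs ℕ.+ sum νs →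
          χ (sum σs ℕ.≟ m ℕ.+ sum νs) * (verticalCoefficient σs νs * skewCoefficient νs (∅ B B)) ≈ coeff (W.weight σs νs (∅ B B)) m
        term-wise νs h = trans (by-cases h) (sym (trans (coeff-const-* _ (X K[y].^ deficit σs νs) m) (trans (*-congˡ (coeff-X^ (deficit σs νs) m)) (*-comm _ _))))
          where
          by-cases : verticalCoefficient σs νs ≈ 0# ⊎ sum σs ≡ deficit σs νs ℕ.+ sum νs →
            χ (sum σs ℕ.≟ m ℕ.+ sum νs) * (verticalCoefficient σs νs * skewCoefficient νs (∅ B B))
              ≈ χ (deficit σs νs ℕ.≟ m) * (verticalCoefficient σs νs * skewCoefficient νs (∅ B B))
          by-cases (inj₁ z) = trans (trans (*-congˡ (trans (*-congʳ z) (zeroˡ _))) (zeroʳ _)) (sym (trans (*-congˡ (trans (*-congʳ z) (zeroˡ _))) (zeroʳ _)))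
          by-cases (inj₂ e) = *-congʳ (χ-cong (sum σs ℕ.≟ m ℕ.+ sum νs) (deficit σs νs ℕ.≟ m)
            (λ e′ → ℕ.+-cancelʳ-≡ (sum νs) (deficit σs νs) m (≡.trans (≡.sym e) e′)) (λ D≡m → ≡.trans e (≡.cong (ℕ._+ sum νs) D≡m)))

      n-columns : ∀ {σs} → σs ∈ columns B B → n⟨ fromColumns σs ⟩ ≡ (ℓ (fromColumns σs) C 2) ℕ.+ E σs
      n-columns {σs} σs∈ = ≡.trans (≡.sym (n-toColumns (fromColumns σs) (part≤B σs∈)))
        (≡.trans (≡.cong (λ cs → sum (map (_C 2) cs)) (to-from {B} {B} σs∈)) (≡.trans (split σs)
          (≡.cong (λ k → (k C 2) ℕ.+ E σs) (≡.sym (length-transpose (entry σs 0) σs)))))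
        where
        part≤B : ∀ {σs} → σs ∈ columns B B → part (fromColumns σs) 0 ≤ B
        part≤B {σs} σs∈ = ≡.subst (part (fromColumns σs) 0 ≤_) (proj₂ (∈-columns⁻ B B σs∈))
          (decreasing⇒head≤ (transpose (entry σs 0) σs) (decreasing-transpose (entry σs 0) σs))
        split : ∀ as → sum (map (_C 2) as) ≡ (entry as 0 C 2) ℕ.+ sum (map (_C 2) (drop 1 as))
        split []       = ≡.refl
        split (a ∷ as) = ≡.refl

      M-∅-c : ∀ m {σs} → σs ∈ columns B B → let σ = fromColumns σs in
        M B B m σs (∅ B B) ≈ t ^ᶻ (n⟨ σ ⟩ ⊖ (ℓ σ C 2)) * c (ℓ σ) m
      M-∅-c m {σs} σs∈ = trans (M-∅ m σs∈) (*-cong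
        (*-cancelʳ (^-nonzero (ℓ σ C 2) t≉0) (trans (trans (*-comm _ _) (sym (^-homo-* t (ℓ σ C 2) (E σs))))
          (trans (reflexive (≡.cong (t ^_) (≡.sym (n-columns σs∈)))) (sym (^ᶻ-⊖ n⟨ σ ⟩ (ℓ σ C 2))))))
        (reflexive (≡.cong (λ l → c l m) (≡.sym (length-transpose (entry σs 0) σs)))))
        where σ = fromColumns σs

      -- Multiplied by t^C(m,2) and t^C(ℓ(σ),2), both integer powers reduce to t^n(σ), and
      -- `c-gaussian` compares what remains.
      M-∅-gaussian : ∀ m {σs} → σs ∈ columns B B → let σ = fromColumns σs in
        M B B m σs (∅ B B) ≈ t ^ᶻ (n⟨ σ ⟩ ⊖ (m C 2)) * g⁻¹ (ℓ σ) m
      M-∅-gaussian m {σs} σs∈ = *-cancelˡ (*-nonzero (^-nonzero (m C 2) t≉0) (^-nonzero (ℓ σ C 2) t≉0)) (begin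
        t ^ (m C 2) * t ^ (ℓ σ C 2) * M B B m σs (∅ B B)
          ≈⟨ *-congˡ (M-∅-c m σs∈) ⟩
        t ^ (m C 2) * t ^ (ℓ σ C 2) * (t ^ᶻ (n⟨ σ ⟩ ⊖ (ℓ σ C 2)) * c (ℓ σ) m)
          ≈⟨ S.solve 4 (λ a b z c → (a S.:* b) S.:* (z S.:* c) S.:= (z S.:* b) S.:* (a S.:* c)) refl (t ^ (m C 2)) (t ^ (ℓ σ C 2)) _ (c (ℓ σ) m) ⟩
        t ^ᶻ (n⟨ σ ⟩ ⊖ (ℓ σ C 2)) * t ^ (ℓ σ C 2) * (t ^ (m C 2) * c (ℓ σ) m)
          ≈⟨ *-cong (trans (^ᶻ-⊖ n⟨ σ ⟩ (ℓ σ C 2)) (sym (^ᶻ-⊖ n⟨ σ ⟩ (m C 2)))) (c-gaussian (ℓ σ) m) ⟩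
        t ^ᶻ (n⟨ σ ⟩ ⊖ (m C 2)) * t ^ (m C 2) * (t ^ (ℓ σ C 2) * g⁻¹ (ℓ σ) m)
          ≈⟨ S.solve 4 (λ z a b g → (z S.:* a) S.:* (b S.:* g) S.:= (a S.:* b) S.:* (z S.:* g)) refl (t ^ᶻ (n⟨ σ ⟩ ⊖ (m C 2))) (t ^ (m C 2)) (t ^ (ℓ σ C 2)) (g⁻¹ (ℓ σ) m) ⟩
        t ^ (m C 2) * t ^ (ℓ σ C 2) * (t ^ᶻ (n⟨ σ ⟩ ⊖ (m C 2)) * g⁻¹ (ℓ σ) m) ∎)
        where σ = fromColumns σs

  module _ (f : Partition → Partition → Partition → Carrier) (structure : IsStructureConstants f) (μ ρ : Partition) where
    private
      -- Serving both as number of variables and as number of columns, B exceeds the degrees of μ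
      -- and ρ, as the Pieri rule requires.
      B = suc (size μ ℕ.+ size ρ)
      μ<B : size μ < B
      μ<B = s≤s (ℕ.m≤m+n (size μ) (size ρ))
      ρ<B : size ρ < B
      ρ<B = s≤s (ℕ.m≤n+m (size ρ) (size μ))
      μs ρs : List ℕ
      μs = toColumns B μ
      ρs = toColumns B ρ
      below : ∀ τ → size τ < B → part τ 0 ≤ B
      below τ τ<B = ℕ.≤-trans (part≤size τ 0) (ℕ.<⇒≤ τ<B)
      inside : ∀ τ → size τ < B → τ ∈ box B B
      inside τ τ<B = ∈-box τ (ℕ.≤-trans (ℓ≤size τ) (ℕ.<⇒≤ τ<B)) (below τ τ<B)

      -- The interval between μ and ρ is exchanged for the box. Outside the interval one of the
      -- column coefficients vanishes, and outside the box the condition |ρ| = m + |ν| fails.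
      skew-sum-M : ∀ m → ∑ (filter (λ ν → (size ρ ∸ size ν) ℕ.≟ m) (interval μ ρ)) (λ ν → vs ρ ν * sk ν μ) ≈ M B B m ρs μs
      skew-sum-M m = begin
        ∑ (filter (λ ν → (size ρ ∸ size ν) ℕ.≟ m) (interval μ ρ)) (λ ν → vs ρ ν * sk ν μ)
          ≈⟨ ∑-filter (λ ν → (size ρ ∸ size ν) ℕ.≟ m) (interval μ ρ) _ ⟩
        ∑ (interval μ ρ) (λ ν → χ ((size ρ ∸ size ν) ℕ.≟ m) * (vs ρ ν * sk ν μ))
          ≈⟨ ∑-cong∈ (interval μ ρ) (λ {ν} ν∈ → in-interval ν (proj₁ (∈-interval⁻ {μ} {ρ} ν∈)) (proj₂ (∈-interval⁻ {μ} {ρ} ν∈))) ⟩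
        ∑ (interval μ ρ) G
          ≈⟨ ∑-support _≟ₚ_ (unique-interval μ ρ) (unique-box B B) G off-interval off-box ⟩
        ∑ (box B B) G
          ≡⟨ ∑-map fromColumns (columns B B) G ⟩
        ∑ (columns B B) (G ∘ fromColumns)
          ≈⟨ ∑-cong∈ (columns B B) (λ {νs} νs∈ → reflexive (≡.cong₂ (λ cs (z , w) → χ (z ℕ.≟ m ℕ.+ w) * (verticalCoefficient ρs cs * skewCoefficient cs μs))
               (to-from {B} {B} νs∈) (≡.cong₂ _,_ (≡.sym (size-toColumns ρ (below ρ ρ<B))) (sum-transpose (entry νs 0) νs (decreasing-lower νs ℕ.≤-refl (proj₁ (∈-columns⁻ B B νs∈))))))) ⟩
        M B B m ρs μs ∎
        where
        G : Partition → Carrier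
        G ν = χ (size ρ ℕ.≟ m ℕ.+ size ν) * (verticalCoefficient ρs (toColumns B ν) * skewCoefficient (toColumns B ν) μs)
        ν<B : ∀ ν → size ρ ≡ m ℕ.+ size ν → size ν < B
        ν<B ν e = ℕ.≤-<-trans (ℕ.≤-trans (ℕ.m≤n+m (size ν) m) (ℕ.≤-reflexive (≡.sym e))) ρ<B
        in-interval : ∀ ν → μ ⊆ ν → ν ⊆ ρ → χ ((size ρ ∸ size ν) ℕ.≟ m) * (vs ρ ν * sk ν μ) ≈ G ν
        in-interval ν μ⊆ν ν⊆ρ = *-cong
          (χ-cong ((size ρ ∸ size ν) ℕ.≟ m) (size ρ ℕ.≟ m ℕ.+ size ν)
            (λ e → ≡.trans (≡.sym (ℕ.m∸n+n≡m ν≤ρ)) (≡.cong (ℕ._+ size ν) e))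
            (λ e → ≡.trans (≡.cong (_∸ size ν) e) (ℕ.m+n∸n≡m m (size ν))))
          (*-cong (vs-columns ρ ν (below ρ ρ<B) ν⊆ρ) (sk-columns ν μ (below ν (ℕ.≤-<-trans ν≤ρ ρ<B)) μ⊆ν))
          where
          ν≤ρ : size ν ≤ size ρ
          ν≤ρ = ⊆⇒size≤ {ν} {ρ} ν⊆ρ
        off-box : ∀ ν → ν ∉ box B B → G ν ≈ 0#
        off-box ν ν∉ = χ-no-* (size ρ ℕ.≟ m ℕ.+ size ν) (λ e → ν∉ (inside ν (ν<B ν e)))
        off-interval : ∀ ν → ν ∉ interval μ ρ → G ν ≈ 0#
        off-interval ν ν∉ = trans (χ-*-cong (size ρ ℕ.≟ m ℕ.+ size ν) (λ e → vanish (ν<B ν e) (μ ⊆? ν) (ν ⊆? ρ))) (zeroʳ _)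
          where
          vanish : size ν < B → Dec (μ ⊆ ν) → Dec (ν ⊆ ρ) → verticalCoefficient ρs (toColumns B ν) * skewCoefficient (toColumns B ν) μs ≈ 0#
          vanish ν<B (yes μ⊆ν) (yes ν⊆ρ) = contradiction (∈-interval⁺ {μ} {ρ} {ν} μ⊆ν ν⊆ρ) ν∉
          vanish ν<B (no μ⊈ν)  _         = trans (*-congˡ (skew-⊈ ν μ (below μ μ<B) μ⊈ν)) (zeroʳ _)
          vanish ν<B (yes _)   (no ν⊈ρ)  = trans (*-congʳ (vertical-⊈ ρ ν (below ν ν<B) ν⊈ρ)) (zeroˡ _)

      -- w is one of the two forms of the coefficient of f ρ σ μ on the right-hand side.
      module _ (w : Partition → ℕ → Carrier) (M-w : ∀ m {σs} → σs ∈ columns B B → M B B m σs (∅ B B) ≈ w (fromColumns σs) m) where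
        expanded : ∀ m → ∑ (filter (λ ν → (size ρ ∸ size ν) ℕ.≟ m) (interval μ ρ)) (λ ν → vs ρ ν * sk ν μ) ≈ ∑ (box B B) (λ σ → w σ m * f ρ σ μ)
        expanded m = trans (skew-sum-M m) (trans (sym (coefficient-identity f structure μ ρ B μ<B ρ<B m))
          (trans (∑-cong∈ (columns B B) (λ σs∈ → *-congʳ (M-w m σs∈))) (reflexive (≡.sym (∑-map fromColumns (columns B B) (λ σ → w σ m * f ρ σ μ))))))

      f-outside : ∀ σ → σ ∉ box B B → f ρ σ μ ≈ 0#
      f-outside σ σ∉ = homogeneous f structure ρ σ μ (λ e → σ∉ (inside σ (ℕ.≤-<-trans (ℕ.≤-trans (ℕ.m≤m+n (size σ) (size μ)) (ℕ.≤-reflexive (≡.sym e))) ρ<B)))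

      lhs : Partition → K[y].Carrier
      lhs ν = K[y].const (vs ρ ν * sk ν μ) K[y].* K[y].y K[y].^ (size ρ ∸ size ν)

      rhs : Partition → K[y].Carrier
      rhs σ = K[y].const (t ^ᶻ (n⟨ σ ⟩ ⊖ (ℓ σ C 2)) * f ρ σ μ) K[y].* K[y].∏ (upTo (ℓ σ)) (λ i → K[y].y K[y].+ K[y].const (t ^ i))

    -- Taking coefficients of yᵐ restricts the left-hand side to |ρ/ν| = m, which is the sum treated
    -- by `expanded`.
    skew-pieri-polynomial : K[y].IsFiniteSum rhs (K[y].∑ (interval μ ρ) lhs)
    skew-pieri-polynomial = box B B , unique-box B B , (λ σ σ∉ → mk≈ λ m → trans (coeff-rhs σ m) (trans (*-congˡ (f-outside σ σ∉)) (zeroʳ _))) , mk≈ λ m → begin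
      coeff (K[y].∑ (interval μ ρ) lhs) m
        ≈⟨ coeff-∑ (interval μ ρ) lhs m ⟩
      ∑ (interval μ ρ) (λ ν → coeff (lhs ν) m)
        ≈⟨ ∑-cong (interval μ ρ) (λ ν → trans (coeff-const-* (vs ρ ν * sk ν μ) (X K[y].^ (size ρ ∸ size ν)) m)
             (trans (*-congˡ (coeff-X^ (size ρ ∸ size ν) m)) (*-comm _ _))) ⟩
      ∑ (interval μ ρ) (λ ν → χ ((size ρ ∸ size ν) ℕ.≟ m) * (vs ρ ν * sk ν μ))
        ≈⟨ ∑-filter (λ ν → (size ρ ∸ size ν) ℕ.≟ m) (interval μ ρ) _ ⟨
      ∑ (filter (λ ν → (size ρ ∸ size ν) ℕ.≟ m) (interval μ ρ)) (λ ν → vs ρ ν * sk ν μ)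
        ≈⟨ expanded (λ σ m → t ^ᶻ (n⟨ σ ⟩ ⊖ (ℓ σ C 2)) * c (ℓ σ) m) (M-∅-c B) m ⟩
      ∑ (box B B) (λ σ → t ^ᶻ (n⟨ σ ⟩ ⊖ (ℓ σ C 2)) * c (ℓ σ) m * f ρ σ μ)
        ≈⟨ ∑-cong (box B B) (λ σ → coeff-rhs σ m) ⟨
      ∑ (box B B) (λ σ → coeff (rhs σ) m)
        ≈⟨ coeff-∑ (box B B) rhs m ⟨
      coeff (K[y].∑ (box B B) rhs) m ∎
      where
      coeff-rhs : ∀ σ m → coeff (rhs σ) m ≈ t ^ᶻ (n⟨ σ ⟩ ⊖ (ℓ σ C 2)) * c (ℓ σ) m * f ρ σ μ
      coeff-rhs σ m = trans (coeff-const-* (t ^ᶻ (n⟨ σ ⟩ ⊖ (ℓ σ C 2)) * f ρ σ μ) (K[y].∏ (upTo (ℓ σ)) (λ i → X +ₚ constₚ (t ^ i))) m)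
        (S.solve 3 (λ x y z → (x S.:* y) S.:* z S.:= (x S.:* z) S.:* y) refl (t ^ᶻ (n⟨ σ ⟩ ⊖ (ℓ σ C 2))) (f ρ σ μ) (c (ℓ σ) m))

    skew-pieri-coefficient : ∀ m → IsFiniteSum (λ σ → t ^ᶻ (n⟨ σ ⟩ ⊖ (m C 2)) * f ρ σ μ * g⁻¹ (ℓ σ) m)
      (∑ (filter (λ ν → (size ρ ∸ size ν) ℕ.≟ m) (interval μ ρ)) (λ ν → vs ρ ν * sk ν μ))
    skew-pieri-coefficient m = box B B , unique-box B B
      , (λ σ σ∉ → trans (*-congʳ (trans (*-congˡ (f-outside σ σ∉)) (zeroʳ _))) (zeroˡ _))
      , trans (expanded (λ σ m → t ^ᶻ (n⟨ σ ⟩ ⊖ (m C 2)) * g⁻¹ (ℓ σ) m) (M-∅-gaussian B) m)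
          (∑-cong (box B B) (λ σ → S.solve 3 (λ x y z → (x S.:* y) S.:* z S.:= (x S.:* z) S.:* y) refl (t ^ᶻ (n⟨ σ ⟩ ⊖ (m C 2))) (g⁻¹ (ℓ σ) m) (f ρ σ μ)))

-- The indeterminate t is nonzero and not a root of unity.

module RationalFunctionField (D : IntegralDomain) where
  open Polynomials D
  open Fractions integralDomainₚ using (ι; fractionField)
  open FractionLemmas integralDomainₚ
  open Field fractionField
  open FieldOperations fractionField
  private
    module D = IntegralDomain D
    module Y = CommutativeRing commutativeRingₚ
    module YO = Operations commutativeRingₚ
    module ι = RingHom ιHom

  ι-X≉0 : ¬ (ι X ≈ 0#)
  ι-X≉0 e = D.1≉0 (at (ι-injective e) 1)

  -- The constant coefficient of X^(k+1) is 0, whereas that of 1 is 1.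
  ι-X-nonroot : ∀ k → ¬ (1# - ι X ^ suc k ≈ 0#)
  ι-X-nonroot k e = D.1≉0 (D.trans (at one 0) (D.trans (coeff-+ (D.0# · (X YO.^ k)) (D.0# ∷ (constₚ D.1# *ₚ (X YO.^ k))) 0)
    (D.trans (D.+-identityʳ _) (D.trans (coeff-· D.0# (X YO.^ k) 0) (D.zeroˡ _)))))
    where
    open Algebra.Properties.Ring Y.ring using (x∙y⁻¹≈ε⇒x≈y)
    one : constₚ D.1# ≈ₚ X *ₚ (X YO.^ k)
    one = x∙y⁻¹≈ε⇒x≈y (constₚ D.1#) (X YO.^ suc k) (ι-injective (trans (ι.+-homo (constₚ D.1#) (-ₚ (X YO.^ suc k)))
      (trans (+-congˡ {ι (constₚ D.1#)} (trans (ι.neg-homo (X YO.^ suc k)) (-‿cong {ι (X YO.^ suc k)} {ι X ^ suc k} (^-homo ιHom X (suc k))))) e)))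

open import Defs
open import Data.Nat.Properties using (_≟_)

theorem7 : (f : Partition → Partition → Partition → Carrier) → IsStructureConstants f →
    (μ ρ : Partition) → μ ⊆ ρ →
    K[y].IsFiniteSum
    (λ σ → K[y].const (t ^ᶻ (n⟨ σ ⟩ ⊖ (ℓ σ C 2)) * f ρ σ μ)
    K[y].* K[y].∏ (upTo (ℓ σ)) (λ i → K[y].y K[y].+ K[y].const (t ^ i)))
    (K[y].∑ (interval μ ρ) (λ ν →
    K[y].const (vs ρ ν * sk ν μ) K[y].* K[y].y K[y].^ (size ρ ∸ size ν)))
    ×
    ((m : ℕ) →
    IsFiniteSum
    (λ σ → t ^ᶻ (n⟨ σ ⟩ ⊖ (m C 2)) * f ρ σ μ * gaussianBinomial (t ⁻¹) (ℓ σ) m)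
    (∑ (filter (λ ν → (size ρ ∸ size ν) ≟ m) (interval μ ρ)) (λ ν → vs ρ ν * sk ν μ)))
theorem7 f structure μ ρ _ = T.skew-pieri-polynomial f structure μ ρ , T.skew-pieri-coefficient f structure μ ρ
  where
  open RationalFunctionField ℚ-domain
  module T = SkewPieriTheorem ℚ⟨t⟩ indeterminate ι-X≉0 ι-X-nonroot
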